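{- For any $k\ge 3$ there exist (polynomial-time) offline scheduling algorithms for the dynamic bin packing problem with the following guarantees on the average cost (total cost divided by $T$). (1) One algorithm has average cost at most $\Pi_k\cdot \mathrm{OPT}_{avg}+O\left(\sqrt{\mathrm{OPT}_{avg}\cdot k\cdot\log\mu}\right)$ in the non-uniform size case, and at most $\mathrm{OPT}_{avg}+O\left(\sqrt{\mathrm{OPT}_{avg}\cdot\log\mu}\right)$ in the uniform size case. (2) One algorithm has average cost at most $2\Pi_k\left(1+\frac{1}{k-2}\right)\cdot \mathrm{OPT}_{avg}+k$ in the non-uniform size case, and at most $2\cdot \mathrm{OPT}_{avg}$ in the uniform size case. (For comparison, the previously known bounds were $4\cdot\mathrm{OPT}_{avg}$ in the non-uniform size case and $2\cdot\mathrm{OPT}_{avg}$ in the uniform size case.)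
   Context: Dynamic bin packing. The time horizon has length $T$. An instance $\mathcal I$ is a set of intervals (VM requests) $I=[s_I,e_I)$ with size $w_I\le 1$; $I$ is active at $t$ if $s_I\le t<e_I$. The length of $I$ is $\ell_I=e_I-s_I$; without loss of generality the minimum length is $1$, and $\mu$ denotes the maximum length (the ratio between the maximum and minimum length). Without loss of generality, at each time at least one interval is active. A schedule assigns each interval to one machine for its entire duration (no migration); at each time the total size of active intervals on a machine is at most $1$. A machine is active at $t$ if at least one interval assigned to it is active at $t$. The (total) cost of a schedule is the total active time summed over all machines; $\mathrm{OPT}$ is the minimum cost and $\mathrm{OPT}_{avg}=\mathrm{OPT}/T$. Uniform size case: all sizes equal $1/g$ for some integer $g$. Non-uniform size case: sizes are arbitrary. An offline algorithm sees the whole instance in advance. The quantity $\Pi_k$: static bin packing asks to pack items of sizes in $(0,1]$ into the minimum number of unit bins. The Harmonic algorithm with parameter $k$ splits items into classes with sizes in $(\frac1{j+1},\frac1j]$ for $j=1,\dots,k-1$, and $(0,\frac1k]$, and packs each class separately by Next-Fit (keep one active bin; if an item does not fit, close it and open a new one). $\Pi_k$ denotes its asymptotic competitive ratio (its number of bins is at most $\Pi_k$ times the optimal number of bins, plus $k$); $\Pi_k$ decreases to $\Pi_\infty\approx1.691$.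
   Formalization: The start and end times, the sizes of the intervals and the horizon T are rational numbers instead of reals; log μ inside O(·) is read as the binary logarithm of max(μ, 2). -}

module Defs where

open import Data.Fin.Base using (Fin)
open import Data.Integer.Base as ℤ using (+_)
open import Data.List.Base as List using (List; []; _∷_; upTo; filter; deduplicate)
import Data.List.Sort.MergeSort as MergeSort
import Data.Nat.ListAction as ℕ using (sum)
open import Data.List.Relation.Unary.All using (All)
open import Data.List.Relation.Unary.Any using (any?)
open import Data.Nat.Base as ℕ using (ℕ; zero; suc)
open import Data.Nat.Logarithm using (⌊log₂_⌋)
import Data.Nat.Properties as ℕ
open import Data.Product using (Σ; ∃; _×_; _,_; proj₁; proj₂)
open import Data.Rational.Base as ℚ
  using (ℚ; 0ℚ; 1ℚ; _+_; _*_; _-_; _÷_; _⊔_; _≤_; _<_; Positive; ↥_; ↧ₙ_)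
open import Data.Rational.Properties as ℚ using (_≤?_; _<?_; pos⇒nonZero)
open import Algebra.Definitions.RawSemiring ℚ.+-*-rawSemiring using (_^_)
open import Data.Sum.Base using (_⊎_; inj₁; inj₂)
open import Data.Unit.Base using (⊤; tt)
open import Data.Vec.Base as Vec using (Vec; lookup; toList)
open import Relation.Binary.PropositionalEquality using (_≡_)
open import Relation.Nullary using (Dec; yes; no)
open import Relation.Nullary.Decidable using (_×-dec_)

fromℕ : ℕ → ℚ
fromℕ n = + n ℚ./ 1

-- 1/n for n ≥ 1; the value at 0 is junk and is never used.
recip : ℕ → ℚ
recip zero    = 0ℚ
recip (suc n) = + 1 ℚ./ suc n

sumℚ : List ℚ → ℚ
sumℚ = List.foldr _+_ 0ℚ

------------------------------------------------------------------------
-- Nonnegative reals, for right-hand sides of inequalities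

-- A nonnegative real x is given by a set of rational numbers u ≥ x whose
-- infimum is x; "q ≤ x" then means that q is below every member.  Sums and
-- products of such sets have the sum and product of the infima as infimum.
ℝ⁺ : Set₁
ℝ⁺ = ℚ → Set

infix  4 _≼_
infixl 6 _⊕_
infixl 7 _⊗_

_≼_ : ℚ → ℝ⁺ → Set
q ≼ x = ∀ u → x u → q ≤ u

⌜_⌝ : ℚ → ℝ⁺
⌜ q ⌝ u = q ≤ u

_⊕_ : ℝ⁺ → ℝ⁺ → ℝ⁺
(x ⊕ y) w = ∃ λ u → ∃ λ v → x u × y v × u + v ≤ w

_⊗_ : ℝ⁺ → ℝ⁺ → ℝ⁺
(x ⊗ y) w = ∃ λ u → ∃ λ v → x u × y v × u * v ≤ w

√_ : ℝ⁺ → ℝ⁺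
(√ x) s = 0ℚ ≤ s × ∃ λ u → x u × u ≤ s * s

-- Binary logarithm of a rational q ≥ 1:  log₂ q ≤ a/b  iff  q ^ b ≤ 2 ^ a.
log₂ : ℚ → ℝ⁺
log₂ q u = ∃ λ (a : ℕ) → ∃ λ (b : ℕ) →
  q ^ suc b ≤ fromℕ 2 ^ a × fromℕ a * recip (suc b) ≤ u

------------------------------------------------------------------------
-- Assignments of objects to machines (or bins), which are named by ℕ

assigned : ∀ {A : Set} {n} → Vec A n → Vec ℕ n → ℕ → List A
assigned xs σ m =
  List.map proj₁ (filter (λ p → proj₂ p ℕ.≟ m) (toList (Vec.zip xs σ)))

used : ∀ {n} → Vec ℕ n → List ℕ
used σ = deduplicate ℕ._≟_ (toList σ)

------------------------------------------------------------------------
-- Static bin packing, Harmonic, and Π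

IsPacking : ∀ {n} → Vec ℚ n → Vec ℕ n → Set
IsPacking ws σ = ∀ b → sumℚ (assigned ws σ b) ≤ 1ℚ

bins : ∀ {n} → Vec ℕ n → ℕ
bins σ = List.length (used σ)

IsMinBins : ∀ {n} → Vec ℚ n → ℕ → Set
IsMinBins ws m =
  (∃ λ σ → IsPacking ws σ × bins σ ≡ m) ×
  (∀ σ → IsPacking ws σ → m ℕ.≤ bins σ)

-- Number of further bins Next-Fit opens when the open bin has the given level.
nextFitFrom : ℚ → List ℚ → ℕ
nextFitFrom level []       = 0
nextFitFrom level (w ∷ ws) with level + w ≤? 1ℚ
... | yes _ = nextFitFrom (level + w) ws
... | no  _ = suc (nextFitFrom w ws)

nextFit : List ℚ → ℕ
nextFit []       = 0
nextFit (w ∷ ws) = suc (nextFitFrom w ws)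

harmonicClass : ℕ → List ℚ → List ℚ
harmonicClass j = filter (λ w → (recip (suc j) <? w) ×-dec (w ≤? recip j))

-- The index i of the sum stands for the class j = i + 1, so j = 1 , … , k - 1.
harmonic : ℕ → List ℚ → ℕ
harmonic k ws =
  ℕ.sum (List.map (λ i → nextFit (harmonicClass (suc i) ws)) (upTo (k ℕ.∸ 1)))
  ℕ.+ nextFit (filter (_≤? recip k) ws)

-- Π k is the least ρ such that Harmonic with parameter k always uses at most
-- ρ · (optimal number of bins) + k bins.
Π : ℕ → ℝ⁺
Π k ρ = ∀ {n} (ws : Vec ℚ n) → (∀ i → 0ℚ < lookup ws i × lookup ws i ≤ 1ℚ) →
  ∀ m → IsMinBins ws m →
  fromℕ (harmonic k (toList ws)) ≤ ρ * fromℕ m + fromℕ k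

------------------------------------------------------------------------
-- Dynamic bin packing

record Request : Set where
  constructor request
  field
    start end size : ℚ

  len : ℚ
  len = end - start

open Request public

Active : ℚ → Request → Set
Active t r = start r ≤ t × t < end r

active? : ∀ t r → Dec (Active t r)
active? t r = (start r ≤? t) ×-dec (t <? end r)

record Instance : Set where
  field
    {n}              : ℕ
    requests         : Vec Request n
    T                : ℚ
    {{T-positive}}   : Positive T
    size-positive    : ∀ i → 0ℚ < size (lookup requests i)
    size≤1           : ∀ i → size (lookup requests i) ≤ 1ℚ
    start≥0          : ∀ i → 0ℚ ≤ start (lookup requests i)
    end≤T            : ∀ i → end (lookup requests i) ≤ T
    1≤len            : ∀ i → 1ℚ ≤ len (lookup requests i)
    minimum-len      : ∃ λ i → len (lookup requests i) ≡ 1ℚ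
    always-active    : ∀ t → 0ℚ ≤ t → t < T → ∃ λ i → Active t (lookup requests i)

  -- The maximum length; the base case 0 is immaterial as lengths are ≥ 1.
  μ : ℚ
  μ = Vec.foldr′ _⊔_ 0ℚ (Vec.map len requests)

  average : ℚ → ℚ
  average c = _÷_ c T {{pos⇒nonZero T}}

open Instance public using (n; requests; T; μ; average)

Uniform : Instance → Set
Uniform I = ∃ λ (g : ℕ) → ∀ i → size (lookup (requests I) i) ≡ recip (suc g)

loadAt : ℚ → List Request → ℚ
loadAt t rs = sumℚ (List.map size (filter (active? t) rs))

-- Between consecutive endpoints of the requests activity does not change, so a
-- gap [ a , b ) counts in full exactly when some request is active at a.
activeGap : List Request → ℚ → ℚ → ℚ
activeGap rs a b with any? (active? a) rs
... | yes _ = b - a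
... | no  _ = 0ℚ

activeGaps : List Request → List ℚ → ℚ
activeGaps rs (a ∷ ts@(b ∷ _)) = activeGap rs a b + activeGaps rs ts
activeGaps rs _                = 0ℚ

activeTime : List Request → ℚ
activeTime rs =
  activeGaps rs (sort (List.map start rs List.++ List.map end rs))
  where open MergeSort ℚ.≤-decTotalOrder using (sort)

Schedule : Instance → Set
Schedule I = Vec ℕ (n I)

Feasible : (I : Instance) → Schedule I → Set
Feasible I σ = ∀ t m → loadAt t (assigned (requests I) σ m) ≤ 1ℚ

cost : (I : Instance) → Schedule I → ℚ
cost I σ =
  sumℚ (List.map (λ m → activeTime (assigned (requests I) σ m)) (used σ))

IsOPT : Instance → ℚ → Set
IsOPT I c =
  (∃ λ σ → Feasible I σ × cost I σ ≡ c) ×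
  (∀ σ → Feasible I σ → c ≤ cost I σ)

------------------------------------------------------------------------
-- Polynomial-time computation

data Ty : Set where
  unit nat num : Ty
  _`×_ _`⊎_    : Ty → Ty → Ty
  list         : Ty → Ty

infixr 5 _`×_
infixr 4 _`⊎_

⟦_⟧ : Ty → Set
⟦ unit ⟧   = ⊤
⟦ nat ⟧    = ℕ
⟦ num ⟧    = ℚ
⟦ A `× B ⟧ = ⟦ A ⟧ × ⟦ B ⟧
⟦ A `⊎ B ⟧ = ⟦ A ⟧ ⊎ ⟦ B ⟧
⟦ list A ⟧ = List ⟦ A ⟧

compare≤ : ℚ × ℚ → ⊤ ⊎ ⊤
compare≤ (p , q) with p ≤? q
... | yes _ = inj₁ tt
... | no  _ = inj₂ tt

uncons : ∀ {A : Set} → List A → ⊤ ⊎ (A × List A)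
uncons []       = inj₁ tt
uncons (x ∷ xs) = inj₂ (x , xs)

unsuc : ℕ → ⊤ ⊎ ℕ
unsuc zero    = inj₁ tt
unsuc (suc n) = inj₂ n

-- Unit-cost operations.  Arithmetic on numbers is deliberately restricted to
-- linear operations with constant coefficients: after t steps every number is
-- an affine combination of input numbers whose coefficients have O(t) bits.
-- Likewise lists and naturals grow by at most one per step.  Hence polynomially
-- many steps can be simulated in polynomial time by a Turing machine.
data Op : Ty → Ty → Set where
  id       : ∀ {A} → Op A A
  fst      : ∀ {A B} → Op (A `× B) A
  snd      : ∀ {A B} → Op (A `× B) B
  inl      : ∀ {A B} → Op A (A `⊎ B)
  inr      : ∀ {A B} → Op B (A `⊎ B)
  star     : ∀ {A} → Op A unit
  zero′    : ∀ {A} → Op A nat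
  suc′     : Op nat nat
  unsuc′   : Op nat (unit `⊎ nat)
  nil      : ∀ {A B} → Op A (list B)
  cons     : ∀ {A} → Op (A `× list A) (list A)
  uncons′  : ∀ {A} → Op (list A) (unit `⊎ A `× list A)
  constant : ∀ {A} → ℚ → Op A num
  add      : Op (num `× num) num
  scale    : ℚ → Op num num
  leq      : Op (num `× num) (unit `⊎ unit)

apply : ∀ {A B} → Op A B → ⟦ A ⟧ → ⟦ B ⟧
apply id           x        = x
apply fst          x        = proj₁ x
apply snd          x        = proj₂ x
apply inl          x        = inj₁ x
apply inr          x        = inj₂ x
apply star         _        = tt
apply zero′        _        = 0
apply suc′         m        = suc m
apply unsuc′       m        = unsuc m
apply nil          _        = []
apply cons         (x , xs) = x ∷ xs
apply uncons′      xs       = uncons xs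
apply (constant q) _        = q
apply add          (p , q)  = p + q
apply (scale q)    p        = q * p
apply leq          pq       = compare≤ pq

-- loop f repeats f until it returns a right injection; it may diverge.
data Prog : Ty → Ty → Set where
  op     : ∀ {A B} → Op A B → Prog A B
  _then_ : ∀ {A B C} → Prog A B → Prog B C → Prog A C
  pair   : ∀ {A B C} → Prog A B → Prog A C → Prog A (B `× C)
  branch : ∀ {A B C D} → Prog (A `× C) D → Prog (B `× C) D →
           Prog ((A `⊎ B) `× C) D
  loop   : ∀ {A B} → Prog A (A `⊎ B) → Prog A B

-- p ⊢ x ⇓ y ⟨ t ⟩ : on input x the program p halts with output y in t steps.
data _⊢_⇓_⟨_⟩ : ∀ {A B} → Prog A B → ⟦ A ⟧ → ⟦ B ⟧ → ℕ → Set where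
  op⇓ : ∀ {A B} {o : Op A B} {x} →
    op o ⊢ x ⇓ apply o x ⟨ 1 ⟩
  then⇓ : ∀ {A B C} {p : Prog A B} {q : Prog B C} {x y z s t} →
    p ⊢ x ⇓ y ⟨ s ⟩ → q ⊢ y ⇓ z ⟨ t ⟩ →
    (p then q) ⊢ x ⇓ z ⟨ suc (s ℕ.+ t) ⟩
  pair⇓ : ∀ {A B C} {p : Prog A B} {q : Prog A C} {x y z s t} →
    p ⊢ x ⇓ y ⟨ s ⟩ → q ⊢ x ⇓ z ⟨ t ⟩ →
    pair p q ⊢ x ⇓ (y , z) ⟨ suc (s ℕ.+ t) ⟩
  branch₁⇓ : ∀ {A B C D} {p : Prog (A `× C) D} {q : Prog (B `× C) D} {x y z t} →
    p ⊢ (x , y) ⇓ z ⟨ t ⟩ →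
    branch p q ⊢ (inj₁ x , y) ⇓ z ⟨ suc t ⟩
  branch₂⇓ : ∀ {A B C D} {p : Prog (A `× C) D} {q : Prog (B `× C) D} {x y z t} →
    q ⊢ (x , y) ⇓ z ⟨ t ⟩ →
    branch p q ⊢ (inj₂ x , y) ⇓ z ⟨ suc t ⟩
  done⇓ : ∀ {A B} {p : Prog A (A `⊎ B)} {x y t} →
    p ⊢ x ⇓ inj₂ y ⟨ t ⟩ →
    loop p ⊢ x ⇓ y ⟨ suc t ⟩
  again⇓ : ∀ {A B} {p : Prog A (A `⊎ B)} {x x′ y s t} →
    p ⊢ x ⇓ inj₁ x′ ⟨ s ⟩ → loop p ⊢ x′ ⇓ y ⟨ t ⟩ →
    loop p ⊢ x ⇓ y ⟨ suc (s ℕ.+ t) ⟩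

requestTy : Ty
requestTy = num `× num `× num

input : Instance → ⟦ list requestTy ⟧
input I = toList (Vec.map (λ r → start r , end r , size r) (requests I))

-- Length, up to a constant factor, of the binary encoding.
bitsℚ : ℚ → ℕ
bitsℚ q = 2 ℕ.+ ⌊log₂ ℤ.∣ ↥ q ∣ ⌋ ℕ.+ ⌊log₂ ↧ₙ q ⌋

inputSize : Instance → ℕ
inputSize I = Vec.sum (Vec.map bitsRequest (requests I))
  where
  bitsRequest : Request → ℕ
  bitsRequest r = bitsℚ (start r) ℕ.+ bitsℚ (end r) ℕ.+ bitsℚ (size r)

record PolyTimeAlgorithm : Set where
  field
    program     : Prog (list requestTy) (list nat)
    schedule    : (I : Instance) → Schedule I
    steps       : Instance → ℕ
    runs        : ∀ I → program ⊢ input I ⇓ toList (schedule I) ⟨ steps I ⟩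
    feasible    : ∀ I → Feasible I (schedule I)
    coefficient : ℕ
    degree      : ℕ
    polynomial  : ∀ I → steps I ℕ.≤ coefficient ℕ.* inputSize I ℕ.^ degree

  averageCost : Instance → ℚ
  averageCost I = average I (cost I (schedule I))

open PolyTimeAlgorithm public using (averageCost)

-- log μ inside O(·), read as log₂ (max (μ , 2)): the bounds concern growth in μ,
-- and log μ itself vanishes at μ = 1.
logμ : Instance → ℝ⁺
logμ I = log₂ (fromℕ 2 ⊔ μ I)

{-# OPTIONS --safe #-}

-- At any time the active machines of an optimal schedule form a static packing
-- of the active sizes.  Packing N copies of these sizes and letting N grow
-- removes the additive k of Harmonic, so the bins that Next-Fit closes in the
-- harmonic classes number at most ρ times the optimal machines, for every ρ
-- above Π_k; the sizes 3/5 and 2/5 force ρ ≥ 3/2.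
--
-- Second algorithm: place items above 1/3 alone.  From the others repeatedly
-- extract a minimal subset F that keeps the load above a threshold wherever the
-- removed items are active.  By minimality every item of F has a time at which
-- the load of F is small, so this load is always at most twice the threshold,
-- and First-Fit by start needs few machines for F.
--
-- First algorithm: divide the items by harmonic class, by length up to a factor
-- 2, and by start into windows of length L.  A window is cut into batches of
-- load 1, 2, 3, …, each packed by Next-Fit in order of decreasing end, so that
-- the active items always form a prefix of the batch.  With B batches the error
-- is O(L B), while their load is at least B²/2; Cauchy–Schwarz turns this into
-- the square root.  The items left over from the last batches have volume of
-- the same order and go to the second algorithm.
module Submission where

open import Defs
open import Data.Bool.Base using (Bool; true; false; if_then_else_; _∧_; not)
open import Data.Empty using (⊥; ⊥-elim)
open import Data.Fin.Base as Fin using (Fin)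
open import Data.Integer.Base as ℤ using ()
open import Data.List.Base as List using (List; []; _∷_; [_]; _++_; map; concat; filter; reverse; length; replicate)
import Data.List.Properties as List
open import Data.List.Membership.Propositional using (_∈_; _∉_; find; lose)
import Data.List.Membership.Propositional.Properties as ∈
open import Data.List.Relation.Binary.Permutation.Propositional as ↭ using (_↭_; ↭-refl; ↭-sym; ↭-trans; prep; swap)
import Data.List.Relation.Binary.Permutation.Propositional.Properties as ↭
open import Data.List.Relation.Unary.All as All using (All; []; _∷_)
import Data.List.Relation.Unary.All.Properties as All
open import Data.List.Relation.Unary.Any as Any using (Any; here; there; any?)
import Data.List.Relation.Unary.Any.Properties as Any
open import Data.Nat.Base as ℕ using (ℕ; zero; suc; z≤n; s≤s)
import Data.Nat.Properties as ℕ
open import Data.Product using (Σ; ∃; _×_; _,_; proj₁; proj₂)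
open import Data.Rational.Base as ℚ using (ℚ; 0ℚ; 1ℚ; _+_; _*_; _-_; -_; _≤_; _<_)
import Data.Rational.Properties as ℚ
open import Data.Sum.Base using (_⊎_; inj₁; inj₂)
open import Data.Unit.Base using (⊤; tt)
open import Data.Vec.Base as Vec using (Vec; lookup; toList)
open import Function.Base using (_∘_; _$_)
open import Relation.Binary.PropositionalEquality using (_≡_; _≢_; refl; sym; trans; cong; cong₂; subst; subst₂)
open import Relation.Nullary using (Dec; yes; no; ¬_; contradiction)
open import Data.List.Relation.Unary.Linked using (Linked; []; [-]; _∷_)
open import Data.Maybe.Base using (just; nothing)
open import Tactic.RingSolver using (solve-∀)
open import Tactic.RingSolver.Core.AlmostCommutativeRing using (AlmostCommutativeRing; fromCommutativeRing)
import Data.List.Sort.MergeSort as MergeSort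
import Data.List.Relation.Unary.Sorted.TotalOrder.Properties as Sorted
open import Data.List.Relation.Binary.Pointwise using (Pointwise-≡⇒≡)
open import Data.List.Relation.Unary.Unique.Propositional using (Unique)
open import Data.List.Relation.Unary.AllPairs using (AllPairs; []; _∷_)
import Data.List.Relation.Unary.Unique.DecPropositional.Properties as Unique
import Data.Vec.Properties as Vec
import Data.Rational.Unnormalised.Base as ℚᵘ
import Data.Rational.Unnormalised.Properties as ℚᵘ
import Data.Integer.Properties as ℤ
import Data.List.Relation.Binary.Permutation.Setoid.Properties as ↭ₛ
open import Relation.Binary.PropositionalEquality.Properties using (setoid)
import Data.Nat.Tactic.RingSolver as ℕ-Solver
open import Relation.Nullary.Decidable using (_×-dec_; from-yes)
import Algebra.Solver.CommutativeMonoid as CM-Solver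
open import Relation.Binary.Bundles using (DecTotalOrder)
import Data.List.Sort.MergeSort.Properties as MergeSortₚ
open import Algebra.Definitions.RawSemiring ℚ.+-*-rawSemiring using (_^_)

-- The second bound compares with the load of the optimum only. Its general branch opens about
-- 3k/(k-1) machines per unit of load, which is at most 3(1 + 1/(k-2)); the value 3/2 is needed to
-- replace this 3 by twice Π_k. In the first bound Harmonic acts on each batch separately, and one
-- extra bin per batch at every time would be too much if it were charged to the optimum. Closed
-- bins are superadditive under concatenation, so all batches together close no more bins than
-- Harmonic does on all active items. The one open bin of a batch is charged to the lifetime of the
-- batch instead, and this is the error that the growing batch loads keep small. The minimum number
-- of bins in the definition of Π_k is available here only up to double negation. This suffices,
-- since it serves to prove inequalities between rationals, which are decidable. Roots are never
-- extracted: a member of the right-hand side supplies a rational `s` whose square is large enough.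
-- The algorithms compare linear expressions only, as the machine model demands; quantities
-- depending on `k` are constants of the program.

-- Every step of a program enlarges lists and naturals by at most one, so a
-- bound on the running time also bounds the size of the output.
Bounded : ∀ A → ⟦ A ⟧ → ℕ → Set
Bounded unit     _        N = ⊤
Bounded nat      m        N = m ℕ.≤ N
Bounded num      _        N = ⊤
Bounded (A `× B) p        N = Bounded A (proj₁ p) N × Bounded B (proj₂ p) N
Bounded (A `⊎ B) (inj₁ x) N = Bounded A x N
Bounded (A `⊎ B) (inj₂ y) N = Bounded B y N
Bounded (list A) xs       N = length xs ℕ.≤ N × All (λ x → Bounded A x N) xs

Bounded-mono : ∀ A {x M N} → M ℕ.≤ N → Bounded A x M → Bounded A x N
Bounded-mono unit     M≤N _        = tt
Bounded-mono nat      M≤N b        = ℕ.≤-trans b M≤N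
Bounded-mono num      M≤N _        = tt
Bounded-mono (A `× B) M≤N (b , b′) = Bounded-mono A M≤N b , Bounded-mono B M≤N b′
Bounded-mono (A `⊎ B) {inj₁ _} M≤N b = Bounded-mono A M≤N b
Bounded-mono (A `⊎ B) {inj₂ _} M≤N b = Bounded-mono B M≤N b
Bounded-mono (list A) M≤N (b , bs) = ℕ.≤-trans b M≤N , All.map (Bounded-mono A M≤N) bs

apply-bounded : ∀ {A B} (o : Op A B) x {N} → Bounded A x N → Bounded B (apply o x) (suc N)
apply-bounded {A} id x b = Bounded-mono A (ℕ.n≤1+n _) b
apply-bounded {A `× B} fst x (b , _) = Bounded-mono A (ℕ.n≤1+n _) b
apply-bounded {A `× B} snd x (_ , b) = Bounded-mono B (ℕ.n≤1+n _) b
apply-bounded {A} inl x b = Bounded-mono A (ℕ.n≤1+n _) b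
apply-bounded {A} inr x b = Bounded-mono A (ℕ.n≤1+n _) b
apply-bounded star x b = tt
apply-bounded zero′ x b = z≤n
apply-bounded suc′ x b = s≤s b
apply-bounded unsuc′ zero b = tt
apply-bounded unsuc′ (suc x) b = ℕ.≤-trans (ℕ.n≤1+n _) (ℕ.≤-trans b (ℕ.n≤1+n _))
apply-bounded nil x b = z≤n , []
apply-bounded {A `× _} cons (x , xs) (b , c , bs) =
  s≤s c , Bounded-mono A (ℕ.n≤1+n _) b ∷ All.map (Bounded-mono A (ℕ.n≤1+n _)) bs
apply-bounded uncons′ [] b = tt
apply-bounded {list A} uncons′ (x ∷ xs) (c , b ∷ bs) =
  Bounded-mono A (ℕ.n≤1+n _) b ,
  ℕ.≤-trans (ℕ.n≤1+n _) (ℕ.≤-trans c (ℕ.n≤1+n _)) , All.map (Bounded-mono A (ℕ.n≤1+n _)) bs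
apply-bounded (constant q) x b = tt
apply-bounded add x b = tt
apply-bounded (scale q) x b = tt
apply-bounded leq (p , q) b with p ℚ.≤? q
... | yes _ = tt
... | no  _ = tt

run-bounded : ∀ {A B} {p : Prog A B} {x y t N} → p ⊢ x ⇓ y ⟨ t ⟩ → Bounded A x N → Bounded B y (t ℕ.+ N)
run-bounded {x = x} (op⇓ {o = o}) b = apply-bounded o x b
run-bounded {B = C} {N = N} (then⇓ {s = s} {t} r r′) b =
  Bounded-mono C (ℕ.≤-trans (ℕ.≤-reflexive (trans (sym (ℕ.+-assoc t s N)) (cong (ℕ._+ N) (ℕ.+-comm t s)))) (ℕ.n≤1+n _))
    (run-bounded r′ (run-bounded r b))
run-bounded {B = B `× C} {N = N} (pair⇓ {s = s} {t} r r′) b =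
  Bounded-mono B (ℕ.+-monoˡ-≤ N (ℕ.m≤n⇒m≤1+n (ℕ.m≤m+n s t))) (run-bounded r b) ,
  Bounded-mono C (ℕ.+-monoˡ-≤ N (ℕ.m≤n⇒m≤1+n (ℕ.m≤n+m t s))) (run-bounded r′ b)
run-bounded {B = D} (branch₁⇓ r) b = Bounded-mono D (ℕ.n≤1+n _) (run-bounded r b)
run-bounded {B = D} (branch₂⇓ r) b = Bounded-mono D (ℕ.n≤1+n _) (run-bounded r b)
run-bounded {B = D} (done⇓ r) b = Bounded-mono D (ℕ.n≤1+n _) (run-bounded r b)
run-bounded {B = D} {N = N} (again⇓ {s = s} {t} r r′) b =
  Bounded-mono D (ℕ.≤-trans (ℕ.≤-reflexive (trans (sym (ℕ.+-assoc t s N)) (cong (ℕ._+ N) (ℕ.+-comm t s)))) (ℕ.n≤1+n _))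
    (run-bounded r′ (run-bounded r b))

-- Polynomial bounds and polynomial-time computable functions.

Poly : (ℕ → ℕ) → Set
Poly g = ∃ λ c → ∃ λ d → ∀ N → g N ℕ.≤ c ℕ.* suc N ℕ.^ d

1≤^ : ∀ N d → 1 ℕ.≤ suc N ℕ.^ d
1≤^ N d = ℕ.m^n>0 (suc N) d

poly-const : ∀ c → Poly (λ _ → c)
poly-const c = c , 0 , λ N → ℕ.≤-reflexive (sym (ℕ.*-identityʳ c))

poly-id : Poly (λ N → N)
poly-id = 1 , 1 , λ N → ℕ.≤-trans (ℕ.n≤1+n N)
  (ℕ.≤-reflexive (sym (trans (ℕ.*-identityˡ _) (ℕ.*-identityʳ (suc N)))))

poly-+ : ∀ {f g} → Poly f → Poly g → Poly (λ N → f N ℕ.+ g N)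
poly-+ (c , d , f≤) (c′ , d′ , g≤) = c ℕ.+ c′ , d ℕ.+ d′ , λ N → let X = suc N in
  ℕ.≤-trans
    (ℕ.+-mono-≤
      (ℕ.≤-trans (f≤ N) (ℕ.*-monoʳ-≤ c (ℕ.^-monoʳ-≤ X (ℕ.m≤m+n d d′))))
      (ℕ.≤-trans (g≤ N) (ℕ.*-monoʳ-≤ c′ (ℕ.^-monoʳ-≤ X (ℕ.m≤n+m d′ d)))))
    (ℕ.≤-reflexive (sym (ℕ.*-distribʳ-+ (X ℕ.^ (d ℕ.+ d′)) c c′)))

poly-* : ∀ {f g} → Poly f → Poly g → Poly (λ N → f N ℕ.* g N)
poly-* (c , d , f≤) (c′ , d′ , g≤) = c ℕ.* c′ , d ℕ.+ d′ , λ N → let X = suc N in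
  ℕ.≤-trans (ℕ.*-mono-≤ (f≤ N) (g≤ N)) (ℕ.≤-reflexive
    (trans (ℕ.[m*n]*[o*p]≡[m*o]*[n*p] c (X ℕ.^ d) c′ (X ℕ.^ d′))
      (cong (c ℕ.* c′ ℕ.*_) (sym (ℕ.^-distribˡ-+-* X d d′)))))

-- The power of `suc N` is at least 1, so `suc (g N)` is at most `suc c′` times that power, and its
-- d-th power is again a constant times a power of `suc N`.
poly-∘ : ∀ {f g} → Poly f → Poly g → Poly (λ N → f (g N))
poly-∘ {f} {g} (c , d , f≤) (c′ , d′ , g≤) = c ℕ.* suc c′ ℕ.^ d , d′ ℕ.* d , λ N →
  let X = suc N in
  ℕ.≤-trans (f≤ (g N)) (ℕ.≤-trans
    (ℕ.*-monoʳ-≤ c (ℕ.^-monoˡ-≤ d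
      (ℕ.≤-trans (s≤s (g≤ N)) (ℕ.+-monoˡ-≤ (c′ ℕ.* X ℕ.^ d′) (1≤^ N d′)))))
    (ℕ.≤-reflexive (trans
      (cong (c ℕ.*_) (trans (^-distribʳ-* (suc c′) (X ℕ.^ d′) d)
        (cong (suc c′ ℕ.^ d ℕ.*_) (ℕ.^-*-assoc X d′ d))))
      (sym (ℕ.*-assoc c _ _)))))
  where
  ^-distribʳ-* : ∀ a b n → (a ℕ.* b) ℕ.^ n ≡ a ℕ.^ n ℕ.* b ℕ.^ n
  ^-distribʳ-* a b zero    = refl
  ^-distribʳ-* a b (suc n) = trans (cong (a ℕ.* b ℕ.*_) (^-distribʳ-* a b n))
    (ℕ.[m*n]*[o*p]≡[m*o]*[n*p] a b _ _)

poly-suc : ∀ {f} → Poly f → Poly (λ N → suc (f N))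
poly-suc p = poly-+ (poly-const 1) p

-- The running time is measured against `N`, a common bound for all list lengths and naturals at
-- every level of the input. By `size-bounded` such a bound for the output follows from the time
-- alone, which is what makes these functions compose.
record Computable {A B : Ty} (f : ⟦ A ⟧ → ⟦ B ⟧) : Set where
  constructor computable
  field
    prog  : Prog A B
    bound : ℕ → ℕ
    poly  : Poly bound
    run   : ∀ N x → Bounded A x N → ∃ λ t → t ℕ.≤ bound N × prog ⊢ x ⇓ f x ⟨ t ⟩

open Computable

size-bounded : ∀ {A B} {f : ⟦ A ⟧ → ⟦ B ⟧} (c : Computable {A} {B} f) {N x} →
  Bounded A x N → Bounded B (f x) (bound c N ℕ.+ N)
size-bounded {B = B} c {N} {x} b with run c N x b
... | t , t≤ , r = Bounded-mono B (ℕ.+-monoˡ-≤ N t≤) (run-bounded r b)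

abstract
  opᶜ : ∀ {A B} (o : Op A B) → Computable {A} {B} (apply o)
  opᶜ o = computable (op o) (λ _ → 1) (poly-const 1) λ N x b → 1 , ℕ.≤-refl , op⇓

infixr 9 _∘ᶜ_
abstract
  _∘ᶜ_ : ∀ {A B C} {g : ⟦ B ⟧ → ⟦ C ⟧} {f : ⟦ A ⟧ → ⟦ B ⟧} →
    Computable {B} {C} g → Computable {A} {B} f → Computable {A} {C} (λ x → g (f x))
  _∘ᶜ_ {f = f} q p = computable (prog p then prog q)
    (λ N → suc (bound p N ℕ.+ bound q (bound p N ℕ.+ N)))
    (poly-suc (poly-+ (poly p) (poly-∘ (poly q) (poly-+ (poly p) poly-id))))
    λ N x b → let (s , s≤ , r) = run p N x b
                  (t , t≤ , r′) = run q _ (f x) (size-bounded p b)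
              in suc (s ℕ.+ t) , s≤s (ℕ.+-mono-≤ s≤ t≤) , then⇓ r r′

infixr 4 _,ᶜ_
abstract
  _,ᶜ_ : ∀ {A B C} {f : ⟦ A ⟧ → ⟦ B ⟧} {g : ⟦ A ⟧ → ⟦ C ⟧} →
    Computable {A} {B} f → Computable {A} {C} g → Computable {A} {B `× C} (λ x → f x , g x)
  p ,ᶜ q = computable (pair (prog p) (prog q))
    (λ N → suc (bound p N ℕ.+ bound q N)) (poly-suc (poly-+ (poly p) (poly q)))
    λ N x b → let (s , s≤ , r) = run p N x b
                  (t , t≤ , r′) = run q N x b
              in suc (s ℕ.+ t) , s≤s (ℕ.+-mono-≤ s≤ t≤) , pair⇓ r r′

either : ∀ {A B C D : Set} → (A × C → D) → (B × C → D) → (A ⊎ B) × C → D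
either f g (inj₁ x , z) = f (x , z)
either f g (inj₂ y , z) = g (y , z)

abstract
  eitherᶜ : ∀ {A B C D} {f : ⟦ A ⟧ × ⟦ C ⟧ → ⟦ D ⟧} {g : ⟦ B ⟧ × ⟦ C ⟧ → ⟦ D ⟧} →
    Computable {A `× C} {D} f → Computable {B `× C} {D} g →
    Computable {(A `⊎ B) `× C} {D} (either f g)
  eitherᶜ p q = computable (branch (prog p) (prog q))
    (λ N → suc (bound p N ℕ.+ bound q N)) (poly-suc (poly-+ (poly p) (poly q)))
    λ { N (inj₁ x , z) b → let (t , t≤ , r) = run p N (x , z) b in
          suc t , s≤s (ℕ.≤-trans t≤ (ℕ.m≤m+n _ _)) , branch₁⇓ r
      ; N (inj₂ y , z) b → let (t , t≤ , r) = run q N (y , z) b in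
          suc t , s≤s (ℕ.≤-trans t≤ (ℕ.m≤n+m _ _)) , branch₂⇓ r }

  _≗ᶜ_ : ∀ {A B} {f g : ⟦ A ⟧ → ⟦ B ⟧} → Computable {A} {B} f → (∀ x → f x ≡ g x) → Computable {A} {B} g
  c ≗ᶜ eq = computable (prog c) (bound c) (poly c) λ N x b →
    let (t , t≤ , r) = run c N x b in
    t , t≤ , subst (λ y → prog c ⊢ x ⇓ y ⟨ t ⟩) (eq x) r

idᶜ : ∀ {A} → Computable {A} {A} (λ x → x)
idᶜ = opᶜ id

flag : Bool → ⊤ ⊎ ⊤
flag b = if b then inj₁ tt else inj₂ tt

Decidableᶜ : ∀ {A} → (⟦ A ⟧ → Bool) → Set
Decidableᶜ {A} p = Computable {A} {unit `⊎ unit} (λ x → flag (p x))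

ifᶜ : ∀ {A B} {p : ⟦ A ⟧ → Bool} {f g : ⟦ A ⟧ → ⟦ B ⟧} →
  Decidableᶜ {A} p → Computable {A} {B} f → Computable {A} {B} g →
  Computable {A} {B} (λ x → if p x then f x else g x)
ifᶜ {p = p} {f} {g} cp cf cg =
  (eitherᶜ (cf ∘ᶜ opᶜ snd) (cg ∘ᶜ opᶜ snd) ∘ᶜ (cp ,ᶜ idᶜ)) ≗ᶜ lem
  where
  lem : ∀ x → either (λ y → f (proj₂ y)) (λ y → g (proj₂ y)) (flag (p x) , x) ≡ (if p x then f x else g x)
  lem x with p x
  ... | true  = refl
  ... | false = refl

trueᶜ : ∀ {A} → Decidableᶜ {A} (λ _ → true)
trueᶜ = opᶜ inl ∘ᶜ opᶜ star

falseᶜ : ∀ {A} → Decidableᶜ {A} (λ _ → false)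
falseᶜ = opᶜ inr ∘ᶜ opᶜ star

-- The Boolean combinators compute to conditionals, hence the eta-like lemma.
flag-if : ∀ a (b c : Bool) → (if a then flag b else flag c) ≡ flag (if a then b else c)
flag-if true  b c = refl
flag-if false b c = refl

if?ᶜ : ∀ {A} {p q r : ⟦ A ⟧ → Bool} → Decidableᶜ {A} p → Decidableᶜ {A} q → Decidableᶜ {A} r →
  Decidableᶜ {A} (λ x → if p x then q x else r x)
if?ᶜ {p = p} {q} {r} cp cq cr = ifᶜ cp cq cr ≗ᶜ λ x → flag-if (p x) (q x) (r x)

_∧ᶜ_ : ∀ {A} {p q : ⟦ A ⟧ → Bool} → Decidableᶜ {A} p → Decidableᶜ {A} q → Decidableᶜ {A} (λ x → p x ∧ q x)
_∧ᶜ_ {p = p} {q} cp cq = if?ᶜ cp cq falseᶜ ≗ᶜ λ x → lem (p x) (q x)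
  where
  lem : ∀ a b → flag (if a then b else false) ≡ flag (a ∧ b)
  lem true  b = refl
  lem false b = refl

notᶜ : ∀ {A} {p : ⟦ A ⟧ → Bool} → Decidableᶜ {A} p → Decidableᶜ {A} (λ x → not (p x))
notᶜ {p = p} cp = if?ᶜ cp falseᶜ trueᶜ ≗ᶜ λ x → lem (p x)
  where
  lem : ∀ a → flag (if a then false else true) ≡ flag (not a)
  lem true  = refl
  lem false = refl

abstract
  le : ℚ → ℚ → Bool
  le p q with p ℚ.≤? q
  ... | yes _ = true
  ... | no  _ = false

  le-true : ∀ {p q} → le p q ≡ true → p ≤ q
  le-true {p} {q} eq with p ℚ.≤? q
  ... | yes p≤q = p≤q

  le-false : ∀ {p q} → le p q ≡ false → q < p
  le-false {p} {q} eq with p ℚ.≤? q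
  ... | no p≰q = ℚ.≰⇒> p≰q

  true-le : ∀ {p q} → p ≤ q → le p q ≡ true
  true-le {p} {q} p≤q with p ℚ.≤? q
  ... | yes _   = refl
  ... | no p≰q = contradiction p≤q p≰q

  false-le : ∀ {p q} → q < p → le p q ≡ false
  false-le {p} {q} q<p with p ℚ.≤? q
  ... | yes p≤q = contradiction (ℚ.<-≤-trans q<p p≤q) (ℚ.<-irrefl refl)
  ... | no _    = refl

  compare≤-flag : ∀ p q → compare≤ (p , q) ≡ flag (le p q)
  compare≤-flag p q with p ℚ.≤? q
  ... | yes _ = refl
  ... | no  _ = refl

leᶜ : ∀ {A} {f g : ⟦ A ⟧ → ℚ} → Computable {A} {num} f → Computable {A} {num} g → Decidableᶜ {A} (λ x → le (f x) (g x))
leᶜ {f = f} {g} cf cg = (opᶜ leq ∘ᶜ (cf ,ᶜ cg)) ≗ᶜ λ x → compare≤-flag (f x) (g x)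

_+ᶜ_ : ∀ {A} {f g : ⟦ A ⟧ → ℚ} → Computable {A} {num} f → Computable {A} {num} g → Computable {A} {num} (λ x → f x + g x)
cf +ᶜ cg = opᶜ add ∘ᶜ (cf ,ᶜ cg)

_·ᶜ_ : ∀ {A} {f : ⟦ A ⟧ → ℚ} q → Computable {A} {num} f → Computable {A} {num} (λ x → q * f x)
q ·ᶜ cf = opᶜ (scale q) ∘ᶜ cf

constᶜ : ∀ {A} q → Computable {A} {num} (λ _ → q)
constᶜ q = opᶜ (constant q)

[]ᶜ : ∀ {A B} → Computable {A} {list B} (λ _ → [])
[]ᶜ = opᶜ nil

_∷ᶜ_ : ∀ {A B} {f : ⟦ A ⟧ → ⟦ B ⟧} {g : ⟦ A ⟧ → ⟦ list B ⟧} → Computable {A} {B} f →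
  Computable {A} {list B} g → Computable {A} {list B} (λ x → f x ∷ g x)
cf ∷ᶜ cg = opᶜ cons ∘ᶜ (cf ,ᶜ cg)

fstᶜ : ∀ {A B C} {f : ⟦ C ⟧ → ⟦ A `× B ⟧} → Computable {C} {A `× B} f → Computable {C} {A} (λ x → proj₁ (f x))
fstᶜ c = opᶜ fst ∘ᶜ c

sndᶜ : ∀ {A B C} {f : ⟦ C ⟧ → ⟦ A `× B ⟧} → Computable {C} {A `× B} f → Computable {C} {B} (λ x → proj₂ (f x))
sndᶜ c = opᶜ snd ∘ᶜ c

-- `iterate` has the order of execution of a program loop, `rec` the shape on which proofs proceed
-- by induction. Both hand the remaining tail to the step, which insertion into sorted lists and the
-- pruning test require.
iterate : ∀ {X S : Set} → (X → List X → S → S) → List X → S → S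
iterate f []       s = s
iterate f (x ∷ xs) s = iterate f xs (f x xs s)

rec : ∀ {X S : Set} → (X → List X → S → S) → S → List X → S
rec f z []       = z
rec f z (x ∷ xs) = f x xs (rec f z xs)

module _ {Γ X S : Ty} {f : ⟦ Γ `× X `× list X `× S ⟧ → ⟦ S ⟧}
  (cf : Computable {Γ `× X `× list X `× S} {S} f) where

  private
    St : Ty
    St = list X `× S `× Γ

    next : (⊤ ⊎ (⟦ X ⟧ × List ⟦ X ⟧)) × (⟦ S ⟧ × ⟦ Γ ⟧) → ⟦ St ⟧ ⊎ ⟦ S ⟧
    next = either (λ y → inj₂ (proj₁ (proj₂ y)))
      (λ y → inj₁ (proj₂ (proj₁ y) ,
        f (proj₂ (proj₂ y) , proj₁ (proj₁ y) , proj₂ (proj₁ y) , proj₁ (proj₂ y)) , proj₂ (proj₂ y)))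

    abstract
      body : Computable {St} {St `⊎ S} (λ z → next (uncons (proj₁ z) , proj₂ z))
      body =
        eitherᶜ {unit} {X `× list X}
          (opᶜ inr ∘ᶜ fstᶜ (sndᶜ idᶜ))
          (opᶜ inl ∘ᶜ (sndᶜ (fstᶜ idᶜ) ,ᶜ
             (cf ∘ᶜ (sndᶜ (sndᶜ idᶜ) ,ᶜ fstᶜ (fstᶜ idᶜ) ,ᶜ sndᶜ (fstᶜ idᶜ) ,ᶜ fstᶜ (sndᶜ idᶜ)) ,ᶜ
              sndᶜ (sndᶜ idᶜ))))
        ∘ᶜ (opᶜ uncons′ ∘ᶜ fstᶜ idᶜ ,ᶜ sndᶜ idᶜ)

    step : ⟦ Γ ⟧ → ⟦ X ⟧ → List ⟦ X ⟧ → ⟦ S ⟧ → ⟦ S ⟧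
    step γ x xs s = f (γ , x , xs , s)

  module _ {z : ⟦ Γ ⟧ → ⟦ S ⟧} {l : ⟦ Γ ⟧ → ⟦ list X ⟧}
    (cz : Computable {Γ} {S} z) (cl : Computable {Γ} {list X} l)
    (Inv : ℕ → ⟦ Γ ⟧ → List ⟦ X ⟧ → ⟦ S ⟧ → Set) {Q : ℕ → ℕ} (polyQ : Poly Q)
    (inv-start : ∀ {N γ} → Bounded Γ γ N → Bounded (list X) (l γ) N → Bounded S (z γ) N → Inv N γ (l γ) (z γ))
    (inv-step : ∀ {N γ x xs s} → Inv N γ (x ∷ xs) s → Inv N γ xs (step γ x xs s))
    (inv-bound : ∀ {N γ xs s} → Inv N γ xs s → Bounded S s (Q N)) where

    private
      B : ℕ → ℕ
      B N = bound body (N ℕ.+ Q N)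

      body-run : ∀ N γ xs s → Bounded Γ γ N → Bounded (list X) xs N → Inv N γ xs s →
        ∃ λ t → t ℕ.≤ B N × prog body ⊢ (xs , s , γ) ⇓ next (uncons xs , s , γ) ⟨ t ⟩
      body-run N γ xs s bγ bxs i = run body (N ℕ.+ Q N) (xs , s , γ)
        ( Bounded-mono (list X) (ℕ.m≤m+n N _) bxs
        , Bounded-mono S (ℕ.m≤n+m _ N) (inv-bound i)
        , Bounded-mono Γ (ℕ.m≤m+n N _) bγ)

      runs : ∀ N γ xs s → Bounded Γ γ N → Bounded (list X) xs N → Inv N γ xs s →
        ∃ λ t → t ℕ.≤ suc (B N) ℕ.* suc (length xs) ×
          loop (prog body) ⊢ (xs , s , γ) ⇓ iterate (step γ) xs s ⟨ t ⟩
      runs N γ [] s bγ bxs i with body-run N γ [] s bγ bxs i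
      ... | t , t≤ , r = suc t , ℕ.≤-trans (s≤s t≤) (ℕ.≤-reflexive (sym (ℕ.*-identityʳ _))) , done⇓ r
      runs N γ (x ∷ xs) s bγ bxs@(l , bx ∷ b) i
        with body-run N γ (x ∷ xs) s bγ bxs i
           | runs N γ xs (step γ x xs s) bγ (ℕ.≤-trans (ℕ.n≤1+n _) l , b) (inv-step i)
      ... | t , t≤ , r | t′ , t′≤ , r′ = suc (t ℕ.+ t′) ,
        ℕ.≤-trans (ℕ.+-mono-≤ (s≤s t≤) t′≤) (ℕ.≤-reflexive (sym (ℕ.*-suc (suc (B N)) (suc (length xs))))) ,
        again⇓ r r′

      abstract
        entry : Computable {Γ} {St} (λ γ → l γ , z γ , γ)
        entry = cl ,ᶜ cz ,ᶜ idᶜ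

      -- Computing the list and the initial state may already enlarge the data, so the invariant is
      -- started at this larger size.
      M : ℕ → ℕ
      M N = bound entry N ℕ.+ N

    -- A polynomial body alone gives no polynomial loop: a state that doubles in every turn grows
    -- exponentially. The invariant `Inv` keeps every intermediate state below `Q N`, so each turn
    -- costs the same polynomial and their number is the length of the list plus one.
    iterateᶜ : Computable {Γ} {S} (λ γ → iterate (λ x xs s → f (γ , x , xs , s)) (l γ) (z γ))
    iterateᶜ = computable (prog entry then loop (prog body))
      (λ N → suc (bound entry N ℕ.+ suc (B (M N)) ℕ.* suc (M N)))
      (poly-suc (poly-+ (poly entry) (poly-∘ {λ N → suc (B N) ℕ.* suc N}
        (poly-* (poly-suc (poly-∘ (poly body) (poly-+ poly-id polyQ))) (poly-suc poly-id))
        (poly-+ (poly entry) poly-id))))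
      λ N γ bγ →
          let (s , s≤ , r) = run entry N γ bγ
              (bl , bz , bγ′) = size-bounded entry bγ
              (t , t≤ , r′) = runs (M N) γ (l γ) (z γ) bγ′ bl (inv-start bγ′ bl bz)
          in suc (s ℕ.+ t) ,
             s≤s (ℕ.+-mono-≤ s≤ (ℕ.≤-trans t≤ (ℕ.*-monoʳ-≤ (suc (B (M N))) (s≤s (proj₁ bl))))) , then⇓ r r′

reverseᶜ : ∀ {Γ A} {f : ⟦ Γ ⟧ → ⟦ list A ⟧} → Computable {Γ} {list A} f → Computable {Γ} {list A} (λ γ → reverse (f γ))
reverseᶜ {Γ} {A} {f} cf =
  iterateᶜ {Γ} {A} {list A} {λ z → proj₁ (proj₂ z) ∷ proj₂ (proj₂ (proj₂ z))}
    (fstᶜ (sndᶜ idᶜ) ∷ᶜ sndᶜ (sndᶜ (sndᶜ idᶜ)))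
    []ᶜ cf
    (λ N _ xs acc → length acc ℕ.+ length xs ℕ.≤ N × All (λ x → Bounded A x N) acc × All (λ x → Bounded A x N) xs)
    poly-id
    (λ _ (l , b) _ → l , [] , b)
    (λ { {N} {xs = xs} {acc} (l , b , bx ∷ bs) → subst (ℕ._≤ N) (ℕ.+-suc (length acc) (length xs)) l , bx ∷ b , bs })
    (λ (l , b , _) → ℕ.≤-trans (ℕ.m≤m+n _ _) l , b)
  ≗ᶜ λ γ → lem (f γ) []
  where
  lem : ∀ (xs acc : List ⟦ A ⟧) → iterate (λ x xs s → x ∷ s) xs acc ≡ List.reverseAcc acc xs
  lem []       acc = refl
  lem (x ∷ xs) acc = lem xs (x ∷ acc)

iterate-++ : ∀ {X S : Set} (f : X → S → S) xs ys s →
  iterate (λ x _ s → f x s) (xs ++ ys) s ≡ iterate (λ x _ s → f x s) ys (iterate (λ x _ s → f x s) xs s)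
iterate-++ f []       ys s = refl
iterate-++ f (x ∷ xs) ys s = iterate-++ f xs ys (f x s)

module _ {Γ X S : Ty} {f : ⟦ Γ `× X `× list X `× S ⟧ → ⟦ S ⟧} {z : ⟦ Γ ⟧ → ⟦ S ⟧} {l : ⟦ Γ ⟧ → ⟦ list X ⟧} where

  private
    W = Γ `× X `× list X `× list X `× S
    x′ : ⟦ W ⟧ → ⟦ X ⟧
    x′ w = proj₁ (proj₂ w)
    t′ : ⟦ W ⟧ → List ⟦ X ⟧
    t′ w = proj₁ (proj₂ (proj₂ (proj₂ w)))
    s′ : ⟦ W ⟧ → ⟦ S ⟧
    s′ w = proj₂ (proj₂ (proj₂ (proj₂ w)))
    c-x : Computable {W} {X} x′
    c-x = fstᶜ (sndᶜ idᶜ)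
    c-t : Computable {W} {list X} t′
    c-t = fstᶜ (sndᶜ (sndᶜ (sndᶜ idᶜ)))
    c-s : Computable {W} {S} s′
    c-s = sndᶜ (sndᶜ (sndᶜ (sndᶜ idᶜ)))

    go : ⟦ Γ ⟧ → List ⟦ X ⟧ → ⟦ S ⟧
    go γ = rec (λ x xs s → f (γ , x , xs , s)) (z γ)

    rebuild : ∀ γ xs → iterate (λ x _ (t , s) → (x ∷ t) , f (γ , x , t , s)) (reverse xs) ([] , z γ) ≡ (xs , go γ xs)
    rebuild γ []       = refl
    rebuild γ (x ∷ xs)
      rewrite List.unfold-reverse x xs
            | iterate-++ (λ x (t , s) → (x ∷ t) , f (γ , x , t , s)) (reverse xs) [ x ] ([] , z γ)
            | rebuild γ xs = refl

  -- The tail of the list is rebuilt while its reversal is traversed.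
  recᶜ : Computable {Γ `× X `× list X `× S} {S} f → Computable {Γ} {S} z → Computable {Γ} {list X} l →
    ∀ {Q} → Poly Q →
    (∀ N γ xs → Bounded Γ γ N → Bounded (list X) xs N → Bounded S (go γ xs) (Q N)) →
    Computable {Γ} {S} (λ γ → go γ (l γ))
  recᶜ cf cz cl {Q} polyQ bnd =
    sndᶜ
      (iterateᶜ {Γ} {X} {list X `× S} {λ w → (x′ w ∷ t′ w) , f (proj₁ w , x′ w , t′ w , s′ w)}
        (c-x ∷ᶜ c-t ,ᶜ cf ∘ᶜ (fstᶜ idᶜ ,ᶜ c-x ,ᶜ c-t ,ᶜ c-s))
        ([]ᶜ ,ᶜ cz) (reverseᶜ cl)
        (λ N γ xs (t , s) → Bounded Γ γ N × s ≡ go γ t × length t ℕ.+ length xs ℕ.≤ N ×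
          All (λ x → Bounded X x N) t × All (λ x → Bounded X x N) xs)
        {λ N → N ℕ.+ Q N} (poly-+ poly-id polyQ)
        (λ bγ (l , b) _ → bγ , refl , l , [] , b)
        (λ { {N} {xs = xs} {t , s} (bγ , refl , l , b , bx ∷ bs) → bγ , refl , subst (ℕ._≤ N) (ℕ.+-suc (length t) (length xs)) l , bx ∷ b , bs })
        (λ { {N} {γ} {xs} {t , s} (bγ , refl , l , b , _) →
          let l′ = ℕ.≤-trans (ℕ.m≤m+n _ _) l in
          (ℕ.≤-trans l′ (ℕ.m≤m+n N _) , All.map (Bounded-mono X (ℕ.m≤m+n N _)) b) ,
          Bounded-mono S (ℕ.m≤n+m _ N) (bnd N γ t bγ (l′ , b)) }))
    ≗ᶜ λ γ → cong proj₂ (rebuild γ (l γ))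

-- Ordered arithmetic, finite sums and integrals of step functions.

ℚ-ring : AlmostCommutativeRing _ _
ℚ-ring = fromCommutativeRing ℚ.+-*-commutativeRing zero?
  where
  zero? : ∀ x → _
  zero? x with 0ℚ ℚ.≟ x
  ... | yes p = just p
  ... | no  _ = nothing

infixl 6 _⊞_ _⊞<_
infixl 7 _⊠_

diff≥0 : ∀ {p q} → p ≤ q → 0ℚ ≤ q - p
diff≥0 {p} {q} p≤q = subst (_≤ q - p) (ℚ.+-inverseʳ p) (ℚ.+-monoˡ-≤ (- p) p≤q)

diff>0 : ∀ {p q} → p < q → 0ℚ < q - p
diff>0 {p} {q} p<q = subst (_< q - p) (ℚ.+-inverseʳ p) (ℚ.+-monoˡ-< (- p) p<q)

_⊞_ : ∀ {p q} → 0ℚ ≤ p → 0ℚ ≤ q → 0ℚ ≤ p + q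
_⊞_ {p} {q} 0≤p 0≤q = subst (_≤ p + q) (ℚ.+-identityˡ 0ℚ) (ℚ.+-mono-≤ 0≤p 0≤q)

_⊞<_ : ∀ {p q} → 0ℚ ≤ p → 0ℚ < q → 0ℚ < p + q
_⊞<_ {p} {q} 0≤p 0<q = subst (_< p + q) (ℚ.+-identityˡ 0ℚ) (ℚ.+-mono-≤-< 0≤p 0<q)

_⊠_ : ∀ {p q} → 0ℚ ≤ p → 0ℚ ≤ q → 0ℚ ≤ p * q
_⊠_ {p} {q} 0≤p 0≤q = subst (_≤ p * q) (ℚ.*-zeroʳ p) (ℚ.*-monoˡ-≤-nonNeg p {{ℚ.nonNegative 0≤p}} 0≤q)

_⊠<_ : ∀ {p q} → 0ℚ < p → 0ℚ < q → 0ℚ < p * q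
_⊠<_ {p} {q} 0<p 0<q = subst (_< p * q) (ℚ.*-zeroʳ p) (ℚ.*-monoʳ-<-pos p {{ℚ.positive 0<p}} 0<q)

-- Linear inequalities: a ≤ b follows from b = a + d with d ≥ 0.
lin : ∀ {a b d} → 0ℚ ≤ d → b ≡ a + d → a ≤ b
lin {a} {d = d} 0≤d refl = subst (_≤ a + d) (ℚ.+-identityʳ a) (ℚ.+-monoʳ-≤ a 0≤d)

lin< : ∀ {a b d} → 0ℚ < d → b ≡ a + d → a < b
lin< {a} {d = d} 0<d refl = subst (_< a + d) (ℚ.+-identityʳ a) (ℚ.+-monoʳ-< a 0<d)

0≤1 : 0ℚ ≤ 1ℚ
0≤1 = ℚ.nonNegative⁻¹ 1ℚ

0<1 : 0ℚ < 1ℚ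
0<1 = ℚ.positive⁻¹ 1ℚ

absurd< : ∀ {ℓ} {A : Set ℓ} {p q} → p < q → q ≤ p → A
absurd< p<q q≤p = ⊥-elim (ℚ.<-irrefl refl (ℚ.<-≤-trans p<q q≤p))

*-cancel-≤ : ∀ {p q} r → 0ℚ < r → r * p ≤ r * q → p ≤ q
*-cancel-≤ r 0<r = ℚ.*-cancelˡ-≤-pos r {{ℚ.positive 0<r}}

*-monoʳ : ∀ {p q} r → 0ℚ ≤ r → p ≤ q → r * p ≤ r * q
*-monoʳ r 0≤r p≤q = ℚ.*-monoˡ-≤-nonNeg r {{ℚ.nonNegative 0≤r}} p≤q

*-monoˡ : ∀ {p q} r → 0ℚ ≤ r → p ≤ q → p * r ≤ q * r
*-monoˡ r 0≤r p≤q = ℚ.*-monoʳ-≤-nonNeg r {{ℚ.nonNegative 0≤r}} p≤q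

*-mono : ∀ {p q r s} → 0ℚ ≤ p → 0ℚ ≤ r → p ≤ q → r ≤ s → p * r ≤ q * s
*-mono {p} {q} {r} {s} 0≤p 0≤r p≤q r≤s =
  ℚ.≤-trans (*-monoʳ p 0≤p r≤s) (*-monoˡ s (ℚ.≤-trans 0≤r r≤s) p≤q)

module _ {A : Set} where

  ∑ : (A → ℚ) → List A → ℚ
  ∑ f []       = 0ℚ
  ∑ f (x ∷ xs) = f x + ∑ f xs

  ∑-++ : ∀ f xs ys → ∑ f (xs ++ ys) ≡ ∑ f xs + ∑ f ys
  ∑-++ f []       ys = sym (ℚ.+-identityˡ _)
  ∑-++ f (x ∷ xs) ys = trans (cong (f x +_) (∑-++ f xs ys)) (sym (ℚ.+-assoc (f x) _ _))

  ∑-mono : ∀ {f g} xs → (∀ {x} → x ∈ xs → f x ≤ g x) → ∑ f xs ≤ ∑ g xs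
  ∑-mono []       f≤g = ℚ.≤-refl
  ∑-mono (x ∷ xs) f≤g = ℚ.+-mono-≤ (f≤g (here refl)) (∑-mono xs (f≤g ∘ there))

  ∑-cong : ∀ {f g} xs → (∀ {x} → x ∈ xs → f x ≡ g x) → ∑ f xs ≡ ∑ g xs
  ∑-cong []       f≡g = refl
  ∑-cong (x ∷ xs) f≡g = cong₂ _+_ (f≡g (here refl)) (∑-cong xs (f≡g ∘ there))

  ∑-0 : ∀ xs → ∑ (λ _ → 0ℚ) xs ≡ 0ℚ
  ∑-0 []       = refl
  ∑-0 (x ∷ xs) = trans (ℚ.+-identityˡ _) (∑-0 xs)

  ∑-nonneg : ∀ {f} xs → (∀ {x} → x ∈ xs → 0ℚ ≤ f x) → 0ℚ ≤ ∑ f xs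
  ∑-nonneg []       0≤f = ℚ.≤-refl
  ∑-nonneg (x ∷ xs) 0≤f = 0≤f (here refl) ⊞ ∑-nonneg xs (0≤f ∘ there)

  ∑-distrib-+ : ∀ f g xs → ∑ (λ x → f x + g x) xs ≡ ∑ f xs + ∑ g xs
  ∑-distrib-+ f g []       = refl
  ∑-distrib-+ f g (x ∷ xs) rewrite ∑-distrib-+ f g xs = lem (f x) (g x) (∑ f xs) (∑ g xs)
    where
    lem : ∀ a b c d → (a + b) + (c + d) ≡ (a + c) + (b + d)
    lem = solve-∀ ℚ-ring

  ∑-*ˡ : ∀ c f xs → ∑ (λ x → c * f x) xs ≡ c * ∑ f xs
  ∑-*ˡ c f []       = sym (ℚ.*-zeroʳ c)
  ∑-*ˡ c f (x ∷ xs) = trans (cong (c * f x +_) (∑-*ˡ c f xs)) (sym (ℚ.*-distribˡ-+ c (f x) _))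

  ∑-↭ : ∀ f {xs ys} → xs ↭ ys → ∑ f xs ≡ ∑ f ys
  ∑-↭ f ↭.refl = refl
  ∑-↭ f (prep x p) = cong (f x +_) (∑-↭ f p)
  ∑-↭ f (swap {xs} {ys} x y p) = trans (cong (λ z → f x + (f y + z)) (∑-↭ f p)) (lem (f x) (f y) (∑ f ys))
    where
    lem : ∀ a b c → a + (b + c) ≡ b + (a + c)
    lem = solve-∀ ℚ-ring
  ∑-↭ f (↭.trans p q) = trans (∑-↭ f p) (∑-↭ f q)

∑-concat : ∀ {A : Set} (f : A → ℚ) xss → ∑ f (concat xss) ≡ ∑ (∑ f) xss
∑-concat f []         = refl
∑-concat f (xs ∷ xss) = trans (∑-++ f xs (concat xss)) (cong (∑ f xs +_) (∑-concat f xss))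

∑-map : ∀ {A B : Set} (f : B → ℚ) (g : A → B) xs → ∑ f (map g xs) ≡ ∑ (f ∘ g) xs
∑-map f g []       = refl
∑-map f g (x ∷ xs) = cong (f (g x) +_) (∑-map f g xs)

-- Integrals of step functions over a sorted list of points

∫ : List ℚ → (ℚ → ℚ) → ℚ
∫ (a ∷ ts@(b ∷ _)) f = (b - a) * f a + ∫ ts f
∫ _                f = 0ℚ

Increasing : List ℚ → Set
Increasing = Linked _≤_

∫-mono : ∀ {f g} ts → Increasing ts → (∀ t → f t ≤ g t) → ∫ ts f ≤ ∫ ts g
∫-mono []           _           f≤g = ℚ.≤-refl
∫-mono (a ∷ [])     _           f≤g = ℚ.≤-refl
∫-mono (a ∷ b ∷ ts) (a≤b ∷ inc) f≤g =
  ℚ.+-mono-≤ (*-monoʳ (b - a) (diff≥0 a≤b) (f≤g a)) (∫-mono (b ∷ ts) inc f≤g)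

∫-cong : ∀ {f g} ts → (∀ t → f t ≡ g t) → ∫ ts f ≡ ∫ ts g
∫-cong []           f≡g = refl
∫-cong (a ∷ [])     f≡g = refl
∫-cong (a ∷ b ∷ ts) f≡g = cong₂ _+_ (cong ((b - a) *_) (f≡g a)) (∫-cong (b ∷ ts) f≡g)

∫-0 : ∀ ts → ∫ ts (λ _ → 0ℚ) ≡ 0ℚ
∫-0 []           = refl
∫-0 (a ∷ [])     = refl
∫-0 (a ∷ b ∷ ts) rewrite ∫-0 (b ∷ ts) | ℚ.*-zeroʳ (b - a) = refl

∫-+ : ∀ f g ts → ∫ ts (λ t → f t + g t) ≡ ∫ ts f + ∫ ts g
∫-+ f g []           = refl
∫-+ f g (a ∷ [])     = refl
∫-+ f g (a ∷ b ∷ ts) rewrite ∫-+ f g (b ∷ ts) = lem (b - a) (f a) (g a) (∫ (b ∷ ts) f) (∫ (b ∷ ts) g)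
  where
  lem : ∀ d x y p q → d * (x + y) + (p + q) ≡ (d * x + p) + (d * y + q)
  lem = solve-∀ ℚ-ring

∫-* : ∀ c f ts → ∫ ts (λ t → c * f t) ≡ c * ∫ ts f
∫-* c f []           = sym (ℚ.*-zeroʳ c)
∫-* c f (a ∷ [])     = sym (ℚ.*-zeroʳ c)
∫-* c f (a ∷ b ∷ ts) rewrite ∫-* c f (b ∷ ts) = lem (b - a) c (f a) (∫ (b ∷ ts) f)
  where
  lem : ∀ d c x p → d * (c * x) + c * p ≡ c * (d * x + p)
  lem = solve-∀ ℚ-ring

∫-∑ : ∀ {A : Set} (f : A → ℚ → ℚ) xs ts → ∫ ts (λ t → ∑ (λ x → f x t) xs) ≡ ∑ (λ x → ∫ ts (f x)) xs
∫-∑ f []       ts = ∫-0 ts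
∫-∑ f (x ∷ xs) ts = trans (∫-+ (f x) (λ t → ∑ (λ x → f x t) xs) ts) (cong (∫ ts (f x) +_) (∫-∑ f xs ts))

-- The points `ps` contain all jumps of a right-continuous step function with bounded support: the
-- value persists from x to y unless a point of `ps` lies in the half-open interval from x,
-- excluded, to y, included.
record Step (ps : List ℚ) (f : ℚ → ℚ) : Set where
  field
    before   : ∀ x → (∀ {p} → p ∈ ps → x < p) → f x ≡ 0ℚ
    after    : ∀ x → (∀ {p} → p ∈ ps → p ≤ x) → f x ≡ 0ℚ
    unchanging : ∀ {x y} → x ≤ y → (∀ {p} → p ∈ ps → p ≤ x ⊎ y < p) → f x ≡ f y

insertPoint : ℚ → List ℚ → List ℚ
insertPoint x []       = [ x ]
insertPoint x (a ∷ ts) with x ℚ.≤? a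
... | yes _ = x ∷ a ∷ ts
... | no  _ = a ∷ insertPoint x ts

insertPoint-↭ : ∀ x ts → insertPoint x ts ↭ x ∷ ts
insertPoint-↭ x []       = ↭-refl
insertPoint-↭ x (a ∷ ts) with x ℚ.≤? a
... | yes _ = ↭-refl
... | no  _ = ↭-trans (prep a (insertPoint-↭ x ts)) (swap a x ↭-refl)

insertPoint-increasing : ∀ x ts → Increasing ts → Increasing (insertPoint x ts)
insertPoint-increasing x []       inc = [-]
insertPoint-increasing x (a ∷ ts) inc with x ℚ.≤? a
... | yes x≤a = x≤a ∷ inc
... | no  x≰a = go ts inc
  where
  a≤x = ℚ.<⇒≤ (ℚ.≰⇒> x≰a)
  go : ∀ ts → Increasing (a ∷ ts) → Increasing (a ∷ insertPoint x ts)
  go []       _           = a≤x ∷ [-]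
  go (b ∷ ts) (a≤b ∷ inc) with x ℚ.≤? b | insertPoint-increasing x (b ∷ ts) inc
  ... | yes x≤b | inc′ = a≤x ∷ inc′
  ... | no  x≰b | inc′ = a≤b ∷ inc′

head-min : ∀ {a p} ts → Increasing (a ∷ ts) → p ∈ ts → a ≤ p
head-min (b ∷ ts) (a≤b ∷ inc) (here refl) = a≤b
head-min (b ∷ ts) (a≤b ∷ inc) (there i)   = ℚ.≤-trans a≤b (head-min ts inc i)

module _ {ps f} (step : Step ps f) where
  open Step step

  private
    split : ∀ {a b x} → a ≤ x → x ≤ b → (x < b → f a ≡ f x) →
      ∀ r → (x - a) * f a + ((b - x) * f x + r) ≡ (b - a) * f a + r
    split {a} {b} {x} a≤x x≤b eq r with x ℚ.<? b
    ... | yes x<b rewrite eq x<b = join a b x (f x) r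
      where
      join : ∀ a b x y r → (x - a) * y + ((b - x) * y + r) ≡ (b - a) * y + r
      join = solve-∀ ℚ-ring
    ... | no  x≮b with ℚ.≤-antisym x≤b (ℚ.≮⇒≥ x≮b)
    ... | refl = join a x (f a) (f x) r
      where
      join : ∀ a x y z r → (x - a) * y + ((x - x) * z + r) ≡ (x - a) * y + r
      join = solve-∀ ℚ-ring

    case-[] : ∀ {a p} → p ≤ a ⊎ p ∈ [] → p ≤ a
    case-[] (inj₁ p≤a) = p≤a

    -- Here `a` is the last grid point passed. Every jump is at most `a` or still ahead in `ts`, so
    -- none lies strictly inside the current gap and splitting the gap is harmless. Behind the last
    -- grid point the function vanishes by `after`.
    ∫-insert-after : ∀ x a ts → Increasing (a ∷ ts) → (∀ {p} → p ∈ ps → p ≤ a ⊎ p ∈ ts) → a ≤ x →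
      ∫ (a ∷ insertPoint x ts) f ≡ ∫ (a ∷ ts) f
    ∫-insert-after x a [] inc ps⊆ a≤x
      rewrite after a (λ i → case-[] (ps⊆ i)) = trans (ℚ.+-identityʳ _) (ℚ.*-zeroʳ (x - a))
    ∫-insert-after x a (b ∷ ts) (a≤b ∷ inc) ps⊆ a≤x with x ℚ.≤? b
    ... | yes x≤b = split a≤x x≤b (λ x<b → unchanging a≤x (λ i → far x<b (ps⊆ i))) (∫ (b ∷ ts) f)
      where
      far : ∀ {p} → x < b → p ≤ a ⊎ p ∈ b ∷ ts → p ≤ a ⊎ x < p
      far x<b (inj₁ p≤a)         = inj₁ p≤a
      far x<b (inj₂ (here refl)) = inj₂ x<b
      far x<b (inj₂ (there i))   = inj₂ (ℚ.<-≤-trans x<b (head-min ts inc i))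
    ... | no  x≰b = cong ((b - a) * f a +_)
      (∫-insert-after x b ts inc (λ i → near (ps⊆ i)) (ℚ.<⇒≤ (ℚ.≰⇒> x≰b)))
      where
      near : ∀ {p} → p ≤ a ⊎ p ∈ b ∷ ts → p ≤ b ⊎ p ∈ ts
      near (inj₁ p≤a)         = inj₁ (ℚ.≤-trans p≤a a≤b)
      near (inj₂ (here refl)) = inj₁ ℚ.≤-refl
      near (inj₂ (there i))   = inj₂ i

  ∫-insertPoint : ∀ x ts → Increasing ts → (∀ {p} → p ∈ ps → p ∈ ts) → ∫ (insertPoint x ts) f ≡ ∫ ts f
  ∫-insertPoint x []       inc ps⊆ = refl
  ∫-insertPoint x (a ∷ ts) inc ps⊆ with x ℚ.≤? a
  ... | no  x≰a = ∫-insert-after x a ts inc (λ i → near (ps⊆ i)) (ℚ.<⇒≤ (ℚ.≰⇒> x≰a))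
    where
    near : ∀ {p} → p ∈ a ∷ ts → p ≤ a ⊎ p ∈ ts
    near (here refl) = inj₁ ℚ.≤-refl
    near (there i)   = inj₂ i
  ... | yes x≤a with x ℚ.<? a
  ... | yes x<a = trans (cong (λ y → (a - x) * y + ∫ (a ∷ ts) f) (before x λ i → far (ps⊆ i)))
                    (trans (cong (_+ ∫ (a ∷ ts) f) (ℚ.*-zeroʳ (a - x))) (ℚ.+-identityˡ _))
    where
    far : ∀ {p} → p ∈ a ∷ ts → x < p
    far (here refl) = x<a
    far (there i)   = ℚ.<-≤-trans x<a (head-min ts inc i)
  ... | no  x≮a with ℚ.≤-antisym x≤a (ℚ.≮⇒≥ x≮a)
  ... | refl = lem x (f x) (∫ (x ∷ ts) f)
    where
    lem : ∀ x y r → (x - x) * y + r ≡ r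
    lem = solve-∀ ℚ-ring

  insertPoints : List ℚ → List ℚ → List ℚ
  insertPoints xs ts = List.foldr insertPoint ts xs

  insertPoints-↭ : ∀ xs ts → insertPoints xs ts ↭ xs ++ ts
  insertPoints-↭ []       ts = ↭-refl
  insertPoints-↭ (x ∷ xs) ts = ↭-trans (insertPoint-↭ x _) (prep x (insertPoints-↭ xs ts))

  insertPoints-increasing : ∀ xs ts → Increasing ts → Increasing (insertPoints xs ts)
  insertPoints-increasing []       ts inc = inc
  insertPoints-increasing (x ∷ xs) ts inc = insertPoint-increasing x _ (insertPoints-increasing xs ts inc)

  ∫-insertPoints : ∀ xs ts → Increasing ts → (∀ {p} → p ∈ ps → p ∈ ts) → ∫ (insertPoints xs ts) f ≡ ∫ ts f
  ∫-insertPoints []       ts inc ps⊆ = refl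
  ∫-insertPoints (x ∷ xs) ts inc ps⊆ = trans
    (∫-insertPoint x _ (insertPoints-increasing xs ts inc)
      (λ i → ↭.∈-resp-↭ (↭-sym (insertPoints-↭ xs ts)) (∈.∈-++⁺ʳ xs (ps⊆ i))))
    (∫-insertPoints xs ts inc ps⊆)

  -- Inserting each list into the other does not change the integral, and the two results are sorted
  -- permutations of each other, hence equal.
  ∫-refine : ∀ {ts us} → Increasing ts → Increasing us →
    (∀ {p} → p ∈ ps → p ∈ ts) → (∀ {p} → p ∈ ps → p ∈ us) → ∫ ts f ≡ ∫ us f
  ∫-refine {ts} {us} incT incU ps⊆ts ps⊆us = trans (sym (∫-insertPoints us ts incT ps⊆ts))
    (trans (cong (λ vs → ∫ vs f) same) (∫-insertPoints ts us incU ps⊆us))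
    where
    same : insertPoints us ts ≡ insertPoints ts us
    same = Pointwise-≡⇒≡ (Sorted.↗↭↗⇒≋ (DecTotalOrder.totalOrder ℚ.≤-decTotalOrder)
      (insertPoints-increasing us ts incT) (insertPoints-increasing ts us incU)
      (↭.↭⇒↭ₛ (↭-trans (insertPoints-↭ us ts) (↭-trans (↭.++-comm us ts) (↭-sym (insertPoints-↭ ts us))))))

abstract
  occ : ℚ → List Request → ℚ
  occ t rs with any? (active? t) rs
  ... | yes _ = 1ℚ
  ... | no  _ = 0ℚ

  occ-1 : ∀ {t rs} → Any (Active t) rs → occ t rs ≡ 1ℚ
  occ-1 {t} {rs} a with any? (active? t) rs
  ... | yes _ = refl
  ... | no ¬a = contradiction a ¬a

  occ-0 : ∀ {t rs} → ¬ Any (Active t) rs → occ t rs ≡ 0ℚ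
  occ-0 {t} {rs} ¬a with any? (active? t) rs
  ... | yes a = contradiction a ¬a
  ... | no _  = refl

  occ≤1 : ∀ t rs → occ t rs ≤ 1ℚ
  occ≤1 t rs with any? (active? t) rs
  ... | yes _ = ℚ.≤-refl
  ... | no  _ = 0≤1

  0≤occ : ∀ t rs → 0ℚ ≤ occ t rs
  0≤occ t rs with any? (active? t) rs
  ... | yes _ = 0≤1
  ... | no  _ = ℚ.≤-refl

  occ-mono : ∀ {t u} rs {rs′} → (∀ {r} → r ∈ rs → Active t r → Any (Active u) rs′) → occ t rs ≤ occ u rs′
  occ-mono {t} {u} rs {rs′} f with any? (active? t) rs
  ... | no  _ = 0≤occ u rs′
  ... | yes a = let (r , i , act) = find a in ℚ.≤-reflexive (sym (occ-1 (f i act)))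

  activeGap-occ : ∀ rs a b → activeGap rs a b ≡ (b - a) * occ a rs
  activeGap-occ rs a b with any? (active? a) rs
  ... | yes _ = sym (ℚ.*-identityʳ (b - a))
  ... | no  _ = sym (ℚ.*-zeroʳ (b - a))

occ-↭ : ∀ t {rs rs′} → rs ↭ rs′ → occ t rs ≡ occ t rs′
occ-↭ t {rs} {rs′} p = ℚ.≤-antisym
  (occ-mono rs (λ i a → lose (↭.∈-resp-↭ p i) a))
  (occ-mono rs′ (λ i a → lose (↭.∈-resp-↭ (↭-sym p) i) a))

abstract
  endpoints : List Request → List ℚ
  endpoints rs = map start rs ++ map end rs

  start∈ : ∀ {r rs} → r ∈ rs → start r ∈ endpoints rs
  start∈ i = ∈.∈-++⁺ˡ (∈.∈-map⁺ start i)

  end∈ : ∀ {r rs} → r ∈ rs → end r ∈ endpoints rs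
  end∈ {rs = rs} i = ∈.∈-++⁺ʳ (map start rs) (∈.∈-map⁺ end i)

  endpoints⁻ : ∀ {p rs} → p ∈ endpoints rs → ∃ λ r → r ∈ rs × (p ≡ start r ⊎ p ≡ end r)
  endpoints⁻ {rs = rs} i with ∈.∈-++⁻ (map start rs) i
  ... | inj₁ j = let (r , r∈ , eq) = ∈.∈-map⁻ start j in r , r∈ , inj₁ eq
  ... | inj₂ j = let (r , r∈ , eq) = ∈.∈-map⁻ end j in r , r∈ , inj₂ eq

active-between : ∀ {x y r ps} → start r ∈ ps → end r ∈ ps → x ≤ y →
  (∀ {p} → p ∈ ps → p ≤ x ⊎ y < p) → (Active x r → Active y r) × (Active y r → Active x r)
active-between {x} {y} {r} s∈ e∈ x≤y far = to , from
  where
  to : Active x r → Active y r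
  to (s≤x , x<e) with far e∈
  ... | inj₁ e≤x = absurd< x<e e≤x
  ... | inj₂ y<e = ℚ.≤-trans s≤x x≤y , y<e
  from : Active y r → Active x r
  from (s≤y , y<e) with far s∈
  ... | inj₁ s≤x = s≤x , ℚ.≤-<-trans x≤y y<e
  ... | inj₂ y<s = absurd< y<s s≤y

occ-step : ∀ rs → Step (endpoints rs) (λ t → occ t rs)
occ-step rs = record
  { before   = λ x x< → occ-0 λ a → let (r , i , s≤x , _) = find a in absurd< (x< (start∈ i)) s≤x
  ; after    = λ x ≤x → occ-0 λ a → let (r , i , _ , x<e) = find a in absurd< x<e (≤x (end∈ i))
  ; unchanging = λ x≤y far → ℚ.≤-antisym
      (occ-mono rs λ {r} i a → lose i (proj₁ (active-between {r = r} (start∈ i) (end∈ i) x≤y far) a))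
      (occ-mono rs λ {r} i a → lose i (proj₂ (active-between {r = r} (start∈ i) (end∈ i) x≤y far) a))
  }

activeGaps-∫ : ∀ rs ts → activeGaps rs ts ≡ ∫ ts (λ t → occ t rs)
activeGaps-∫ rs []           = refl
activeGaps-∫ rs (a ∷ [])     = refl
activeGaps-∫ rs (a ∷ b ∷ ts) = cong₂ _+_ (activeGap-occ rs a b) (activeGaps-∫ rs (b ∷ ts))

abstract
  sortℚ : List ℚ → List ℚ
  sortℚ = MergeSort.sort ℚ.≤-decTotalOrder

  sortℚ-↭ : ∀ xs → sortℚ xs ↭ xs
  sortℚ-↭ = MergeSortₚ.sort-↭ ℚ.≤-decTotalOrder

  sortℚ-increasing : ∀ xs → Increasing (sortℚ xs)
  sortℚ-increasing = MergeSortₚ.sort-↗ ℚ.≤-decTotalOrder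

  activeTime-sortℚ : ∀ rs → activeTime rs ≡ activeGaps rs (sortℚ (endpoints rs))
  activeTime-sortℚ rs = refl

∈-sortℚ : ∀ {x xs} → x ∈ xs → x ∈ sortℚ xs
∈-sortℚ {xs = xs} = ↭.∈-resp-↭ (↭-sym (sortℚ-↭ xs))

-- Each machine is measured on its own endpoints. On a common grid the costs of all machines add up
-- under one integral, so schedules can be compared time by time.
activeTime-∫ : ∀ rs {ts} → Increasing ts → (∀ {p} → p ∈ endpoints rs → p ∈ ts) →
  activeTime rs ≡ ∫ ts (λ t → occ t rs)
activeTime-∫ rs inc ⊆ts = trans (trans (activeTime-sortℚ rs) (activeGaps-∫ rs (sortℚ (endpoints rs))))
  (∫-refine (occ-step rs) (sortℚ-increasing (endpoints rs)) inc ∈-sortℚ ⊆ts)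

abstract
  sizeAt : ℚ → Request → ℚ
  sizeAt t r with active? t r
  ... | yes _ = size r
  ... | no  _ = 0ℚ

  sizeAt-active : ∀ {t r} → Active t r → sizeAt t r ≡ size r
  sizeAt-active {t} {r} a with active? t r
  ... | yes _ = refl
  ... | no ¬a = contradiction a ¬a

  sizeAt-inactive : ∀ {t r} → ¬ Active t r → sizeAt t r ≡ 0ℚ
  sizeAt-inactive {t} {r} ¬a with active? t r
  ... | yes a = contradiction a ¬a
  ... | no _  = refl

  0≤sizeAt : ∀ t r → 0ℚ ≤ size r → 0ℚ ≤ sizeAt t r
  0≤sizeAt t r 0≤s with active? t r
  ... | yes _ = 0≤s
  ... | no  _ = ℚ.≤-refl

  sizeAt≤size : ∀ t r → 0ℚ ≤ size r → sizeAt t r ≤ size r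
  sizeAt≤size t r 0≤s with active? t r
  ... | yes _ = ℚ.≤-refl
  ... | no  _ = 0≤s

sizeAt-step : ∀ r → Step (start r ∷ end r ∷ []) (λ t → sizeAt t r)
sizeAt-step r = record
  { before   = λ x x< → sizeAt-inactive {x} {r} λ (s≤x , _) → absurd< (x< (here refl)) s≤x
  ; after    = λ x ≤x → sizeAt-inactive {x} {r} λ (_ , x<e) → absurd< x<e (≤x (there (here refl)))
  ; unchanging = λ {x} {y} x≤y far → same (active-between {r = r} (here refl) (there (here refl)) x≤y far)
  }
  where
  same : ∀ {x y} → (Active x r → Active y r) × (Active y r → Active x r) → sizeAt x r ≡ sizeAt y r
  same {x} {y} (to , from) = go (active? x r)
    where
    go : Dec (Active x r) → sizeAt x r ≡ sizeAt y r
    go (yes a) = trans (sizeAt-active {x} {r} a) (sym (sizeAt-active {y} {r} (to a)))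
    go (no ¬a) = trans (sizeAt-inactive {x} {r} ¬a) (sym (sizeAt-inactive {y} {r} (¬a ∘ from)))

∫-sizeAt : ∀ r {ts} → Increasing ts → start r ∈ ts → end r ∈ ts → start r ≤ end r →
  ∫ ts (λ t → sizeAt t r) ≡ size r * len r
∫-sizeAt r {ts} inc s∈ e∈ s≤e = trans (∫-refine (sizeAt-step r) inc (s≤e ∷ [-]) ⊆ts (λ i → i)) base
  where
  ⊆ts : ∀ {p} → p ∈ start r ∷ end r ∷ [] → p ∈ ts
  ⊆ts (here refl)         = s∈
  ⊆ts (there (here refl)) = e∈
  base : ∫ (start r ∷ end r ∷ []) (λ t → sizeAt t r) ≡ size r * len r
  base = go (start r ℚ.<? end r)
    where
    lem : ∀ e s w → (e - s) * w + 0ℚ ≡ w * (e - s)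
    lem = solve-∀ ℚ-ring
    lem₀ : ∀ s w y → (s - s) * y + 0ℚ ≡ w * (s - s)
    lem₀ = solve-∀ ℚ-ring
    empty : ∀ {s e} w y → s ≡ e → (e - s) * y + 0ℚ ≡ w * (e - s)
    empty {s} w y refl = lem₀ s w y
    go : Dec (start r < end r) → ∫ (start r ∷ end r ∷ []) (λ t → sizeAt t r) ≡ size r * len r
    go (yes s<e) = trans (cong (λ y → (end r - start r) * y + 0ℚ) (sizeAt-active {start r} {r} (ℚ.≤-refl , s<e)))
      (lem (end r) (start r) (size r))
    go (no  s≮e) = empty (size r) (sizeAt (start r) r) (ℚ.≤-antisym s≤e (ℚ.≮⇒≥ s≮e))

loadAt-∑ : ∀ t rs → loadAt t rs ≡ ∑ (sizeAt t) rs
loadAt-∑ t []       = refl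
loadAt-∑ t (r ∷ rs) = go (active? t r)
  where
  go : Dec (Active t r) → loadAt t (r ∷ rs) ≡ sizeAt t r + ∑ (sizeAt t) rs
  go (yes a) = trans (cong (sumℚ ∘ map size) (List.filter-accept (active? t) a))
    (cong₂ _+_ (sym (sizeAt-active {t} {r} a)) (loadAt-∑ t rs))
  go (no ¬a) = trans (cong (sumℚ ∘ map size) (List.filter-reject (active? t) ¬a))
    (trans (loadAt-∑ t rs) (trans (sym (ℚ.+-identityˡ _)) (cong (_+ ∑ (sizeAt t) rs) (sym (sizeAt-inactive {t} {r} ¬a)))))

-- A step function below the indicator of [ a , b ) has integral at most b - a.
∫-indicator : ∀ {ps f a b ts} → Step ps f → Increasing ts → (∀ {p} → p ∈ ps → p ∈ ts) → a ≤ b →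
  (∀ t → f t ≤ sizeAt t (request a b 1ℚ)) → ∫ ts f ≤ b - a
∫-indicator {ps} {f} {a} {b} {ts} step inc ps⊆ a≤b f≤ =
  ℚ.≤-trans (ℚ.≤-reflexive (∫-refine step inc inc′ ps⊆ ⊆us))
    (ℚ.≤-trans (∫-mono us inc′ f≤)
      (ℚ.≤-reflexive (trans (∫-sizeAt (request a b 1ℚ) inc′ (∈-sortℚ (here refl)) (∈-sortℚ (there (here refl))) a≤b)
        (ℚ.*-identityˡ _))))
  where
  us = sortℚ (a ∷ b ∷ ts)
  inc′ : Increasing us
  inc′ = sortℚ-increasing (a ∷ b ∷ ts)
  ⊆us : ∀ {p} → p ∈ ps → p ∈ us
  ⊆us i = ∈-sortℚ (there (there (ps⊆ i)))

∑-⊆ : ∀ {A : Set} {f : A → ℚ} → (∀ x → 0ℚ ≤ f x) → ∀ us vs → Unique us →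
  (∀ {x} → x ∈ us → x ∈ vs) → ∑ f us ≤ ∑ f vs
∑-⊆ 0≤f []       vs _          us⊆ = ∑-nonneg vs (λ {x} _ → 0≤f x)
∑-⊆ {f = f} 0≤f (u ∷ us) vs (u∉ ∷ uniq) us⊆ with ∈.∈-∃++ (us⊆ (here refl))
... | as , bs , refl = ℚ.≤-trans (ℚ.+-monoʳ-≤ (f u) (∑-⊆ 0≤f us (as ++ bs) uniq us⊆′))
    (ℚ.≤-reflexive (sym (∑-↭ f (↭.shift u as bs))))
  where
  us⊆′ : ∀ {x} → x ∈ us → x ∈ as ++ bs
  us⊆′ i with ↭.∈-resp-↭ (↭.shift u as bs) (us⊆ (there i))
  ... | here refl = contradiction refl (All.lookup u∉ i)
  ... | there j   = j

sumℚ-∑ : ∀ {A : Set} (f : A → ℚ) xs → sumℚ (map f xs) ≡ ∑ f xs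
sumℚ-∑ f []       = refl
sumℚ-∑ f (x ∷ xs) = cong (f x +_) (sumℚ-∑ f xs)

abstract
  -- An opaque copy of fromℕ, whose normalisation would otherwise slow down unification.
  ι : ℕ → ℚ
  ι = fromℕ

  ι≡fromℕ : ∀ n → ι n ≡ fromℕ n
  ι≡fromℕ n = refl

  ι-+ : ∀ m n → ι (m ℕ.+ n) ≡ ι m + ι n
  ι-+ m n = ℚ.toℚᵘ-injective (begin
    ℚ.toℚᵘ (ι (m ℕ.+ n))               ≈⟨ ℚ.toℚᵘ-fromℚᵘ (ℚᵘ.mkℚᵘ (ℤ.+ (m ℕ.+ n)) 0) ⟩
    ℚᵘ.mkℚᵘ (ℤ.+ (m ℕ.+ n)) 0                 ≈⟨ ℚᵘ.*≡* (cong (ℤ._* (ℤ.+ 1)) (cong₂ ℤ._+_ (sym (ℤ.*-identityʳ (ℤ.+ m))) (sym (ℤ.*-identityʳ (ℤ.+ n))))) ⟩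
    ℚᵘ.mkℚᵘ (ℤ.+ m) 0 ℚᵘ.+ ℚᵘ.mkℚᵘ (ℤ.+ n) 0    ≈⟨ ℚᵘ.+-cong (ℚ.toℚᵘ-fromℚᵘ (ℚᵘ.mkℚᵘ (ℤ.+ m) 0)) (ℚ.toℚᵘ-fromℚᵘ (ℚᵘ.mkℚᵘ (ℤ.+ n) 0)) ⟨
    ℚ.toℚᵘ (ι m) ℚᵘ.+ ℚ.toℚᵘ (ι n)  ≈⟨ ℚ.toℚᵘ-homo-+ (ι m) (ι n) ⟨
    ℚ.toℚᵘ (ι m + ι n)             ∎)
    where open ℚᵘ.≃-Reasoning

  recip-inverse : ∀ n → ι (suc n) * recip (suc n) ≡ 1ℚ
  recip-inverse n = ℚ.toℚᵘ-injective (begin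
    ℚ.toℚᵘ (ι (suc n) * recip (suc n))  ≈⟨ ℚ.toℚᵘ-homo-* (ι (suc n)) (recip (suc n)) ⟩
    ℚ.toℚᵘ (ι (suc n)) ℚᵘ.* ℚ.toℚᵘ (recip (suc n))
      ≈⟨ ℚᵘ.*-cong (ℚ.toℚᵘ-fromℚᵘ (ℚᵘ.mkℚᵘ (ℤ.+ suc n) 0)) (ℚ.toℚᵘ-fromℚᵘ (ℚᵘ.mkℚᵘ (ℤ.+ 1) n)) ⟩
    ℚᵘ.mkℚᵘ (ℤ.+ suc n) 0 ℚᵘ.* ℚᵘ.mkℚᵘ (ℤ.+ 1) n ≈⟨ ℚᵘ.*≡* (cong ℤ.+_ (trans (trans (ℕ.*-identityʳ _) (ℕ.*-identityʳ _)) (sym (trans (ℕ.*-identityˡ _) (ℕ.*-identityˡ _))))) ⟩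
    ℚᵘ.1ℚᵘ                                   ∎)
    where open ℚᵘ.≃-Reasoning

ι-0 : ι 0 ≡ 0ℚ
ι-0 = ι≡fromℕ 0

ι-zeroˡ : ∀ q → ι 0 * q ≡ 0ℚ
ι-zeroˡ q = trans (cong (_* q) ι-0) (ℚ.*-zeroˡ q)

ι-zeroʳ : ∀ q → q * ι 0 ≡ 0ℚ
ι-zeroʳ q = trans (cong (q *_) ι-0) (ℚ.*-zeroʳ q)

ι-suc : ∀ n → ι (suc n) ≡ 1ℚ + ι n
ι-suc n = trans (ι-+ 1 n) (cong (_+ ι n) (ι≡fromℕ 1))

ι-* : ∀ m n → ι (m ℕ.* n) ≡ ι m * ι n
ι-* zero    n = trans (ι≡fromℕ 0) (sym (trans (cong (_* ι n) (ι≡fromℕ 0)) (ℚ.*-zeroˡ (ι n))))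
ι-* (suc m) n rewrite ι-+ n (m ℕ.* n) | ι-* m n | ι-suc m = lem (ι m) (ι n)
  where
  lem : ∀ a b → b + a * b ≡ (1ℚ + a) * b
  lem = solve-∀ ℚ-ring

0≤ι : ∀ n → 0ℚ ≤ ι n
0≤ι zero    = ℚ.≤-reflexive (sym (ι≡fromℕ 0))
0≤ι (suc n) rewrite ι-suc n = 0≤1 ⊞ 0≤ι n

ι-mono : ∀ {m n} → m ℕ.≤ n → ι m ≤ ι n
ι-mono {m} {n} m≤n = lin (0≤ι (n ℕ.∸ m))
  (trans (cong ι (sym (ℕ.m+[n∸m]≡n m≤n))) (ι-+ m (n ℕ.∸ m)))

ι-<-suc : ∀ n → ι n < ι (suc n)
ι-<-suc n = lin< 0<1 (trans (ι-suc n) (ℚ.+-comm 1ℚ (ι n)))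

ι-cancel : ∀ {m n} → ι m ≤ ι n → m ℕ.≤ n
ι-cancel {m} {n} p with m ℕ.≤? n
... | yes m≤n = m≤n
... | no  m≰n = absurd< (ℚ.<-≤-trans (ι-<-suc n) (ι-mono (ℕ.≰⇒> m≰n))) p

0<recip : ∀ n → 0ℚ < recip (suc n)
0<recip n = ℚ.positive⁻¹ (recip (suc n)) {{ℚ.normalize-pos 1 (suc n)}}

1≤ι : ∀ n → 1ℚ ≤ ι (suc n)
1≤ι n = lin (0≤ι n) (ι-suc n)

archimedean : ∀ q → ∃ λ n → q ≤ ι n
archimedean q = ℤ.∣ ℚ.↥ q ∣ , subst (q ≤_) (sym (ι≡fromℕ ℤ.∣ ℚ.↥ q ∣)) (go q)
  where
  go : ∀ q → q ≤ fromℕ ℤ.∣ ℚ.↥ q ∣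
  go q@(ℚ.mkℚ (ℤ.+ m) d _) = ℚ.toℚᵘ-cancel-≤ (ℚᵘ.≤-respʳ-≃ (ℚᵘ.≃-sym (ℚ.toℚᵘ-fromℚᵘ (ℚᵘ.mkℚᵘ (ℤ.+ m) 0)))
    (ℚᵘ.*≤* (ℤ.*-monoˡ-≤-nonNeg (ℤ.+ m) (ℤ.+≤+ (s≤s z≤n)))))
  go q@(ℚ.mkℚ (ℤ.-[1+ m ]) d _) = ℚ.≤-trans (ℚ.<⇒≤ (ℚ.negative⁻¹ q)) (subst (0ℚ ≤_) (ι≡fromℕ (suc m)) (0≤ι (suc m)))

-- If a exceeded b, the multiple N (a - b) would outgrow c. In this way an additive constant
-- disappears once an inequality holds for N-fold copies.
≤-by-multiples : ∀ {a b} c → (∀ N → ι N * a ≤ ι N * b + c) → a ≤ b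
≤-by-multiples {a} {b} c h with a ℚ.≤? b
... | yes a≤b = a≤b
... | no  a≰b = absurd< (ℚ.<-≤-trans (lin< {c} 0<1 refl) big) (lin (diff≥0 (h (suc N))) (lem′ (ι (suc N)) a b c))
  where
  d = a - b
  0<d : 0ℚ < d
  0<d = diff>0 (ℚ.≰⇒> a≰b)
  inv = ℚ.1/_ d {{ℚ.pos⇒nonZero d {{ℚ.positive 0<d}}}}
  inv≡ : d * inv ≡ 1ℚ
  inv≡ = ℚ.*-inverseʳ d {{ℚ.pos⇒nonZero d {{ℚ.positive 0<d}}}}
  N = proj₁ (archimedean ((c + 1ℚ) * inv))
  lem′ : ∀ n a b c → c ≡ n * (a - b) + (n * b + c - n * a)
  lem′ = solve-∀ ℚ-ring
  big : c + 1ℚ ≤ ι (suc N) * d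
  big = ℚ.≤-trans (ℚ.≤-reflexive (trans (sym (ℚ.*-identityʳ _)) (trans (cong ((c + 1ℚ) *_) (trans (sym inv≡) (ℚ.*-comm d inv))) (sym (ℚ.*-assoc (c + 1ℚ) inv d)))))
    (ℚ.*-monoʳ-≤-nonNeg d {{ℚ.nonNegative (ℚ.<⇒≤ 0<d)}}
      (ℚ.≤-trans (proj₂ (archimedean ((c + 1ℚ) * inv))) (ℚ.<⇒≤ (ι-<-suc N))))

∑-length : ∀ {A : Set} (xs : List A) → ∑ (λ _ → 1ℚ) xs ≡ ι (length xs)
∑-length []       = sym ι-0
∑-length (x ∷ xs) = trans (cong (1ℚ +_) (∑-length xs)) (sym (ι-suc (length xs)))

filter-cong : ∀ {A : Set} {P Q : A → Set} (P? : ∀ x → Dec (P x)) (Q? : ∀ x → Dec (Q x)) {xs} →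
  All (λ x → (P x → Q x) × (Q x → P x)) xs → filter P? xs ≡ filter Q? xs
filter-cong P? Q? [] = refl
filter-cong P? Q? {x ∷ xs} ((to , from) ∷ h) with P? x | Q? x
... | yes _ | yes _ = cong (x ∷_) (filter-cong P? Q? h)
... | yes p | no ¬q = contradiction (to p) ¬q
... | no ¬p | yes q = contradiction (from q) ¬p
... | no _  | no _  = filter-cong P? Q? h

-- Schedules as families of static packings.

module _ {A : Set} where

  private
    named : ℕ → List (A × ℕ) → List (A × ℕ)
    named m = filter (λ z → proj₂ z ℕ.≟ m)

  split-by-name : ∀ us zs → Unique us → All (λ z → proj₂ z ∈ us) zs →
    zs ↭ concat (map (λ m → named m zs) us)
  split-by-name us []       uniq _ = ↭.↭-reflexive (sym (none us))
    where
    none : ∀ us → concat (map (λ m → named m []) us) ≡ []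
    none []       = refl
    none (u ∷ us) = none us
  split-by-name us (z ∷ zs) uniq (z∈ ∷ zs∈) =
    ↭-trans (prep z (split-by-name us zs uniq zs∈)) (↭-sym (go us uniq z∈))
    where
    unaffected : ∀ us → proj₂ z ∉ us → map (λ m → named m (z ∷ zs)) us ≡ map (λ m → named m zs) us
    unaffected []       _  = refl
    unaffected (u ∷ us) z∉ = cong₂ _∷_ (List.filter-reject (λ z → proj₂ z ℕ.≟ u) (z∉ ∘ here)) (unaffected us (z∉ ∘ there))
    go : ∀ us → Unique us → proj₂ z ∈ us →
      concat (map (λ m → named m (z ∷ zs)) us) ↭ z ∷ concat (map (λ m → named m zs) us)
    go (u ∷ us) (u∉ ∷ _) (here refl)
      rewrite List.filter-accept (λ z → proj₂ z ℕ.≟ u) {z} {zs} refl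
            | unaffected us (λ i → All.lookup u∉ i refl) = ↭-refl
    go (u ∷ us) (u∉ ∷ uniq) (there i)
      rewrite List.filter-reject (λ z → proj₂ z ℕ.≟ u) {z} {zs} (λ eq → All.lookup u∉ i (sym eq)) =
      ↭-trans (↭.++⁺ˡ (named u zs) (go us uniq i)) (↭.shift z (named u zs) _)

zipped : ∀ {A : Set} {n} → Vec A n → Vec ℕ n → List (A × ℕ)
zipped xs σ = toList (Vec.zip xs σ)

zipped-proj₁ : ∀ {A : Set} {n} (xs : Vec A n) σ → map proj₁ (zipped xs σ) ≡ toList xs
zipped-proj₁ Vec.[]       Vec.[]       = refl
zipped-proj₁ (x Vec.∷ xs) (m Vec.∷ σ) = cong (x ∷_) (zipped-proj₁ xs σ)

zipped-names : ∀ {A : Set} {n} (xs : Vec A n) σ → All (λ z → proj₂ z ∈ toList σ) (zipped xs σ)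
zipped-names Vec.[]       Vec.[]       = []
zipped-names (x Vec.∷ xs) (m Vec.∷ σ) = here refl ∷ All.map there (zipped-names xs σ)

used-unique : ∀ {n} (σ : Vec ℕ n) → Unique (used σ)
used-unique σ = Unique.deduplicate-! ℕ._≟_ (toList σ)

∈-used : ∀ {n} {σ : Vec ℕ n} {m} → m ∈ toList σ → m ∈ used σ
∈-used {σ = σ} = ∈.∈-deduplicate⁺ ℕ._≟_

assigned-split : ∀ {A : Set} {n} (xs : Vec A n) σ → toList xs ↭ concat (map (assigned xs σ) (used σ))
assigned-split xs σ = subst₂ _↭_ (zipped-proj₁ xs σ)
  (trans (sym (List.concat-map (map (λ m → filter (λ z → proj₂ z ℕ.≟ m) (zipped xs σ)) (used σ))))
    (cong concat (sym (List.map-∘ (used σ)))))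
  (↭.map⁺ proj₁ (split-by-name (used σ) (zipped xs σ) (used-unique σ)
    (All.map (λ {z} i → ∈-used {σ = σ} i) (zipped-names xs σ))))

activeSizes : ℚ → List Request → List ℚ
activeSizes t rs = map size (filter (active? t) rs)

activeSizes-++ : ∀ t rs rs′ → activeSizes t (rs ++ rs′) ≡ activeSizes t rs ++ activeSizes t rs′
activeSizes-++ t rs rs′ = trans (cong (map size) (List.filter-++ (active? t) rs rs′))
  (List.map-++ size (filter (active? t) rs) (filter (active? t) rs′))

-- The machines of a feasible schedule that are active at t form a packing of
-- the sizes of the active requests.
PackableIn : List ℚ → ℚ → Set
PackableIn ws q = ∃ λ bs → ws ↭ concat bs × All (λ b → sumℚ b ≤ 1ℚ) bs × ι (length bs) ≡ q

machines-pack : ∀ t (rss : List (List Request)) → All (λ rs → loadAt t rs ≤ 1ℚ) rss →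
  PackableIn (activeSizes t (concat rss)) (∑ (occ t) rss)
machines-pack t []         _        = [] , ↭-refl , [] , ι-0
machines-pack t (rs ∷ rss) (l ∷ ls)
  with machines-pack t rss ls | any? (active? t) rs
... | bs , p , fit , len | yes a = activeSizes t rs ∷ bs ,
      ↭-trans (↭.↭-reflexive (activeSizes-++ t rs (concat rss))) (↭.++⁺ˡ (activeSizes t rs) p) , l ∷ fit ,
      trans (ι-suc (length bs)) (cong₂ _+_ (sym (occ-1 a)) len)
... | bs , p , fit , len | no ¬a = bs ,
      ↭-trans (↭.↭-reflexive (trans (activeSizes-++ t rs (concat rss))
        (cong (λ ws → map size ws ++ activeSizes t (concat rss)) (List.filter-none (active? t) (All.¬Any⇒All¬ rs ¬a))))) p , fit ,
      trans len (trans (sym (ℚ.+-identityˡ _)) (cong (_+ ∑ (occ t) rss) (sym (occ-0 ¬a))))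

module _ (I : Instance) where

  requestList : List Request
  requestList = toList (requests I)

  -- The points 0 and T are included so that the horizon itself is an interval of the grid; `T≤O`
  -- integrates its indicator.
  grid : List ℚ
  grid = sortℚ (0ℚ ∷ T I ∷ endpoints requestList)

  grid-increasing : Increasing grid
  grid-increasing = sortℚ-increasing _

  endpoints∈grid : ∀ {p} rs → (∀ {r} → r ∈ rs → r ∈ requestList) → p ∈ endpoints rs → p ∈ grid
  endpoints∈grid rs rs⊆ i with endpoints⁻ i
  ... | r , r∈ , inj₁ refl = ∈-sortℚ (there (there (start∈ (rs⊆ r∈))))
  ... | r , r∈ , inj₂ refl = ∈-sortℚ (there (there (end∈ (rs⊆ r∈))))

  assigned⊆ : ∀ (σ : Schedule I) m {r} → r ∈ assigned (requests I) σ m → r ∈ requestList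
  assigned⊆ σ m i with ∈.∈-map⁻ proj₁ i
  ... | z , z∈ , refl = subst (proj₁ z ∈_) (zipped-proj₁ (requests I) σ)
    (∈.∈-map⁺ proj₁ (proj₁ (∈.∈-filter⁻ (λ z → proj₂ z ℕ.≟ m) z∈)))

  machinesAt : Schedule I → ℚ → ℚ
  machinesAt σ t = ∑ (λ m → occ t (assigned (requests I) σ m)) (used σ)

  cost-∫ : ∀ σ → cost I σ ≡ ∫ grid (machinesAt σ)
  cost-∫ σ = trans (sumℚ-∑ _ (used σ)) (trans
    (∑-cong (used σ) λ {m} _ → activeTime-∫ (assigned (requests I) σ m) grid-increasing
      (endpoints∈grid _ (assigned⊆ σ m)))
    (sym (∫-∑ (λ m t → occ t (assigned (requests I) σ m)) (used σ) grid)))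

  schedule-packs : ∀ σ → Feasible I σ → ∀ t → PackableIn (activeSizes t requestList) (machinesAt σ t)
  schedule-packs σ feas t
    with machines-pack t (map (assigned (requests I) σ) (used σ)) (All.map⁺ (All.universal (feas t) (used σ)))
  ... | bs , p , fit , len = bs ,
    ↭-trans (↭.map⁺ size (↭.filter-↭ (active? t) (assigned-split (requests I) σ))) p , fit ,
    trans len (∑-map (occ t) (assigned (requests I) σ) (used σ))

-- Items with identifiers, and the schedule given by a list of machines.

itemTy : Ty
itemTy = num `× requestTy

Item : Set
Item = ⟦ itemTy ⟧

-- The identifier tells equal requests apart. It is a rational number because the machine compares
-- rationals in one step.
ident st en sz : Item → ℚ
ident x = proj₁ x
st    x = proj₁ (proj₂ x)
en    x = proj₁ (proj₂ (proj₂ x))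
sz    x = proj₂ (proj₂ (proj₂ x))

req : Item → Request
req x = request (st x) (en x) (sz x)

memberId : ℚ → List Item → Bool
memberId i = rec (λ x _ b → if le i (ident x) ∧ le (ident x) i then true else b) false

indexOf : ℚ → List (List Item) → ℕ
indexOf i = rec (λ m _ r → if memberId i m then 0 else suc r) 0

nth : ℕ → List (List Item) → List Item
nth j       []       = []
nth zero    (m ∷ ms) = m
nth (suc j) (m ∷ ms) = nth j ms

memberId-∈ : ∀ {x} m → x ∈ m → memberId (ident x) m ≡ true
memberId-∈ {x} (y ∷ m) (here refl) rewrite true-le (ℚ.≤-refl {ident x}) = refl
memberId-∈ {x} (y ∷ m) (there i) with le (ident x) (ident y) ∧ le (ident y) (ident x)
... | true  = refl
... | false = memberId-∈ m i

memberId-∉ : ∀ {i} m → All (λ y → i ≢ ident y) m → memberId i m ≡ false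
memberId-∉ []      _ = refl
memberId-∉ {i} (y ∷ m) (i≢ ∷ h) with le i (ident y) in p | le (ident y) i in q
... | true  | true  = contradiction (ℚ.≤-antisym (le-true p) (le-true q)) i≢
... | true  | false = memberId-∉ m h
... | false | _     = memberId-∉ m h

DistinctIds : List Item → Set
DistinctIds = AllPairs (λ x y → ident x ≢ ident y)

distinct-↭ : ∀ {xs ys} → xs ↭ ys → DistinctIds xs → DistinctIds ys
distinct-↭ p = ↭ₛ.AllPairs-resp-↭ (setoid Item) (λ p → p ∘ sym) ((λ { refl p → p }) , λ { refl p → p }) (↭.↭⇒↭ₛ p)

machineOf-nth : ∀ j ms → DistinctIds (concat ms) →
  filter (λ x → indexOf (ident x) ms ℕ.≟ j) (concat ms) ≡ nth j ms
machineOf-nth j []       _    = refl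
machineOf-nth j (m ∷ ms) dist with AllPairs-split m dist
  where
  AllPairs-split : ∀ xs {ys} → DistinctIds (xs ++ ys) → DistinctIds ys × All (λ y → All (λ x → ident y ≢ ident x) xs) ys
  AllPairs-split []       d       = d , All.universal (λ _ → []) _
  AllPairs-split (x ∷ xs) (h ∷ d) with AllPairs-split xs d
  ... | d′ , a = d′ , All.zipWith (λ (x≢ , r) → (x≢ ∘ sym) ∷ r) (All.++⁻ʳ xs h , a)
machineOf-nth zero (m ∷ ms) _ | d , outside = trans (List.filter-++ _ m (concat ms))
  (trans (cong₂ _++_
    (List.filter-all (λ x → indexOf (ident x) (m ∷ ms) ℕ.≟ 0) (All.tabulate λ {x} i → cong (λ b → if b then 0 else suc (indexOf (ident x) ms)) (memberId-∈ m i)))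
    (List.filter-none (λ x → indexOf (ident x) (m ∷ ms) ℕ.≟ 0) (All.map (λ {y} o eq → ℕ.1+n≢0 (trans (cong (λ b → if b then 0 else suc (indexOf (ident y) ms)) (sym (memberId-∉ m o))) eq)) outside)))
    (List.++-identityʳ m))
machineOf-nth (suc j) (m ∷ ms) _ | d , outside = trans (List.filter-++ _ m (concat ms))
  (trans (cong₂ _++_
    (List.filter-none (λ x → indexOf (ident x) (m ∷ ms) ℕ.≟ suc j) (All.tabulate λ {x} i eq → ℕ.0≢1+n (trans (sym (cong (λ b → if b then 0 else suc (indexOf (ident x) ms)) (memberId-∈ m i))) eq)))
    (filter-cong (λ x → indexOf (ident x) (m ∷ ms) ℕ.≟ suc j) (λ x → indexOf (ident x) ms ℕ.≟ j)
      (All.map (λ {y} o → let eq = cong (λ b → if b then 0 else suc (indexOf (ident y) ms)) (memberId-∉ m o) in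
        (λ e → ℕ.suc-injective (trans (sym eq) e)) , λ e → trans eq (cong suc e)) outside)))
    (machineOf-nth j ms d))

rate : ℚ → List (List Item) → ℚ
rate t = ∑ (λ m → occ t (map req m))

indexOf≤ : ∀ i ms → indexOf i ms ℕ.≤ length ms
indexOf≤ i []       = z≤n
indexOf≤ i (m ∷ ms) with memberId i m
... | true  = z≤n
... | false = s≤s (indexOf≤ i ms)

∑-nth : ∀ {f : List Item → ℚ} → f [] ≡ 0ℚ → ∀ K ms → length ms ℕ.≤ K →
  ∑ (λ j → f (nth j ms)) (List.upTo K) ≡ ∑ f ms
∑-nth {f} f[] K []       _ = trans (∑-cong (List.upTo K) (λ _ → f[])) (∑-0 (List.upTo K))
∑-nth {f} f[] (suc K) (m ∷ ms) (s≤s l) = cong (f m +_)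
  (trans (cong (∑ (λ j → f (nth j (m ∷ ms)))) (sym (List.map-upTo suc K)))
    (trans (∑-map _ suc (List.upTo K)) (∑-nth f[] K ms l)))

zipped-zip : ∀ {A : Set} {n} (xs : Vec A n) σ → zipped xs σ ≡ List.zip (toList xs) (toList σ)
zipped-zip Vec.[]       Vec.[]       = refl
zipped-zip (x Vec.∷ xs) (m Vec.∷ σ) = cong ((x , m) ∷_) (zipped-zip xs σ)

zip-map : ∀ {A B C : Set} (f : A → B) (g : A → C) xs → List.zip (map f xs) (map g xs) ≡ map (λ x → f x , g x) xs
zip-map f g []       = refl
zip-map f g (x ∷ xs) = cong (_ ∷_) (zip-map f g xs)

filter-map : ∀ {A B : Set} {P : B → Set} (P? : ∀ x → Dec (P x)) (f : A → B) xs →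
  filter P? (map f xs) ≡ map f (filter (λ x → P? (f x)) xs)
filter-map P? f []       = refl
filter-map P? f (x ∷ xs) with P? (f x)
... | yes _ = cong (f x ∷_) (filter-map P? f xs)
... | no  _ = filter-map P? f xs

module Realize (I : Instance) (items : List Item) (items≡ : map req items ≡ requestList I)
  (dist : DistinctIds items) (ms : List (List Item)) (ms↭ : concat ms ↭ items)
  (σ : Schedule I) (σ≡ : toList σ ≡ map (λ x → indexOf (ident x) ms) items) where

  assigned↭ : ∀ j → assigned (requests I) σ j ↭ map req (nth j ms)
  assigned↭ j = ↭-trans (↭.↭-reflexive eq) (↭.map⁺ req
    (↭-trans (↭.filter-↭ (λ x → indexOf (ident x) ms ℕ.≟ j) (↭-sym ms↭))
      (↭.↭-reflexive (machineOf-nth j ms (distinct-↭ (↭-sym ms↭) dist)))))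
    where
    eq : assigned (requests I) σ j ≡ map req (filter (λ x → indexOf (ident x) ms ℕ.≟ j) items)
    eq rewrite zipped-zip (requests I) σ | σ≡ | sym items≡ | zip-map req (λ x → indexOf (ident x) ms) items
             | filter-map (λ z → proj₂ z ℕ.≟ j) (λ x → req x , indexOf (ident x) ms) items =
      sym (List.map-∘ (filter (λ x → indexOf (ident x) ms ℕ.≟ j) items))

  nth∈ : ∀ j ms′ {P : List Item → Set} → P [] → All P ms′ → P (nth j ms′)
  nth∈ j       []        p[] _        = p[]
  nth∈ zero    (m ∷ ms′) p[] (p ∷ _)  = p
  nth∈ (suc j) (m ∷ ms′) p[] (_ ∷ ps) = nth∈ j ms′ p[] ps

  realize-feasible : All (λ m → ∀ t → loadAt t (map req m) ≤ 1ℚ) ms → Feasible I σ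
  realize-feasible fits t j = ℚ.≤-trans
    (ℚ.≤-reflexive (trans (loadAt-∑ t (assigned (requests I) σ j))
      (trans (∑-↭ (sizeAt t) (assigned↭ j)) (sym (loadAt-∑ t (map req (nth j ms)))))))
    (nth∈ j ms {λ m → ∀ t → loadAt t (map req m) ≤ 1ℚ} (λ _ → 0≤1) fits t)

  -- The range includes `length ms`, the value of `indexOf` when no machine contains the identifier;
  -- `nth` assigns the empty machine to it.
  used⊆ : ∀ {j} → j ∈ used σ → j ∈ List.upTo (suc (length ms))
  used⊆ {j} i with ∈.∈-map⁻ (λ x → indexOf (ident x) ms) (subst (j ∈_) σ≡ (∈.∈-deduplicate⁻ ℕ._≟_ (toList σ) i))
  ... | x , _ , refl = ∈.∈-upTo⁺ (s≤s (indexOf≤ (ident x) ms))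

  realize-cost : cost I σ ≤ ∫ (grid I) (λ t → rate t ms)
  realize-cost = ℚ.≤-trans (ℚ.≤-reflexive (cost-∫ I σ)) (∫-mono (grid I) (grid-increasing I) λ t →
    ℚ.≤-trans (ℚ.≤-reflexive (∑-cong (used σ) λ {j} _ → occ-↭ t (assigned↭ j)))
      (ℚ.≤-trans (∑-⊆ {f = λ j → occ t (map req (nth j ms))} (λ j → 0≤occ t _) (used σ) _ (used-unique σ) used⊆)
        (ℚ.≤-reflexive (∑-nth {λ m → occ t (map req m)} (occ-0 {t} {[]} λ ()) _ ms (ℕ.n≤1+n _)))))

-- Closed bins of Next-Fit and Harmonic, and lower bounds for Π.

Positive≤1 : ℚ → Set
Positive≤1 w = 0ℚ < w × w ≤ 1ℚ

-- Next-Fit starts with an empty open bin, so for sizes up to 1 this counts all bins except the last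
-- one. Unlike `nextFit` it is superadditive under concatenation.
closed : List ℚ → ℕ
closed = nextFitFrom 0ℚ

closed≤nextFit : ∀ ws → closed ws ℕ.≤ nextFit ws
closed≤nextFit []       = z≤n
closed≤nextFit (w ∷ ws) with 0ℚ + w ℚ.≤? 1ℚ
... | yes _ rewrite ℚ.+-identityˡ w = ℕ.n≤1+n _
... | no  _ = ℕ.≤-refl

-- When the two runs first differ, the fuller one closes its bin and restarts at level w, while the
-- other continues at l + w, which is at least w. The roles are now exchanged and the run that
-- closed is one bin ahead, so both inequalities have to be proved together.
nextFitFrom-mono : ∀ ws {l l′} → All Positive≤1 ws → 0ℚ ≤ l → l ≤ l′ →
  nextFitFrom l ws ℕ.≤ nextFitFrom l′ ws × nextFitFrom l′ ws ℕ.≤ suc (nextFitFrom l ws)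
nextFitFrom-mono []       _        _   _ = z≤n , z≤n
nextFitFrom-mono (w ∷ ws) {l} {l′} ((0<w , w≤1) ∷ pos) 0≤l l≤l′ with l + w ℚ.≤? 1ℚ | l′ + w ℚ.≤? 1ℚ
... | yes _ | yes _ = nextFitFrom-mono ws pos (0≤l ⊞ ℚ.<⇒≤ 0<w) (ℚ.+-monoˡ-≤ w l≤l′)
... | no  _ | no  _ = ℕ.≤-refl , ℕ.n≤1+n _
... | no  f | yes f′ = contradiction (ℚ.≤-trans (ℚ.+-monoˡ-≤ w l≤l′) f′) f
... | yes _ | no  _ = let (p , q) = nextFitFrom-mono ws pos (ℚ.<⇒≤ 0<w) (lin 0≤l (ℚ.+-comm l w))
  in q , s≤s p

-- The bin left open after `xs` has nonnegative level, and by monotonicity Next-Fit then closes at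
-- least as many bins on `ys` as from an empty bin.
nextFitFrom-++ : ∀ xs {ys l} → All Positive≤1 xs → All Positive≤1 ys → 0ℚ ≤ l →
  nextFitFrom l xs ℕ.+ closed ys ℕ.≤ nextFitFrom l (xs ++ ys)
nextFitFrom-++ []       {ys} _                  pos 0≤l = proj₁ (nextFitFrom-mono ys pos ℚ.≤-refl 0≤l)
nextFitFrom-++ (x ∷ xs) {ys} {l} ((0<x , _) ∷ p) pos 0≤l with l + x ℚ.≤? 1ℚ
... | yes _ = nextFitFrom-++ xs p pos (0≤l ⊞ ℚ.<⇒≤ 0<x)
... | no  _ = s≤s (nextFitFrom-++ xs p pos (ℚ.<⇒≤ 0<x))

small : ℕ → List ℚ → List ℚ
small k = filter (ℚ._≤? recip k)

sumℕ : List ℕ → ℕ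
sumℕ = List.foldr ℕ._+_ 0

harmonicClosed : ℕ → List ℚ → ℕ
harmonicClosed k ws =
  sumℕ (map (λ i → closed (harmonicClass (suc i) ws)) (List.upTo (k ℕ.∸ 1))) ℕ.+ closed (small k ws)

sumℕ-mono : ∀ {A : Set} {f g : A → ℕ} xs → (∀ x → f x ℕ.≤ g x) → sumℕ (map f xs) ℕ.≤ sumℕ (map g xs)
sumℕ-mono []       f≤g = z≤n
sumℕ-mono (x ∷ xs) f≤g = ℕ.+-mono-≤ (f≤g x) (sumℕ-mono xs f≤g)

sumℕ-+ : ∀ {A : Set} (f g : A → ℕ) xs → sumℕ (map f xs) ℕ.+ sumℕ (map g xs) ≡ sumℕ (map (λ x → f x ℕ.+ g x) xs)
sumℕ-+ f g []       = refl
sumℕ-+ f g (x ∷ xs) = trans (+-interchange (f x) _ (g x) _) (cong (f x ℕ.+ g x ℕ.+_) (sumℕ-+ f g xs))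
  where
  +-interchange : ∀ a b c d → (a ℕ.+ b) ℕ.+ (c ℕ.+ d) ≡ (a ℕ.+ c) ℕ.+ (b ℕ.+ d)
  +-interchange = ℕ-Solver.solve-∀

sumℕ-∈ : ∀ {A : Set} (f : A → ℕ) {x xs} → x ∈ xs → f x ℕ.≤ sumℕ (map f xs)
sumℕ-∈ f (here refl) = ℕ.m≤m+n _ _
sumℕ-∈ f {xs = y ∷ xs} (there i) = ℕ.≤-trans (sumℕ-∈ f i) (ℕ.m≤n+m _ (f y))

harmonicClosed≤harmonic : ∀ k ws → harmonicClosed k ws ℕ.≤ harmonic k ws
harmonicClosed≤harmonic k ws = ℕ.+-mono-≤
  (sumℕ-mono (List.upTo (k ℕ.∸ 1)) (λ i → closed≤nextFit (harmonicClass (suc i) ws)))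
  (closed≤nextFit (small k ws))

harmonicClosed-++ : ∀ k xs ys → All Positive≤1 xs → All Positive≤1 ys →
  harmonicClosed k xs ℕ.+ harmonicClosed k ys ℕ.≤ harmonicClosed k (xs ++ ys)
harmonicClosed-++ k xs ys px py = ℕ.≤-trans (ℕ.≤-reflexive (trans
    (+-interchange (sumℕ (map f (List.upTo (k ℕ.∸ 1)))) (closed (small k xs)) _ _)
    (cong (ℕ._+ (closed (small k xs) ℕ.+ closed (small k ys))) (sumℕ-+ f g (List.upTo (k ℕ.∸ 1))))))
  (ℕ.+-mono-≤
    (sumℕ-mono (List.upTo (k ℕ.∸ 1)) (λ i → part (λ w → (recip (suc (suc i)) ℚ.<? w) ×-dec (w ℚ.≤? recip (suc i)))))
    (part (ℚ._≤? recip k)))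
  where
  f g : ℕ → ℕ
  f i = closed (harmonicClass (suc i) xs)
  g i = closed (harmonicClass (suc i) ys)
  +-interchange : ∀ a b c d → (a ℕ.+ b) ℕ.+ (c ℕ.+ d) ≡ (a ℕ.+ c) ℕ.+ (b ℕ.+ d)
  +-interchange = ℕ-Solver.solve-∀
  part : ∀ {P : ℚ → Set} (P? : ∀ w → Dec (P w)) →
    closed (filter P? xs) ℕ.+ closed (filter P? ys) ℕ.≤ closed (filter P? (xs ++ ys))
  part P? rewrite List.filter-++ P? xs ys =
    nextFitFrom-++ (filter P? xs) (All.filter⁺ P? px) (All.filter⁺ P? py) ℚ.≤-refl

copies : ∀ {A : Set} → ℕ → List A → List A
copies N xs = concat (replicate N xs)

copies-All : ∀ {A : Set} {P : A → Set} N {xs} → All P xs → All P (copies N xs)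
copies-All zero    p = []
copies-All (suc N) p = All.++⁺ p (copies-All N p)

copies-packing : ∀ {A : Set} N {ws : List A} {bs} → ws ↭ concat bs → copies N ws ↭ concat (copies N bs)
copies-packing zero p = ↭-refl
copies-packing (suc N) {ws} {bs} p = ↭-trans (↭.++⁺ p (copies-packing N p))
  (↭.↭-reflexive (List.concat-++ bs (copies N bs)))

copies-length : ∀ {A : Set} N (xs : List A) → length (copies N xs) ≡ N ℕ.* length xs
copies-length zero    xs = refl
copies-length (suc N) xs = trans (List.length-++ xs) (cong (length xs ℕ.+_) (copies-length N xs))

harmonicClosed-copies : ∀ k N ws → All Positive≤1 ws → N ℕ.* harmonicClosed k ws ℕ.≤ harmonicClosed k (copies N ws)
harmonicClosed-copies k zero    ws p = z≤n
harmonicClosed-copies k (suc N) ws p = ℕ.≤-trans (ℕ.+-monoʳ-≤ _ (harmonicClosed-copies k N ws p))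
  (harmonicClosed-++ k ws (copies N ws) p (copies-All N p))

tag : ℕ → List (List ℚ) → List (ℚ × ℕ)
tag j []       = []
tag j (b ∷ bs) = map (_, j) b ++ tag (suc j) bs

tag-proj₁ : ∀ j bs → map proj₁ (tag j bs) ≡ concat bs
tag-proj₁ j []       = refl
tag-proj₁ j (b ∷ bs) = trans (List.map-++ proj₁ (map (_, j) b) (tag (suc j) bs))
  (cong₂ _++_ (trans (sym (List.map-∘ b)) (List.map-id b)) (tag-proj₁ (suc j) bs))

tag-names : ∀ j bs → All (λ z → j ℕ.≤ proj₂ z × proj₂ z ℕ.< j ℕ.+ length bs) (tag j bs)
tag-names j []       = []
tag-names j (b ∷ bs) = All.++⁺
  (All.map⁺ (All.universal (λ _ → ℕ.≤-refl , ℕ.≤-trans (ℕ.≤-reflexive (ℕ.+-comm 1 j)) (ℕ.+-monoʳ-≤ j (s≤s z≤n))) b))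
  (All.map (λ {z} (p , q) → ℕ.<⇒≤ p , subst (proj₂ z ℕ.<_) (sym (ℕ.+-suc j (length bs))) q) (tag-names (suc j) bs))

tag-fits : ∀ m j bs → All (λ b → sumℚ b ≤ 1ℚ) bs → sumℚ (map proj₁ (filter (λ z → proj₂ z ℕ.≟ m) (tag j bs))) ≤ 1ℚ
tag-fits m j []       _          = 0≤1
tag-fits m j (b ∷ bs) (fit ∷ fits)
  rewrite List.filter-++ (λ z → proj₂ z ℕ.≟ m) (map (_, j) b) (tag (suc j) bs) with j ℕ.≟ m
... | no j≢m rewrite List.filter-none (λ z → proj₂ z ℕ.≟ m) {map (_, j) b} (All.map⁺ (All.universal (λ _ → j≢m) b)) =
  tag-fits m (suc j) bs fits
... | yes refl
  rewrite List.filter-all (λ z → proj₂ z ℕ.≟ j) {map (_, j) b} (All.map⁺ (All.universal (λ _ → refl) b))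
        | List.filter-none (λ z → proj₂ z ℕ.≟ j) {tag (suc j) bs} (All.map (λ (p , _) eq → ℕ.<-irrefl (sym eq) p) (tag-names (suc j) bs))
        | List.++-identityʳ (map (_, j) b) | sym (List.map-∘ {g = proj₁} {f = _, j} b) | List.map-id b = fit

sumℚ-↭ : ∀ {xs ys} → xs ↭ ys → sumℚ xs ≡ sumℚ ys
sumℚ-↭ {xs} {ys} p = trans (cong sumℚ (sym (List.map-id xs))) (trans (sumℚ-∑ (λ x → x) xs)
  (trans (∑-↭ (λ x → x) p) (trans (sym (sumℚ-∑ (λ x → x) ys)) (cong sumℚ (List.map-id ys)))))

toList-map-fromList : ∀ {A B : Set} (f : A → B) xs → toList (Vec.map f (Vec.fromList xs)) ≡ map f xs
toList-map-fromList f []       = refl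
toList-map-fromList f (x ∷ xs) = cong (f x ∷_) (toList-map-fromList f xs)

zip-unzip : ∀ (zs : List (ℚ × ℕ)) →
  toList (Vec.zip (Vec.map proj₁ (Vec.fromList zs)) (Vec.map proj₂ (Vec.fromList zs))) ≡ zs
zip-unzip []       = refl
zip-unzip (z ∷ zs) = cong (z ∷_) (zip-unzip zs)

packing-vector : ∀ {ws bs} → ws ↭ concat bs → All (λ b → sumℚ b ≤ 1ℚ) bs →
  ∃ λ n → ∃ λ (v : Vec ℚ n) → ∃ λ σ → toList v ≡ ws × IsPacking v σ × bins σ ℕ.≤ length bs
packing-vector {ws} {bs} p fits
  with ↭.↭-map-inv proj₁ {tag 0 bs} (subst (_↭ ws) (sym (tag-proj₁ 0 bs)) (↭-sym p))
... | zs , refl , q = length zs , Vec.map proj₁ (Vec.fromList zs) , σ , toList-map-fromList proj₁ zs , fits′ , few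
  where
  σ = Vec.map proj₂ (Vec.fromList zs)
  fits′ : IsPacking (Vec.map proj₁ (Vec.fromList zs)) σ
  fits′ b = subst (λ z → sumℚ (map proj₁ (filter (λ z → proj₂ z ℕ.≟ b) z)) ≤ 1ℚ) (sym (zip-unzip zs)) (ℚ.≤-trans
    (ℚ.≤-reflexive (sumℚ-↭ (↭.map⁺ proj₁ (↭.filter-↭ (λ z → proj₂ z ℕ.≟ b) (↭-sym q)))))
    (tag-fits b 0 bs fits))
  names : ∀ {m} → m ∈ used σ → m ∈ List.upTo (length bs)
  names {m} i with ∈.∈-map⁻ proj₂ (subst (m ∈_) (toList-map-fromList proj₂ zs) (∈.∈-deduplicate⁻ ℕ._≟_ (toList σ) i))
  ... | z , z∈ , refl = ∈.∈-upTo⁺ (proj₂ (All.lookup (tag-names 0 bs) (↭.∈-resp-↭ (↭-sym q) z∈)))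
  few : bins σ ℕ.≤ length bs
  few = ι-cancel (subst₂ _≤_ (∑-length (used σ))
    (trans (∑-length (List.upTo (length bs))) (cong ι (List.length-upTo (length bs))))
    (∑-⊆ {f = λ _ → 1ℚ} (λ _ → 0≤1) (used σ) (List.upTo (length bs)) (used-unique σ) names))

-- The least number principle, by descent on M. It holds up to double negation because the existence
-- of a better packing is not decided.
minimum-bins : ∀ {n} (v : Vec ℚ n) M → ∀ σ → IsPacking v σ → bins σ ℕ.≤ M →
  ¬ ¬ (∃ λ m → m ℕ.≤ M × IsMinBins v m)
minimum-bins v zero σ pack b≤ none = none (0 , z≤n , (σ , pack , ℕ.n≤0⇒n≡0 b≤) , λ _ _ → z≤n)
minimum-bins v (suc M) σ pack b≤ none with bins σ ℕ.≤? M
... | yes b≤M = minimum-bins v M σ pack b≤M λ (m , m≤ , min) → none (m , ℕ.m≤n⇒m≤1+n m≤ , min)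
... | no  b≰M = none (suc M , ℕ.≤-refl , (σ , pack , ℕ.≤-antisym b≤ (ℕ.≰⇒> b≰M)) , least)
  where
  least : ∀ σ′ → IsPacking v σ′ → suc M ℕ.≤ bins σ′
  least σ′ pack′ with suc M ℕ.≤? bins σ′
  ... | yes l = l
  ... | no ¬l = ⊥-elim (minimum-bins v M σ′ pack′ (ℕ.≤-pred (ℕ.≰⇒> ¬l))
    λ (m , m≤ , min) → none (m , ℕ.m≤n⇒m≤1+n m≤ , min))

all-lookup : ∀ {n} {P : ℚ → Set} (v : Vec ℚ n) → All P (toList v) → ∀ i → P (lookup v i)
all-lookup (x Vec.∷ v) (p ∷ ps) Fin.zero    = p
all-lookup (x Vec.∷ v) (p ∷ ps) (Fin.suc i) = all-lookup v ps i

module _ {k : ℕ} {ρ : ℚ} (ρ∈Π : Π k ρ) where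

  -- The minimum m cannot yet be replaced by the length of `bs`: that requires ρ to be nonnegative,
  -- which `Π-nonneg` derives from this very bound.
  harmonic-bound : ∀ {ws bs} → All Positive≤1 ws → ws ↭ concat bs → All (λ b → sumℚ b ≤ 1ℚ) bs →
    ¬ ¬ (∃ λ m → m ℕ.≤ length bs × ι (harmonic k ws) ≤ ρ * ι m + ι k)
  harmonic-bound {ws} {bs} pos p fits none = go (packing-vector p fits)
    where
    go : (∃ λ n → ∃ λ (v : Vec ℚ n) → ∃ λ σ → toList v ≡ ws × IsPacking v σ × bins σ ℕ.≤ length bs) → ⊥
    go (n , v , σ , eq , pack , b≤) = minimum-bins v (length bs) σ pack b≤ λ (m , m≤ , min) →
      none (m , m≤ , subst (λ z → ι (harmonic k z) ≤ ρ * ι m + ι k) eq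
        (subst₂ _≤_ (sym (ι≡fromℕ (harmonic k (toList v))))
          (cong₂ (λ x y → ρ * x + y) (sym (ι≡fromℕ m)) (sym (ι≡fromℕ k)))
          (ρ∈Π v (all-lookup v (subst (All Positive≤1) (sym eq) pos)) m min)))

  module _ (3≤k : 3 ℕ.≤ k) where

    private
      a b : ℚ
      a = ℤ.+ 3 ℚ./ 5
      b = ℤ.+ 2 ℚ./ 5

      -- One copy fills two bins with 3/5 + 2/5 each. Harmonic gives each 3/5, in the class above
      -- 1/2, a bin of its own and pairs the two 2/5 of the next class, which makes three bins. For
      -- k at least 3 these are two separate classes.
      quads : ℕ → List ℚ
      quads M = copies M (a ∷ b ∷ a ∷ b ∷ [])

      class-a : ∀ M → harmonicClass 1 (quads M) ≡ copies M (a ∷ a ∷ [])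
      class-a zero    = refl
      class-a (suc M) = cong (λ ws → a ∷ a ∷ ws) (class-a M)

      class-b : ∀ M → harmonicClass 2 (quads M) ≡ copies M (b ∷ b ∷ [])
      class-b zero    = refl
      class-b (suc M) = cong (λ ws → b ∷ b ∷ ws) (class-b M)

      closed-a : ∀ M → nextFitFrom a (copies M (a ∷ a ∷ [])) ≡ M ℕ.+ M
      closed-a zero    = refl
      closed-a (suc M) = trans (cong (λ n → suc (suc n)) (closed-a M)) (cong suc (sym (ℕ.+-suc M M)))

      closed-b : ∀ M → nextFitFrom (b + b) (copies M (b ∷ b ∷ [])) ≡ M
      closed-b zero    = refl
      closed-b (suc M) = cong suc (closed-b M)

      nextFit-a : ∀ M → M ℕ.+ M ℕ.≤ nextFit (harmonicClass 1 (quads (suc M)))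
      nextFit-a M = ℕ.≤-trans (ℕ.≤-reflexive (sym (closed-a M))) (ℕ.≤-trans (ℕ.m≤n+m _ 2)
        (ℕ.≤-reflexive (sym (cong nextFit (class-a (suc M))))))

      nextFit-b : ∀ M → M ℕ.≤ nextFit (harmonicClass 2 (quads (suc M)))
      nextFit-b M = ℕ.≤-trans (ℕ.≤-reflexive (sym (closed-b M))) (ℕ.≤-trans (ℕ.n≤1+n _)
        (ℕ.≤-reflexive (sym (cong nextFit (class-b (suc M))))))

      many : ∀ M k → 3 ℕ.≤ k → 3 ℕ.* M ℕ.≤ harmonic k (quads (suc M))
      many M (suc (suc (suc k))) (s≤s (s≤s (s≤s z≤n))) = ℕ.≤-trans
        (ℕ.≤-reflexive (arith M))
        (ℕ.≤-trans (ℕ.+-mono-≤ (nextFit-a M) (ℕ.≤-trans (nextFit-b M) (ℕ.m≤m+n _ _))) (ℕ.m≤m+n _ _))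
        where
        arith : ∀ M → 3 ℕ.* M ≡ (M ℕ.+ M) ℕ.+ M
        arith = ℕ-Solver.solve-∀

      bins-ab : List (List ℚ)
      bins-ab = (a ∷ b ∷ []) ∷ (a ∷ b ∷ []) ∷ []

      sizes-ok : All Positive≤1 (a ∷ b ∷ a ∷ b ∷ [])
      sizes-ok = a-ok ∷ b-ok ∷ a-ok ∷ b-ok ∷ []
        where
        a-ok : Positive≤1 a
        a-ok = ℚ.positive⁻¹ a , from-yes (a ℚ.≤? 1ℚ)
        b-ok : Positive≤1 b
        b-ok = ℚ.positive⁻¹ b , from-yes (b ℚ.≤? 1ℚ)

      bins-ok : All (λ b → sumℚ b ≤ 1ℚ) bins-ab
      bins-ok = ok ∷ ok ∷ []
        where
        ok : sumℚ (a ∷ b ∷ []) ≤ 1ℚ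
        ok = from-yes (sumℚ (a ∷ b ∷ []) ℚ.≤? 1ℚ)

      bound-at : ∀ M → ¬ ¬ (∃ λ m → m ℕ.≤ suc M ℕ.* 2 × ι (3 ℕ.* M) ≤ ρ * ι m + ι k)
      bound-at M none = harmonic-bound {quads (suc M)} {copies (suc M) bins-ab}
        (copies-All (suc M) sizes-ok) (copies-packing (suc M) {bs = bins-ab} ↭-refl) (copies-All (suc M) bins-ok)
        λ (m , m≤ , h) → none (m , ℕ.≤-trans m≤ (ℕ.≤-reflexive (copies-length (suc M) bins-ab)) ,
          ℚ.≤-trans (ι-mono (many M k 3≤k)) h)

    -- A negative ρ would allow at most k bins in all, while Harmonic uses at least 3(k + 1) bins on
    -- k + 2 copies of the quadruple.
    Π-nonneg : 0ℚ ≤ ρ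
    Π-nonneg = go (0ℚ ℚ.≤? ρ)
      where
      go : Dec (0ℚ ≤ ρ) → 0ℚ ≤ ρ
      go (yes p) = p
      go (no ¬p) = ⊥-elim (bound-at (suc k) λ (m , _ , h) → absurd< (many′ m h) (nonpos m))
        where
        many′ : ∀ m → ι (3 ℕ.* suc k) ≤ ρ * ι m + ι k → ι k < ρ * ι m + ι k
        many′ m h = ℚ.<-≤-trans (ι-<-suc k) (ℚ.≤-trans (ι-mono (ℕ.m≤n*m (suc k) 3)) h)
        nonpos : ∀ m → ρ * ι m + ι k ≤ ι k
        nonpos m = ℚ.≤-trans (ℚ.+-monoˡ-≤ (ι k) (*-monoˡ (ι m) (0≤ι m) (ℚ.<⇒≤ (ℚ.≰⇒> ¬p))))
          (ℚ.≤-reflexive (trans (cong (_+ ι k) (ℚ.*-zeroˡ (ι m))) (ℚ.+-identityˡ (ι k))))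

    3≤2Π : fromℕ 3 ≤ fromℕ 2 * ρ
    -- The constant is the cost of the one copy more than M, namely 2ρ, and the additive k of
    -- Harmonic.
    3≤2Π = ≤-by-multiples (fromℕ 2 * ρ + ι k) λ M → at M (_ ℚ.≤? _)
      where
      lem : ∀ M r k → r * ((1ℚ + M) * (1ℚ + 1ℚ)) + k ≡ M * ((1ℚ + 1ℚ) * r) + ((1ℚ + 1ℚ) * r + k)
      lem = solve-∀ ℚ-ring
      at : ∀ M → Dec (ι M * fromℕ 3 ≤ ι M * (fromℕ 2 * ρ) + (fromℕ 2 * ρ + ι k)) →
        ι M * fromℕ 3 ≤ ι M * (fromℕ 2 * ρ) + (fromℕ 2 * ρ + ι k)
      at M (yes p) = p
      at M (no ¬p) = ⊥-elim (bound-at M λ (m , m≤ , h) → ¬p (ℚ.≤-trans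
        (ℚ.≤-reflexive (trans (ℚ.*-comm (ι M) (fromℕ 3)) (trans (cong (_* ι M) (sym (ι≡fromℕ 3))) (sym (ι-* 3 M)))))
        (ℚ.≤-trans h (ℚ.≤-trans
          (ℚ.+-monoˡ-≤ (ι k) (*-monoʳ ρ Π-nonneg (ι-mono m≤)))
          (ℚ.≤-reflexive (trans (cong (λ x → ρ * x + ι k) (trans (ι-* (suc M) 2) (cong₂ _*_ (ι-suc M) (ι≡fromℕ 2))))
            (lem (ι M) ρ (ι k))))))))

    -- The additive term of Π disappears when many copies of an input are packed together.
    closed-bound : ∀ {ws q} → All Positive≤1 ws → PackableIn ws q → ι (harmonicClosed k ws) ≤ ρ * q
    closed-bound {ws} {q} pos (bs , p , fits , refl) = ≤-by-multiples (ι k) λ N → at N (_ ℚ.≤? _)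
      where
      lem : ∀ r n l → r * (n * l) ≡ n * (r * l)
      lem = solve-∀ ℚ-ring
      at : ∀ N → Dec (ι N * ι (harmonicClosed k ws) ≤ ι N * (ρ * ι (length bs)) + ι k) →
        ι N * ι (harmonicClosed k ws) ≤ ι N * (ρ * ι (length bs)) + ι k
      at N (yes h) = h
      at N (no ¬h) = ⊥-elim (harmonic-bound {copies N ws} {copies N bs}
        (copies-All N pos) (copies-packing N p) (copies-All N fits)
        λ (m , m≤ , h) → ¬h (ℚ.≤-trans (ℚ.≤-reflexive (sym (ι-* N (harmonicClosed k ws))))
          (ℚ.≤-trans (ι-mono (ℕ.≤-trans (harmonicClosed-copies k N ws pos) (harmonicClosed≤harmonic k (copies N ws))))
          (ℚ.≤-trans h (ℚ.≤-trans (ℚ.+-monoˡ-≤ (ι k) (*-monoʳ ρ Π-nonneg (ι-mono m≤)))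
            (ℚ.≤-reflexive (cong (_+ ι k) (trans (cong (λ x → ρ * ι x) (copies-length N bs))
              (trans (cong (ρ *_) (ι-* N (length bs))) (lem ρ (ι N) (ι (length bs))))))))))))

-- The algorithms.

act : ℚ → Item → Bool
act t x = le (st x) t ∧ not (le (en x) t)

lenI : Item → ℚ
lenI x = en x + (- 1ℚ) * st x

load : ℚ → List Item → ℚ
load t = rec (λ x _ s → (if act t x then sz x else 0ℚ) + s) 0ℚ

insertBy : (Item → ℚ) → Item → List Item → List Item
insertBy key x = rec (λ y ys r → if le (key x) (key y) then x ∷ y ∷ ys else y ∷ r) [ x ]

sortBy : (Item → ℚ) → List Item → List Item
sortBy key = rec (λ x _ r → insertBy key x r) []

covered : ℚ → ℚ → List Item → Item → ℚ → Bool
covered c w F x p = if act p x then not (le (load p F + w) c) else true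

-- The load of F is smallest, after the start of x, at the end of some item.
removable : ℚ → ℚ → Item → List Item → Bool
removable c w x F = rec (λ y _ b → covered c w F x (en y) ∧ b) (covered c w F x (st x)) F

pruneStep : ℚ → ℚ → Item → List Item → List Item × List Item → List Item × List Item
pruneStep c w x rest s =
  if removable c w x (proj₁ s ++ rest) then (proj₁ s , x ∷ proj₂ s) else (x ∷ proj₁ s , proj₂ s)

prune : ℚ → ℚ → List Item → List Item × List Item
prune c w R = iterate (pruneStep c w) R ([] , [])

place : Item → List (List Item) → List (List Item)
place x = rec (λ m ms r → if le (load (st x) m + sz x) 1ℚ then (x ∷ m) ∷ ms else m ∷ r) [ [ x ] ]

firstFit : List Item → List (List Item)
firstFit F = iterate (λ x _ ms → place x ms) F []

roundStep : ℚ → ℚ → List Item × List (List Item) → List Item × List (List Item)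
roundStep c w s = proj₂ (prune c w (proj₁ s)) , firstFit (sortBy st (proj₁ (prune c w (proj₁ s)))) ++ proj₂ s

-- The list serves as its own fuel: every round extracts at least one item.
rounds : ℚ → ℚ → List Item → List (List Item)
rounds c w R = proj₂ (iterate (λ _ _ s → roundStep c w s) R (R , []))

third : ℚ
third = recip 3

singles : List Item → List (List Item)
singles = rec (λ x _ r → if le (sz x) third then r else [ x ] ∷ r) []

atMostThird : List Item → List Item
atMostThird = rec (λ x _ r → if le (sz x) third then x ∷ r else r) []

-- The value 1/3 balances two losses. A single item above 1/3 costs fewer than 3 machines per unit
-- of load. A machine that rejects an item of at most 1/3 has load above 2/3, and minimality loses a
-- factor 2, so a round also pays about 3 machines per unit of load.
packGeneral : ℕ → List Item → List (List Item)
packGeneral k xs = singles xs ++ rounds (ι k * third) third (atMostThird xs)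

headSize : List Item → ℚ
headSize = rec (λ x _ _ → sz x) 0ℚ

allEqual : ℚ → List Item → Bool
allEqual w = rec (λ x _ b → (le (sz x) w ∧ le w (sz x)) ∧ b) true

algorithm₂ : ℕ → List Item → List (List Item)
algorithm₂ k xs = if allEqual (headSize xs) xs then rounds 1ℚ (headSize xs) xs else packGeneral k xs

nextFitStep : Item → ℚ × List Item × List (List Item) → ℚ × List Item × List (List Item)
nextFitStep x s = if le (proj₁ s + sz x) 1ℚ
  then (proj₁ s + sz x , x ∷ proj₁ (proj₂ s) , proj₂ (proj₂ s))
  else (sz x , [ x ] , proj₁ (proj₂ s) ∷ proj₂ (proj₂ s))

nextFitPack : List Item → List (List Item)
nextFitPack b = finish (iterate (λ x _ s → nextFitStep x s) b (0ℚ , [] , []))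
  where
  finish : ℚ × List Item × List (List Item) → List (List Item)
  finish s = proj₁ (proj₂ s) ∷ proj₂ (proj₂ s)

-- The rational is the latest start of the items.
Group : Set
Group = ℚ × List Item

-- `rec` meets a list sorted by start from its end, so x starts no later than all items met before.
-- The head group has latest start s and accepts x only if x starts after s - L; hence its starts
-- span less than L.
extend : ℚ → Item → List Group → List Group
extend L x []             = [ (st x , [ x ]) ]
extend L x ((s , g) ∷ gs) = if le (st x + L) s then (st x , [ x ]) ∷ (s , g) ∷ gs else (s , x ∷ g) ∷ gs

groups : ℚ → List Item → List Group
groups L = rec (λ x _ gs → extend L x gs) []

-- The number of the current batch, its load, its items, and the complete batches.
BatchState : Set
BatchState = ℚ × ℚ × List Item × List (List Item)

batchStep : Item → BatchState → BatchState
batchStep x (q , l , cur , done) =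
  if le q (l + sz x) then (q + 1ℚ , 0ℚ , [] , (x ∷ cur) ∷ done) else (q , l + sz x , x ∷ cur , done)

batches : List Item → BatchState
batches = rec (λ x _ s → batchStep x s) (1ℚ , 0ℚ , [] , [])

Batched : Set
Batched = List (List Item) × List Item

passGroups : List Group → Batched
passGroups = rec (λ g _ r → proj₂ (proj₂ (proj₂ (batches (proj₂ g)))) ++ proj₁ r ,
                             proj₁ (proj₂ (proj₂ (batches (proj₂ g)))) ++ proj₂ r) ([] , [])

pass : ℚ → List Item → Batched
pass L xs = passGroups (groups L (sortBy st xs))

headLen : List Item → ℚ
headLen = rec (λ x _ _ → lenI x) 0ℚ

minLen : List Item → ℚ
minLen xs = rec (λ x _ m → if le (lenI x) m then lenI x else m) (headLen xs) xs

shorter longer : ℚ → List Item → List Item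
shorter b = rec (λ x _ r → if le b (lenI x) then r else x ∷ r) []
longer  b = rec (λ x _ r → if le b (lenI x) then x ∷ r else r) []

-- The unit of length is the least length that remains, not a power of 2. Each step then handles a
-- nonempty class and at least doubles the least length, so the number of steps is logarithmic
-- without computing any logarithm.
lengthStep : List Item × Batched → List Item × Batched
lengthStep (xs , bs , left) =
  longer (fromℕ 2 * minLen xs) xs ,
  proj₁ (pass (minLen xs) (shorter (fromℕ 2 * minLen xs) xs)) ++ bs ,
  proj₂ (pass (minLen xs) (shorter (fromℕ 2 * minLen xs) xs)) ++ left

lengthClasses : List Item → Batched
lengthClasses xs = proj₂ (iterate (λ _ _ s → lengthStep s) xs (xs , [] , []))

above notAbove : ℚ → List Item → List Item
above    lo = rec (λ x _ r → if le (sz x) lo then r else x ∷ r) []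
notAbove lo = rec (λ x _ r → if le (sz x) lo then x ∷ r else r) []

harmonicStep : ℚ → List Item × Batched → List Item × Batched
harmonicStep lo (xs , bs , left) =
  notAbove lo xs ,
  proj₁ (lengthClasses (above lo xs)) ++ bs ,
  proj₂ (lengthClasses (above lo xs)) ++ left

-- From j = 1 with m = k - 1 these are 1/2, 1/3, ..., 1/k and then 0. Taking the items above each
-- threshold in turn yields the classes of Harmonic; the final 0 takes the class of sizes up to 1/k.
thresholds : ℕ → ℕ → List ℚ
thresholds j zero    = [ 0ℚ ]
thresholds j (suc m) = recip (suc j) ∷ thresholds (suc j) m

harmonicClasses : ℕ → List Item → List Item × Batched
harmonicClasses k xs = iterate (λ lo _ s → harmonicStep lo s) (thresholds 1 (k ℕ.∸ 1)) (xs , [] , [])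

packBatches : List (List Item) → List (List Item)
packBatches = rec (λ b _ r → nextFitPack (sortBy (λ x → (- 1ℚ) * en x) b) ++ r) []

algorithm₁ : ℕ → List Item → List (List Item)
algorithm₁ k xs = packBatches (proj₁ (proj₂ (harmonicClasses k xs))) ++
  packGeneral 3 (proj₂ (proj₂ (harmonicClasses k xs)) ++ proj₁ (harmonicClasses k xs))

-- Every stage permutes its items.

module _ {A : Set} where
  open CM-Solver (↭.++-commutativeMonoid {A = A}) public using (_⊜_) renaming (solve to ↭-solve; _⊕_ to _⊍_)

insertBy-↭ : ∀ key x ys → insertBy key x ys ↭ x ∷ ys
insertBy-↭ key x []       = ↭-refl
insertBy-↭ key x (y ∷ ys) with le (key x) (key y)
... | true  = ↭-refl
... | false = ↭-trans (prep y (insertBy-↭ key x ys)) (swap y x ↭-refl)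

sortBy-↭ : ∀ key xs → sortBy key xs ↭ xs
sortBy-↭ key []       = ↭-refl
sortBy-↭ key (x ∷ xs) = ↭-trans (insertBy-↭ key x (sortBy key xs)) (prep x (sortBy-↭ key xs))

SortedBy : (Item → ℚ) → List Item → Set
SortedBy key = AllPairs (λ x y → key x ≤ key y)

sortBy-sorted : ∀ key xs → SortedBy key (sortBy key xs)
sortBy-sorted key []       = []
sortBy-sorted key (x ∷ xs) = insert (sortBy key xs) (sortBy-sorted key xs)
  where
  insert : ∀ ys → SortedBy key ys → SortedBy key (insertBy key x ys)
  insert []       _          = [] ∷ []
  insert (y ∷ ys) (y≤ ∷ ys↗) with le (key x) (key y) in eq
  ... | true  = (le-true eq ∷ All.map (ℚ.≤-trans (le-true eq)) y≤) ∷ y≤ ∷ ys↗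
  ... | false = ↭.All-resp-↭ (↭-sym (insertBy-↭ key x ys)) (ℚ.<⇒≤ (le-false eq) ∷ y≤) ∷ insert ys ys↗

prune-↭ : ∀ c w R kept del → let (F , D) = iterate (pruneStep c w) R (kept , del) in
  F ++ D ↭ R ++ (kept ++ del)
prune-↭ c w []      kept del = ↭-refl
prune-↭ c w (x ∷ R) kept del with removable c w x (kept ++ R)
... | true  = ↭-trans (prune-↭ c w R kept (x ∷ del))
  (↭-solve 4 (λ x R a b → R ⊍ (a ⊍ (x ⊍ b)) ⊜ x ⊍ (R ⊍ (a ⊍ b))) ↭-refl [ x ] R kept del)
... | false = ↭-trans (prune-↭ c w R (x ∷ kept) del)
  (↭-solve 4 (λ x R a b → R ⊍ ((x ⊍ a) ⊍ b) ⊜ x ⊍ (R ⊍ (a ⊍ b))) ↭-refl [ x ] R kept del)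

place-↭ : ∀ x ms → concat (place x ms) ↭ x ∷ concat ms
place-↭ x []       = ↭-refl
place-↭ x (m ∷ ms) with le (load (st x) m + sz x) 1ℚ
... | true  = ↭-refl
... | false = ↭-trans (↭.++⁺ˡ m (place-↭ x ms)) (↭.shift x m (concat ms))

firstFit-↭′ : ∀ F ms → concat (iterate (λ x _ ms → place x ms) F ms) ↭ F ++ concat ms
firstFit-↭′ []      ms = ↭-refl
firstFit-↭′ (x ∷ F) ms = ↭-trans (firstFit-↭′ F (place x ms))
  (↭-trans (↭.++⁺ˡ F (place-↭ x ms)) (↭.shift x F (concat ms)))

firstFit-↭ : ∀ F → concat (firstFit F) ↭ F
firstFit-↭ F = ↭-trans (firstFit-↭′ F []) (↭.↭-reflexive (List.++-identityʳ F))

roundStep-↭ : ∀ c w rem ms → let (rem′ , ms′) = roundStep c w (rem , ms) in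
  concat ms′ ++ rem′ ↭ concat ms ++ rem
roundStep-↭ c w rem ms = ↭-trans
  (↭.++⁺ʳ D (↭-trans (↭.↭-reflexive (sym (List.concat-++ (firstFit (sortBy st F)) ms)))
    (↭.++⁺ʳ (concat ms) (↭-trans (firstFit-↭ (sortBy st F)) (sortBy-↭ st F)))))
  (↭-trans (↭-solve 3 (λ F m D → (F ⊍ m) ⊍ D ⊜ m ⊍ (F ⊍ D)) ↭-refl F (concat ms) D)
    (↭.++⁺ˡ (concat ms) (↭-trans (prune-↭ c w rem [] []) (↭.↭-reflexive (List.++-identityʳ rem)))))
  where
  F = proj₁ (prune c w rem)
  D = proj₂ (prune c w rem)

nextFitPack-↭′ : ∀ b l cur ms → let (_ , cur′ , ms′) = iterate (λ x _ s → nextFitStep x s) b (l , cur , ms) in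
  concat (cur′ ∷ ms′) ↭ b ++ concat (cur ∷ ms)
nextFitPack-↭′ []      l cur ms = ↭-refl
nextFitPack-↭′ (x ∷ b) l cur ms with le (l + sz x) 1ℚ
... | true  = ↭-trans (nextFitPack-↭′ b (l + sz x) (x ∷ cur) ms) (↭.shift x b (cur ++ concat ms))
... | false = ↭-trans (nextFitPack-↭′ b (sz x) [ x ] (cur ∷ ms)) (↭.shift x b (cur ++ concat ms))

nextFitPack-↭ : ∀ b → concat (nextFitPack b) ↭ b
nextFitPack-↭ b = ↭-trans (nextFitPack-↭′ b 0ℚ [] []) (↭.↭-reflexive (List.++-identityʳ b))

groups-↭ : ∀ L xs → concat (map proj₂ (groups L xs)) ↭ xs
groups-↭ L []       = ↭-refl
groups-↭ L (x ∷ xs) = ↭-trans (lem (groups L xs)) (prep x (groups-↭ L xs))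
  where
  lem : ∀ gs → concat (map proj₂ (extend L x gs)) ↭ x ∷ concat (map proj₂ gs)
  lem []             = ↭-refl
  lem ((s , g) ∷ gs) with le (st x + L) s
  ... | true  = ↭-refl
  ... | false = ↭-refl

batches-↭ : ∀ g → let (_ , _ , cur , done) = batches g in cur ++ concat done ↭ g
batches-↭ []      = ↭-refl
batches-↭ (x ∷ g) = ↭-trans (lem (batches g)) (prep x (batches-↭ g))
  where
  lem : ∀ s → proj₁ (proj₂ (proj₂ (batchStep x s))) ++ concat (proj₂ (proj₂ (proj₂ (batchStep x s)))) ↭
    x ∷ (proj₁ (proj₂ (proj₂ s)) ++ concat (proj₂ (proj₂ (proj₂ s))))
  lem (q , l , cur , done) with le q (l + sz x)
  ... | true  = ↭-refl
  ... | false = ↭-refl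

all-items : Batched → List Item
all-items r = concat (proj₁ r) ++ proj₂ r

all-items-++ : ∀ bs bs′ (l l′ : List Item) → all-items (bs ++ bs′ , l ++ l′) ↭ all-items (bs , l) ++ all-items (bs′ , l′)
all-items-++ bs bs′ l l′ = ↭-trans (↭.++⁺ʳ (l ++ l′) (↭.↭-reflexive (sym (List.concat-++ bs bs′))))
  (↭-solve 4 (λ a b c d → (a ⊍ b) ⊍ (c ⊍ d) ⊜ (a ⊍ c) ⊍ (b ⊍ d)) ↭-refl (concat bs) (concat bs′) l l′)

passGroups-↭ : ∀ gs → all-items (passGroups gs) ↭ concat (map proj₂ gs)
passGroups-↭ []       = ↭-refl
passGroups-↭ (g ∷ gs) = ↭-trans
  (all-items-++ done (proj₁ (passGroups gs)) cur (proj₂ (passGroups gs)))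
  (↭.++⁺ (↭-trans (↭.++-comm (concat done) cur) (batches-↭ (proj₂ g))) (passGroups-↭ gs))
  where
  cur  = proj₁ (proj₂ (proj₂ (batches (proj₂ g))))
  done = proj₂ (proj₂ (proj₂ (batches (proj₂ g))))

pass-↭ : ∀ L xs → all-items (pass L xs) ↭ xs
pass-↭ L xs = ↭-trans (passGroups-↭ (groups L (sortBy st xs))) (↭-trans (groups-↭ L (sortBy st xs)) (sortBy-↭ st xs))

shorter-longer-↭ : ∀ b xs → shorter b xs ++ longer b xs ↭ xs
shorter-longer-↭ b []       = ↭-refl
shorter-longer-↭ b (x ∷ xs) with le b (lenI x)
... | true  = ↭-trans (↭.shift x (shorter b xs) (longer b xs)) (prep x (shorter-longer-↭ b xs))
... | false = prep x (shorter-longer-↭ b xs)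

lengthStep-↭ : ∀ (s : List Item × Batched) → let (xs , r) = s ; (xs′ , r′) = lengthStep s in all-items r′ ++ xs′ ↭ all-items r ++ xs
lengthStep-↭ (xs , bs , left) = ↭-trans
  (↭.++⁺ʳ (longer b xs) (↭-trans (all-items-++ (proj₁ p) bs (proj₂ p) left) (↭.++⁺ʳ (all-items (bs , left)) (pass-↭ (minLen xs) (shorter b xs)))))
  (↭-trans (↭-solve 3 (λ s r l → (s ⊍ r) ⊍ l ⊜ r ⊍ (s ⊍ l)) ↭-refl (shorter b xs) (all-items (bs , left)) (longer b xs))
    (↭.++⁺ˡ (all-items (bs , left)) (shorter-longer-↭ b xs)))
  where
  b = fromℕ 2 * minLen xs
  p = pass (minLen xs) (shorter b xs)

above-↭ : ∀ lo xs → above lo xs ++ notAbove lo xs ↭ xs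
above-↭ lo []       = ↭-refl
above-↭ lo (x ∷ xs) with le (sz x) lo
... | true  = ↭-trans (↭.shift x (above lo xs) (notAbove lo xs)) (prep x (above-↭ lo xs))
... | false = prep x (above-↭ lo xs)

packBatches-↭ : ∀ bs → concat (packBatches bs) ↭ concat bs
packBatches-↭ []       = ↭-refl
packBatches-↭ (b ∷ bs) = ↭-trans (↭.↭-reflexive (sym (List.concat-++ (nextFitPack b′) (packBatches bs))))
  (↭.++⁺ (↭-trans (nextFitPack-↭ b′) (sortBy-↭ _ b)) (packBatches-↭ bs))
  where
  b′ = sortBy (λ x → (- 1ℚ) * en x) b

singles-↭ : ∀ xs → concat (singles xs) ++ atMostThird xs ↭ xs
singles-↭ []       = ↭-refl
singles-↭ (x ∷ xs) with le (sz x) third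
... | true  = ↭-trans (↭.shift x (concat (singles xs)) (atMostThird xs)) (prep x (singles-↭ xs))
... | false = prep x (singles-↭ xs)

-- Loads, minimal subsets and First-Fit rounds.

ActiveI : ℚ → Item → Set
ActiveI t x = Active t (req x)

act-true : ∀ {t x} → act t x ≡ true → ActiveI t x
act-true {t} {x} eq with le (st x) t in p | le (en x) t in q
... | true | false = le-true p , le-false q

act-false : ∀ {t x} → act t x ≡ false → ¬ ActiveI t x
act-false {t} {x} eq (s≤t , t<e) with le (st x) t in p | le (en x) t in q
... | true  | true  = absurd< t<e (le-true q)
... | false | _     = absurd< (le-false p) s≤t

sizeAtI : ℚ → Item → ℚ
sizeAtI t x = sizeAt t (req x)

loadI : ℚ → List Item → ℚ
loadI t = ∑ (sizeAtI t)

load≡ : ∀ t xs → load t xs ≡ loadI t xs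
load≡ t []       = refl
load≡ t (x ∷ xs) = cong₂ _+_ (head x) (load≡ t xs)
  where
  head : ∀ x → (if act t x then sz x else 0ℚ) ≡ sizeAtI t x
  head x with act t x in eq
  ... | true  = sym (sizeAt-active {t} {req x} (act-true {t} {x} eq))
  ... | false = sym (sizeAt-inactive {t} {req x} (act-false {t} {x} eq))

loadAt≡ : ∀ t xs → loadAt t (map req xs) ≡ loadI t xs
loadAt≡ t xs = trans (loadAt-∑ t (map req xs)) (∑-map (sizeAt t) req xs)

record Valid (x : Item) : Set where
  constructor valid
  field
    sz>0  : 0ℚ < sz x
    sz≤1  : sz x ≤ 1ℚ
    st<en : st x < en x

open Valid

0≤sizeAtI : ∀ t {x} → Valid x → 0ℚ ≤ sizeAtI t x
0≤sizeAtI t {x} v = 0≤sizeAt t (req x) (ℚ.<⇒≤ (sz>0 v))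

0≤loadI : ∀ t {xs} → All Valid xs → 0ℚ ≤ loadI t xs
0≤loadI t {xs} v = ∑-nonneg xs (λ i → 0≤sizeAtI t (All.lookup v i))

sizeAtI≤ : ∀ t {x} → Valid x → sizeAtI t x ≤ sz x
sizeAtI≤ t {x} v = sizeAt≤size t (req x) (ℚ.<⇒≤ (sz>0 v))

sizeAtI-mono : ∀ {t u x} → Valid x → (ActiveI t x → ActiveI u x) → sizeAtI t x ≤ sizeAtI u x
sizeAtI-mono {t} {u} {x} v f = go (active? t (req x))
  where
  go : Dec (ActiveI t x) → sizeAtI t x ≤ sizeAtI u x
  go (yes a) = ℚ.≤-reflexive (trans (sizeAt-active {t} {req x} a) (sym (sizeAt-active {u} {req x} (f a))))
  go (no ¬a) = subst (_≤ sizeAtI u x) (sym (sizeAt-inactive {t} {req x} ¬a)) (0≤sizeAtI u v)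

Fits : List Item → Set
Fits m = ∀ t → loadI t m ≤ 1ℚ

ActiveIn : ℚ → List Item → Set
ActiveIn t xs = Any (ActiveI t) xs

activeIn? : ∀ t xs → Dec (ActiveIn t xs)
activeIn? t = any? (λ x → active? t (req x))

inactive-load : ∀ {t xs} → ¬ ActiveIn t xs → loadI t xs ≡ 0ℚ
inactive-load {t} {xs} ¬a = trans (∑-cong xs (λ {x} i → sizeAt-inactive {t} {req x} (λ a → ¬a (lose i a)))) (∑-0 xs)

active-load : ∀ {t xs} → All Valid xs → ActiveIn t xs → 0ℚ < loadI t xs
active-load {t} {x ∷ xs} (v ∷ vs) (here a) = subst (0ℚ <_) (ℚ.+-comm _ (sizeAtI t x))
  (0≤loadI t vs ⊞< subst (0ℚ <_) (sym (sizeAt-active {t} {req x} a)) (sz>0 v))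
active-load {t} {x ∷ xs} (v ∷ vs) (there a) = 0≤sizeAtI t v ⊞< active-load vs a

record Light (c : ℚ) (F : List Item) (x : Item) : Set where
  constructor light
  field
    time : ℚ
    alive : ActiveI time x
    low   : loadI time F ≤ c

light-map : ∀ {c F G x} → (∀ t → loadI t G ≤ loadI t F) → Light c F x → Light c G x
light-map G≤F (light p a l) = light p a (ℚ.≤-trans (G≤F p) l)

module Prune (c w : ℚ) where

  covered-true : ∀ {F x p} → covered c w F x p ≡ true → ActiveI p x → c < loadI p F + w
  covered-true {F} {x} {p} eq a with act p x in q
  ... | false = ⊥-elim (act-false {p} {x} q a)
  ... | true with le (load p F + w) c in l
  ... | false = subst (λ y → c < y + w) (load≡ p F) (le-false l)

  covered-false : ∀ {F x p} → covered c w F x p ≡ false → ActiveI p x × loadI p F + w ≤ c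
  covered-false {F} {x} {p} eq with act p x in q
  ... | true with le (load p F + w) c in l
  ... | true = act-true {p} {x} q , subst (λ y → y + w ≤ c) (load≡ p F) (le-true l)

  private
    check : Item → List Item → List Item → Bool
    check x F = rec (λ y _ b → covered c w F x (en y) ∧ b) (covered c w F x (st x))

    last-checked : ∀ x F G {t} → check x F G ≡ true → st x ≤ t →
      ∃ λ p → covered c w F x p ≡ true × st x ≤ p × p ≤ t × (∀ {y} → y ∈ G → en y ≤ t → en y ≤ p)
    last-checked x F [] eq s≤t = st x , eq , ℚ.≤-refl , s≤t , λ ()
    last-checked x F (y ∷ G) {t} eq s≤t with covered c w F x (en y) in q
    ... | true with last-checked x F G eq s≤t
    ... | p , ok , s≤p , p≤t , max with en y ℚ.≤? t | en y ℚ.≤? p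
    ... | no  y≰t | _ = p , ok , s≤p , p≤t , λ { (here refl) y≤t → contradiction y≤t y≰t ; (there i) → max i }
    ... | yes _   | yes y≤p = p , ok , s≤p , p≤t , λ { (here refl) _ → y≤p ; (there i) → max i }
    ... | yes y≤t | no  y≰p = en y , q , ℚ.≤-trans s≤p p≤y , y≤t ,
          λ { (here refl) _ → ℚ.≤-refl ; (there i) z≤t → ℚ.≤-trans (max i z≤t) p≤y }
      where p≤y = ℚ.<⇒≤ (ℚ.≰⇒> y≰p)

    check-false : ∀ x F G → check x F G ≡ false → ∃ λ p → covered c w F x p ≡ false
    check-false x F []      eq = st x , eq
    check-false x F (y ∷ G) eq with covered c w F x (en y) in q
    ... | false = en y , q
    ... | true  = check-false x F G eq

  -- Let p be the latest tested time up to t. No item of F ends after p and up to t, so everything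
  -- active at p is still active at t, and the load at t is at least the tested load.
  removable-true : ∀ {x F t} → All Valid F → removable c w x F ≡ true → ActiveI t x → c < loadI t F + w
  removable-true {x} {F} {t} vs eq (s≤t , t<e) with last-checked x F F eq s≤t
  ... | p , ok , s≤p , p≤t , max = ℚ.<-≤-trans (covered-true {F} {x} {p} ok (s≤p , ℚ.≤-<-trans p≤t t<e))
    (ℚ.+-monoˡ-≤ w (∑-mono F λ {y} i → sizeAtI-mono {p} {t} {y} (All.lookup vs i)
      λ (sy≤p , p<ey) → ℚ.≤-trans sy≤p p≤t , ℚ.≰⇒> λ ey≤t → absurd< p<ey (max i ey≤t)))

  removable-false : ∀ {x F} → removable c w x F ≡ false → ∃ λ p → ActiveI p x × loadI p F + w ≤ c
  removable-false {x} {F} eq = let (p , q) = check-false x F F eq in p , covered-false {F} {x} {p} q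

  loadI-insert : ∀ t x kept rest → loadI t (kept ++ x ∷ rest) ≡ sizeAtI t x + loadI t (kept ++ rest)
  loadI-insert t x kept rest = ∑-↭ (sizeAtI t) (↭.shift x kept rest)

  record Pruned (F D : List Item) : Set where
    field
      dense   : ∀ {t} → ActiveIn t D → c < loadI t F + w
      tight   : All (Light c F) F

  -- The current candidate set is `kept ++ R`. Light times survive deletions because loads only
  -- fall. Density survives the deletion of x: where x is active its own test gives the bound, and
  -- elsewhere the load is unchanged. If x is kept, its test failed for the set without x; adding x,
  -- of size at most w, brings the load to at most c.
  pruned : ∀ R → All Valid R → All (λ x → sz x ≤ w) R → Pruned (proj₁ (prune c w R)) (proj₂ (prune c w R))
  pruned R vs sz≤ = go R [] [] vs sz≤ [] (λ ()) []
    where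
    go : ∀ R kept del → All Valid R → All (λ x → sz x ≤ w) R → All Valid kept →
      (∀ {t} → ActiveIn t del → c < loadI t (kept ++ R) + w) → All (Light c (kept ++ R)) kept →
      let (F , D) = iterate (pruneStep c w) R (kept , del) in Pruned F D
    go [] kept del vs sz≤ vk dense tight = record
      { dense = λ {t} a → subst (λ y → c < loadI t y + w) (List.++-identityʳ kept) (dense a)
      ; tight = subst (λ y → All (Light c y) kept) (List.++-identityʳ kept) tight }
    go (x ∷ R) kept del (v ∷ vs) (s ∷ sz≤) vk dense tight with removable c w x (kept ++ R) in eq
    ... | true = go R kept (x ∷ del) vs sz≤ vk dense′
        (All.map (light-map {F = kept ++ x ∷ R} {kept ++ R} λ t → lin (0≤sizeAtI t v) (trans (loadI-insert t x kept R) (ℚ.+-comm (sizeAtI t x) (loadI t (kept ++ R))))) tight)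
      where
      dense′ : ∀ {t} → ActiveIn t (x ∷ del) → c < loadI t (kept ++ R) + w
      dense′ {t} (here a) = removable-true {x} {kept ++ R} {t} (All.++⁺ vk vs) eq a
      dense′ {t} (there a) = inactive-or (active? t (req x))
        where
        inactive-or : Dec (ActiveI t x) → c < loadI t (kept ++ R) + w
        inactive-or (yes ax) = removable-true {x} {kept ++ R} {t} (All.++⁺ vk vs) eq ax
        inactive-or (no ¬ax) = subst (λ y → c < y + w) (trans (loadI-insert t x kept R)
          (trans (cong (_+ loadI t (kept ++ R)) (sizeAt-inactive {t} {req x} ¬ax)) (ℚ.+-identityˡ (loadI t (kept ++ R))))) (dense a)
    ... | false = let (p , a , l) = removable-false {x} {kept ++ R} eq in go R (x ∷ kept) del vs sz≤ (v ∷ vk)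
        (λ {t} a → subst (λ y → c < y + w) (loadI-insert t x kept R) (dense a))
        (light p a (ℚ.≤-trans (ℚ.≤-reflexive (ℚ.+-comm (sizeAtI p x) _)) (ℚ.≤-trans (ℚ.+-monoʳ-≤ (loadI p (kept ++ R)) (ℚ.≤-trans (sizeAtI≤ p v) s)) l))
         ∷ All.map (light-map {F = kept ++ x ∷ R} {x ∷ kept ++ R} λ t → ℚ.≤-reflexive (sym (loadI-insert t x kept R))) tight)

-- If every item is active at some time of load at most C, then the load never
-- exceeds 2 C: the items active at t whose chosen time is at most t are all
-- active at the latest such time, and likewise for the others.
module _ {C : ℚ} (0≤C : 0ℚ ≤ C) (F : List Item) where

  private
    record Marked (z : Item × ℚ) : Set where
      constructor marked
      field
        is-valid : Valid (proj₁ z)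
        alive    : ActiveI (proj₂ z) (proj₁ z)
        low      : loadI (proj₂ z) F ≤ C

    mark : ∀ G → All Valid G → All (Light C F) G → ∃ λ zs → map proj₁ zs ≡ G × All Marked zs
    mark []      _        _        = [] , refl , []
    mark (x ∷ G) (v ∷ vs) (light p a l ∷ ms) = let (zs , eq , h) = mark G vs ms in
      (x , p) ∷ zs , cong (x ∷_) eq , marked v a l ∷ h

    latest : ∀ t zs → All Marked zs →
      All (λ z → t < proj₂ z) zs ⊎ ∃ λ p → p ≤ t × loadI p F ≤ C × All (λ z → proj₂ z ≤ p ⊎ t < proj₂ z) zs
    latest t []             _                = inj₁ []
    latest t ((x , p) ∷ zs) (marked _ _ l ∷ ms) with p ℚ.≤? t | latest t zs ms
    ... | no  p≰t | inj₁ a             = inj₁ (ℚ.≰⇒> p≰t ∷ a)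
    ... | no  p≰t | inj₂ (q , q≤ , l′ , a) = inj₂ (q , q≤ , l′ , inj₂ (ℚ.≰⇒> p≰t) ∷ a)
    ... | yes p≤t | inj₁ a             = inj₂ (p , p≤t , l , inj₁ ℚ.≤-refl ∷ All.map inj₂ a)
    ... | yes p≤t | inj₂ (q , q≤ , l′ , a) with ℚ.≤-total p q
    ... | inj₁ p≤q = inj₂ (q , q≤ , l′ , inj₁ p≤q ∷ a)
    ... | inj₂ q≤p = inj₂ (p , p≤t , l , inj₁ ℚ.≤-refl ∷
            All.map (λ { (inj₁ r) → inj₁ (ℚ.≤-trans r q≤p) ; (inj₂ r) → inj₂ r }) a)

    earliest : ∀ t zs → All Marked zs →
      All (λ z → proj₂ z ≤ t) zs ⊎ ∃ λ p → t < p × loadI p F ≤ C × All (λ z → p ≤ proj₂ z ⊎ proj₂ z ≤ t) zs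
    earliest t []             _                = inj₁ []
    earliest t ((x , p) ∷ zs) (marked _ _ l ∷ ms) with p ℚ.≤? t | earliest t zs ms
    ... | yes p≤t | inj₁ a             = inj₁ (p≤t ∷ a)
    ... | yes p≤t | inj₂ (q , q≤ , l′ , a) = inj₂ (q , q≤ , l′ , inj₂ p≤t ∷ a)
    ... | no  p≰t | inj₁ a             = inj₂ (p , ℚ.≰⇒> p≰t , l , inj₁ ℚ.≤-refl ∷ All.map inj₂ a)
    ... | no  p≰t | inj₂ (q , q≤ , l′ , a) with ℚ.≤-total q p
    ... | inj₁ q≤p = inj₂ (q , q≤ , l′ , inj₁ q≤p ∷ a)
    ... | inj₂ p≤q = inj₂ (p , ℚ.≰⇒> p≰t , l , inj₁ ℚ.≤-refl ∷
            All.map (λ { (inj₁ r) → inj₁ (ℚ.≤-trans p≤q r) ; (inj₂ r) → inj₂ r }) a)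

    left right : ℚ → Item × ℚ → ℚ
    left  t z = if le (proj₂ z) t then sizeAtI t (proj₁ z) else 0ℚ
    right t z = if le (proj₂ z) t then 0ℚ else sizeAtI t (proj₁ z)

    left+right : ∀ t z → sizeAtI t (proj₁ z) ≡ left t z + right t z
    left+right t z with le (proj₂ z) t
    ... | true  = sym (ℚ.+-identityʳ _)
    ... | false = sym (ℚ.+-identityˡ _)

    vanish : ∀ {zs} (f : Item × ℚ → ℚ) → All (λ z → f z ≡ 0ℚ) zs → ∑ f zs ≤ C
    vanish {zs} f h = ℚ.≤-trans (ℚ.≤-reflexive (trans (∑-cong zs λ i → All.lookup h i) (∑-0 zs))) 0≤C

    below : ∀ zs → map proj₁ zs ≡ F → ∀ p (f : Item × ℚ → ℚ) → loadI p F ≤ C →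
      All (λ z → f z ≤ sizeAtI p (proj₁ z)) zs → ∑ f zs ≤ C
    below zs eq p f l f≤ = ℚ.≤-trans (∑-mono zs λ i → All.lookup f≤ i)
      (ℚ.≤-trans (ℚ.≤-reflexive (trans (sym (∑-map (sizeAtI p) proj₁ zs)) (cong (loadI p) eq))) l)

    left≤ : ∀ t zs → map proj₁ zs ≡ F → All Marked zs → ∑ (left t) zs ≤ C
    left≤ t zs eq ms with latest t zs ms
    ... | inj₁ late = vanish (left t) (All.map (λ {z} → none z) late)
      where
      none : ∀ z → t < proj₂ z → left t z ≡ 0ℚ
      none z t<p = cong (λ b → if b then sizeAtI t (proj₁ z) else 0ℚ) (false-le t<p)
    ... | inj₂ (q , q≤t , l , a) = below zs eq q (left t) l (All.zipWith (λ {z} (m , h) → dom z m h) (ms , a))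
      where
      dom : ∀ z → Marked z → proj₂ z ≤ q ⊎ t < proj₂ z → left t z ≤ sizeAtI q (proj₁ z)
      dom z m h with le (proj₂ z) t in pt
      dom z (marked v _ _) h                  | false = 0≤sizeAtI q v
      dom z _ (inj₂ t<p)                      | true  = absurd< t<p (le-true pt)
      dom z (marked v (s≤p , _) _) (inj₁ p≤q) | true  =
        sizeAtI-mono {t} {q} {proj₁ z} v λ (_ , t<e) → ℚ.≤-trans s≤p p≤q , ℚ.≤-<-trans q≤t t<e

    right≤ : ∀ t zs → map proj₁ zs ≡ F → All Marked zs → ∑ (right t) zs ≤ C
    right≤ t zs eq ms with earliest t zs ms
    ... | inj₁ early = vanish (right t) (All.map (λ {z} → none z) early)
      where
      none : ∀ z → proj₂ z ≤ t → right t z ≡ 0ℚ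
      none z p≤t = cong (λ b → if b then 0ℚ else sizeAtI t (proj₁ z)) (true-le p≤t)
    ... | inj₂ (q , t<q , l , a) = below zs eq q (right t) l (All.zipWith (λ {z} (m , h) → dom z m h) (ms , a))
      where
      dom : ∀ z → Marked z → q ≤ proj₂ z ⊎ proj₂ z ≤ t → right t z ≤ sizeAtI q (proj₁ z)
      dom z m h with le (proj₂ z) t in pt
      dom z (marked v _ _) h                  | true  = 0≤sizeAtI q v
      dom z _ (inj₂ p≤t)                      | false = absurd< (le-false pt) p≤t
      dom z (marked v (_ , p<e) _) (inj₁ q≤p) | false =
        sizeAtI-mono {t} {q} {proj₁ z} v λ (s≤t , _) → ℚ.≤-trans s≤t (ℚ.<⇒≤ t<q) , ℚ.≤-<-trans q≤p p<e

  load≤2C : All Valid F → All (Light C F) F → ∀ t → loadI t F ≤ C + C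
  load≤2C vs tight t = let (zs , eq , ms) = mark F vs tight in
    ℚ.≤-trans (ℚ.≤-reflexive (trans (cong (loadI t) (sym eq)) (trans (∑-map (sizeAtI t) proj₁ zs)
      (trans (∑-cong zs (λ {z} _ → left+right t z)) (∑-distrib-+ (left t) (right t) zs)))))
    (ℚ.+-mono-≤ (left≤ t zs eq ms) (right≤ t zs eq ms))

rate-++ : ∀ t ms ns → rate t (ms ++ ns) ≡ rate t ms + rate t ns
rate-++ t ms ns = ∑-++ _ ms ns

occI : ℚ → List Item → ℚ
occI t xs = occ t (map req xs)

active⇒any : ∀ {t xs} → ActiveIn t xs → Any (Active t) (map req xs)
active⇒any = Any.map⁺

occI-1 : ∀ {t xs} → ActiveIn t xs → occI t xs ≡ 1ℚ
occI-1 {t} {xs} a = occ-1 {t} {map req xs} (active⇒any a)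

occI-0 : ∀ {t xs} → ¬ ActiveIn t xs → occI t xs ≡ 0ℚ
occI-0 {t} {xs} ¬a = occ-0 {t} {map req xs} (λ a → ¬a (Any.map⁻ a))

rate≤length : ∀ t ms → rate t ms ≤ ι (length ms)
rate≤length t ms = ℚ.≤-trans (∑-mono ms (λ {m} _ → occ≤1 t (map req m))) (ℚ.≤-reflexive (∑-length ms))

rate-inactive : ∀ {t} ms → ¬ ActiveIn t (concat ms) → rate t ms ≡ 0ℚ
rate-inactive {t} []       ¬a = refl
rate-inactive {t} (m ∷ ms) ¬a = cong₂ _+_ (occI-0 {t} {m} (¬a ∘ Any.++⁺ˡ)) (rate-inactive ms (¬a ∘ Any.++⁺ʳ m))

active-↭ : ∀ {t xs ys} → xs ↭ ys → ActiveIn t xs → ActiveIn t ys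
active-↭ = ↭.Any-resp-↭

loadI-++ : ∀ t xs ys → loadI t (xs ++ ys) ≡ loadI t xs + loadI t ys
loadI-++ t xs ys = ∑-++ (sizeAtI t) xs ys

floorDiv : ∀ {x w} → 0ℚ ≤ x → 0ℚ < w → ∃ λ m → ι m * w ≤ x × x < ι (suc m) * w
floorDiv {x} {w} 0≤x 0<w = go (suc N) big
  where
  N = proj₁ (archimedean (x * ℚ.1/_ w {{ℚ.pos⇒nonZero w {{ℚ.positive 0<w}}}}))
  x≤ : x ≤ ι N * w
  x≤ = ℚ.≤-trans (ℚ.≤-reflexive (trans (sym (ℚ.*-identityʳ x)) (trans
      (cong (x *_) (sym (ℚ.*-inverseˡ w {{ℚ.pos⇒nonZero w {{ℚ.positive 0<w}}}}))) (sym (ℚ.*-assoc x _ w)))))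
    (ℚ.*-monoʳ-≤-nonNeg w {{ℚ.nonNegative (ℚ.<⇒≤ 0<w)}} (proj₂ (archimedean (x * ℚ.1/_ w {{ℚ.pos⇒nonZero w {{ℚ.positive 0<w}}}}))))
  big : x < ι (suc N) * w
  big = ℚ.≤-<-trans x≤ (ℚ.*-monoˡ-<-pos w {{ℚ.positive 0<w}} (ι-<-suc N))
  go : ∀ N → x < ι N * w → ∃ λ m → ι m * w ≤ x × x < ι (suc m) * w
  go zero    x< = absurd< x< (ℚ.≤-trans (ℚ.≤-reflexive (ι-zeroˡ w)) 0≤x)
  go (suc N) x< with ι N * w ℚ.≤? x
  ... | yes p = N , p , x<
  ... | no ¬p = go N (ℚ.≰⇒> ¬p)

-- Three roundings are kept apart: C bounds those loads of such items that are at most c, θ those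
-- above c - w from below, and φ the load of a machine that rejects an item. With equal sizes all
-- three equal the largest multiple of w up to 1, and r = 2. In general C = k/3, θ = (k-1)/3, φ =
-- 2/3 and r = k.
module Rounds (c w C θ φ : ℚ) (r : ℕ) (P : Item → Set)
  (P-valid : ∀ {x} → P x → Valid x) (P-sz : ∀ {x} → P x → sz x ≤ w)
  (w≤c : w ≤ c) (0≤C : 0ℚ ≤ C) (0<θ : 0ℚ < θ) (0<φ : 0ℚ < φ) (2C≤ : C + C ≤ ι r * φ)
  (c→C : ∀ {t m} → All P m → loadI t m ≤ c → loadI t m ≤ C)
  (c→θ : ∀ {t m} → All P m → c < loadI t m + w → θ ≤ loadI t m)
  (1→φ : ∀ {t m x} → All P m → P x → 1ℚ < loadI t m + sz x → φ ≤ loadI t m)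
  where

  open Prune c w

  Full : Item → List (List Item) → Set
  Full x ms = All (λ m → 1ℚ < loadI (st x) m + sz x) ms

  place-length : ∀ x ms → length (place x ms) ≡ length ms ⊎ (length (place x ms) ≡ suc (length ms) × Full x ms)
  place-length x []       = inj₂ (refl , [])
  place-length x (m ∷ ms) with le (load (st x) m + sz x) 1ℚ in eq
  ... | true  = inj₁ refl
  ... | false with place-length x ms
  ... | inj₁ l       = inj₁ (cong suc l)
  ... | inj₂ (l , f) = inj₂ (cong suc l , subst (λ y → 1ℚ < y + sz x) (load≡ (st x) m) (le-false eq) ∷ f)

  -- All items placed earlier start no later than x. While x is active the load of the others is
  -- therefore at most their load at `st x`, and testing that single time suffices.
  place-fits : ∀ x ms → Valid x → All (All (λ y → Valid y × st y ≤ st x)) ms → All Fits ms → All Fits (place x ms)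
  place-fits x [] v _ _ = (λ t → ℚ.≤-trans (ℚ.≤-reflexive (ℚ.+-identityʳ (sizeAtI t x))) (ℚ.≤-trans (sizeAtI≤ t v) (sz≤1 v))) ∷ []
  place-fits x (m ∷ ms) v (e ∷ es) (f ∷ fs) with le (load (st x) m + sz x) 1ℚ in eq
  ... | false = f ∷ place-fits x ms v es fs
  ... | true  = fit ∷ fs
    where
    fit : Fits (x ∷ m)
    fit t = go (active? t (req x))
      where
      go : Dec (ActiveI t x) → sizeAtI t x + loadI t m ≤ 1ℚ
      go (no ¬a) = ℚ.≤-trans (ℚ.≤-reflexive (trans (cong (_+ loadI t m) (sizeAt-inactive {t} {req x} ¬a)) (ℚ.+-identityˡ (loadI t m)))) (f t)
      go (yes (s≤t , _)) = ℚ.≤-trans (ℚ.≤-trans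
        (ℚ.+-monoˡ-≤ (loadI t m) (sizeAtI≤ t v))
        (ℚ.≤-trans (ℚ.≤-reflexive (ℚ.+-comm (sz x) (loadI t m)))
          (ℚ.+-monoˡ-≤ (sz x) (∑-mono m λ {y} i → let (vy , y≤x) = All.lookup e i in
            sizeAtI-mono {t} {st x} {y} vy λ (_ , t<e) → y≤x , ℚ.≤-<-trans s≤t t<e))))
        (subst (λ y → y + sz x ≤ 1ℚ) (load≡ (st x) m) (le-true eq))

  full-load : ∀ x ms → P x → All (All P) ms → Full x ms → ι (length ms) * φ ≤ loadI (st x) (concat ms)
  full-load x []       px _        _        = ℚ.≤-reflexive (ι-zeroˡ φ)
  full-load x (m ∷ ms) px (p ∷ ps) (f ∷ fs) = ℚ.≤-trans
    (ℚ.≤-reflexive (trans (cong (_* φ) (ι-suc (length ms))) (lem (ι (length ms)) φ)))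
    (ℚ.≤-trans (ℚ.+-mono-≤ (1→φ p px f) (full-load x ms px ps fs)) (ℚ.≤-reflexive (sym (loadI-++ (st x) m (concat ms)))))
    where
    lem : ∀ n f → (1ℚ + n) * f ≡ f + n * f
    lem = solve-∀ ℚ-ring

  All-concat⁻ : ∀ {Q : Item → Set} ms → All Q (concat ms) → All (All Q) ms
  All-concat⁻ = λ ms → All.concat⁻ {xss = ms}

  -- If r machines rejected x, they would carry at least r φ, hence at least 2 C, at the start of x.
  -- Together with the positive size of x this exceeds the load of F.
  firstFit-ok : ∀ F → All P F → SortedBy st F → (∀ t → loadI t F ≤ C + C) →
    All Fits (firstFit F) × length (firstFit F) ℕ.≤ r
  firstFit-ok F pF sorted load≤ = go F [] pF sorted (↭.↭-reflexive (List.++-identityʳ F)) [] [] [] z≤n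
    where
    go : ∀ G ms → All P G → SortedBy st G → G ++ concat ms ↭ F → All P (concat ms) →
      All (λ y → All (λ x → st y ≤ st x) G) (concat ms) → All Fits ms → length ms ℕ.≤ r →
      All Fits (iterate (λ x _ ms → place x ms) G ms) × length (iterate (λ x _ ms → place x ms) G ms) ℕ.≤ r
    go []      ms _ _ _ _ _ fits len = fits , len
    go (x ∷ G) ms (px ∷ pG) (x≤ ∷ sorted) perm pms early fits len = go G (place x ms) pG sorted
      (↭-trans (↭.++⁺ˡ G (place-↭ x ms)) (↭-trans (↭.shift x G (concat ms)) perm))
      (↭.All-resp-↭ (↭-sym (place-↭ x ms)) (px ∷ pms))
      (↭.All-resp-↭ (↭-sym (place-↭ x ms)) (x≤ ∷ All.map All.tail early))
      (place-fits x ms (P-valid px) (All-concat⁻ ms (All.zipWith (λ (p , e) → P-valid p , All.head e) (pms , early))) fits)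
      len′
      where
      len′ : length (place x ms) ℕ.≤ r
      len′ with place-length x ms
      ... | inj₁ eq = ℕ.≤-trans (ℕ.≤-reflexive eq) len
      ... | inj₂ (eq , full) = ℕ.≤-trans (ℕ.≤-reflexive eq) (fewer (ℚ.<-≤-trans lt 2C≤))
        where
        v : Valid x
        v = P-valid px
        lt : ι (length ms) * φ < C + C
        lt = ℚ.≤-<-trans (full-load x ms px (All-concat⁻ ms pms) full)
          (ℚ.<-≤-trans (lin< (subst (0ℚ <_) (sym (sizeAt-active {st x} {req x} (ℚ.≤-refl , st<en v))) (sz>0 v)) (ℚ.+-comm (sizeAtI (st x) x) (loadI (st x) (concat ms))))
          (ℚ.≤-trans (lin (0≤loadI (st x) {G} (All.map P-valid pG)) (trans (trans (sym (∑-↭ (sizeAtI (st x)) perm)) (loadI-++ (st x) (x ∷ G) (concat ms)))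
              (lem (sizeAtI (st x) x) (loadI (st x) G) (loadI (st x) (concat ms)))))
            (load≤ (st x))))
          where
          lem : ∀ a g m → (a + g) + m ≡ (a + m) + g
          lem = solve-∀ ℚ-ring
        fewer : ι (length ms) * φ < ι r * φ → length ms ℕ.< r
        fewer h with length ms ℕ.<? r
        ... | yes l = l
        ... | no ¬l = absurd< h (ℚ.*-monoʳ-≤-nonNeg φ {{ℚ.nonNegative (ℚ.<⇒≤ 0<φ)}} (ι-mono (ℕ.≮⇒≥ ¬l)))

  module Round (R : List Item) (pR : All P R) where

    F D : List Item
    F = proj₁ (prune c w R)
    D = proj₂ (prune c w R)

    F++D : F ++ D ↭ R
    F++D = ↭-trans (prune-↭ c w R [] []) (↭.↭-reflexive (List.++-identityʳ R))

    pFD : All P (F ++ D)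
    pFD = ↭.All-resp-↭ (↭-sym F++D) pR

    pF : All P F
    pF = All.++⁻ˡ F pFD

    pD : All P D
    pD = All.++⁻ʳ F pFD

    facts : Pruned F D
    facts = pruned R (All.map P-valid pR) (All.map P-sz pR)

    open Pruned facts

    F-load : ∀ t → loadI t F ≤ C + C
    F-load = load≤2C 0≤C F (All.map P-valid pF) (All.map (λ (light p a l) → light p a (c→C pF l)) tight)

    new : List (List Item)
    new = firstFit (sortBy st F)

    new↭ : concat new ↭ F
    new↭ = ↭-trans (firstFit-↭ (sortBy st F)) (sortBy-↭ st F)

    new-ok : All Fits new × length new ℕ.≤ r
    new-ok = firstFit-ok (sortBy st F) (↭.All-resp-↭ (↭-sym (sortBy-↭ st F)) pF) (sortBy-sorted st F)
      (λ t → ℚ.≤-trans (ℚ.≤-reflexive (∑-↭ (sizeAtI t) (sortBy-↭ st F))) (F-load t))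

    θ≤F : ∀ {t} → ActiveIn t D → θ ≤ loadI t F
    θ≤F a = c→θ pF (dense a)

    -- If nothing were kept, the first item would be deleted, and density at its start would read c
    -- < w, against w ≤ c.
    fewer : ∀ x R′ → R ≡ x ∷ R′ → length D ℕ.≤ length R′
    fewer x R′ refl = ℕ.≤-pred (ℕ.≤-trans (shrink F refl) (ℕ.≤-reflexive (↭.↭-length F++D)))
      where
      x∈ : x ∈ F ++ D
      x∈ = ↭.∈-resp-↭ (↭-sym F++D) (here refl)
      shrink : ∀ F′ → F ≡ F′ → suc (length D) ℕ.≤ length (F ++ D)
      shrink (y ∷ F′) eq = ℕ.≤-trans (s≤s (ℕ.m≤n+m (length D) (length F′)))
        (ℕ.≤-reflexive (sym (trans (List.length-++ F) (cong (λ z → length z ℕ.+ length D) eq))))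
      shrink [] eq = absurd< (subst (λ z → c < loadI (st x) z + w) eq (dense {st x} (lose x∈D (ℚ.≤-refl , st<en (P-valid (All.head pR))))))
        (ℚ.≤-trans (ℚ.≤-reflexive (ℚ.+-identityˡ w)) w≤c)
        where
        x∈D : x ∈ D
        x∈D = subst (λ z → x ∈ z ++ D) eq x∈

    -- The number n is a budget of rounds at time t. If some deleted item is active at t, the
    -- extracted set carries at least θ there and one unit of the budget pays its r machines. If
    -- only extracted items are active, this is the last round that matters at t; the load is
    -- positive, so n is at least 1 and the whole budget may be spent.
    rate-split : ∀ {t n} → loadI t R ≤ θ * ι n →
      ∃ λ n′ → loadI t D ≤ θ * ι n′ × rate t new + ι r * ι n′ ≤ ι r * ι n
    rate-split {t} {n} l with activeIn? t D
    rate-split {t} {zero} l | yes a = absurd< 0<θ (ℚ.≤-trans (θ≤F a)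
      (ℚ.≤-trans (lin (0≤loadI t (All.map P-valid pD)) (trans (sym (∑-↭ (sizeAtI t) F++D)) (loadI-++ t F D)))
        (ℚ.≤-trans l (ℚ.≤-reflexive (ι-zeroʳ θ)))))
    rate-split {t} {suc n} l | yes a = n ,
      lin (diff≥0 (θ≤F a) ⊞ diff≥0 l) (trans (lem θ (ι n) (loadI t F) (loadI t D))
        (cong₂ (λ x y → loadI t D + ((loadI t F - θ) + (θ * x - y))) (sym (ι-suc n)) (trans (sym (loadI-++ t F D)) (∑-↭ (sizeAtI t) F++D)))) ,
      ℚ.≤-trans (ℚ.+-monoˡ-≤ (ι r * ι n) (ℚ.≤-trans (rate≤length t new) (ι-mono (proj₂ new-ok))))
        (ℚ.≤-reflexive (trans (lem′ (ι r) (ι n)) (cong (ι r *_) (sym (ι-suc n)))))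
      where
      lem : ∀ h n f d → h * n ≡ d + ((f - h) + (h * (1ℚ + n) - (f + d)))
      lem = solve-∀ ℚ-ring
      lem′ : ∀ r n → r + r * n ≡ r * (1ℚ + n)
      lem′ = solve-∀ ℚ-ring
    rate-split {t} {n} l | no ¬a with activeIn? t F
    ... | no ¬f = n , ℚ.≤-trans (ℚ.≤-reflexive (inactive-load ¬a)) (ℚ.<⇒≤ 0<θ ⊠ 0≤ι n) ,
      ℚ.≤-reflexive (trans (cong (_+ ι r * ι n) (rate-inactive new (¬f ∘ active-↭ new↭))) (ℚ.+-identityˡ _))
    rate-split {t} {zero} l | no ¬a | yes f = absurd< (active-load {t} {R} (All.map P-valid pR) (active-↭ F++D (Any.++⁺ˡ f)))
      (ℚ.≤-trans l (ℚ.≤-reflexive (ι-zeroʳ θ)))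
    rate-split {t} {suc n} l | no ¬a | yes f = 0 ,
      ℚ.≤-reflexive (trans (inactive-load ¬a) (sym (ι-zeroʳ θ))) ,
      ℚ.≤-trans (ℚ.≤-reflexive (trans (cong (rate t new +_) (ι-zeroʳ (ι r))) (ℚ.+-identityʳ _)))
        (ℚ.≤-trans (rate≤length t new) (ℚ.≤-trans (ι-mono (proj₂ new-ok))
          (ℚ.≤-trans (ℚ.≤-reflexive (sym (ℚ.*-identityʳ (ι r)))) (*-monoʳ (ι r) (0≤ι r) (1≤ι n)))))

  rounds-ok : ∀ fuel R ms → All P R → length R ℕ.≤ length fuel → All Fits ms →
    let (R′ , ms′) = iterate (λ (_ : Item) _ s → roundStep c w s) fuel (R , ms) in
    R′ ≡ [] × All Fits ms′ × (∀ t n → loadI t R ≤ θ * ι n → rate t ms′ ≤ rate t ms + ι r * ι n)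
  rounds-ok [] [] ms pR len fits = refl , fits , λ t n _ → lin (0≤ι r ⊠ 0≤ι n) refl
  rounds-ok (_ ∷ fuel) R ms pR len fits with rounds-ok fuel D (new ++ ms) pD len′ (All.++⁺ (proj₁ new-ok) fits)
    where
    open Round R pR
    shorter′ : ∀ R′ → R ≡ R′ → length D ℕ.≤ length fuel
    shorter′ []       eq = ℕ.≤-trans (ℕ.≤-trans (ℕ.m≤n+m (length D) (length F))
      (ℕ.≤-reflexive (trans (sym (List.length-++ F)) (trans (↭.↭-length F++D) (cong length eq))))) z≤n
    shorter′ (x ∷ R′) eq = ℕ.≤-trans (fewer x R′ eq) (ℕ.≤-pred (subst (λ z → length z ℕ.≤ suc (length fuel)) eq len))
    len′ : length D ℕ.≤ length fuel
    len′ = shorter′ R refl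
  ... | eq , fits′ , rate≤ = eq , fits′ , λ t n l → let (n′ , l′ , h) = rate-split {t} {n} l in
    ℚ.≤-trans (rate≤ t n′ l′) (lin (diff≥0 h) (trans (lem (rate t ms) (rate t new) (ι r * ι n) (ι r * ι n′))
      (cong (λ z → (z + ι r * ι n′) + (ι r * ι n - (rate t new + ι r * ι n′))) (sym (rate-++ t new ms)))))
    where
    open Round R pR
    lem : ∀ a b c d → a + c ≡ ((b + a) + d) + (c - (b + d))
    lem = solve-∀ ℚ-ring

  module _ {R : List Item} (pR : All P R) where

    private
      result = rounds-ok R R [] pR ℕ.≤-refl []

    rounds-fits : All Fits (rounds c w R)
    rounds-fits = proj₁ (proj₂ result)

    rounds-rate : ∀ t n → loadI t R ≤ θ * ι n → rate t (rounds c w R) ≤ ι r * ι n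
    rounds-rate t n l = ℚ.≤-trans (proj₂ (proj₂ result) t n l) (ℚ.≤-reflexive (ℚ.+-identityˡ _))

    rounds-↭ : concat (rounds c w R) ↭ R
    rounds-↭ = ↭-trans (↭.↭-reflexive (trans (sym (List.++-identityʳ _)) (cong (concat (rounds c w R) ++_) (sym (proj₁ result)))))
      (go R R [])
      where
      go : ∀ (fuel : List Item) S ms → let (S′ , ms′) = iterate (λ _ _ s → roundStep c w s) fuel (S , ms) in
        concat ms′ ++ S′ ↭ concat ms ++ S
      go []         S ms = ↭-refl
      go (_ ∷ fuel) S ms = ↭-trans (go fuel (proj₁ (roundStep c w (S , ms))) (proj₂ (roundStep c w (S , ms)))) (roundStep-↭ c w S ms)

-- The second algorithm against an arbitrary packing.

sum-bins : ∀ {v} bs → All (λ b → sumℚ b ≤ v) bs → sumℚ (concat bs) ≤ v * ι (length bs)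
sum-bins {v} []       _        = ℚ.≤-reflexive (sym (ι-zeroʳ v))
sum-bins {v} (b ∷ bs) (f ∷ fs) = ℚ.≤-trans (ℚ.≤-reflexive (sum-++ b (concat bs)))
  (ℚ.≤-trans (ℚ.+-mono-≤ f (sum-bins bs fs))
    (ℚ.≤-reflexive (trans (lem v (ι (length bs))) (cong (v *_) (sym (ι-suc (length bs)))))))
  where
  lem : ∀ v n → v + v * n ≡ v * (1ℚ + n)
  lem = solve-∀ ℚ-ring
  sum-++ : ∀ xs ys → sumℚ (xs ++ ys) ≡ sumℚ xs + sumℚ ys
  sum-++ []       ys = sym (ℚ.+-identityˡ _)
  sum-++ (x ∷ xs) ys = trans (cong (x +_) (sum-++ xs ys)) (sym (ℚ.+-assoc x _ _))

load≤bins : ∀ t xs {q} → PackableIn (activeSizes t (map req xs)) q → loadI t xs ≤ q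
load≤bins t xs (bs , p , fits , refl) = ℚ.≤-trans (ℚ.≤-reflexive (trans (sym (loadAt≡ t xs)) (sumℚ-↭ p)))
  (ℚ.≤-trans (sum-bins bs fits) (ℚ.≤-reflexive (ℚ.*-identityˡ (ι (length bs)))))

occ≤bins : ∀ t xs {q} → All Valid xs → PackableIn (activeSizes t (map req xs)) q → occI t xs ≤ q
occ≤bins t xs {q} vs packs = go (activeIn? t xs) packs
  where
  go : Dec (ActiveIn t xs) → PackableIn (activeSizes t (map req xs)) q → occI t xs ≤ q
  go (no ¬a) (bs , _ , _ , refl) = ℚ.≤-trans (ℚ.≤-reflexive (occI-0 {t} {xs} ¬a)) (0≤ι (length bs))
  go (yes a) ([] , _ , _ , refl) = absurd< (active-load {t} {xs} vs a) (ℚ.≤-trans (load≤bins t xs packs′) (ℚ.≤-reflexive ι-0))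
    where packs′ = packs
  go (yes a) (b ∷ bs , _ , _ , refl) = ℚ.≤-trans (ℚ.≤-reflexive (occI-1 {t} {xs} a)) (1≤ι (length bs))

-- The number g is the integer part of 1/w. All loads are multiples of w, so the capacity 1 acts as
-- g w, both for the machines built here and for the bins of the packing compared with. No rounding
-- is lost and exactly the factor 2 from minimality remains.
module EqualSizes {w : ℚ} (0<w : 0ℚ < w) {g : ℕ} (g≤ : ι g * w ≤ 1ℚ) (<g : 1ℚ < ι (suc g) * w) where

  P : Item → Set
  P x = Valid x × sz x ≡ w

  count : ∀ ws → All (_≡ w) ws → ∃ λ n → sumℚ ws ≡ ι n * w
  count []       _           = 0 , sym (ι-zeroˡ w)
  count (v ∷ ws) (refl ∷ es) = let (n , eq) = count ws es in suc n ,
    trans (cong (w +_) eq) (trans (lem w (ι n)) (cong (_* w) (sym (ι-suc n))))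
    where
    lem : ∀ w n → w + n * w ≡ (1ℚ + n) * w
    lem = solve-∀ ℚ-ring

  activeSizes-equal : ∀ t {m} → All P m → All (_≡ w) (activeSizes t (map req m))
  activeSizes-equal t {m} ps = All.map⁺ (All.filter⁺ (active? t) (All.map⁺ (All.map proj₂ ps)))

  count-load : ∀ t {m} → All P m → ∃ λ n → loadI t m ≡ ι n * w
  count-load t {m} ps = let (n , eq) = count _ (activeSizes-equal t ps) in n , trans (sym (loadAt≡ t m)) eq

  few : ∀ n → ι n * w ≤ 1ℚ → ι n * w ≤ ι g * w
  few n h with n ℕ.≤? g
  ... | yes n≤g = ℚ.*-monoʳ-≤-nonNeg w {{ℚ.nonNegative (ℚ.<⇒≤ 0<w)}} (ι-mono n≤g)
  ... | no  n≰g = absurd< <g (ℚ.≤-trans (ℚ.*-monoʳ-≤-nonNeg w {{ℚ.nonNegative (ℚ.<⇒≤ 0<w)}} (ι-mono (ℕ.≰⇒> n≰g))) h)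

  many : ∀ n → 1ℚ < ι n * w + w → ι g * w ≤ ι n * w
  many n h with g ℕ.≤? n
  ... | yes g≤n = ℚ.*-monoʳ-≤-nonNeg w {{ℚ.nonNegative (ℚ.<⇒≤ 0<w)}} (ι-mono g≤n)
  ... | no  g≰n = absurd< h (ℚ.≤-trans (ℚ.≤-reflexive (trans (lem (ι n) w) (cong (_* w) (sym (ι-suc n)))))
      (ℚ.≤-trans (ℚ.*-monoʳ-≤-nonNeg w {{ℚ.nonNegative (ℚ.<⇒≤ 0<w)}} (ι-mono (ℕ.≰⇒> g≰n))) g≤))
    where
    lem : ∀ n w → n * w + w ≡ (1ℚ + n) * w
    lem = solve-∀ ℚ-ring

  module _ (w≤1 : w ≤ 1ℚ) where

    private
      gw = ι g * w

      0<g : 0ℚ < gw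
      0<g with 0ℚ ℚ.<? gw
      ... | yes p = p
      ... | no ¬p = absurd< <g (ℚ.≤-trans (ℚ.≤-reflexive (trans (cong (_* w) (ι-suc g)) (lem w (ι g))))
              (ℚ.≤-trans (ℚ.+-monoʳ-≤ w (ℚ.≮⇒≥ ¬p)) (ℚ.≤-trans (ℚ.≤-reflexive (ℚ.+-identityʳ w)) w≤1)))
        where
        lem : ∀ w g → (1ℚ + g) * w ≡ w + g * w
        lem = solve-∀ ℚ-ring

      capped : ∀ {t m} → All P m → loadI t m ≤ 1ℚ → loadI t m ≤ gw
      capped {t} ps h = let (n , eq) = count-load t ps in subst (_≤ gw) (sym eq) (few n (subst (_≤ 1ℚ) eq h))

      enough : ∀ {t m} → All P m → 1ℚ < loadI t m + w → gw ≤ loadI t m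
      enough {t} ps h with count-load t ps
      ... | n , eq = subst (gw ≤_) (sym eq) (many n (subst (λ y → 1ℚ < y + w) eq h))

      double : ∀ x → x + x ≡ (1ℚ + 1ℚ) * x
      double = solve-∀ ℚ-ring

    open Rounds 1ℚ w gw gw gw 2 P proj₁ (ℚ.≤-reflexive ∘ proj₂) w≤1 (ℚ.<⇒≤ 0<g) 0<g 0<g
      (ℚ.≤-reflexive (trans (double gw) (cong (_* gw) (sym (ι≡fromℕ 2)))))
      capped
      enough (λ {t} {m} ps (_ , eq) h → enough ps (subst (λ z → 1ℚ < loadI t m + z) eq h)) public

    equal-rate : ∀ {t xs q} → All P xs → PackableIn (activeSizes t (map req xs)) q →
      rate t (rounds 1ℚ w xs) ≤ fromℕ 2 * q
    equal-rate {t} {xs} ps (bs , p , fits , refl) = subst (λ z → rate t (rounds 1ℚ w xs) ≤ z * ι (length bs)) (ι≡fromℕ 2) $ rounds-rate ps t (length bs)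
      (ℚ.≤-trans (ℚ.≤-reflexive (trans (sym (loadAt≡ t xs)) (sumℚ-↭ p))) (sum-bins bs (bins≤ bs fits sizes)))
      where
      sizes : All (_≡ w) (concat bs)
      sizes = ↭.All-resp-↭ p (activeSizes-equal t ps)
      bins≤ : ∀ bs → All (λ b → sumℚ b ≤ 1ℚ) bs → All (_≡ w) (concat bs) → All (λ b → sumℚ b ≤ gw) bs
      bins≤ []       _        _  = []
      bins≤ (b ∷ bs) (f ∷ fs) es = let (n , eq) = count b (All.++⁻ˡ b es) in
        subst (_≤ gw) (sym eq) (few n (subst (_≤ 1ℚ) eq f)) ∷ bins≤ bs fs (All.++⁻ʳ b es)

module General (k : ℕ) (2≤k : 2 ℕ.≤ k) where

  private
    K = ι k
    h = third
    3h : h + h + h ≡ 1ℚ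
    3h = refl
    0<h : 0ℚ < h
    0<h = ℚ.positive⁻¹ h
    2≤K : fromℕ 2 ≤ K
    2≤K = subst (_≤ K) (ι≡fromℕ 2) (ι-mono 2≤k)
    0≤K : 0ℚ ≤ K
    0≤K = 0≤ι k
    1≤K : 1ℚ ≤ K
    1≤K = ℚ.≤-trans (from-yes (1ℚ ℚ.≤? fromℕ 2)) 2≤K

  -- The load guaranteed while a further round is active.
  θ : ℚ
  θ = (K - 1ℚ) * h

  0<θ : 0ℚ < θ
  0<θ = ℚ.<-≤-trans 0<1 (lin (diff≥0 2≤K) (lem K)) ⊠< 0<h
    where
    lem : ∀ k → k - 1ℚ ≡ 1ℚ + (k - (1ℚ + 1ℚ))
    lem = solve-∀ ℚ-ring

  private
    P : Item → Set
    P x = Valid x × sz x ≤ h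

    lem₁ : ∀ k h → k * h ≡ h + (k - 1ℚ) * h
    lem₁ = solve-∀ ℚ-ring
    lem₂ : ∀ k h l → l ≡ (k - 1ℚ) * h + (l + h - k * h)
    lem₂ = solve-∀ ℚ-ring
    lem₃ : ∀ h l s → l ≡ (h + h) + ((l + s - (h + h + h)) + (h - s))
    lem₃ = solve-∀ ℚ-ring

    -- An item of size at most 1/3 is rejected only by a machine with load above 2/3, and twice the
    -- threshold k/3 is k times 2/3: hence k machines per round.
    open Rounds (K * h) h (K * h) θ (h + h) k P proj₁ proj₂
      (lin (diff≥0 1≤K ⊠ ℚ.<⇒≤ 0<h) (lem₁ K h))
      (0≤K ⊠ ℚ.<⇒≤ 0<h) 0<θ (ℚ.<⇒≤ 0<h ⊞< 0<h)
      (ℚ.≤-reflexive (sym (ℚ.*-distribˡ-+ K h h)))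
      (λ _ l → l)
      (λ {t} {m} _ l → lin (diff≥0 (ℚ.<⇒≤ l)) (lem₂ K h (loadI t m)))
      (λ {t} {m} {x} _ (_ , s) l → lin (diff≥0 (ℚ.<⇒≤ l) ⊞ diff≥0 s) (trans (lem₃ h (loadI t m) (sz x))
        (cong (λ z → (h + h) + ((loadI t m + sz x - z) + (h - sz x))) 3h)))

    small-P : ∀ xs → All Valid xs → All P (atMostThird xs)
    small-P []       _        = []
    small-P (x ∷ xs) (v ∷ vs) with le (sz x) third in eq
    ... | true  = (v , le-true eq) ∷ small-P xs vs
    ... | false = small-P xs vs

    singles-fits : ∀ xs → All Valid xs → All Fits (singles xs)
    singles-fits []       _        = []
    singles-fits (x ∷ xs) (v ∷ vs) with le (sz x) third
    ... | true  = singles-fits xs vs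
    ... | false = (λ t → ℚ.≤-trans (ℚ.≤-reflexive (ℚ.+-identityʳ (sizeAtI t x))) (ℚ.≤-trans (sizeAtI≤ t v) (sz≤1 v))) ∷ singles-fits xs vs

    -- A large item pays for its own machine: K times its size exceeds K/3, which is more than θ =
    -- (K-1)/3. The small items pass through with their load unchanged, to be spent on the rounds.
    singles-rate : ∀ t xs → All Valid xs → θ * rate t (singles xs) + K * loadI t (atMostThird xs) ≤ K * loadI t xs
    singles-rate t []       _        = ℚ.≤-reflexive (trans (cong (_+ K * 0ℚ) (ℚ.*-zeroʳ θ)) (ℚ.+-identityˡ (K * 0ℚ)))
    singles-rate t (x ∷ xs) (v ∷ vs) with le (sz x) third in eq
    ... | true  = lin (diff≥0 (singles-rate t xs vs)) (lem θ K (sizeAtI t x) (rate t (singles xs)) (loadI t (atMostThird xs)) (loadI t xs))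
      where
      lem : ∀ h k s r l m → k * (s + m) ≡ (h * r + k * (s + l)) + (k * m - (h * r + k * l))
      lem = solve-∀ ℚ-ring
    ... | false = lin (diff≥0 one ⊞ diff≥0 (singles-rate t xs vs))
      (lem θ K (occ t [ req x ]) (sizeAtI t x) (rate t (singles xs)) (loadI t (atMostThird xs)) (loadI t xs))
      where
      lem : ∀ h k o s r l m → k * (s + m) ≡ (h * (o + r) + k * l) + ((k * s - h * o) + (k * m - (h * r + k * l)))
      lem = solve-∀ ℚ-ring
      one : θ * occ t [ req x ] ≤ K * sizeAtI t x
      one with activeIn? t [ x ]
      ... | no ¬a = ℚ.≤-trans (ℚ.≤-reflexive (trans (cong (θ *_) (occI-0 {t} {[ x ]} ¬a)) (ℚ.*-zeroʳ θ))) (0≤K ⊠ 0≤sizeAtI t v)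
      ... | yes (here a) = ℚ.≤-trans (ℚ.≤-reflexive (trans (cong (θ *_) (occI-1 {t} {[ x ]} (here a))) (ℚ.*-identityʳ θ)))
        (subst (λ z → θ ≤ K * z) (sym (sizeAt-active {t} {req x} a))
          (lin (0≤K ⊠ diff≥0 (ℚ.<⇒≤ (le-false eq)) ⊞ ℚ.<⇒≤ 0<h) (lem′ K h (sz x))))
        where
        lem′ : ∀ k h s → k * s ≡ (k - 1ℚ) * h + (k * (s - h) + h)
        lem′ = solve-∀ ℚ-ring

    rounds-bound : ∀ t xs → All P xs → θ * rate t (rounds (K * h) h xs) ≤ K * loadI t xs + K * θ
    rounds-bound t xs ps = go (floorDiv (0≤loadI t (All.map proj₁ ps)) 0<θ)
      where
      l = loadI t xs
      lem : ∀ k l h m → k * l + k * h ≡ h * (k * (1ℚ + m)) + k * (l - m * h)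
      lem = solve-∀ ℚ-ring
      go : (∃ λ m → ι m * θ ≤ l × l < ι (suc m) * θ) → θ * rate t (rounds (K * h) h xs) ≤ K * l + K * θ
      go (m , m≤ , <m) = ℚ.≤-trans
        (*-monoʳ θ (ℚ.<⇒≤ 0<θ) (rounds-rate ps t (suc m) (ℚ.≤-trans (ℚ.<⇒≤ <m) (ℚ.≤-reflexive (ℚ.*-comm (ι (suc m)) θ)))))
        (lin (0≤K ⊠ diff≥0 m≤) (trans (lem K l θ (ι m)) (cong (λ z → θ * (K * z) + K * (l - ι m * θ)) (sym (ι-suc m)))))

  general-↭ : ∀ xs → All Valid xs → concat (packGeneral k xs) ↭ xs
  general-↭ xs vs = ↭-trans (↭.↭-reflexive (sym (List.concat-++ (singles xs) _)))
    (↭-trans (↭.++⁺ˡ (concat (singles xs)) (rounds-↭ (small-P xs vs))) (singles-↭ xs))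

  general-fits : ∀ xs → All Valid xs → All Fits (packGeneral k xs)
  general-fits xs vs = All.++⁺ (singles-fits xs vs) (rounds-fits (small-P xs vs))

  -- Division by θ is avoided by multiplying through; the ratio is K/θ = 3k/(k-1). The additive K
  -- comes from rounding load/θ up to a number of rounds, and it is paid only at times when some
  -- item is active.
  general-rate : ∀ t xs → All Valid xs → θ * rate t (packGeneral k xs) ≤ K * loadI t xs + (K * θ) * occI t xs
  general-rate t xs vs = go (activeIn? t xs)
    where
    rs = rounds (K * h) h (atMostThird xs)
    big = θ * rate t (singles xs)
    small-load = K * loadI t (atMostThird xs)
    lem : ∀ b r m l k → m + k ≡ (b + r) + ((m - (b + l)) + (l + k - r))
    lem = solve-∀ ℚ-ring
    total : θ * rate t (packGeneral k xs) ≤ K * loadI t xs + K * θ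
    total = lin (diff≥0 (singles-rate t xs vs) ⊞ diff≥0 (rounds-bound t (atMostThird xs) (small-P xs vs)))
      (trans (lem big (θ * rate t rs) (K * loadI t xs) small-load (K * θ))
        (cong (_+ ((K * loadI t xs - (big + small-load)) + (small-load + K * θ - θ * rate t rs)))
          (trans (sym (ℚ.*-distribˡ-+ θ (rate t (singles xs)) (rate t rs))) (cong (θ *_) (sym (rate-++ t (singles xs) rs))))))
    go : Dec (ActiveIn t xs) → θ * rate t (packGeneral k xs) ≤ K * loadI t xs + (K * θ) * occI t xs
    go (yes a) = ℚ.≤-trans total (ℚ.≤-reflexive (cong (K * loadI t xs +_)
      (trans (sym (ℚ.*-identityʳ (K * θ))) (cong ((K * θ) *_) (sym (occI-1 {t} {xs} a))))))
    go (no ¬a) = ℚ.≤-trans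
      (ℚ.≤-reflexive (trans (cong (θ *_) (rate-inactive (packGeneral k xs) (¬a ∘ active-↭ (general-↭ xs vs)))) (ℚ.*-zeroʳ θ)))
      (0≤K ⊠ 0≤loadI t vs ⊞ 0≤K ⊠ ℚ.<⇒≤ 0<θ ⊠ 0≤occ t (map req xs))

headSize-positive : ∀ xs → All Valid xs → xs ≡ [] ⊎ (0ℚ < headSize xs × headSize xs ≤ 1ℚ)
headSize-positive []       _       = inj₁ refl
headSize-positive (x ∷ xs) (v ∷ _) = inj₂ (sz>0 v , sz≤1 v)

allEqual-true : ∀ w xs → allEqual w xs ≡ true → All (λ x → sz x ≡ w) xs
allEqual-true w []       _  = []
allEqual-true w (x ∷ xs) eq with le (sz x) w in p | le w (sz x) in q
... | true | true = ℚ.≤-antisym (le-true p) (le-true q) ∷ allEqual-true w xs eq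

true-allEqual : ∀ w xs → All (λ x → sz x ≡ w) xs → allEqual w xs ≡ true
true-allEqual w []       _          = refl
true-allEqual w (x ∷ xs) (refl ∷ h) rewrite true-le (ℚ.≤-refl {w}) = true-allEqual w xs h

record Packing (xs : List Item) (ms : List (List Item)) : Set where
  field
    all-packed : concat ms ↭ xs
    all-fit    : All Fits ms

open Packing

equal-packing : ∀ xs → All Valid xs → All (λ x → sz x ≡ headSize xs) xs →
  Packing xs (rounds 1ℚ (headSize xs) xs) ×
  (∀ {t q} → PackableIn (activeSizes t (map req xs)) q → rate t (rounds 1ℚ (headSize xs) xs) ≤ fromℕ 2 * q)
equal-packing xs vs eqs with headSize-positive xs vs
... | inj₁ refl = record { all-packed = ↭-refl ; all-fit = [] } ,
  λ { (bs , _ , _ , refl) → ℚ.nonNegative⁻¹ (fromℕ 2) ⊠ 0≤ι (length bs) }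
... | inj₂ (0<w , w≤1) with floorDiv 0≤1 0<w
... | g , g≤ , <g = record { all-packed = rounds-↭ w≤1 ps ; all-fit = rounds-fits w≤1 ps } , λ {t} {q} packs → equal-rate w≤1 ps packs
  where
  open EqualSizes 0<w {g} g≤ <g
  ps : All P xs
  ps = All.zip (vs , eqs)

module _ {k : ℕ} (3≤k : 3 ℕ.≤ k) where

  private
    2≤k : 2 ℕ.≤ k
    2≤k = ℕ.≤-trans (ℕ.n≤1+n 2) 3≤k

  open General k 2≤k

  algorithm₂-packing : ∀ xs → All Valid xs → Packing xs (algorithm₂ k xs)
  algorithm₂-packing xs vs = go (allEqual (headSize xs) xs) refl
    where
    go : ∀ b → allEqual (headSize xs) xs ≡ b → Packing xs (if b then rounds 1ℚ (headSize xs) xs else packGeneral k xs)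
    go true  eq = proj₁ (equal-packing xs vs (allEqual-true _ xs eq))
    go false eq = record { all-packed = general-↭ xs vs ; all-fit = general-fits xs vs }

  algorithm₂-uniform : ∀ {xs t q} → All Valid xs → All (λ x → sz x ≡ headSize xs) xs →
    PackableIn (activeSizes t (map req xs)) q → rate t (algorithm₂ k xs) ≤ fromℕ 2 * q
  algorithm₂-uniform {xs} {t} {q} vs eqs packs =
    subst (λ b → rate t (if b then rounds 1ℚ (headSize xs) xs else packGeneral k xs) ≤ fromℕ 2 * q)
      (sym (true-allEqual (headSize xs) xs eqs)) (proj₂ (equal-packing xs vs eqs) packs)

-- In the general branch the ratio 3k/(k-1) is at most 3(k-1)/(k-2), since k(k-2) is at most the
-- square of k-1, and 3 is at most 2ρ. If all sizes happen to be equal, the ratio 2 is already below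
-- 2ρ.
algorithm₂-rate : ∀ {k xs t q ρ} → 3 ℕ.≤ k → All Valid xs → fromℕ 3 ≤ fromℕ 2 * ρ →
  PackableIn (activeSizes t (map req xs)) q →
  rate t (algorithm₂ k xs) ≤ (fromℕ 2 * ρ * (1ℚ + recip (k ℕ.∸ 2))) * q + ι k * occI t xs
algorithm₂-rate {k@(suc (suc (suc j)))} {xs} {t} {q} {ρ} (s≤s (s≤s (s≤s z≤n))) vs 3≤2ρ packs =
  cases (allEqual (headSize xs) xs) refl
  where
  open General k (s≤s (s≤s z≤n))
  K = ι k
  R = recip (suc j)
  β = fromℕ 2 * ρ * (1ℚ + R)
  0≤R : 0ℚ ≤ R
  0≤R = ℚ.<⇒≤ (0<recip j)
  0≤q : 0ℚ ≤ q
  0≤q = ℚ.≤-trans (0≤loadI t vs) (load≤bins t xs packs)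
  N = ι (suc j)
  K≡ : K ≡ fromℕ 2 + N
  K≡ = trans (ι-+ 2 (suc j)) (cong (_+ N) (ι≡fromℕ 2))
  -- This is the excess of 2ρ over 3 with its cofactors. Without it θ β equals (N + 1)(1 + R) with N
  -- = k - 2, and N R = 1 turns this into K + R.
  slack : ℚ
  slack = (fromℕ 2 * ρ - fromℕ 3) * third * (N + 1ℚ) * (1ℚ + R)
  K≤θβ : K ≤ θ * β
  K≤θβ = lin {K} {θ * β} {slack + R}
    (diff≥0 3≤2ρ ⊠ ℚ.<⇒≤ (ℚ.positive⁻¹ third) ⊠ (0≤ι (suc j) ⊞ 0≤1) ⊠ (0≤1 ⊞ 0≤R) ⊞ 0≤R)
    (trans (cong (λ z → (z - 1ℚ) * third * β) K≡)
    (trans (lem₁ N R ρ third)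
    (trans (cong (slack +_) (trans (ℚ.*-identityˡ ((N + 1ℚ) * (1ℚ + R))) (lem₂ N R)))
    (trans (cong (λ z → slack + ((N + 1ℚ) + z + R)) (recip-inverse j))
    (trans (lem₃ slack N R) (cong (_+ (slack + R)) (sym K≡)))))))
    where
    lem₁ : ∀ n r p h → (((1ℚ + 1ℚ) + n) - 1ℚ) * h * ((1ℚ + 1ℚ) * p * (1ℚ + r)) ≡
      ((1ℚ + 1ℚ) * p - (1ℚ + 1ℚ + 1ℚ)) * h * (n + 1ℚ) * (1ℚ + r) + (h + h + h) * ((n + 1ℚ) * (1ℚ + r))
    lem₁ = solve-∀ ℚ-ring
    lem₂ : ∀ n r → (n + 1ℚ) * (1ℚ + r) ≡ (n + 1ℚ) + n * r + r
    lem₂ = solve-∀ ℚ-ring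
    lem₃ : ∀ s n r → s + ((n + 1ℚ) + 1ℚ + r) ≡ ((1ℚ + 1ℚ) + n) + (s + r)
    lem₃ = solve-∀ ℚ-ring
  cases : ∀ b → allEqual (headSize xs) xs ≡ b →
    rate t (if b then rounds 1ℚ (headSize xs) xs else packGeneral k xs) ≤ β * q + K * occI t xs
  cases true eq = ℚ.≤-trans (proj₂ (equal-packing xs vs (allEqual-true _ xs eq)) packs)
    (lin (((diff≥0 3≤2ρ ⊞ 0≤1) ⊞ (ℚ.≤-trans (ℚ.nonNegative⁻¹ (fromℕ 3)) 3≤2ρ ⊠ 0≤R)) ⊠ 0≤q ⊞ 0≤ι k ⊠ 0≤occ t (map req xs)) (lem q ρ R K (occI t xs)))
    where
    lem : ∀ q p r k o → (1ℚ + 1ℚ) * p * (1ℚ + r) * q + k * o ≡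
      (1ℚ + 1ℚ) * q + ((((1ℚ + 1ℚ) * p - (1ℚ + 1ℚ + 1ℚ)) + 1ℚ + (1ℚ + 1ℚ) * p * r) * q + k * o)
    lem = solve-∀ ℚ-ring
  cases false eq = *-cancel-≤ θ 0<θ (ℚ.≤-trans (general-rate t xs vs)
    (lin (0≤ι k ⊠ diff≥0 (load≤bins t xs packs) ⊞ diff≥0 K≤θβ ⊠ 0≤q) (lem θ β q K (loadI t xs) (occI t xs))))
    where
    lem : ∀ h b q k l o → h * (b * q + k * o) ≡ (k * l + k * h * o) + (k * (q - l) + (h * b - k) * q)
    lem = solve-∀ ℚ-ring

-- The first algorithm: a single batch.

byEnd : List Item → List Item
byEnd = sortBy (λ x → (- 1ℚ) * en x)

totalSize : List Item → ℚ
totalSize = ∑ sz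

loadI≤totalSize : ∀ t {xs} → All Valid xs → loadI t xs ≤ totalSize xs
loadI≤totalSize t {xs} vs = ∑-mono xs (λ i → sizeAtI≤ t (All.lookup vs i))

NFState : Set
NFState = ℚ × List Item × List (List Item)

runNF : List Item → NFState → NFState
runNF b s = iterate (λ x _ s → nextFitStep x s) b s

machinesNF : NFState → List (List Item)
machinesNF s = proj₁ (proj₂ s) ∷ proj₂ (proj₂ s)

nextFitFrom-yes : ∀ l w ws → l + w ≤ 1ℚ → nextFitFrom l (w ∷ ws) ≡ nextFitFrom (l + w) ws
nextFitFrom-yes l w ws p with l + w ℚ.≤? 1ℚ
... | yes _ = refl
... | no ¬p = contradiction p ¬p

nextFitFrom-no : ∀ l w ws → 1ℚ < l + w → nextFitFrom l (w ∷ ws) ≡ suc (nextFitFrom w ws)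
nextFitFrom-no l w ws p with l + w ℚ.≤? 1ℚ
... | yes q = absurd< p q
... | no _  = refl

runNF-length : ∀ b l cur ms → length (proj₂ (proj₂ (runNF b (l , cur , ms)))) ≡ length ms ℕ.+ nextFitFrom l (map sz b)
runNF-length []      l cur ms = sym (ℕ.+-identityʳ (length ms))
runNF-length (x ∷ b) l cur ms with le (l + sz x) 1ℚ in eq
... | true  = trans (runNF-length b (l + sz x) (x ∷ cur) ms) (cong (length ms ℕ.+_) (sym (nextFitFrom-yes l (sz x) (map sz b) (le-true eq))))
... | false = trans (runNF-length b (sz x) [ x ] (cur ∷ ms))
  (trans (sym (ℕ.+-suc (length ms) _)) (cong (length ms ℕ.+_) (sym (nextFitFrom-no l (sz x) (map sz b) (le-false eq)))))

runNF-fits : ∀ b l cur ms → All Valid b → totalSize cur ≡ l → l ≤ 1ℚ → All (λ m → totalSize m ≤ 1ℚ) ms →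
  All (λ m → totalSize m ≤ 1ℚ) (machinesNF (runNF b (l , cur , ms)))
runNF-fits []      l cur ms _        eq l≤1 fits = subst (_≤ 1ℚ) (sym eq) l≤1 ∷ fits
runNF-fits (x ∷ b) l cur ms (v ∷ vs) eq l≤1 fits with le (l + sz x) 1ℚ in e
... | true  = runNF-fits b (l + sz x) (x ∷ cur) ms vs (trans (cong (sz x +_) eq) (ℚ.+-comm (sz x) l)) (le-true e) fits
... | false = runNF-fits b (sz x) [ x ] (cur ∷ ms) vs (ℚ.+-identityʳ (sz x)) (sz≤1 v) (subst (_≤ 1ℚ) (sym eq) l≤1 ∷ fits)

nextFitPack-fits : ∀ b → All Valid b → All Fits (nextFitPack b)
nextFitPack-fits b vs = All.zipWith (λ {m} (s , vm) t → ℚ.≤-trans (loadI≤totalSize t {m} vm) s)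
  (runNF-fits b 0ℚ [] [] vs refl 0≤1 [] , All.concat⁻ (↭.All-resp-↭ (↭-sym (nextFitPack-↭ b)) vs))

-- A closed bin and the item that overflows it exceed 1 together. Every item is counted at most
-- twice in these sums, once in its own bin and once as the overflowing item. The last two
-- alternatives keep the induction free of sign conditions; `closed≤2size` excludes them.
nextFitFrom≤ : ∀ ws l → ι (nextFitFrom l ws) ≤ l + (sumℚ ws + sumℚ ws) ⊎ l < 0ℚ ⊎ Any (_< 0ℚ) ws
nextFitFrom≤ [] l with 0ℚ ℚ.≤? l
... | yes 0≤l = inj₁ (ℚ.≤-trans (ℚ.≤-reflexive ι-0) (ℚ.≤-trans 0≤l (ℚ.≤-reflexive (sym (ℚ.+-identityʳ l)))))
... | no  l<0 = inj₂ (inj₁ (ℚ.≰⇒> l<0))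
nextFitFrom≤ (w ∷ ws) l with 0ℚ ℚ.≤? w
... | no  w<0 = inj₂ (inj₂ (here (ℚ.≰⇒> w<0)))
... | yes 0≤w with l + w ℚ.≤? 1ℚ
... | yes fit with nextFitFrom≤ ws (l + w)
... | inj₁ h = inj₁ (ℚ.≤-trans h (lin 0≤w (lem l w (sumℚ ws))))
  where
  lem : ∀ l w s → l + ((w + s) + (w + s)) ≡ ((l + w) + (s + s)) + w
  lem = solve-∀ ℚ-ring
... | inj₂ (inj₁ neg) = inj₂ (inj₁ (ℚ.≤-<-trans (lin 0≤w refl) neg))
... | inj₂ (inj₂ neg) = inj₂ (inj₂ (there neg))
nextFitFrom≤ (w ∷ ws) l | yes 0≤w | no full with nextFitFrom≤ ws w
... | inj₂ (inj₁ neg) = absurd< neg 0≤w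
... | inj₂ (inj₂ neg) = inj₂ (inj₂ (there neg))
... | inj₁ h = inj₁ (ℚ.≤-trans (ℚ.≤-reflexive (ι-suc (nextFitFrom w ws)))
    (lin (diff≥0 h ⊞ diff≥0 (ℚ.<⇒≤ (ℚ.≰⇒> full))) (lem l w (sumℚ ws) (ι (nextFitFrom w ws)))))
  where
  lem : ∀ l w s n → l + ((w + s) + (w + s)) ≡ (1ℚ + n) + (((w + (s + s)) - n) + ((l + w) - 1ℚ))
  lem = solve-∀ ℚ-ring

closed≤2size : ∀ {b} → All Valid b → ι (closed (map sz b)) ≤ totalSize b + totalSize b
closed≤2size {b} vs with nextFitFrom≤ (map sz b) 0ℚ
... | inj₁ h = ℚ.≤-trans h (ℚ.≤-reflexive (trans (ℚ.+-identityˡ _) (cong (λ s → s + s) (sumℚ-∑ sz b))))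
... | inj₂ (inj₁ neg) = absurd< neg ℚ.≤-refl
... | inj₂ (inj₂ neg) = let (x , i , neg′) = find (Any.map⁻ neg) in absurd< neg′ (ℚ.<⇒≤ (sz>0 (All.lookup vs i)))

machines≤ : ∀ t {b} → All Valid b → rate t (nextFitPack b) ≤ 1ℚ + (totalSize b + totalSize b)
machines≤ t {b} vs = ℚ.≤-trans (rate≤length t (nextFitPack b))
  (ℚ.≤-trans (ℚ.≤-reflexive (trans (cong (λ n → ι (suc n)) (runNF-length b 0ℚ [] [])) (ι-suc (closed (map sz b)))))
    (ℚ.+-monoʳ-≤ 1ℚ (closed≤2size vs)))

-- New machines opened for inactive items are not active at t, and closing the current machine only
-- moves its contribution to the finished ones.
runNF-inactive : ∀ t Q l cur ms → ¬ ActiveIn t Q →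
  rate t (machinesNF (runNF Q (l , cur , ms))) ≤ occI t cur + rate t ms
runNF-inactive t []      l cur ms _  = ℚ.≤-refl
runNF-inactive t (x ∷ Q) l cur ms ¬a with le (l + sz x) 1ℚ
... | true  = ℚ.≤-trans (runNF-inactive t Q (l + sz x) (x ∷ cur) ms (¬a ∘ there))
  (ℚ.+-monoˡ-≤ (rate t ms) (occ-mono {t} {t} (map req (x ∷ cur)) {map req cur} λ { (here refl) a → ⊥-elim (¬a (here a)) ; (there i) a → lose i a }))
... | false = ℚ.≤-trans (runNF-inactive t Q (sz x) [ x ] (cur ∷ ms) (¬a ∘ there))
  (ℚ.≤-reflexive (trans (cong (_+ rate t (cur ∷ ms)) (occI-0 {t} {[ x ]} λ { (here a) → ¬a (here a) })) (ℚ.+-identityˡ (rate t (cur ∷ ms)))))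

-- By decreasing end, the items still active at t come first.
active-prefix : ∀ t b → SortedBy (λ x → (- 1ℚ) * en x) b → All (λ x → st x ≤ t) b →
  ∃ λ P → ∃ λ Q → b ≡ P ++ Q × ¬ ActiveIn t Q × activeSizes t (map req b) ≡ map sz P
active-prefix t []      _            _            = [] , [] , refl , (λ ()) , refl
active-prefix t (x ∷ b) (x≤ ∷ sorted) (s≤t ∷ ss) with t ℚ.<? en x
... | yes t<e = let (P , Q , eq , ¬a , sizes) = active-prefix t b sorted ss in
  x ∷ P , Q , cong (x ∷_) eq , ¬a , trans (cong (map size) (List.filter-accept (active? t) {req x} (s≤t , t<e))) (cong (sz x ∷_) sizes)
... | no t≮e = [] , x ∷ b , refl , over , cong (map size) (List.filter-none (active? t) (All.map⁺ (All.tabulate λ {y} i a → over (lose i a))))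
  where
  e≤t : en x ≤ t
  e≤t = ℚ.≮⇒≥ t≮e
  lem : ∀ a b → a - b ≡ (- 1ℚ) * b - (- 1ℚ) * a
  lem = solve-∀ ℚ-ring
  over : ¬ ActiveIn t (x ∷ b)
  over (here (_ , t<e)) = t≮e t<e
  over (there a) = let (y , i , (_ , t<e)) = find a in absurd< t<e
    (ℚ.≤-trans (lin (diff≥0 (All.lookup x≤ i)) (trans (lem₂ (en x) (en y)) (cong (en y +_) (lem (en x) (en y))))) e≤t)
    where
    lem₂ : ∀ a b → a ≡ b + (a - b)
    lem₂ = solve-∀ ℚ-ring

activeClosed : ℚ → List Item → ℚ
activeClosed t b = ι (closed (activeSizes t (map req b)))

-- Once all items have started, the active ones are a prefix P, and Next-Fit on P does not see the
-- rest. Its closed machines are the closed bins of the active sizes; the one still open after P is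
-- paid by `occI`.
rate-started : ∀ t b → SortedBy (λ x → (- 1ℚ) * en x) b → All (λ x → st x ≤ t) b →
  rate t (nextFitPack b) ≤ activeClosed t b + occI t b
rate-started t b sorted started with active-prefix t b sorted started
... | P , Q , refl , ¬a , sizes = ℚ.≤-trans (ℚ.≤-reflexive (cong (λ s → rate t (machinesNF s)) (iterate-++ nextFitStep P Q (0ℚ , [] , []))))
  (ℚ.≤-trans (runNF-inactive t Q l cur ms ¬a)
    (ℚ.≤-trans (ℚ.≤-reflexive (ℚ.+-comm (occI t cur) (rate t ms))) (ℚ.+-mono-≤ few within)))
  where
  s = runNF P (0ℚ , [] , [])
  l = proj₁ s
  cur = proj₁ (proj₂ s)
  ms = proj₂ (proj₂ s)
  few : rate t ms ≤ activeClosed t (P ++ Q)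
  few = ℚ.≤-trans (rate≤length t ms) (ℚ.≤-reflexive (cong ι (trans (runNF-length P 0ℚ [] []) (cong closed (sym sizes)))))
  within : occI t cur ≤ occI t (P ++ Q)
  within = occ-mono {t} {t} (map req cur) {map req (P ++ Q)} λ i a →
    let (x , x∈ , eq) = ∈.∈-map⁻ req i in
    active⇒any {t} {P ++ Q} (lose (∈.∈-++⁺ˡ (↭.∈-resp-↭ (nextFitPack-↭ P) (∈.∈-++⁺ˡ {xs = cur} {concat ms} x∈))) (subst (Active t) eq a))

0≤activeClosed : ∀ t b → 0ℚ ≤ activeClosed t b
0≤activeClosed t b = 0≤ι (closed (activeSizes t (map req b)))

-- While the batch is still growing, all its machines are charged.
rate-batch : ∀ t b {f e} → All Valid b → SortedBy (λ x → (- 1ℚ) * en x) b → All (λ x → f ≤ st x × st x ≤ e) b →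
  rate t (nextFitPack b) ≤ (activeClosed t b + occI t b) + (1ℚ + (totalSize b + totalSize b)) * sizeAt t (request f e 1ℚ)
rate-batch t b {f} {e} vs sorted range = go (f ℚ.≤? t) (t ℚ.<? e)
  where
  M = 1ℚ + (totalSize b + totalSize b)
  0≤size : 0ℚ ≤ totalSize b
  0≤size = ∑-nonneg b (λ i → ℚ.<⇒≤ (sz>0 (All.lookup vs i)))
  0≤M : 0ℚ ≤ M
  0≤M = 0≤1 ⊞ (0≤size ⊞ 0≤size)
  0≤rest : 0ℚ ≤ activeClosed t b + occI t b
  0≤rest = 0≤activeClosed t b ⊞ 0≤occ t (map req b)
  go : Dec (f ≤ t) → Dec (t < e) → rate t (nextFitPack b) ≤ (activeClosed t b + occI t b) + M * sizeAt t (request f e 1ℚ)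
  go (no f≰t) _ = ℚ.≤-trans (ℚ.≤-reflexive (rate-inactive (nextFitPack b) λ a →
      let (x , i , (s≤t , _)) = find (active-↭ (nextFitPack-↭ b) a) in f≰t (ℚ.≤-trans (proj₁ (All.lookup range i)) s≤t)))
    (0≤rest ⊞ 0≤M ⊠ 0≤sizeAt t (request f e 1ℚ) 0≤1)
  go (yes f≤t) (yes t<e) = ℚ.≤-trans (machines≤ t vs) (lin 0≤rest
    (trans (ℚ.+-comm (activeClosed t b + occI t b) _) (cong (_+ (activeClosed t b + occI t b))
      (trans (cong (M *_) (sizeAt-active {t} {request f e 1ℚ} (f≤t , t<e))) (ℚ.*-identityʳ M)))))
  go (yes f≤t) (no t≮e) = ℚ.≤-trans (rate-started t b sorted (All.map (λ (_ , s≤e) → ℚ.≤-trans s≤e (ℚ.≮⇒≥ t≮e)) range))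
    (lin (0≤M ⊠ 0≤sizeAt t (request f e 1ℚ) 0≤1) refl)

module Grid (G : List ℚ) (inc : Increasing G) where

  record OnGrid (x : Item) : Set where
    constructor on-grid
    field
      is-valid : Valid x
      st∈      : st x ∈ G
      en∈      : en x ∈ G

  open OnGrid public

  endpoints⊆ : ∀ {b p} → All OnGrid b → p ∈ endpoints (map req b) → p ∈ G
  endpoints⊆ {b} on i with endpoints⁻ i
  ... | r , r∈ , p≡ with ∈.∈-map⁻ req r∈
  endpoints⊆ on i | r , r∈ , inj₁ refl | x , x∈ , refl = st∈ (All.lookup on x∈)
  endpoints⊆ on i | r , r∈ , inj₂ refl | x , x∈ , refl = en∈ (All.lookup on x∈)

  ∫-occ≤ : ∀ {b lo hi} → All OnGrid b → All (λ x → lo ≤ st x × en x ≤ hi) b → lo ≤ hi →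
    ∫ G (λ t → occI t b) ≤ hi - lo
  ∫-occ≤ {b} {lo} {hi} on range lo≤hi = ∫-indicator (occ-step (map req b)) inc (endpoints⊆ on) lo≤hi λ t → go t (activeIn? t b)
    where
    go : ∀ t → Dec (ActiveIn t b) → occI t b ≤ sizeAt t (request lo hi 1ℚ)
    go t (no ¬a) = ℚ.≤-trans (ℚ.≤-reflexive (occI-0 {t} {b} ¬a)) (0≤sizeAt t (request lo hi 1ℚ) 0≤1)
    go t (yes a) = let (x , i , (s≤t , t<e)) = find a ; (lo≤s , e≤hi) = All.lookup range i in
      ℚ.≤-trans (occ≤1 t (map req b)) (ℚ.≤-reflexive (sym (sizeAt-active {t} {request lo hi 1ℚ} (ℚ.≤-trans lo≤s s≤t , ℚ.<-≤-trans t<e e≤hi))))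

  lengthOf : Item → ℚ
  lengthOf x = en x - st x

  volume : List Item → ℚ
  volume = ∑ (λ x → sz x * lengthOf x)

  ∫-loadI : ∀ {xs} → All OnGrid xs → ∫ G (λ t → loadI t xs) ≡ volume xs
  ∫-loadI {xs} on = trans (∫-∑ (λ x t → sizeAtI t x) xs G)
    (∑-cong xs λ {x} i → let o = All.lookup on i in ∫-sizeAt (req x) inc (st∈ o) (en∈ o) (ℚ.<⇒≤ (st<en (is-valid o))))

  valids : ∀ {xs} → All OnGrid xs → All Valid xs
  valids = All.map is-valid

  -- The two error terms are the lifetime hi - lo, for the one open machine, and the window e - f of
  -- starts, during which the active items need not form a prefix and all of the at most 1 + 2·size
  -- machines are charged.
  batch-cost : ∀ b {f e lo hi} → All OnGrid b → f ∈ G → e ∈ G → f ≤ e →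
    All (λ x → f ≤ st x × st x ≤ e) b → All (λ x → lo ≤ st x × en x ≤ hi) b → lo ≤ hi →
    ∫ G (λ t → rate t (nextFitPack (byEnd b))) ≤
      ∫ G (λ t → activeClosed t (byEnd b)) + ((hi - lo) + (1ℚ + (totalSize b + totalSize b)) * (e - f))
  batch-cost b {f} {e} {lo} {hi} on f∈ e∈ f≤e starts range lo≤hi = ℚ.≤-trans
    (∫-mono G inc (λ t → rate-batch t b′ {f} {e} (valids on′) (sortBy-sorted _ b) starts′))
    (ℚ.≤-trans (ℚ.≤-reflexive (trans (∫-+ (λ t → activeClosed t b′ + occI t b′) (λ t → M * sizeAt t (request f e 1ℚ)) G)
        (cong₂ _+_ (∫-+ (λ t → activeClosed t b′) (λ t → occI t b′) G)
          (trans (∫-* M (λ t → sizeAt t (request f e 1ℚ)) G) (cong₂ _*_ sizes (trans (∫-sizeAt (request f e 1ℚ) inc f∈ e∈ f≤e) (ℚ.*-identityˡ (e - f))))))))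
      (ℚ.≤-trans (ℚ.≤-reflexive (ℚ.+-assoc (∫ G (λ t → activeClosed t b′)) _ _))
        (ℚ.+-monoʳ-≤ (∫ G (λ t → activeClosed t b′)) (ℚ.+-monoˡ-≤ ((1ℚ + (totalSize b + totalSize b)) * (e - f)) (∫-occ≤ on′ range′ lo≤hi)))))
    where
    b′ = byEnd b
    M = 1ℚ + (totalSize b′ + totalSize b′)
    p : b′ ↭ b
    p = sortBy-↭ _ b
    sizes : M ≡ 1ℚ + (totalSize b + totalSize b)
    sizes = cong (λ z → 1ℚ + (z + z)) (∑-↭ sz p)
    on′ : All OnGrid b′
    on′ = ↭.All-resp-↭ (↭-sym p) on
    starts′ : All (λ x → f ≤ st x × st x ≤ e) b′
    starts′ = ↭.All-resp-↭ (↭-sym p) starts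
    range′ : All (λ x → lo ≤ st x × en x ≤ hi) b′
    range′ = ↭.All-resp-↭ (↭-sym p) range

-- Accounts of batches and Cauchy-Schwarz with multipliers.

square≥0 : ∀ x → 0ℚ ≤ x * x
square≥0 x with ℚ.≤-total 0ℚ x
... | inj₁ 0≤x = 0≤x ⊠ 0≤x
... | inj₂ x≤0 = subst (0ℚ ≤_) (lem x) (neg ⊠ neg)
  where
  neg : 0ℚ ≤ - x
  neg = ℚ.neg-antimono-≤ x≤0
  lem : ∀ x → (- x) * (- x) ≡ x * x
  lem = solve-∀ ℚ-ring

lenI≡ : ∀ x → lenI x ≡ en x - st x
lenI≡ x = lem (en x) (st x)
  where
  lem : ∀ e s → e + (- 1ℚ) * s ≡ e - s
  lem = solve-∀ ℚ-ring

module Phase (G : List ℚ) (inc : Increasing G) where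

  open Grid G inc public

  machineCost closingCost : List (List Item) → ℚ
  machineCost = ∑ (λ b → ∫ G (λ t → rate t (nextFitPack (byEnd b))))
  closingCost = ∑ (λ b → ∫ G (λ t → activeClosed t (byEnd b)))

  -- The error of packing batches, and the volume of the left-over items, in
  -- terms of a total length a and of sums β and γ which by Cauchy–Schwarz, stated
  -- in `quad` with its optimal multipliers s and κ, satisfy β² ≤ a γ.
  record Account (a : ℚ) (r : Batched) : Set where
    constructor account
    field
      β γ  : ℚ
      0≤β  : 0ℚ ≤ β
      paid : machineCost (proj₁ r) ≤ closingCost (proj₁ r) + fromℕ 8 * β
      left : volume (proj₂ r) ≤ fromℕ 2 * (β + a)
      γ≤   : γ ≤ fromℕ 2 * ∑ volume (proj₁ r)
      quad : ∀ s κ → (s + s) * κ * β ≤ s * s * a + κ * κ * γ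

  open Account public

  account-[] : Account 0ℚ ([] , [])
  account-[] = account 0ℚ 0ℚ ℚ.≤-refl ℚ.≤-refl ℚ.≤-refl ℚ.≤-refl
    λ s κ → ℚ.≤-reflexive (trans (ℚ.*-zeroʳ ((s + s) * κ))
      (sym (trans (cong₂ _+_ (ℚ.*-zeroʳ (s * s)) (ℚ.*-zeroʳ (κ * κ))) (ℚ.+-identityʳ 0ℚ))))

  account-mono : ∀ {a a′ r} → a ≤ a′ → Account a r → Account a′ r
  account-mono {a} {a′} a≤ A = account (β A) (γ A) (0≤β A) (paid A)
    (ℚ.≤-trans (left A) (*-monoʳ (fromℕ 2) (ℚ.nonNegative⁻¹ (fromℕ 2)) (ℚ.+-monoʳ-≤ (β A) a≤))) (γ≤ A)
    λ s κ → ℚ.≤-trans (quad A s κ) (ℚ.+-monoˡ-≤ (κ * κ * γ A) (*-monoʳ (s * s) (square≥0 s) a≤))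

  account-++ : ∀ {a a′ bs bs′ l l′} → Account a (bs , l) → Account a′ (bs′ , l′) →
    Account (a + a′) (bs ++ bs′ , l ++ l′)
  account-++ {a} {a′} {bs} {bs′} {l} {l′} A A′ = account (β A + β A′) (γ A + γ A′) (0≤β A ⊞ 0≤β A′)
    (subst₂ _≤_ (sym (∑-++ _ bs bs′))
      (trans (lem₁ (closingCost bs) (closingCost bs′) (fromℕ 8) (β A) (β A′)) (cong (_+ fromℕ 8 * (β A + β A′)) (sym (∑-++ _ bs bs′))))
      (ℚ.+-mono-≤ (paid A) (paid A′)))
    (subst₂ _≤_ (sym (∑-++ _ l l′)) (lem₂ (fromℕ 2) (β A) (β A′) a a′) (ℚ.+-mono-≤ (left A) (left A′)))
    (subst (γ A + γ A′ ≤_) (trans (sym (ℚ.*-distribˡ-+ (fromℕ 2) (∑ volume bs) (∑ volume bs′))) (cong (fromℕ 2 *_) (sym (∑-++ volume bs bs′))))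
      (ℚ.+-mono-≤ (γ≤ A) (γ≤ A′)))
    λ s κ → subst₂ _≤_ (sym (ℚ.*-distribˡ-+ ((s + s) * κ) (β A) (β A′))) (lem₃ s κ a a′ (γ A) (γ A′)) (ℚ.+-mono-≤ (quad A s κ) (quad A′ s κ))
    where
    lem₁ : ∀ c c′ e b b′ → (c + e * b) + (c′ + e * b′) ≡ (c + c′) + e * (b + b′)
    lem₁ = solve-∀ ℚ-ring
    lem₂ : ∀ e b b′ a a′ → e * (b + a) + e * (b′ + a′) ≡ e * ((b + b′) + (a + a′))
    lem₂ = solve-∀ ℚ-ring
    lem₃ : ∀ s k a a′ g g′ → (s * s * a + k * k * g) + (s * s * a′ + k * k * g′) ≡ s * s * (a + a′) + k * k * (g + g′)
    lem₃ = solve-∀ ℚ-ring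

  module GroupAccount (L s₀ : ℚ) (0<L : 0ℚ < L) (s₀∈ : s₀ ∈ G) where

    record InGroup (x : Item) : Set where
      constructor in-group
      field
        on    : OnGrid x
        late  : s₀ - L ≤ st x
        early : st x ≤ s₀
        ends  : en x ≤ s₀ + (L + L)
        L≤len : L ≤ lengthOf x
        len≤  : lengthOf x ≤ L + L

    open InGroup

    -- Items arrive in order of decreasing start. `top` is the earliest start in a finished batch,
    -- or `s₀` at the beginning, and `σ` adds up the windows of starts of the finished batches.
    -- These windows do not overlap, hence `σ≤`. Finished batch number i has size at least i, and
    -- summing over i < q gives `size≥`. In `cost≤` the factor of `L` is the lifetime 3L of the
    -- group.
    record BatchingAt (g : List Item) (q l : ℚ) (cur : List Item) (done : List (List Item)) : Set where
      field
        1≤q   : 1ℚ ≤ q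
        l≡    : totalSize cur ≡ l
        l<q   : l < q
        top σ : ℚ
        top∈  : top ∈ G
        0≤σ   : 0ℚ ≤ σ
        σ≤    : σ ≤ s₀ - top
        cur≤  : All (λ x → st x ≤ top) cur
        next  : ∀ z → All (λ y → z ≤ st y) g → z ≤ s₀ → z ≤ top
        cost≤ : machineCost done ≤ closingCost done + (fromℕ 5 * (q - 1ℚ) * σ + (L + L + L) * (q - 1ℚ))
        size≥ : q * (q - 1ℚ) ≤ fromℕ 2 * ∑ totalSize done

    Batching : List Item → BatchState → Set
    Batching g s = BatchingAt g (proj₁ s) (proj₁ (proj₂ s)) (proj₁ (proj₂ (proj₂ s))) (proj₂ (proj₂ (proj₂ s)))

    batching : ∀ g → All InGroup g → SortedBy st g → Batching g (batches g)
    batching [] _ _ = record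
      { 1≤q = ℚ.≤-refl ; l≡ = refl ; l<q = 0<1 ; top = s₀ ; σ = 0ℚ ; top∈ = s₀∈ ; 0≤σ = ℚ.≤-refl
      ; σ≤ = ℚ.≤-reflexive (sym (ℚ.+-inverseʳ s₀)) ; cur≤ = [] ; next = λ _ _ z≤ → z≤
      ; cost≤ = ℚ.≤-reflexive (sym (trans (ℚ.+-identityˡ _) (trans (ℚ.+-identityˡ ((L + L + L) * 0ℚ)) (ℚ.*-zeroʳ (L + L + L)))))
      ; size≥ = ℚ.≤-refl }
    batching (x ∷ g) (ix ∷ ig) (x≤ ∷ sorted) = step (batches g) (batching g ig sorted) cur-in (le _ _) refl
      where
      curOf : BatchState → List Item
      curOf s = proj₁ (proj₂ (proj₂ s))
      cur-in : All (λ y → InGroup y × st x ≤ st y) (curOf (batches g))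
      cur-in = All.++⁻ˡ (curOf (batches g)) (↭.All-resp-↭ (↭-sym (batches-↭ g)) (All.zip (ig , x≤)))
      step : ∀ s → Batching g s → All (λ y → InGroup y × st x ≤ st y) (curOf s) → ∀ b → le (proj₁ s) (proj₁ (proj₂ s) + sz x) ≡ b →
        Batching (x ∷ g) (if b then (proj₁ s + 1ℚ , 0ℚ , [] , (x ∷ curOf s) ∷ proj₂ (proj₂ (proj₂ s)))
                          else (proj₁ s , proj₁ (proj₂ s) + sz x , x ∷ curOf s , proj₂ (proj₂ (proj₂ s))))
      step (q , l , cur , done) B cin false eq = record
        { 1≤q = 1≤q ; l≡ = trans (cong (sz x +_) l≡) (ℚ.+-comm (sz x) l) ; l<q = le-false eq ; top = top ; σ = σ ; top∈ = top∈
        ; 0≤σ = 0≤σ ; σ≤ = σ≤ ; cur≤ = next (st x) x≤ (early ix) ∷ cur≤ ; next = λ z h → next z (All.tail h)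
        ; cost≤ = cost≤ ; size≥ = size≥ }
        where open BatchingAt B
      step (q , l , cur , done) B cin true eq = record
        { 1≤q = lin (ℚ.≤-trans 0≤1 1≤q) (ℚ.+-comm q 1ℚ) ; l≡ = refl ; l<q = ℚ.≤-<-trans (ℚ.≤-trans 0≤1 1≤q) (lin< 0<1 refl)
        ; top = st x ; σ = σ + (top - st x) ; top∈ = st∈ (on ix) ; 0≤σ = 0≤σ ⊞ diff≥0 f≤top
        ; σ≤ = lin (diff≥0 σ≤) (lem₁ s₀ (st x) top σ) ; cur≤ = [] ; next = λ z h _ → All.head h
        ; cost≤ = ℚ.≤-trans (ℚ.+-mono-≤ cost-b cost≤) (lin (0≤5 ⊠ 0≤σ ⊞ diff≥0 5q ⊠ diff≥0 f≤top)
            (lem₂ (∫ G (λ t → activeClosed t (byEnd b))) (closingCost done) (s₀ - L) (s₀ + (L + L)) L q σ (top - st x) (1ℚ + (totalSize b + totalSize b)) (lem₃ s₀ L)))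
        ; size≥ = lin (diff≥0 size≥ ⊞ 0≤2 ⊠ diff≥0 q≤) (lem₄ q (∑ totalSize done) (totalSize b)) }
        where
        open BatchingAt B
        b = x ∷ cur
        0≤5 : 0ℚ ≤ fromℕ 5
        0≤5 = ℚ.nonNegative⁻¹ (fromℕ 5)
        0≤2 : 0ℚ ≤ fromℕ 2
        0≤2 = ℚ.nonNegative⁻¹ (fromℕ 2)
        f≤top : st x ≤ top
        f≤top = next (st x) x≤ (early ix)
        size≡ : totalSize b ≡ l + sz x
        size≡ = trans (cong (sz x +_) l≡) (ℚ.+-comm (sz x) l)
        q≤ : q ≤ totalSize b
        q≤ = subst (q ≤_) (sym size≡) (le-true eq)
        lem₁ : ∀ z x t s → z - x ≡ (s + (t - x)) + ((z - t) - s)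
        lem₁ = solve-∀ ℚ-ring
        lem₂ : ∀ a c lo hi L q σ d M → hi - lo ≡ L + L + L →
          (a + c) + (fromℕ 5 * ((q + 1ℚ) - 1ℚ) * (σ + d) + (L + L + L) * ((q + 1ℚ) - 1ℚ)) ≡
          ((a + ((hi - lo) + M * d)) + (c + (fromℕ 5 * (q - 1ℚ) * σ + (L + L + L) * (q - 1ℚ)))) +
            (fromℕ 5 * σ + (fromℕ 5 * q - M) * d)
        lem₂ a c lo hi L q σ d M eq rewrite eq = ring a c L q σ d M
          where
          ring : ∀ a c L q σ d M → (a + c) + (fromℕ 5 * ((q + 1ℚ) - 1ℚ) * (σ + d) + (L + L + L) * ((q + 1ℚ) - 1ℚ)) ≡
            ((a + ((L + L + L) + M * d)) + (c + (fromℕ 5 * (q - 1ℚ) * σ + (L + L + L) * (q - 1ℚ)))) +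
              (fromℕ 5 * σ + (fromℕ 5 * q - M) * d)
          ring = solve-∀ ℚ-ring
        lem₃ : ∀ s L → (s + (L + L)) - (s - L) ≡ L + L + L
        lem₃ = solve-∀ ℚ-ring
        -- Before x the batch was below q, so its size is below q + 1, and 1 + 2(q + 1) is at most
        -- 5q as q is at least 1.
        5q : 1ℚ + (totalSize b + totalSize b) ≤ fromℕ 5 * q
        5q = lin ((diff≥0 1≤q ⊞ diff≥0 1≤q ⊞ diff≥0 1≤q) ⊞ (diff≥0 (ℚ.<⇒≤ l<q) ⊞ diff≥0 (sz≤1 (is-valid (on ix)))) ⊞ (diff≥0 (ℚ.<⇒≤ l<q) ⊞ diff≥0 (sz≤1 (is-valid (on ix)))))
          (trans (ring q l (sz x)) (cong (λ z → (1ℚ + (z + z)) + (((q - 1ℚ) + (q - 1ℚ) + (q - 1ℚ)) + ((q - l) + (1ℚ - sz x)) + ((q - l) + (1ℚ - sz x)))) (sym size≡)))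
          where
          ring : ∀ q l s → fromℕ 5 * q ≡ (1ℚ + ((l + s) + (l + s))) + (((q - 1ℚ) + (q - 1ℚ) + (q - 1ℚ)) + ((q - l) + (1ℚ - s)) + ((q - l) + (1ℚ - s)))
          ring = solve-∀ ℚ-ring
        lem₄ : ∀ q S T → fromℕ 2 * (T + S) ≡ (q + 1ℚ) * ((q + 1ℚ) - 1ℚ) + ((fromℕ 2 * S - q * (q - 1ℚ)) + fromℕ 2 * (T - q))
        lem₄ = solve-∀ ℚ-ring
        in-b : All InGroup b
        in-b = ix ∷ All.map proj₁ cin
        cost-b : ∫ G (λ t → rate t (nextFitPack (byEnd b))) ≤ ∫ G (λ t → activeClosed t (byEnd b)) +
          (((s₀ + (L + L)) - (s₀ - L)) + (1ℚ + (totalSize b + totalSize b)) * (top - st x))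
        cost-b = batch-cost b {st x} {top} {s₀ - L} {s₀ + (L + L)} (All.map on in-b) (st∈ (on ix)) top∈ f≤top
          ((ℚ.≤-refl , f≤top) ∷ All.zipWith (λ (c , h) → proj₂ c , h) (cin , cur≤))
          (All.map (λ i → late i , ends i) in-b) (lin (ℚ.<⇒≤ 0<L ⊞ (ℚ.<⇒≤ 0<L ⊞ ℚ.<⇒≤ 0<L)) (ring s₀ L))
          where
          ring : ∀ s L → s + (L + L) ≡ (s - L) + (L + (L + L))
          ring = solve-∀ ℚ-ring

    -- With B = q - 1 finished batches, β = L B and γ = L B², so β² = L γ holds exactly and `quad`
    -- is the square of s - κ B. The windows of starts have total length at most L, so the errors 5
    -- B σ and 3 L B add up to 8 β. The unfinished batch has size below q = B + 1 and lengths up to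
    -- 2L.
    group-account : ∀ g → All InGroup g → SortedBy st g →
      Account L (proj₂ (proj₂ (proj₂ (batches g))) , proj₁ (proj₂ (proj₂ (batches g))))
    group-account g ig sorted = account (L * B) (L * (B * B)) (ℚ.<⇒≤ 0<L ⊠ 0≤B)
      (ℚ.≤-trans cost≤ (lin (ℚ.nonNegative⁻¹ (fromℕ 5) ⊠ 0≤B ⊠ diff≥0 σ≤L) (lem₁ (closingCost done) B σ L)))
      (ℚ.≤-trans (vol≤ cur (All.++⁻ˡ cur in-all)) (lin (0≤L+L ⊠ diff≥0 (ℚ.<⇒≤ (subst (_< q) (sym l≡) l<q))) (lem₂ L q (totalSize cur))))
      (ℚ.≤-trans (lin (ℚ.<⇒≤ 0<L ⊠ 0≤B ⊞ ℚ.<⇒≤ 0<L ⊠ diff≥0 size≥) (lem₃ L q (∑ totalSize done)))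
        (*-monoʳ (fromℕ 2) (ℚ.nonNegative⁻¹ (fromℕ 2)) (vol≥ done (All.concat⁻ (All.++⁻ʳ cur in-all)))))
      λ s κ → lin (ℚ.<⇒≤ 0<L ⊠ square≥0 (s - κ * B)) (lem₄ s κ L B)
      where
      q = proj₁ (batches g)
      l = proj₁ (proj₂ (batches g))
      cur = proj₁ (proj₂ (proj₂ (batches g)))
      done = proj₂ (proj₂ (proj₂ (batches g)))
      open BatchingAt (batching g ig sorted)
      B = q - 1ℚ
      0≤B : 0ℚ ≤ B
      0≤B = diff≥0 1≤q
      0≤L+L : 0ℚ ≤ L + L
      0≤L+L = ℚ.<⇒≤ 0<L ⊞ ℚ.<⇒≤ 0<L
      in-all : All InGroup (cur ++ concat done)
      in-all = ↭.All-resp-↭ (↭-sym (batches-↭ g)) ig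
      σ≤L : σ ≤ L
      σ≤L = ℚ.≤-trans σ≤ (lin (diff≥0 (next (s₀ - L) (All.map late ig) (lin (ℚ.<⇒≤ 0<L) (ring s₀ L)))) (ring′ s₀ L top))
        where
        ring : ∀ s L → s ≡ (s - L) + L
        ring = solve-∀ ℚ-ring
        ring′ : ∀ s L t → L ≡ (s - t) + (t - (s - L))
        ring′ = solve-∀ ℚ-ring
      vol≤ : ∀ xs → All InGroup xs → volume xs ≤ (L + L) * totalSize xs
      vol≤ xs ixs = ℚ.≤-trans (∑-mono xs λ {x} i → let ix = All.lookup ixs i in
        ℚ.≤-trans (*-monoʳ (sz x) (ℚ.<⇒≤ (sz>0 (is-valid (on ix)))) (len≤ ix)) (ℚ.≤-reflexive (ℚ.*-comm (sz x) (L + L))))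
        (ℚ.≤-reflexive (∑-*ˡ (L + L) sz xs))
      vol≥′ : ∀ xs → All InGroup xs → L * totalSize xs ≤ volume xs
      vol≥′ xs ixs = ℚ.≤-trans (ℚ.≤-reflexive (sym (∑-*ˡ L sz xs))) (∑-mono xs λ {x} i → let ix = All.lookup ixs i in
        ℚ.≤-trans (ℚ.≤-reflexive (ℚ.*-comm L (sz x))) (*-monoʳ (sz x) (ℚ.<⇒≤ (sz>0 (is-valid (on ix)))) (L≤len ix)))
      vol≥ : ∀ bs → All (All InGroup) bs → L * ∑ totalSize bs ≤ ∑ volume bs
      vol≥ bs ibs = ℚ.≤-trans (ℚ.≤-reflexive (sym (∑-*ˡ L totalSize bs))) (∑-mono bs λ {b} i → vol≥′ b (All.lookup ibs i))
      lem₁ : ∀ c B σ L → c + fromℕ 8 * (L * B) ≡ (c + (fromℕ 5 * B * σ + (L + L + L) * B)) + fromℕ 5 * B * (L - σ)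
      lem₁ = solve-∀ ℚ-ring
      lem₂ : ∀ L q T → fromℕ 2 * (L * (q - 1ℚ) + L) ≡ (L + L) * T + (L + L) * (q - T)
      lem₂ = solve-∀ ℚ-ring
      lem₃ : ∀ L q S → fromℕ 2 * (L * S) ≡ L * ((q - 1ℚ) * (q - 1ℚ)) + (L * (q - 1ℚ) + L * (fromℕ 2 * S - q * (q - 1ℚ)))
      lem₃ = solve-∀ ℚ-ring
      lem₄ : ∀ s k L B → s * s * L + k * k * (L * (B * B)) ≡ (s + s) * k * (L * B) + L * ((s - k * B) * (s - k * B))
      lem₄ = solve-∀ ℚ-ring

-- Length classes and harmonic classes.

shorter-longer : ∀ b xs → All (λ x → lenI x < b) (shorter b xs) × All (λ x → b ≤ lenI x) (longer b xs)
shorter-longer b []       = [] , []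
shorter-longer b (x ∷ xs) with le b (lenI x) in eq | shorter-longer b xs
... | true  | s , l = s , le-true eq ∷ l
... | false | s , l = le-false eq ∷ s , l

minLen-min : ∀ h xs → let m = rec (λ x _ m → if le (lenI x) m then lenI x else m) h xs in
  m ≤ h × All (λ x → m ≤ lenI x) xs × (m ≡ h ⊎ Any (λ x → lenI x ≡ m) xs)
minLen-min h []       = ℚ.≤-refl , [] , inj₁ refl
minLen-min h (x ∷ xs) with minLen-min h xs
... | m≤h , all , which with le (lenI x) (rec (λ x _ m → if le (lenI x) m then lenI x else m) h xs) in eq
... | true  = ℚ.≤-trans (le-true eq) m≤h , ℚ.≤-refl ∷ All.map (ℚ.≤-trans (le-true eq)) all , inj₂ (here refl)
... | false = m≤h , ℚ.<⇒≤ (le-false eq) ∷ all , map-there which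
  where
  map-there : ∀ {A : Set} {P : Item → Set} → A ⊎ Any P xs → A ⊎ Any P (x ∷ xs)
  map-there (inj₁ a) = inj₁ a
  map-there (inj₂ a) = inj₂ (there a)

minLen-attained : ∀ x xs → Any (λ y → lenI y ≡ minLen (x ∷ xs)) (x ∷ xs)
minLen-attained x xs with minLen-min (lenI x) (x ∷ xs)
... | _ , _ , inj₁ eq = here (sym eq)
... | _ , _ , inj₂ a  = a

above-spec : ∀ lo xs → All (λ x → lo < sz x) (above lo xs) × All (λ x → sz x ≤ lo) (notAbove lo xs)
above-spec lo []       = [] , []
above-spec lo (x ∷ xs) with le (sz x) lo in eq | above-spec lo xs
... | true  | a , n = a , le-true eq ∷ n
... | false | a , n = le-false eq ∷ a , n

InClass : ℕ → List Item → Set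
InClass k b = (∃ λ i → i ℕ.< k ℕ.∸ 1 × All (λ x → recip (suc (suc i)) < sz x × sz x ≤ recip (suc i)) b) ⊎ All (λ x → sz x ≤ recip k) b

module Classes (G : List ℚ) (inc : Increasing G) (E μ : ℚ) where

  open Phase G inc public

  -- E bounds all ends and μ all lengths.
  record Timed (x : Item) : Set where
    constructor timed
    field
      on    : OnGrid x
      0≤st  : 0ℚ ≤ st x
      en≤E  : en x ≤ E
      len≤μ : lenI x ≤ μ

  open Timed public

  module Pass (L : ℚ) (0<L : 0ℚ < L) where

    record Fit (x : Item) : Set where
      constructor fit
      field
        is-timed : Timed x
        L≤len    : L ≤ lenI x
        len≤2L   : lenI x ≤ L + L

    open Fit

    record GoodGroup (s : ℚ) (g : List Item) : Set where
      field
        s∈     : s ∈ G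
        0≤s    : 0ℚ ≤ s
        s+L≤E  : s + L ≤ E
        inside : All (GroupAccount.InGroup L s 0<L s∈) g
        sorted : SortedBy st g

    open GoodGroup

    s+L≤ : ∀ {x} → Fit x → st x + L ≤ E
    s+L≤ {x} f = ℚ.≤-trans (lin (diff≥0 (L≤len f)) (lem (st x) (en x) L)) (en≤E (is-timed f))
      where
      lem : ∀ s e L → e ≡ (s + L) + ((e + (- 1ℚ) * s) - L)
      lem = solve-∀ ℚ-ring

    en≤ : ∀ {x s} → Fit x → st x ≤ s → en x ≤ s + (L + L)
    en≤ {x} {s} f x≤s = lin (diff≥0 (len≤2L f) ⊞ diff≥0 x≤s) (lem (st x) (en x) s L)
      where
      lem : ∀ x e s L → s + (L + L) ≡ e + (((L + L) - (e + (- 1ℚ) * x)) + (s - x))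
      lem = solve-∀ ℚ-ring

    member : ∀ {x s} (s∈ : s ∈ G) → Fit x → s - L ≤ st x → st x ≤ s → GroupAccount.InGroup L s 0<L s∈ x
    member {x} s∈ f late early = GroupAccount.in-group (on (is-timed f)) late early (en≤ f early)
      (subst (L ≤_) (lenI≡ x) (L≤len f)) (subst (_≤ L + L) (lenI≡ x) (len≤2L f))

    -- Heads of consecutive groups are at distance at least L.
    Spaced : List Group → Set
    Spaced []             = ⊤
    Spaced ((s , g) ∷ gs) = s + ι (suc (length gs)) * L ≤ E

    record Grouping (xs : List Item) (gs : List Group) : Set where
      field
        good   : All (λ h → GoodGroup (proj₁ h) (proj₂ h)) gs
        spaced : Spaced gs
        head≥  : ∀ z → All (λ x → z ≤ st x) xs → All (λ h → z ≤ proj₁ h) gs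

    singleton : ∀ {x} → Fit x → GoodGroup (st x) [ x ]
    singleton {x} f = record
      { s∈ = st∈ (on (is-timed f)) ; 0≤s = 0≤st (is-timed f) ; s+L≤E = s+L≤ f
      ; inside = member (st∈ (on (is-timed f))) f (lin (ℚ.<⇒≤ 0<L) (lem (st x) L)) ℚ.≤-refl ∷ [] ; sorted = [] ∷ [] }
      where
      lem : ∀ s L → s ≡ (s - L) + L
      lem = solve-∀ ℚ-ring

    grouping : ∀ xs → All Fit xs → SortedBy st xs → Grouping xs (groups L xs)
    grouping [] _ _ = record { good = [] ; spaced = tt ; head≥ = λ _ _ → [] }
    grouping (x ∷ xs) (f ∷ fs) (x≤ ∷ sort) = step (groups L xs) (grouping xs fs sort)
      (All.map⁻ (All.concat⁻ (↭.All-resp-↭ (↭-sym (groups-↭ L xs)) x≤)))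
      where
      one : ∀ s L → (s + L) ≡ s + (1ℚ + 0ℚ) * L
      one s L = cong (s +_) (trans (sym (ℚ.*-identityˡ L)) (cong (_* L) (sym (ℚ.+-identityʳ 1ℚ))))
      step : ∀ gs → Grouping xs gs → All (λ h → All (λ y → st x ≤ st y) (proj₂ h)) gs → Grouping (x ∷ xs) (extend L x gs)
      step [] gr _ = record
        { good = singleton f ∷ [] ; spaced = ℚ.≤-trans (ℚ.≤-reflexive (cong (λ z → st x + z)
            (trans (cong (_* L) (trans (ι-suc 0) (trans (cong (1ℚ +_) ι-0) (ℚ.+-identityʳ 1ℚ)))) (ℚ.*-identityˡ L)))) (s+L≤ f)
        ; head≥ = λ z h → All.head h ∷ [] }
      step ((s , g) ∷ gs) gr (gx ∷ _) with le (st x + L) s in eq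
      ... | true = record
        { good = singleton f ∷ good ; spaced = ℚ.≤-trans (lin (diff≥0 (le-true eq)) (trans (lem (st x) s L (ι (suc (length gs))))
              (cong (λ z → (st x + z * L) + (s - (st x + L))) (sym (ι-suc (suc (length gs))))))) spaced
        ; head≥ = λ z h → All.head h ∷ head≥ z (All.tail h) }
        where
        open Grouping gr
        lem : ∀ x s L n → s + n * L ≡ (x + (1ℚ + n) * L) + (s - (x + L))
        lem = solve-∀ ℚ-ring
      ... | false = record
        { good = record { s∈ = s∈ g₀ ; 0≤s = 0≤s g₀ ; s+L≤E = s+L≤E g₀
            ; inside = member (s∈ g₀) f (lin (diff≥0 (ℚ.<⇒≤ (le-false eq))) (lem (st x) s L)) (All.head (head≥ (st x) x≤)) ∷ inside g₀
            ; sorted = gx ∷ sorted g₀ } ∷ All.tail good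
        ; spaced = spaced ; head≥ = λ z h → All.head (head≥ z (All.tail h)) ∷ All.tail (head≥ z (All.tail h)) }
        where
        open Grouping gr
        g₀ : GoodGroup s g
        g₀ = All.head good
        lem : ∀ x s L → x ≡ (s - L) + ((x + L) - s)
        lem = solve-∀ ℚ-ring

    passGroups-account : ∀ gs → All (λ h → GoodGroup (proj₁ h) (proj₂ h)) gs → Account (ι (length gs) * L) (passGroups gs)
    passGroups-account []       _        = subst (λ a → Account a ([] , [])) (sym (ι-zeroˡ L)) account-[]
    passGroups-account ((s , g) ∷ gs) (o ∷ os) = subst (λ a → Account a (passGroups ((s , g) ∷ gs)))
      (trans (lem L (ι (length gs))) (cong (_* L) (sym (ι-suc (length gs)))))
      (account-++ (GroupAccount.group-account L s 0<L (s∈ o) g (inside o) (sorted o)) (passGroups-account gs os))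
      where
      lem : ∀ L n → L + n * L ≡ (1ℚ + n) * L
      lem = solve-∀ ℚ-ring

    -- The groups have heads at least L apart between 0 and E - L, so the sum of L over all groups
    -- is at most E, whatever L is. Every length class therefore contributes the same amount.
    pass-account : 0ℚ ≤ E → ∀ xs → All Fit xs → Account E (pass L xs)
    pass-account 0≤E xs fs = account-mono (total (groups L sorted-xs) good spaced) (passGroups-account (groups L sorted-xs) good)
      where
      sorted-xs = sortBy st xs
      open Grouping (grouping sorted-xs (↭.All-resp-↭ (↭-sym (sortBy-↭ st xs)) fs) (sortBy-sorted st xs))
      total : ∀ gs → All (λ h → GoodGroup (proj₁ h) (proj₂ h)) gs → Spaced gs → ι (length gs) * L ≤ E
      total []             _       _  = ℚ.≤-trans (ℚ.≤-reflexive (ι-zeroˡ L)) 0≤E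
      total ((s , g) ∷ gs) (o ∷ _) sp = ℚ.≤-trans (lin (0≤s o) (ℚ.+-comm s _)) sp

  module _ (0≤E : 0ℚ ≤ E) where

    -- The number c of length classes when all lengths are between m and μ.
    Few : ℚ → ℕ → Set
    Few m c = c ≡ 0 ⊎ m * ι (2 ℕ.^ ℕ.pred c) ≤ μ

    few-suc : ∀ {m c} → m ≤ μ → Few (m + m) c → Few m (suc c)
    few-suc {m} m≤μ (inj₁ refl) = inj₂ (ℚ.≤-trans (ℚ.≤-reflexive (trans (cong (m *_) (ι≡fromℕ 1)) (ℚ.*-identityʳ m))) m≤μ)
    few-suc {m} {zero} m≤μ _ = inj₂ (ℚ.≤-trans (ℚ.≤-reflexive (trans (cong (m *_) (ι≡fromℕ 1)) (ℚ.*-identityʳ m))) m≤μ)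
    few-suc {m} {suc c} m≤μ (inj₂ h) = inj₂ (ℚ.≤-trans (ℚ.≤-reflexive (trans (cong (m *_) (trans (ι-* 2 (2 ℕ.^ c)) (cong (_* ι (2 ℕ.^ c)) (ι≡fromℕ 2))))
      (lem m (ι (2 ℕ.^ c))))) h)
      where
      lem : ∀ m p → m * ((1ℚ + 1ℚ) * p) ≡ (m + m) * p
      lem = solve-∀ ℚ-ring

    record Classified (a m : ℚ) (r : Batched) (xs : List Item) (s : List Item × Batched) : Set where
      field
        empty   : proj₁ s ≡ []
        packed  : all-items (proj₂ s) ↭ all-items r ++ xs
        c       : ℕ
        few     : Few m c
        none    : xs ≡ [] → c ≡ 0
        balance : Account (ι c * E + a) (proj₂ s)

    runLengths : List Item → List Item × Batched → List Item × Batched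
    runLengths fuel s = iterate (λ _ _ s → lengthStep s) fuel s

    runLengths-[] : ∀ fuel r → runLengths fuel ([] , r) ≡ ([] , r)
    runLengths-[] []         r = refl
    runLengths-[] (_ ∷ fuel) r = runLengths-[] fuel r

    classified-[] : ∀ {a m r} → Account a r → Classified a m r [] ([] , r)
    classified-[] {a} {m} {r} A = record
      { empty = refl ; packed = ↭.↭-reflexive (sym (List.++-identityʳ (all-items r))) ; c = 0 ; few = inj₁ refl ; none = λ _ → refl
      ; balance = subst (λ z → Account z r) (sym (trans (cong (_+ a) (ι-zeroˡ E)) (ℚ.+-identityˡ a))) A }

    -- An item of least length L is below 2L and leaves in this step, so the fuel suffices. All
    -- remaining lengths are at least twice the old lower bound m, which gives `few` for 2m and, by
    -- `few-suc`, for m with one more class.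
    classify : ∀ fuel xs r {a m} → Account a r → length xs ℕ.≤ length fuel → 0ℚ < m →
      All (λ x → Timed x × m ≤ lenI x) xs → Classified a m r xs (runLengths fuel (xs , r))
    classify fuel [] r A _ _ _ = subst (Classified _ _ r []) (sym (runLengths-[] fuel r)) (classified-[] A)
    classify (_ ∷ fuel) xs@(x ∷ xs′) r@(bs , left) {a} {m} A (s≤s len) 0<m ts = record
      { empty = empty ; packed = ↭-trans packed (lengthStep-↭ (xs , r))
      ; c = suc c ; few = few-suc m≤μ few ; none = λ ()
      ; balance = subst (λ z → Account z _) (trans (lem (ι c) E a) (cong (λ z → z * E + a) (sym (ι-suc c)))) balance }
      where
      L = minLen xs
      b = fromℕ 2 * L
      L+L : b ≡ L + L
      L+L = double L
        where
        double : ∀ L → (1ℚ + 1ℚ) * L ≡ L + L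
        double = solve-∀ ℚ-ring
      attained = find (minLen-attained x xs′)
      y = proj₁ attained
      y∈ : y ∈ xs
      y∈ = proj₁ (proj₂ attained)
      y≡ : lenI y ≡ L
      y≡ = proj₂ (proj₂ attained)
      m≤L : m ≤ L
      m≤L = subst (m ≤_) y≡ (proj₂ (All.lookup ts y∈))
      m≤μ : m ≤ μ
      m≤μ = ℚ.≤-trans (proj₂ (All.lookup ts y∈)) (len≤μ (proj₁ (All.lookup ts y∈)))
      0<L : 0ℚ < L
      0<L = ℚ.<-≤-trans 0<m m≤L
      L≤ : All (λ x → L ≤ lenI x) xs
      L≤ = proj₁ (proj₂ (minLen-min (lenI x) xs))
      both : All (λ x → (Timed x × m ≤ lenI x) × L ≤ lenI x) (shorter b xs ++ longer b xs)
      both = ↭.All-resp-↭ (↭-sym (shorter-longer-↭ b xs)) (All.zip (ts , L≤))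
      fits : All (Pass.Fit L 0<L) (shorter b xs)
      fits = All.zipWith (λ {z} (((t , _) , l) , s) → Pass.fit t l (subst (lenI z ≤_) L+L (ℚ.<⇒≤ s)))
        (All.++⁻ˡ (shorter b xs) both , proj₁ (shorter-longer b xs))
      rest : All (λ x → Timed x × m + m ≤ lenI x) (longer b xs)
      rest = All.zipWith (λ {z} (((t , _) , _) , l) → t , ℚ.≤-trans (ℚ.+-mono-≤ m≤L m≤L) (subst (_≤ lenI z) L+L l))
        (All.++⁻ʳ (shorter b xs) both , proj₂ (shorter-longer b xs))
      y∉ : y ∉ longer b xs
      y∉ i = absurd< (lin< {L} {b} {L} 0<L L+L) (subst (b ≤_) y≡ (All.lookup (proj₂ (shorter-longer b xs)) i))
      fewer : length (longer b xs) ℕ.≤ length xs′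
      fewer = ℕ.≤-pred (ℕ.≤-trans (nonempty (shorter b xs) refl) (ℕ.≤-reflexive (trans (sym (List.length-++ (shorter b xs))) (↭.↭-length (shorter-longer-↭ b xs)))))
        where
        nonempty : ∀ zs → shorter b xs ≡ zs → suc (length (longer b xs)) ℕ.≤ length (shorter b xs) ℕ.+ length (longer b xs)
        nonempty (_ ∷ zs) eq = subst (λ z → suc (length (longer b xs)) ℕ.≤ length z ℕ.+ length (longer b xs)) (sym eq) (s≤s (ℕ.m≤n+m _ (length zs)))
        nonempty [] eq = ⊥-elim (y∉ (subst (λ z → y ∈ z ++ longer b xs) eq (↭.∈-resp-↭ (↭-sym (shorter-longer-↭ b xs)) y∈)))
      A′ : Account (E + a) (proj₂ (lengthStep (xs , r)))
      A′ = account-++ (Pass.pass-account L 0<L 0≤E (shorter b xs) fits) A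
      open Classified (classify fuel (longer b xs) (proj₂ (lengthStep (xs , r))) {E + a} {m + m} A′
        (ℕ.≤-trans fewer len) (ℚ.<⇒≤ 0<m ⊞< 0<m) rest)
      lem : ∀ c E a → c * E + (E + a) ≡ (1ℚ + c) * E + a
      lem = solve-∀ ℚ-ring

    lengthClasses-classified : ∀ xs → All (λ x → Timed x × 1ℚ ≤ lenI x) xs → Classified 0ℚ 1ℚ ([] , []) xs (runLengths xs (xs , [] , []))
    lengthClasses-classified xs ts = classify xs xs ([] , []) account-[] ℕ.≤-refl 0<1 ts

    module _ {Λ : ℚ} (0≤Λ : 0ℚ ≤ Λ) (few≤ : ∀ c → Few 1ℚ c → ι c ≤ Λ) where

      Sized : Item → Set
      Sized x = Timed x × 1ℚ ≤ lenI x

      -- The number n counts only nonempty harmonic classes. It is at most k in general and at most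
      -- 1 for equal sizes, which is why k is absent from the error in the uniform case.
      record Harmonized (k : ℕ) (a : ℚ) (r : Batched) (xs : List Item) (bound : ℕ) (s : List Item × Batched) : Set where
        field
          exhausted : proj₁ s ≡ []
          packed    : all-items (proj₂ s) ↭ all-items r ++ xs
          in-class  : All (InClass k) (proj₁ r) → All (InClass k) (proj₁ (proj₂ s))
          n         : ℕ
          n≤        : n ℕ.≤ bound
          n≤1       : (∃ λ w → All (λ x → sz x ≡ w) xs) → n ℕ.≤ 1
          n≡0       : xs ≡ [] → n ≡ 0
          balance   : Account (ι n * (Λ * E) + a) (proj₂ s)

      runClasses : List ℚ → List Item × Batched → List Item × Batched
      runClasses los s = iterate (λ lo _ s → harmonicStep lo s) los s

      module OneClass (lo : ℚ) (xs : List Item) (ts : All Sized xs) where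

        sized : All Sized (above lo xs ++ notAbove lo xs)
        sized = ↭.All-resp-↭ (↭-sym (above-↭ lo xs)) ts

        open Classified (lengthClasses-classified (above lo xs) (All.++⁻ˡ (above lo xs) sized)) public

        new : Batched
        new = lengthClasses (above lo xs)

        new↭ : all-items new ↭ above lo xs
        new↭ = packed

        new-class : ∀ {P : Item → Set} → All P (above lo xs) → All (All P) (proj₁ new)
        new-class h = All.concat⁻ (All.++⁻ˡ (concat (proj₁ new)) (↭.All-resp-↭ (↭-sym new↭) h))

        step↭ : ∀ r → all-items (proj₂ (harmonicStep lo (xs , r))) ++ notAbove lo xs ↭ all-items r ++ xs
        step↭ (bs , left) = ↭-trans (↭.++⁺ʳ (notAbove lo xs) (↭-trans (all-items-++ (proj₁ new) bs (proj₂ new) left) (↭.++⁺ʳ (all-items (bs , left)) new↭)))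
          (↭-trans (↭-solve 3 (λ s r l → (s ⊍ r) ⊍ l ⊜ r ⊍ (s ⊍ l)) ↭-refl (above lo xs) (all-items (bs , left)) (notAbove lo xs))
            (↭.++⁺ˡ (all-items (bs , left)) (above-↭ lo xs)))

        used₁ : List Item → ℕ
        used₁ []      = 0
        used₁ (_ ∷ _) = 1

        new-account : Account (ι (used₁ (above lo xs)) * (Λ * E)) new
        new-account = go (above lo xs) refl
          where
          go : ∀ ys → above lo xs ≡ ys → Account (ι (used₁ ys) * (Λ * E)) new
          go [] eq = subst (λ z → Account z new) (trans (ℚ.+-identityʳ (ι c * E)) (trans (cong (λ z → ι z * E) (none eq)) (trans (ι-zeroˡ E) (sym (ι-zeroˡ (Λ * E)))))) balance
          go (_ ∷ _) eq = account-mono (ℚ.≤-trans (ℚ.≤-reflexive (ℚ.+-identityʳ (ι c * E)))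
            (ℚ.≤-trans (*-monoˡ E 0≤E (few≤ c few)) (ℚ.≤-reflexive (sym (trans (cong (_* (Λ * E)) (ι≡fromℕ 1)) (ℚ.*-identityˡ (Λ * E))))))) balance

        used₁≤1 : ∀ ys → used₁ ys ℕ.≤ 1
        used₁≤1 []      = z≤n
        used₁≤1 (_ ∷ _) = s≤s z≤n

      harmonize : ∀ m i k r {a} xs → suc i ℕ.+ m ≡ k → Account a r → All Sized xs → All (λ x → sz x ≤ recip (suc i)) xs →
        Harmonized k a r xs (suc m) (runClasses (thresholds (suc i) m) (xs , r))
      harmonize m i k r {a} xs k≡ A ts sizes = go m refl
        where
        go : ∀ m′ → m ≡ m′ → Harmonized k a r xs (suc m′) (runClasses (thresholds (suc i) m′) (xs , r))
        go zero m≡ = record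
          { exhausted = nothing-left (notAbove 0ℚ xs) (All.zip (All.++⁻ʳ (above 0ℚ xs) sized , proj₂ (above-spec 0ℚ xs)))
          ; packed = ↭-trans (↭.↭-reflexive (trans (sym (List.++-identityʳ _)) (cong (all-items (proj₂ (harmonicStep 0ℚ (xs , r))) ++_)
              (sym (nothing-left (notAbove 0ℚ xs) (All.zip (All.++⁻ʳ (above 0ℚ xs) sized , proj₂ (above-spec 0ℚ xs)))))))) (step↭ r)
          ; in-class = λ h → All.++⁺ (All.map inj₂ (new-class (All.++⁻ˡ (above 0ℚ xs) (↭.All-resp-↭ (↭-sym (above-↭ 0ℚ xs))
              (subst (λ j → All (λ x → sz x ≤ recip j) xs) (trans (sym (ℕ.+-identityʳ (suc i))) (trans (cong (suc i ℕ.+_) (sym m≡)) k≡)) sizes))))) h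
          ; n = used₁ (above 0ℚ xs) ; n≤ = used₁≤1 (above 0ℚ xs) ; n≤1 = λ _ → used₁≤1 (above 0ℚ xs)
          ; n≡0 = λ { refl → refl }
          ; balance = account-++ new-account A }
          where
          open OneClass 0ℚ xs ts
          nothing-left : ∀ ys → All (λ x → Sized x × sz x ≤ 0ℚ) ys → ys ≡ []
          nothing-left []       _             = refl
          nothing-left (y ∷ ys) ((s , z) ∷ _) = absurd< (sz>0 (is-valid (on (proj₁ s)))) z
        go (suc m′) m≡ = record
          { exhausted = H.exhausted ; packed = ↭-trans H.packed (step↭ r)
          ; in-class = λ h → H.in-class (All.++⁺ (All.map (λ c → inj₁ (i , i< , c)) (new-class (All.zip (proj₁ (above-spec lo xs) ,
              All.++⁻ˡ (above lo xs) (↭.All-resp-↭ (↭-sym (above-↭ lo xs)) sizes))))) h)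
          ; n = H.n ℕ.+ used₁ (above lo xs)
          ; n≤ = ℕ.≤-trans (ℕ.+-mono-≤ H.n≤ (used₁≤1 (above lo xs))) (ℕ.≤-reflexive (ℕ.+-comm (suc m′) 1))
          ; n≤1 = λ (w , eqs) → single w eqs (above lo xs) refl
          ; n≡0 = λ { refl → trans (ℕ.+-identityʳ H.n) (H.n≡0 refl) }
          ; balance = subst (λ z → Account z _) (trans (lem (ι H.n) (Λ * E) (ι (used₁ (above lo xs))) a)
              (cong (λ z → z * (Λ * E) + a) (sym (ι-+ H.n (used₁ (above lo xs)))))) H.balance }
          where
          lo = recip (suc (suc i))
          open OneClass lo xs ts
          i< : i ℕ.< k ℕ.∸ 1
          i< = subst (λ j → i ℕ.< j ℕ.∸ 1) (trans (cong (suc i ℕ.+_) (sym m≡)) k≡) (ℕ.m<m+n i (s≤s z≤n))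
          module H = Harmonized (harmonize m′ (suc i) k (proj₂ (harmonicStep lo (xs , r))) (notAbove lo xs)
            (trans (sym (ℕ.+-suc (suc i) m′)) (trans (cong (suc i ℕ.+_) (sym m≡)) k≡)) (account-++ new-account A)
            (All.++⁻ʳ (above lo xs) sized) (proj₂ (above-spec lo xs)))
          lem : ∀ n L u a → n * L + (u * L + a) ≡ (n + u) * L + a
          lem = solve-∀ ℚ-ring
          -- If this class contains an item, the common size exceeds the threshold, so nothing is
          -- left for the later classes.
          single : ∀ w → All (λ x → sz x ≡ w) xs → ∀ ys → above lo xs ≡ ys → H.n ℕ.+ used₁ ys ℕ.≤ 1
          single w eqs [] _ = ℕ.≤-trans (ℕ.≤-reflexive (ℕ.+-identityʳ H.n)) (H.n≤1 (w , All.++⁻ʳ (above lo xs) (↭.All-resp-↭ (↭-sym (above-↭ lo xs)) eqs)))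
          single w eqs (y ∷ ys) eq = ℕ.≤-reflexive (cong (ℕ._+ 1) (H.n≡0 (vanish (notAbove lo xs) (All.zip (All.++⁻ʳ (above lo xs) eqs′ , proj₂ (above-spec lo xs))))))
            where
            eqs′ : All (λ x → sz x ≡ w) (above lo xs ++ notAbove lo xs)
            eqs′ = ↭.All-resp-↭ (↭-sym (above-↭ lo xs)) eqs
            lo<w : lo < w
            lo<w = subst (lo <_) (All.head (subst (All (λ x → sz x ≡ w)) eq (All.++⁻ˡ (above lo xs) eqs′)))
              (All.head (subst (All (λ x → lo < sz x)) eq (proj₁ (above-spec lo xs))))
            vanish : ∀ zs → All (λ x → sz x ≡ w × sz x ≤ lo) zs → zs ≡ []
            vanish []       _              = refl
            vanish (z ∷ zs) ((e , l) ∷ _) = absurd< lo<w (subst (_≤ lo) e l)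

-- The closed bins of all batches against the optimum.

activeI-All : ∀ {P : ℚ → Set} t {xs} → All (λ x → P (sz x)) xs → All P (activeSizes t (map req xs))
activeI-All t h = All.map⁺ (All.filter⁺ (active? t) (All.map⁺ h))

closed-class : ∀ k t {b} → InClass k b → closed (activeSizes t (map req b)) ℕ.≤ harmonicClosed k (activeSizes t (map req b))
closed-class k t {b} (inj₁ (i , i< , h)) = ℕ.≤-trans
  (ℕ.≤-trans (ℕ.≤-reflexive (cong closed (sym (List.filter-all (λ w → (recip (suc (suc i)) ℚ.<? w) ×-dec (w ℚ.≤? recip (suc i))) (activeI-All t h)))))
    (sumℕ-∈ (λ i → closed (harmonicClass (suc i) (activeSizes t (map req b)))) (∈.∈-upTo⁺ i<)))
  (ℕ.m≤m+n _ _)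
closed-class k t {b} (inj₂ h) = ℕ.≤-trans
  (ℕ.≤-reflexive (cong closed (sym (List.filter-all (ℚ._≤? recip k) (activeI-All t h)))))
  (ℕ.m≤n+m _ (sumℕ (map (λ i → closed (harmonicClass (suc i) (activeSizes t (map req b)))) (List.upTo (k ℕ.∸ 1)))))

allActive : ℚ → List (List Item) → List ℚ
allActive t bs = concat (map (λ b → activeSizes t (map req (byEnd b))) bs)

activeSizes-↭ : ∀ t {xs ys} → xs ↭ ys → activeSizes t (map req xs) ↭ activeSizes t (map req ys)
activeSizes-↭ t p = ↭.map⁺ size (↭.filter-↭ (active? t) (↭.map⁺ req p))

activeI-++ : ∀ t xs ys → activeSizes t (map req (xs ++ ys)) ≡ activeSizes t (map req xs) ++ activeSizes t (map req ys)
activeI-++ t xs ys = trans (cong (activeSizes t) (List.map-++ req xs ys)) (activeSizes-++ t (map req xs) (map req ys))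

allActive-↭ : ∀ t bs → activeSizes t (map req (concat bs)) ↭ allActive t bs
allActive-↭ t []       = ↭-refl
allActive-↭ t (b ∷ bs) = ↭-trans (↭.↭-reflexive (activeI-++ t b (concat bs)))
  (↭.++⁺ (activeSizes-↭ t (↭-sym (sortBy-↭ _ b))) (allActive-↭ t bs))

valid-sizes : ∀ t {xs} → All Valid xs → All Positive≤1 (activeSizes t (map req xs))
valid-sizes t vs = activeI-All t (All.map (λ v → sz>0 v , sz≤1 v) vs)

closings : ℚ → List (List Item) → ℚ
closings t = ∑ (λ b → activeClosed t (byEnd b))

byEnd-All : ∀ {P : Item → Set} {b} → All P b → All P (byEnd b)
byEnd-All {b = b} = ↭.All-resp-↭ (↭-sym (sortBy-↭ _ b))

inClass-byEnd : ∀ k {b} → InClass k b → InClass k (byEnd b)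
inClass-byEnd k {b} (inj₁ (i , i< , h)) = inj₁ (i , i< , byEnd-All h)
inClass-byEnd k {b} (inj₂ h)            = inj₂ (byEnd-All h)

allActive-valid : ∀ t bs → All (All Valid) bs → All Positive≤1 (allActive t bs)
allActive-valid t []       _        = []
allActive-valid t (b ∷ bs) (v ∷ vs) = All.++⁺ (valid-sizes t (byEnd-All v)) (allActive-valid t bs vs)

-- Each batch lies in a single class, so its closed bins are among those of Harmonic on its own
-- active sizes; superadditivity then merges the batches without an additive loss.
closings≤harmonic : ∀ k t bs → All (InClass k) bs → All (All Valid) bs → closings t bs ≤ ι (harmonicClosed k (allActive t bs))
closings≤harmonic k t []       _        _        = 0≤ι (harmonicClosed k [])
closings≤harmonic k t (b ∷ bs) (c ∷ cs) (v ∷ vs) = ℚ.≤-trans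
  (ℚ.+-mono-≤ (ι-mono (closed-class k t {byEnd b} (inClass-byEnd k c))) (closings≤harmonic k t bs cs vs))
  (ℚ.≤-trans (ℚ.≤-reflexive (sym (ι-+ (harmonicClosed k ws) (harmonicClosed k (allActive t bs)))))
    (ι-mono (harmonicClosed-++ k ws (allActive t bs) (valid-sizes t (byEnd-All v)) (allActive-valid t bs vs))))
  where
  ws = activeSizes t (map req (byEnd b))

module _ {xs : List Item} {bs : List (List Item)} {left : List Item} (packed : all-items (bs , left) ↭ xs) (vs : All Valid xs) where

  private
    all-valid : All Valid (concat bs ++ left)
    all-valid = ↭.All-resp-↭ (↭-sym packed) vs

    valid-batches : All (All Valid) bs
    valid-batches = All.concat⁻ (All.++⁻ˡ (concat bs) all-valid)

    valid-left : All Valid left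
    valid-left = All.++⁻ʳ (concat bs) all-valid

  closings-Π : ∀ {k ρ} → Π k ρ → 3 ℕ.≤ k → All (InClass k) bs → ∀ t {q} → PackableIn (activeSizes t (map req xs)) q → closings t bs ≤ ρ * q
  closings-Π {k} {ρ} ρ∈Π 3≤k cs t {q} (bins , p , fits , len) = ℚ.≤-trans (closings≤harmonic k t bs cs valid-batches)
    (ℚ.≤-trans (ι-mono (ℕ.≤-trans (ℕ.m≤m+n _ _) (harmonicClosed-++ k (allActive t bs) rest (allActive-valid t bs valid-batches) (valid-sizes t valid-left))))
      (closed-bound {k} {ρ} ρ∈Π 3≤k (All.++⁺ (allActive-valid t bs valid-batches) (valid-sizes t valid-left)) (bins , ↭-trans ws↭ p , fits , len)))
    where
    rest = activeSizes t (map req left)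
    ws↭ : allActive t bs ++ rest ↭ activeSizes t (map req xs)
    ws↭ = ↭-trans (↭.++⁺ʳ rest (↭-sym (allActive-↭ t bs)))
      (↭-trans (↭.↭-reflexive (sym (activeI-++ t (concat bs) left))) (activeSizes-↭ t packed))

  module _ {g : ℕ} (eqs : All (λ x → sz x ≡ recip (suc g)) xs) where

    private
      w = recip (suc g)

      full : ∀ i → 1ℚ < ι i * w + w → 1ℚ ≤ ι i * w
      full i h with suc g ℕ.≤? i
      ... | yes g<i = ℚ.≤-trans (ℚ.≤-reflexive (sym (recip-inverse g))) (*-monoˡ w (ℚ.<⇒≤ (0<recip g)) (ι-mono g<i))
      ... | no  g≮i = absurd< h (ℚ.≤-trans (ℚ.≤-reflexive (trans (lem (ι i) w) (cong (_* w) (sym (ι-suc i)))))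
          (ℚ.≤-trans (*-monoˡ w (ℚ.<⇒≤ (0<recip g)) (ι-mono (ℕ.≰⇒> g≮i))) (ℚ.≤-reflexive (recip-inverse g))))
        where
        lem : ∀ i w → i * w + w ≡ (1ℚ + i) * w
        lem = solve-∀ ℚ-ring

      -- Levels are multiples of w = 1/(g+1). By `full` a bin that rejects an item is completely
      -- full, so each closed bin accounts for load 1 and the ratio is exactly 1.
      closed≤sum : ∀ ws i → All (_≡ w) ws → ι (nextFitFrom (ι i * w) ws) ≤ ι i * w + sumℚ ws
      closed≤sum [] i _ = ℚ.≤-trans (ℚ.≤-reflexive ι-0) (ℚ.≤-trans (0≤ι i ⊠ ℚ.<⇒≤ (0<recip g)) (ℚ.≤-reflexive (sym (ℚ.+-identityʳ (ι i * w)))))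
      closed≤sum (v ∷ ws) i (v≡ ∷ es) = go (ι i * w + w ℚ.≤? 1ℚ)
        where
        next : ∀ j → ι j * w + w ≡ ι (suc j) * w
        next j = trans (lem (ι j) w) (cong (_* w) (sym (ι-suc j)))
          where
          lem : ∀ i w → i * w + w ≡ (1ℚ + i) * w
          lem = solve-∀ ℚ-ring
        start-over : ι 1 * w ≡ w
        start-over = trans (cong (_* w) (ι≡fromℕ 1)) (ℚ.*-identityˡ w)
        go : Dec (ι i * w + w ≤ 1ℚ) → ι (nextFitFrom (ι i * w) (v ∷ ws)) ≤ ι i * w + (v + sumℚ ws)
        go (yes p) = subst (λ z → ι (nextFitFrom (ι i * w) (z ∷ ws)) ≤ ι i * w + (z + sumℚ ws)) (sym v≡)
          (ℚ.≤-trans (ℚ.≤-reflexive (cong ι (trans (nextFitFrom-yes (ι i * w) w ws p) (cong (λ l → nextFitFrom l ws) (next i)))))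
            (ℚ.≤-trans (closed≤sum ws (suc i) es) (ℚ.≤-reflexive (trans (cong (_+ sumℚ ws) (sym (next i))) (ℚ.+-assoc (ι i * w) w (sumℚ ws))))))
        go (no ¬p) = subst (λ z → ι (nextFitFrom (ι i * w) (z ∷ ws)) ≤ ι i * w + (z + sumℚ ws)) (sym v≡)
          (ℚ.≤-trans (ℚ.≤-reflexive (trans (cong ι (nextFitFrom-no (ι i * w) w ws (ℚ.≰⇒> ¬p))) (ι-suc (nextFitFrom w ws))))
            (ℚ.+-mono-≤ (full i (ℚ.≰⇒> ¬p)) (subst (λ l → ι (nextFitFrom l ws) ≤ l + sumℚ ws) start-over (closed≤sum ws 1 es))))

      closed≤load : ∀ t b → All (λ x → sz x ≡ w) b → activeClosed t (byEnd b) ≤ loadI t b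
      closed≤load t b es = ℚ.≤-trans
        (subst (λ l → ι (nextFitFrom l ws) ≤ l + sumℚ ws) (ι-zeroˡ w) (closed≤sum ws 0 (activeI-All t (byEnd-All es))))
        (ℚ.≤-reflexive (trans (ℚ.+-identityˡ (sumℚ ws)) (trans (loadAt≡ t (byEnd b)) (∑-↭ (sizeAtI t) (sortBy-↭ _ b)))))
        where
        ws = activeSizes t (map req (byEnd b))

    closings-uniform : ∀ t {q} → PackableIn (activeSizes t (map req xs)) q → closings t bs ≤ q
    closings-uniform t packs = ℚ.≤-trans
      (ℚ.≤-trans (∑-mono bs λ {b} i → closed≤load t b (All.lookup equal-batches i)) (ℚ.≤-reflexive (sym (∑-concat (sizeAtI t) bs))))
      (ℚ.≤-trans (lin (0≤loadI t valid-left) (trans (sym (∑-↭ (sizeAtI t) packed)) (loadI-++ t (concat bs) left))) (load≤bins t xs packs))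
      where
      equal-batches : All (All (λ x → sz x ≡ w)) bs
      equal-batches = All.concat⁻ (All.++⁻ˡ (concat bs) (↭.All-resp-↭ (↭-sym packed) eqs))

-- The total error of the first algorithm.

√-mono : ∀ {x y} → 0ℚ ≤ y → x * x ≤ y * y → x ≤ y
√-mono {x} {y} 0≤y h with x ℚ.≤? y
... | yes p = p
... | no ¬p = absurd< (strict (ℚ.≰⇒> ¬p)) h
  where
  lem : ∀ x y → x * x ≡ y * y + (y * (x - y) + x * (x - y))
  lem = solve-∀ ℚ-ring
  strict : y < x → y * y < x * x
  strict y<x = lin< (0≤y ⊠ diff≥0 (ℚ.<⇒≤ y<x) ⊞< (ℚ.≤-<-trans 0≤y y<x ⊠< diff>0 y<x)) (lem x y)

-- κ bounds the number of classes, T the horizon, O the optimal cost and s the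
-- square root of κ O / T, from above.
module Error {s κ T O a β γ v : ℚ} (0≤s : 0ℚ ≤ s) (1≤κ : 1ℚ ≤ κ) (0<T : 0ℚ < T) (T≤O : T ≤ O)
  (s² : O * κ ≤ s * s * T) (a≤ : a ≤ fromℕ 2 * (κ * T)) (γ≤2O : γ ≤ fromℕ 2 * O)
  (quad : ∀ s κ → (s + s) * κ * β ≤ s * s * a + κ * κ * γ)
  (v≤ : v ≤ fromℕ 2 * (β + a)) (v≤O : v ≤ O) where

  private
    0≤κ : 0ℚ ≤ κ
    0≤κ = ℚ.≤-trans 0≤1 1≤κ
    0≤T : 0ℚ ≤ T
    0≤T = ℚ.<⇒≤ 0<T
    0≤O : 0ℚ ≤ O
    0≤O = ℚ.≤-trans 0≤T T≤O
    0≤2 : 0ℚ ≤ fromℕ 2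
    0≤2 = ℚ.nonNegative⁻¹ (fromℕ 2)
    0≤sT : 0ℚ ≤ s * T
    0≤sT = 0≤s ⊠ 0≤T

    square : ∀ {x} → x * x ≤ O * κ * T → x ≤ s * T
    square {x} h = √-mono 0≤sT (ℚ.≤-trans h (ℚ.≤-trans (*-monoˡ T 0≤T s²) (ℚ.≤-reflexive (lem s T))))
      where
      lem : ∀ s T → s * s * T * T ≡ (s * T) * (s * T)
      lem = solve-∀ ℚ-ring

  T≤sT : T ≤ s * T
  T≤sT = square (lin (0≤T ⊠ diff≥0 T≤O ⊞ 0≤O ⊠ diff≥0 1≤κ ⊠ 0≤T) (lem T O κ))
    where
    lem : ∀ T O k → O * k * T ≡ T * T + (T * (O - T) + O * (k - 1ℚ) * T)
    lem = solve-∀ ℚ-ring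

  private
    0<s : 0ℚ < s
    0<s with 0ℚ ℚ.<? s
    ... | yes p = p
    ... | no ¬p = absurd< 0<T (ℚ.≤-trans T≤sT (ℚ.≤-trans (*-monoˡ T 0≤T (ℚ.≮⇒≥ ¬p)) (ℚ.≤-reflexive (ℚ.*-zeroˡ T))))

  -- With the multipliers s and κ, the value 2 s κ β is at most s² a + κ² γ, hence at most 2 s² κ T
  -- + 2 κ² O. As κ O is at most s² T, both terms are at most 2 s² κ T; division by 2 s κ leaves 2 s
  -- T.
  β≤ : β ≤ fromℕ 2 * (s * T)
  β≤ = *-cancel-≤ ((s + s) * κ) ((ℚ.<⇒≤ 0<s ⊞< 0<s) ⊠< ℚ.<-≤-trans 0<1 1≤κ) (ℚ.≤-trans (quad s κ)
    (lin (square≥0 s ⊠ diff≥0 a≤ ⊞ square≥0 κ ⊠ diff≥0 γ≤2O ⊞ 0≤2 ⊠ 0≤κ ⊠ diff≥0 s²) (lem s κ T O a γ)))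
    where
    lem : ∀ s k T O a g → (s + s) * k * (fromℕ 2 * (s * T)) ≡
      (s * s * a + k * k * g) + ((s * s * (fromℕ 2 * (k * T) - a) + k * k * (fromℕ 2 * O - g)) + fromℕ 2 * k * (s * s * T - O * k))
    lem = solve-∀ ℚ-ring

  -- The smaller of O and κ T is at most the root of their product, hence at most s T. If it is O,
  -- then v ≤ O suffices. If it is κ T, then a is at most 2 s T, and v is at most 2(2 + 2) s T.
  v≤8 : v ≤ fromℕ 8 * (s * T)
  v≤8 with ℚ.≤-total O (κ * T)
  ... | inj₁ O≤ = ℚ.≤-trans v≤O (ℚ.≤-trans (square (lin (0≤O ⊠ diff≥0 O≤) (lem O κ T)))
      (lin (ℚ.nonNegative⁻¹ (fromℕ 7) ⊠ 0≤sT) (lem′ (s * T))))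
    where
    lem : ∀ O k T → O * k * T ≡ O * O + O * (k * T - O)
    lem = solve-∀ ℚ-ring
    lem′ : ∀ x → fromℕ 8 * x ≡ x + fromℕ 7 * x
    lem′ = solve-∀ ℚ-ring
  ... | inj₂ κT≤ = ℚ.≤-trans v≤ (lin (0≤2 ⊠ (diff≥0 β≤ ⊞ diff≥0 a≤) ⊞ ℚ.nonNegative⁻¹ (fromℕ 4) ⊠ diff≥0 κT≤sT) (lem′ (s * T) (κ * T) β a))
    where
    lem : ∀ O k T → O * k * T ≡ (k * T) * (k * T) + (O - k * T) * (k * T)
    lem = solve-∀ ℚ-ring
    κT≤sT : κ * T ≤ s * T
    κT≤sT = square (lin (diff≥0 κT≤ ⊠ (0≤κ ⊠ 0≤T)) (lem O κ T))
    lem′ : ∀ x y b a → fromℕ 8 * x ≡ fromℕ 2 * (b + a) + (fromℕ 2 * ((fromℕ 2 * x - b) + (fromℕ 2 * y - a)) + fromℕ 4 * (x - y))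
    lem′ = solve-∀ ℚ-ring

  -- The constant is 8·2 + 5·8 + 3: the error of the batches, the packing of the left-over volume,
  -- and its additive 3 machines over the horizon.
  total-error : fromℕ 8 * β + (fromℕ 5 * v + fromℕ 3 * T) ≤ fromℕ 59 * (s * T)
  total-error = lin (ℚ.nonNegative⁻¹ (fromℕ 8) ⊠ diff≥0 β≤ ⊞ ℚ.nonNegative⁻¹ (fromℕ 5) ⊠ diff≥0 v≤8 ⊞ ℚ.nonNegative⁻¹ (fromℕ 3) ⊠ diff≥0 T≤sT)
    (lem (s * T) β v T)
    where
    lem : ∀ x b v T → fromℕ 59 * x ≡ (fromℕ 8 * b + (fromℕ 5 * v + fromℕ 3 * T)) +
      ((fromℕ 8 * (fromℕ 2 * x - b) + fromℕ 5 * (fromℕ 8 * x - v)) + fromℕ 3 * (x - T))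
    lem = solve-∀ ℚ-ring

-- Programs for the algorithms.

module _ {Γ X S : Ty} where

  γᵛ : Computable {Γ `× X `× list X `× S} {Γ} proj₁
  γᵛ = fstᶜ idᶜ

  xᵛ : Computable {Γ `× X `× list X `× S} {X} (λ w → proj₁ (proj₂ w))
  xᵛ = fstᶜ (sndᶜ idᶜ)

  tailᵛ : Computable {Γ `× X `× list X `× S} {list X} (λ w → proj₁ (proj₂ (proj₂ w)))
  tailᵛ = fstᶜ (sndᶜ (sndᶜ idᶜ))

  sᵛ : Computable {Γ `× X `× list X `× S} {S} (λ w → proj₂ (proj₂ (proj₂ w)))
  sᵛ = sndᶜ (sndᶜ (sndᶜ idᶜ))

items machines : Ty
items    = list itemTy
machines = list items

items-bounded : ∀ {xs : List Item} {N} → length xs ℕ.≤ N → Bounded items xs N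
items-bounded {xs} l = l , All.universal (λ _ → tt , tt , tt , tt) xs

-- `Bounded` measures each machine separately, so it does not show that placing an item adds one to
-- the total. Here the total is bounded, and permutation lemmas yield the bound directly.
Tidy : List (List Item) → ℕ → Set
Tidy ms n = length ms ℕ.≤ n × length (concat ms) ℕ.≤ n

machines-bounded : ∀ {ms : List (List Item)} {N} → Tidy ms N → Bounded machines ms N
machines-bounded {ms} (l , c) = l , go ms c
  where
  go : ∀ ms {N} → length (concat ms) ℕ.≤ N → All (λ m → Bounded items m N) ms
  go []       _ = []
  go (m ∷ ms) c = items-bounded {m} (ℕ.≤-trans (ℕ.≤-trans (ℕ.m≤m+n (length m) _) (ℕ.≤-reflexive (sym (List.length-++ m)))) c) ∷
    go ms (ℕ.≤-trans (ℕ.≤-trans (ℕ.m≤n+m (length (concat ms)) (length m)) (ℕ.≤-reflexive (sym (List.length-++ m)))) c)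

bounded-tidy : ∀ {ms : List (List Item)} {N} → Bounded machines ms N → Tidy ms (N ℕ.+ N ℕ.* N)
bounded-tidy {ms} {N} (l , bs) = ℕ.≤-trans l (ℕ.m≤m+n N _) , ℕ.≤-trans (ℕ.≤-trans (go ms bs) (ℕ.*-monoˡ-≤ N l)) (ℕ.m≤n+m _ N)
  where
  go : ∀ ms → All (λ m → Bounded items m N) ms → length (concat ms) ℕ.≤ length ms ℕ.* N
  go []       _              = z≤n
  go (m ∷ ms) ((b , _) ∷ bs) = ℕ.≤-trans (ℕ.≤-reflexive (List.length-++ m)) (ℕ.+-mono-≤ b (go ms bs))

poly-N+N² : Poly (λ N → N ℕ.+ N ℕ.* N)
poly-N+N² = poly-+ poly-id (poly-* poly-id poly-id)

-- The machine has no type of Booleans. Folds with a Boolean accumulator run on the sum of two units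
-- and are translated back through this map.
unflag : ⊤ ⊎ ⊤ → Bool
unflag (inj₁ _) = true
unflag (inj₂ _) = false

flag-unflag : ∀ s → flag (unflag s) ≡ s
flag-unflag (inj₁ tt) = refl
flag-unflag (inj₂ tt) = refl

unflag-flag : ∀ b → unflag (flag b) ≡ b
unflag-flag true  = refl
unflag-flag false = refl

flag-bounded : ∀ (s : ⊤ ⊎ ⊤) N → Bounded (unit `⊎ unit) s N
flag-bounded (inj₁ _) N = tt
flag-bounded (inj₂ _) N = tt

unflagᶜ : ∀ {Γ} {s : ⟦ Γ ⟧ → ⊤ ⊎ ⊤} → Computable {Γ} {unit `⊎ unit} s → Decidableᶜ {Γ} (λ γ → unflag (s γ))
unflagᶜ {s = s} c = c ≗ᶜ λ γ → sym (flag-unflag (s γ))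

Flag : Ty
Flag = unit `⊎ unit

recBoolᶜ : ∀ {Γ X} {f : ⟦ Γ ⟧ → ⟦ X ⟧ → List ⟦ X ⟧ → Bool → Bool} {z : ⟦ Γ ⟧ → Bool} {l : ⟦ Γ ⟧ → ⟦ list X ⟧} →
  Decidableᶜ {Γ `× X `× list X `× Flag} (λ w → f (proj₁ w) (proj₁ (proj₂ w)) (proj₁ (proj₂ (proj₂ w))) (unflag (proj₂ (proj₂ (proj₂ w))))) →
  Decidableᶜ {Γ} z → Computable {Γ} {list X} l → Decidableᶜ {Γ} (λ γ → rec (f γ) (z γ) (l γ))
recBoolᶜ {Γ} {X} {f} {z} {l} cf cz cl = recᶜ {Γ} {X} {Flag} cf cz cl (poly-const 0) (λ N γ xs _ _ → flag-bounded (rec (λ x xs s → flag (f γ x xs (unflag s))) (flag (z γ)) xs) 0)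
  ≗ᶜ λ γ → lem γ (l γ)
  where
  lem : ∀ γ xs → rec (λ x xs s → flag (f γ x xs (unflag s))) (flag (z γ)) xs ≡ flag (rec (f γ) (z γ) xs)
  lem γ []       = refl
  lem γ (x ∷ xs) = cong flag (cong (f γ x xs) (trans (cong unflag (lem γ xs)) (unflag-flag _)))

stᶜ : ∀ {Γ} {x : ⟦ Γ ⟧ → Item} → Computable {Γ} {itemTy} x → Computable {Γ} {num} (λ γ → st (x γ))
stᶜ c = fstᶜ (sndᶜ c)

enᶜ : ∀ {Γ} {x : ⟦ Γ ⟧ → Item} → Computable {Γ} {itemTy} x → Computable {Γ} {num} (λ γ → en (x γ))
enᶜ c = fstᶜ (sndᶜ (sndᶜ c))

szᶜ : ∀ {Γ} {x : ⟦ Γ ⟧ → Item} → Computable {Γ} {itemTy} x → Computable {Γ} {num} (λ γ → sz (x γ))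
szᶜ c = sndᶜ (sndᶜ (sndᶜ c))

actᶜ : ∀ {Γ} {t : ⟦ Γ ⟧ → ℚ} {x : ⟦ Γ ⟧ → Item} → Computable {Γ} {num} t → Computable {Γ} {itemTy} x →
  Decidableᶜ {Γ} (λ γ → act (t γ) (x γ))
actᶜ ct cx = leᶜ (stᶜ cx) ct ∧ᶜ notᶜ (leᶜ (enᶜ cx) ct)

lenIᶜ : ∀ {Γ} {x : ⟦ Γ ⟧ → Item} → Computable {Γ} {itemTy} x → Computable {Γ} {num} (λ γ → lenI (x γ))
lenIᶜ cx = enᶜ cx +ᶜ ((- 1ℚ) ·ᶜ stᶜ cx)

loadᵇ : Computable {num `× items} {num} (λ γ → load (proj₁ γ) (proj₂ γ))
loadᵇ = recᶜ {num `× items} {itemTy} {num}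
  (ifᶜ (actᶜ (fstᶜ γᵛ) xᵛ) (szᶜ xᵛ) (constᶜ 0ℚ) +ᶜ sᵛ) (constᶜ 0ℚ) (sndᶜ idᶜ)
  (poly-const 0) (λ _ _ _ _ _ → tt)

loadᶜ : ∀ {Γ} {t : ⟦ Γ ⟧ → ℚ} {xs : ⟦ Γ ⟧ → List Item} → Computable {Γ} {num} t → Computable {Γ} {items} xs →
  Computable {Γ} {num} (λ γ → load (t γ) (xs γ))
loadᶜ ct cx = loadᵇ ∘ᶜ (ct ,ᶜ cx)

length-insertBy : ∀ key x ys → length (insertBy key x ys) ≡ suc (length ys)
length-insertBy key x ys = ↭.↭-length (insertBy-↭ key x ys)

length-sortBy : ∀ key xs → length (sortBy key xs) ≡ length xs
length-sortBy key xs = ↭.↭-length (sortBy-↭ key xs)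

module _ (key : Item → ℚ) (ckey : Computable {itemTy} {num} key) where

  insertByᵇ : Computable {itemTy `× items} {items} (λ γ → insertBy key (proj₁ γ) (proj₂ γ))
  insertByᵇ = recᶜ {itemTy `× items} {itemTy} {items}
    (ifᶜ (leᶜ (ckey ∘ᶜ fstᶜ γᵛ) (ckey ∘ᶜ xᵛ)) (fstᶜ γᵛ ∷ᶜ (xᵛ ∷ᶜ tailᵛ)) (xᵛ ∷ᶜ sᵛ))
    (fstᶜ idᶜ ∷ᶜ []ᶜ) (sndᶜ idᶜ)
    (poly-suc poly-id) (λ N γ ys _ (l , _) → items-bounded (ℕ.≤-trans (ℕ.≤-reflexive (length-insertBy key (proj₁ γ) ys)) (s≤s l)))

  sortByᵇ : Computable {items} {items} (sortBy key)
  sortByᵇ = recᶜ {items} {itemTy} {items} (insertByᵇ ∘ᶜ (xᵛ ,ᶜ sᵛ)) []ᶜ idᶜ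
    poly-id (λ N γ xs _ (l , _) → items-bounded (ℕ.≤-trans (ℕ.≤-reflexive (length-sortBy key xs)) l))

sortByStᶜ : Computable {items} {items} (sortBy st)
sortByStᶜ = sortByᵇ st (stᶜ idᶜ)

byEndᶜ : Computable {items} {items} byEnd
byEndᶜ = sortByᵇ (λ x → (- 1ℚ) * en x) ((- 1ℚ) ·ᶜ enᶜ idᶜ)

rec-++ : ∀ {A : Set} (xs ys : List A) → rec (λ x _ r → x ∷ r) ys xs ≡ xs ++ ys
rec-++ []       ys = refl
rec-++ (x ∷ xs) ys = cong (x ∷_) (rec-++ xs ys)

module _ {A : Ty} where

  appendᵇ : Computable {list A `× list A} {list A} (λ γ → proj₁ γ ++ proj₂ γ)
  appendᵇ = recᶜ {list A `× list A} {A} {list A} (xᵛ ∷ᶜ sᵛ) (sndᶜ idᶜ) (fstᶜ idᶜ)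
    (poly-+ poly-id poly-id) (λ N γ xs (_ , bs) b → subst (λ z → Bounded (list A) z (N ℕ.+ N)) (sym (rec-++ xs (proj₂ γ))) (bounded N xs (proj₂ γ) b bs))
    ≗ᶜ λ γ → rec-++ (proj₁ γ) (proj₂ γ)
    where
    bounded : ∀ N xs ys → Bounded (list A) xs N → Bounded (list A) ys N → Bounded (list A) (xs ++ ys) (N ℕ.+ N)
    bounded N xs ys (l , b) (l′ , b′) = ℕ.≤-trans (ℕ.≤-reflexive (List.length-++ xs)) (ℕ.+-mono-≤ l l′) ,
      All.++⁺ (All.map (Bounded-mono A (ℕ.m≤m+n N N)) b) (All.map (Bounded-mono A (ℕ.m≤m+n N N)) b′)

_++ᶜ_ : ∀ {Γ A} {f g : ⟦ Γ ⟧ → ⟦ list A ⟧} → Computable {Γ} {list A} f → Computable {Γ} {list A} g →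
  Computable {Γ} {list A} (λ γ → f γ ++ g γ)
cf ++ᶜ cg = appendᵇ ∘ᶜ (cf ,ᶜ cg)

-- The environment of the pruning test: c, w, F and x.
coveredᶜ : ∀ {Γ} {c w p : ⟦ Γ ⟧ → ℚ} {F : ⟦ Γ ⟧ → List Item} {x : ⟦ Γ ⟧ → Item} →
  Computable {Γ} {num} c → Computable {Γ} {num} w → Computable {Γ} {items} F → Computable {Γ} {itemTy} x → Computable {Γ} {num} p →
  Decidableᶜ {Γ} (λ γ → covered (c γ) (w γ) (F γ) (x γ) (p γ))
coveredᶜ cc cw cF cx cp = if?ᶜ (actᶜ cp cx) (notᶜ (leᶜ (loadᶜ cp cF +ᶜ cw) cc)) trueᶜ

removableᵇ : Decidableᶜ {num `× num `× items `× itemTy} (λ γ → removable (proj₁ γ) (proj₁ (proj₂ γ)) (proj₂ (proj₂ (proj₂ γ))) (proj₁ (proj₂ (proj₂ γ))))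
removableᵇ = recBoolᶜ {num `× num `× items `× itemTy} {itemTy}
  {λ γ y _ b → covered (proj₁ γ) (proj₁ (proj₂ γ)) (proj₁ (proj₂ (proj₂ γ))) (proj₂ (proj₂ (proj₂ γ))) (en y) ∧ b}
  (coveredᶜ (fstᶜ γᵛ) (fstᶜ (sndᶜ γᵛ)) (fstᶜ (sndᶜ (sndᶜ γᵛ))) (sndᶜ (sndᶜ (sndᶜ γᵛ))) (enᶜ xᵛ) ∧ᶜ unflagᶜ sᵛ)
  (coveredᶜ (fstᶜ idᶜ) (fstᶜ (sndᶜ idᶜ)) (fstᶜ (sndᶜ (sndᶜ idᶜ))) (sndᶜ (sndᶜ (sndᶜ idᶜ))) (stᶜ (sndᶜ (sndᶜ (sndᶜ idᶜ)))))
  (fstᶜ (sndᶜ (sndᶜ idᶜ)))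

pruneᵇ : Computable {num `× num `× items} {items `× items} (λ γ → prune (proj₁ γ) (proj₁ (proj₂ γ)) (proj₂ (proj₂ γ)))
pruneᵇ = iterateᶜ {num `× num `× items} {itemTy} {items `× items}
  {λ w → pruneStep (proj₁ (proj₁ w)) (proj₁ (proj₂ (proj₁ w))) (proj₁ (proj₂ w)) (proj₁ (proj₂ (proj₂ w))) (proj₂ (proj₂ (proj₂ w)))}
  (ifᶜ (removableᵇ ∘ᶜ (fstᶜ γᵛ ,ᶜ fstᶜ (sndᶜ γᵛ) ,ᶜ (fstᶜ sᵛ ++ᶜ tailᵛ) ,ᶜ xᵛ)) (fstᶜ sᵛ ,ᶜ (xᵛ ∷ᶜ sndᶜ sᵛ)) ((xᵛ ∷ᶜ fstᶜ sᵛ) ,ᶜ sndᶜ sᵛ))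
  ([]ᶜ ,ᶜ []ᶜ) (sndᶜ (sndᶜ idᶜ))
  (λ N γ xs s → length (proj₁ s) ℕ.+ length (proj₂ s) ℕ.+ length xs ℕ.≤ N)
  poly-id
  (λ _ (l , _) _ → l)
  (λ {N} {γ} {x} {xs} {s} l → ℕ.≤-trans (ℕ.≤-reflexive (grow (removable (proj₁ γ) (proj₁ (proj₂ γ)) x (proj₁ s ++ xs)) x xs s)) l)
  (λ {N} {γ} {xs} {s} l → items-bounded (ℕ.≤-trans (ℕ.≤-trans (ℕ.m≤m+n _ _) (ℕ.m≤m+n _ _)) l) ,
    items-bounded (ℕ.≤-trans (ℕ.≤-trans (ℕ.m≤n+m _ (length (proj₁ s))) (ℕ.m≤m+n _ (length xs))) l))
  where
  pick : Bool → Item → List Item × List Item → List Item × List Item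
  pick b x s = if b then (proj₁ s , x ∷ proj₂ s) else (x ∷ proj₁ s , proj₂ s)
  grow : ∀ b x (xs : List Item) (s : List Item × List Item) →
    length (proj₁ (pick b x s)) ℕ.+ length (proj₂ (pick b x s)) ℕ.+ length xs ≡
    length (proj₁ s) ℕ.+ length (proj₂ s) ℕ.+ suc (length xs)
  grow true  x xs s = arith (length (proj₁ s)) (length (proj₂ s)) (length xs)
    where
    arith : ∀ a b c → a ℕ.+ suc b ℕ.+ c ≡ a ℕ.+ b ℕ.+ suc c
    arith = ℕ-Solver.solve-∀
  grow false x xs s = arith (length (proj₁ s)) (length (proj₂ s)) (length xs)
    where
    arith : ∀ a b c → suc a ℕ.+ b ℕ.+ c ≡ a ℕ.+ b ℕ.+ suc c
    arith = ℕ-Solver.solve-∀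

length-place : ∀ x ms → length (place x ms) ℕ.≤ suc (length ms)
length-place x []       = ℕ.≤-refl
length-place x (m ∷ ms) with le (load (st x) m + sz x) 1ℚ
... | true  = ℕ.n≤1+n _
... | false = s≤s (length-place x ms)

place-tidy : ∀ x ms {n} → Tidy ms n → Tidy (place x ms) (suc n)
place-tidy x ms (l , c) = ℕ.≤-trans (length-place x ms) (s≤s l) ,
  ℕ.≤-trans (ℕ.≤-reflexive (↭.↭-length (place-↭ x ms))) (s≤s c)

placeᵇ : Computable {itemTy `× machines} {machines} (λ γ → place (proj₁ γ) (proj₂ γ))
placeᵇ = recᶜ {itemTy `× machines} {items} {machines}
  (ifᶜ (leᶜ (loadᶜ (stᶜ (fstᶜ γᵛ)) xᵛ +ᶜ szᶜ (fstᶜ γᵛ)) (constᶜ 1ℚ)) ((fstᶜ γᵛ ∷ᶜ xᵛ) ∷ᶜ tailᵛ) (xᵛ ∷ᶜ sᵛ))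
  ((fstᶜ idᶜ ∷ᶜ []ᶜ) ∷ᶜ []ᶜ) (sndᶜ idᶜ)
  (poly-suc poly-N+N²)
  (λ N γ ms _ b → machines-bounded (place-tidy (proj₁ γ) ms (bounded-tidy {ms} {N} b)))

firstFitᶜ : Computable {items} {machines} firstFit
firstFitᶜ = iterateᶜ {items} {itemTy} {machines}
  (placeᵇ ∘ᶜ (xᵛ ,ᶜ sᵛ)) []ᶜ idᶜ
  (λ N _ xs ms → ∃ λ n → Tidy ms n × n ℕ.+ length xs ℕ.≤ N)
  poly-id
  (λ _ (l , _) _ → 0 , (z≤n , z≤n) , l)
  (λ {N} {_} {x} {xs} {ms} (n , t , l) → suc n , place-tidy x ms t , ℕ.≤-trans (ℕ.≤-reflexive (sym (ℕ.+-suc n (length xs)))) l)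
  (λ {N} {_} {xs} {ms} (n , (a , b) , l) → let n≤ = ℕ.≤-trans (ℕ.m≤m+n n (length xs)) l in
    machines-bounded (ℕ.≤-trans a n≤ , ℕ.≤-trans b n≤))

length-firstFit : ∀ F → length (firstFit F) ℕ.≤ length F
length-firstFit F = ℕ.≤-trans (go F []) (ℕ.≤-reflexive (ℕ.+-identityʳ (length F)))
  where
  go : ∀ G ms → length (iterate (λ x _ ms → place x ms) G ms) ℕ.≤ length G ℕ.+ length ms
  go []      ms = ℕ.≤-refl
  go (x ∷ G) ms = ℕ.≤-trans (go G (place x ms)) (ℕ.≤-trans (ℕ.+-monoʳ-≤ (length G) (length-place x ms)) (ℕ.≤-reflexive (ℕ.+-suc (length G) (length ms))))

-- Two potentials for the loop: a round opens at most one machine per extracted item, so the number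
-- of machines plus the number of remaining items does not grow, and neither does the number of
-- placed plus remaining items.
Producing : ℕ → List Item → List (List Item) → Set
Producing N rem ms = length ms ℕ.+ length rem ℕ.≤ N × length (concat ms) ℕ.+ length rem ℕ.≤ N

producing-tidy : ∀ {N rem ms} → Producing N rem ms → Tidy ms N
producing-tidy (a , b) = ℕ.≤-trans (ℕ.m≤m+n _ _) a , ℕ.≤-trans (ℕ.m≤m+n _ _) b

roundStep-producing : ∀ {N} c w rem ms → Producing N rem ms → Producing N (proj₁ (roundStep c w (rem , ms))) (proj₂ (roundStep c w (rem , ms)))
roundStep-producing {N} c w rem ms (a , b) =
  ℕ.≤-trans (ℕ.≤-trans (ℕ.+-monoˡ-≤ (length D) (ℕ.≤-trans (ℕ.≤-reflexive (List.length-++ (firstFit (sortBy st F))))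
      (ℕ.+-monoˡ-≤ (length ms) (ℕ.≤-trans (length-firstFit (sortBy st F)) (ℕ.≤-reflexive (length-sortBy st F))))))
    (ℕ.≤-reflexive (trans (arith (length F) (length ms) (length D)) (cong (length ms ℕ.+_) F+D)))) a ,
  ℕ.≤-trans (ℕ.≤-reflexive (trans (sym (List.length-++ (concat (proj₂ (roundStep c w (rem , ms))))))
    (trans (↭.↭-length (roundStep-↭ c w rem ms)) (List.length-++ (concat ms))))) b
  where
  F = proj₁ (prune c w rem)
  D = proj₂ (prune c w rem)
  arith : ∀ f m d → f ℕ.+ m ℕ.+ d ≡ m ℕ.+ (f ℕ.+ d)
  arith = ℕ-Solver.solve-∀
  F+D : length F ℕ.+ length D ≡ length rem
  F+D = trans (sym (List.length-++ F)) (trans (↭.↭-length (prune-↭ c w rem [] [])) (cong length (List.++-identityʳ rem)))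

roundsᵇ : Computable {num `× num `× items} {machines} (λ γ → rounds (proj₁ γ) (proj₁ (proj₂ γ)) (proj₂ (proj₂ γ)))
roundsᵇ = sndᶜ (iterateᶜ {num `× num `× items} {itemTy} {items `× machines}
  {λ w → roundStep (proj₁ (proj₁ w)) (proj₁ (proj₂ (proj₁ w))) (proj₂ (proj₂ (proj₂ w)))}
  (sndᶜ pruned′ ,ᶜ ((firstFitᶜ ∘ᶜ sortByStᶜ ∘ᶜ fstᶜ pruned′) ++ᶜ sndᶜ sᵛ))
  (sndᶜ (sndᶜ idᶜ) ,ᶜ []ᶜ) (sndᶜ (sndᶜ idᶜ))
  (λ N _ _ s → Producing N (proj₁ s) (proj₂ s))
  poly-id
  (λ _ (l , _) _ → l , l)
  (λ {N} {γ} {_} {_} {s} i → roundStep-producing (proj₁ γ) (proj₁ (proj₂ γ)) (proj₁ s) (proj₂ s) i)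
  (λ {N} {γ} {xs} {s} i → items-bounded (ℕ.≤-trans (ℕ.m≤n+m _ (length (proj₂ s))) (proj₁ i)) , machines-bounded (producing-tidy {N} {proj₁ s} {proj₂ s} i)))
  where
  pruned′ = pruneᵇ ∘ᶜ (fstᶜ γᵛ ,ᶜ fstᶜ (sndᶜ γᵛ) ,ᶜ fstᶜ (sᵛ {num `× num `× items} {itemTy} {items `× machines}))

singlesᶜ : Computable {items} {machines} singles
singlesᶜ = recᶜ {items} {itemTy} {machines} (ifᶜ (leᶜ (szᶜ xᵛ) (constᶜ third)) sᵛ ((xᵛ ∷ᶜ []ᶜ) ∷ᶜ sᵛ)) []ᶜ idᶜ
  poly-id (λ N _ xs _ (l , _) → machines-bounded (ℕ.≤-trans (count xs) l , ℕ.≤-trans (total xs) l))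
  where
  count : ∀ xs → length (singles xs) ℕ.≤ length xs
  count []       = z≤n
  count (x ∷ xs) with le (sz x) third
  ... | true  = ℕ.m≤n⇒m≤1+n (count xs)
  ... | false = s≤s (count xs)
  total : ∀ xs → length (concat (singles xs)) ℕ.≤ length xs
  total []       = z≤n
  total (x ∷ xs) with le (sz x) third
  ... | true  = ℕ.m≤n⇒m≤1+n (total xs)
  ... | false = s≤s (total xs)

module Filter {Γ : Ty} (p : ⟦ Γ ⟧ → Item → Bool) (cp : Decidableᶜ {Γ `× itemTy} (λ γ → p (proj₁ γ) (proj₂ γ))) where

  keep drop′ : ⟦ Γ ⟧ → List Item → List Item
  keep  γ = rec (λ x _ r → if p γ x then x ∷ r else r) []
  drop′ γ = rec (λ x _ r → if p γ x then r else x ∷ r) []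

  length-keep : ∀ γ xs → length (keep γ xs) ℕ.≤ length xs
  length-keep γ []       = z≤n
  length-keep γ (x ∷ xs) with p γ x
  ... | true  = s≤s (length-keep γ xs)
  ... | false = ℕ.m≤n⇒m≤1+n (length-keep γ xs)

  length-drop : ∀ γ xs → length (drop′ γ xs) ℕ.≤ length xs
  length-drop γ []       = z≤n
  length-drop γ (x ∷ xs) with p γ x
  ... | true  = ℕ.m≤n⇒m≤1+n (length-drop γ xs)
  ... | false = s≤s (length-drop γ xs)

  keepᶜ : Computable {Γ `× items} {items} (λ γ → keep (proj₁ γ) (proj₂ γ))
  keepᶜ = recᶜ {Γ `× items} {itemTy} {items} (ifᶜ (cp ∘ᶜ (fstᶜ γᵛ ,ᶜ xᵛ)) (xᵛ ∷ᶜ sᵛ) sᵛ) []ᶜ (sndᶜ idᶜ)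
    poly-id (λ N γ xs _ (l , _) → items-bounded (ℕ.≤-trans (length-keep (proj₁ γ) xs) l))

  dropᶜ : Computable {Γ `× items} {items} (λ γ → drop′ (proj₁ γ) (proj₂ γ))
  dropᶜ = recᶜ {Γ `× items} {itemTy} {items} (ifᶜ (cp ∘ᶜ (fstᶜ γᵛ ,ᶜ xᵛ)) sᵛ (xᵛ ∷ᶜ sᵛ)) []ᶜ (sndᶜ idᶜ)
    poly-id (λ N γ xs _ (l , _) → items-bounded (ℕ.≤-trans (length-drop (proj₁ γ) xs) l))

module BySize   = Filter {num} (λ b x → le (sz x) b) (leᶜ (szᶜ (sndᶜ idᶜ)) (fstᶜ idᶜ))
module ByLength = Filter {num} (λ b x → le b (lenI x)) (leᶜ (fstᶜ idᶜ) (lenIᶜ (sndᶜ idᶜ)))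

packGeneralᶜ : ∀ k → Computable {items} {machines} (packGeneral k)
packGeneralᶜ k = singlesᶜ ++ᶜ (roundsᵇ ∘ᶜ (constᶜ (ι k * third) ,ᶜ constᶜ third ,ᶜ (BySize.keepᶜ ∘ᶜ (constᶜ third ,ᶜ idᶜ))))

headSizeᶜ : Computable {items} {num} headSize
headSizeᶜ = recᶜ {items} {itemTy} {num} (szᶜ xᵛ) (constᶜ 0ℚ) idᶜ (poly-const 0) (λ _ _ _ _ _ → tt)

allEqualᵇ : Decidableᶜ {num `× items} (λ γ → allEqual (proj₁ γ) (proj₂ γ))
allEqualᵇ = recBoolᶜ {num `× items} {itemTy} {λ γ x _ b → (le (sz x) (proj₁ γ) ∧ le (proj₁ γ) (sz x)) ∧ b}
  ((leᶜ (szᶜ xᵛ) (fstᶜ γᵛ) ∧ᶜ leᶜ (fstᶜ γᵛ) (szᶜ xᵛ)) ∧ᶜ unflagᶜ sᵛ) trueᶜ (sndᶜ idᶜ)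

algorithm₂ᶜ : ∀ k → Computable {items} {machines} (algorithm₂ k)
algorithm₂ᶜ k = ifᶜ (allEqualᵇ ∘ᶜ (headSizeᶜ ,ᶜ idᶜ)) (roundsᵇ ∘ᶜ (constᶜ 1ℚ ,ᶜ headSizeᶜ ,ᶜ idᶜ)) (packGeneralᶜ k)

nextFitFrom≤length : ∀ l ws → nextFitFrom l ws ℕ.≤ length ws
nextFitFrom≤length l []       = z≤n
nextFitFrom≤length l (w ∷ ws) with l + w ℚ.≤? 1ℚ
... | yes _ = ℕ.m≤n⇒m≤1+n (nextFitFrom≤length (l + w) ws)
... | no  _ = s≤s (nextFitFrom≤length w ws)

length-nextFitPack : ∀ b → length (nextFitPack b) ℕ.≤ suc (length b)
length-nextFitPack b = s≤s (ℕ.≤-trans (ℕ.≤-reflexive (runNF-length b 0ℚ [] []))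
  (ℕ.≤-trans (nextFitFrom≤length 0ℚ (map sz b)) (ℕ.≤-reflexive (List.length-map sz b))))

nfTy : Ty
nfTy = num `× items `× machines

nextFitPackᶜ : Computable {items} {machines} nextFitPack
nextFitPackᶜ = (fstᶜ (sndᶜ idᶜ) ∷ᶜ sndᶜ (sndᶜ idᶜ)) ∘ᶜ
  iterateᶜ {items} {itemTy} {nfTy} {λ w → nextFitStep (proj₁ (proj₂ w)) (proj₂ (proj₂ (proj₂ w)))}
  (ifᶜ (leᶜ (fstᶜ sᵛ +ᶜ szᶜ xᵛ) (constᶜ 1ℚ))
    ((fstᶜ sᵛ +ᶜ szᶜ xᵛ) ,ᶜ (xᵛ ∷ᶜ fstᶜ (sndᶜ sᵛ)) ,ᶜ sndᶜ (sndᶜ sᵛ))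
    (szᶜ xᵛ ,ᶜ (xᵛ ∷ᶜ []ᶜ) ,ᶜ (fstᶜ (sndᶜ sᵛ) ∷ᶜ sndᶜ (sndᶜ sᵛ))))
  (constᶜ 0ℚ ,ᶜ []ᶜ ,ᶜ []ᶜ) idᶜ
  Inv poly-id
  (λ _ (l , _) _ → l , l)
  (λ {N} {γ} {x} {xs} {s} i → step N x xs s i (le (proj₁ s + sz x) 1ℚ))
  (λ {N} {γ} {xs} {s} (a , b) → tt ,
    items-bounded (ℕ.≤-trans (ℕ.≤-trans (ℕ.m≤m+n _ _) (ℕ.≤-trans (ℕ.≤-reflexive (sym (List.length-++ (proj₁ (proj₂ s))))) (ℕ.m≤m+n _ (length xs)))) b) ,
    machines-bounded (ℕ.≤-trans (ℕ.m≤m+n _ (length xs)) a ,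
      ℕ.≤-trans (ℕ.≤-trans (ℕ.m≤n+m _ (length (proj₁ (proj₂ s)))) (ℕ.≤-trans (ℕ.≤-reflexive (sym (List.length-++ (proj₁ (proj₂ s))))) (ℕ.m≤m+n _ (length xs)))) b))
  where
  Inv : ℕ → List Item → List Item → NFState → Set
  Inv N _ xs s = length (proj₂ (proj₂ s)) ℕ.+ length xs ℕ.≤ N × length (concat (machinesNF s)) ℕ.+ length xs ℕ.≤ N
  step : ∀ N x xs s → Inv N [] (x ∷ xs) s → ∀ b →
    let s′ : NFState
        s′ = if b then (proj₁ s + sz x , x ∷ proj₁ (proj₂ s) , proj₂ (proj₂ s)) else (sz x , [ x ] , proj₁ (proj₂ s) ∷ proj₂ (proj₂ s))
    in Inv N [] xs s′
  step N x xs s (a , b) true  = ℕ.≤-trans (ℕ.+-monoʳ-≤ (length (proj₂ (proj₂ s))) (ℕ.n≤1+n (length xs))) a ,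
    ℕ.≤-trans (ℕ.≤-reflexive (sym (ℕ.+-suc (length (concat (machinesNF s))) (length xs)))) b
  step N x xs s (a , b) false = ℕ.≤-trans (ℕ.≤-reflexive (sym (ℕ.+-suc (length (proj₂ (proj₂ s))) (length xs)))) a ,
    ℕ.≤-trans (ℕ.≤-reflexive (sym (ℕ.+-suc (length (concat (machinesNF s))) (length xs)))) b

groupTy groupsTy : Ty
groupTy  = num `× items
groupsTy = list groupTy

contents : List Group → List (List Item)
contents = map proj₂

groups-bounded : ∀ {gs : List Group} {N} → Tidy (contents gs) N → Bounded groupsTy gs N
groups-bounded {gs} t = let (l , bs) = machines-bounded {contents gs} t in
  ℕ.≤-trans (ℕ.≤-reflexive (sym (List.length-map proj₂ gs))) l , All.map (λ b → tt , b) (All.map⁻ bs)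

bounded-groups : ∀ {gs : List Group} {N} → Bounded groupsTy gs N → Tidy (contents gs) (N ℕ.+ N ℕ.* N)
bounded-groups {gs} {N} (l , bs) = bounded-tidy {contents gs} {N} (ℕ.≤-trans (ℕ.≤-reflexive (List.length-map proj₂ gs)) l , All.map⁺ (All.map proj₂ bs))

extendᵇ : Computable {num `× itemTy `× items `× groupsTy} {groupsTy} (λ w → extend (proj₁ w) (proj₁ (proj₂ w)) (proj₂ (proj₂ (proj₂ w))))
extendᵇ = (eitherᶜ {unit} {groupTy `× groupsTy} {num `× itemTy `× items `× groupsTy} {groupsTy}
    (singleton′ (sndᶜ idᶜ) ∷ᶜ []ᶜ)
    (ifᶜ (leᶜ (stᶜ (fstᶜ (sndᶜ (sndᶜ idᶜ))) +ᶜ fstᶜ (sndᶜ idᶜ)) (fstᶜ (fstᶜ (fstᶜ idᶜ))))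
      (singleton′ (sndᶜ idᶜ) ∷ᶜ (fstᶜ (fstᶜ idᶜ) ∷ᶜ sndᶜ (fstᶜ idᶜ)))
      ((fstᶜ (fstᶜ (fstᶜ idᶜ)) ,ᶜ (fstᶜ (sndᶜ (sndᶜ idᶜ)) ∷ᶜ sndᶜ (fstᶜ (fstᶜ idᶜ)))) ∷ᶜ sndᶜ (fstᶜ idᶜ)))
  ∘ᶜ (opᶜ uncons′ ∘ᶜ sᵛ ,ᶜ idᶜ))
  ≗ᶜ λ { (L , x , t , []) → refl ; (L , x , t , (s , g) ∷ gs) → refl }
  where
  singleton′ : ∀ {A} {w : ⟦ A ⟧ → ⟦ num `× itemTy `× items `× groupsTy ⟧} → Computable {A} {num `× itemTy `× items `× groupsTy} w →
    Computable {A} {groupTy} (λ a → st (proj₁ (proj₂ (w a))) , [ proj₁ (proj₂ (w a)) ])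
  singleton′ c = stᶜ (fstᶜ (sndᶜ c)) ,ᶜ (fstᶜ (sndᶜ c) ∷ᶜ []ᶜ)

length-groups : ∀ L xs → length (groups L xs) ℕ.≤ length xs
length-groups L []       = z≤n
length-groups L (x ∷ xs) = ℕ.≤-trans (lem (groups L xs)) (s≤s (length-groups L xs))
  where
  lem : ∀ gs → length (extend L x gs) ℕ.≤ suc (length gs)
  lem []             = ℕ.≤-refl
  lem ((s , g) ∷ gs) with le (st x + L) s
  ... | true  = ℕ.≤-refl
  ... | false = ℕ.n≤1+n _

groups-tidy : ∀ L xs → Tidy (contents (groups L xs)) (length xs)
groups-tidy L xs = ℕ.≤-trans (ℕ.≤-reflexive (List.length-map proj₂ (groups L xs))) (length-groups L xs) ,
  ℕ.≤-reflexive (↭.↭-length (groups-↭ L xs))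

tidy-mono : ∀ {ms m n} → m ℕ.≤ n → Tidy ms m → Tidy ms n
tidy-mono m≤n (a , b) = ℕ.≤-trans a m≤n , ℕ.≤-trans b m≤n

groupsᵇ : Computable {num `× items} {groupsTy} (λ γ → groups (proj₁ γ) (proj₂ γ))
groupsᵇ = recᶜ {num `× items} {itemTy} {groupsTy} (extendᵇ ∘ᶜ (fstᶜ γᵛ ,ᶜ xᵛ ,ᶜ tailᵛ ,ᶜ sᵛ)) []ᶜ (sndᶜ idᶜ)
  poly-id (λ N γ xs _ (l , _) → groups-bounded (tidy-mono {contents (groups (proj₁ γ) xs)} l (groups-tidy (proj₁ γ) xs)))

batchTy : Ty
batchTy = num `× num `× items `× machines

doneOf : BatchState → List (List Item)
doneOf s = proj₂ (proj₂ (proj₂ s))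

curOf : BatchState → List Item
curOf s = proj₁ (proj₂ (proj₂ s))

length-done : ∀ g → length (doneOf (batches g)) ℕ.≤ length g
length-done []      = z≤n
length-done (x ∷ g) = ℕ.≤-trans (lem (batches g)) (s≤s (length-done g))
  where
  lem : ∀ s → length (doneOf (batchStep x s)) ℕ.≤ suc (length (doneOf s))
  lem (q , l , cur , done) with le q (l + sz x)
  ... | true  = ℕ.≤-refl
  ... | false = ℕ.n≤1+n _

batches-total : ∀ g → length (curOf (batches g)) ℕ.+ length (concat (doneOf (batches g))) ≡ length g
batches-total g = trans (sym (List.length-++ (curOf (batches g)))) (↭.↭-length (batches-↭ g))

batchesᶜ : Computable {items} {batchTy} batches
batchesᶜ = recᶜ {items} {itemTy} {batchTy} {λ w → batchStep (proj₁ (proj₂ w)) (proj₂ (proj₂ (proj₂ w)))}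
  (ifᶜ (leᶜ (fstᶜ sᵛ) (fstᶜ (sndᶜ sᵛ) +ᶜ szᶜ xᵛ))
    ((fstᶜ sᵛ +ᶜ constᶜ 1ℚ) ,ᶜ constᶜ 0ℚ ,ᶜ []ᶜ ,ᶜ ((xᵛ ∷ᶜ fstᶜ (sndᶜ (sndᶜ sᵛ))) ∷ᶜ sndᶜ (sndᶜ (sndᶜ sᵛ))))
    (fstᶜ sᵛ ,ᶜ (fstᶜ (sndᶜ sᵛ) +ᶜ szᶜ xᵛ) ,ᶜ (xᵛ ∷ᶜ fstᶜ (sndᶜ (sndᶜ sᵛ))) ,ᶜ sndᶜ (sndᶜ (sndᶜ sᵛ))))
  (constᶜ 1ℚ ,ᶜ constᶜ 0ℚ ,ᶜ []ᶜ ,ᶜ []ᶜ) idᶜ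
  poly-id (λ N _ g _ (l , _) → tt , tt ,
    items-bounded (ℕ.≤-trans (ℕ.≤-trans (ℕ.m≤m+n _ _) (ℕ.≤-reflexive (batches-total g))) l) ,
    machines-bounded (ℕ.≤-trans (length-done g) l , ℕ.≤-trans (ℕ.≤-trans (ℕ.m≤n+m _ (length (curOf (batches g)))) (ℕ.≤-reflexive (batches-total g))) l))

batchedTy : Ty
batchedTy = machines `× items

Small : Batched → ℕ → Set
Small r n = length (proj₁ r) ℕ.≤ n × length (all-items r) ℕ.≤ n

small-bounded : ∀ {r : Batched} {N} → Small r N → Bounded batchedTy r N
small-bounded {r} (a , b) = machines-bounded (a , ℕ.≤-trans (ℕ.m≤m+n _ _) b′) , items-bounded (ℕ.≤-trans (ℕ.m≤n+m _ (length (concat (proj₁ r)))) b′)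
  where
  b′ = ℕ.≤-trans (ℕ.≤-reflexive (sym (List.length-++ (concat (proj₁ r))))) b

small-++ : ∀ {bs bs′ l l′ m n} → Small (bs , l) m → Small (bs′ , l′) n → Small (bs ++ bs′ , l ++ l′) (m ℕ.+ n)
small-++ {bs} {bs′} {l} {l′} (a , b) (a′ , b′) = ℕ.≤-trans (ℕ.≤-reflexive (List.length-++ bs)) (ℕ.+-mono-≤ a a′) ,
  ℕ.≤-trans (ℕ.≤-reflexive (trans (↭.↭-length (all-items-++ bs bs′ l l′)) (List.length-++ (all-items (bs , l))))) (ℕ.+-mono-≤ b b′)

small-mono : ∀ {r m n} → m ℕ.≤ n → Small r m → Small r n
small-mono m≤n (a , b) = ℕ.≤-trans a m≤n , ℕ.≤-trans b m≤n

passGroups-small : ∀ gs → Small (passGroups gs) (length (concat (contents gs)))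
passGroups-small []       = z≤n , z≤n
passGroups-small (g ∷ gs) = small-mono {passGroups (g ∷ gs)} (ℕ.≤-reflexive (sym (List.length-++ (proj₂ g))))
  (small-++ {doneOf (batches (proj₂ g))} {proj₁ (passGroups gs)} {curOf (batches (proj₂ g))} {proj₂ (passGroups gs)}
    (length-done (proj₂ g) , ℕ.≤-reflexive (trans (List.length-++ (concat (doneOf (batches (proj₂ g))))) (trans (ℕ.+-comm _ (length (curOf (batches (proj₂ g))))) (batches-total (proj₂ g)))))
    (passGroups-small gs))

passGroupsᶜ : Computable {groupsTy} {batchedTy} passGroups
passGroupsᶜ = recᶜ {groupsTy} {groupTy} {batchedTy}
  ((sndᶜ (sndᶜ (sndᶜ bs)) ++ᶜ fstᶜ sᵛ) ,ᶜ (fstᶜ (sndᶜ (sndᶜ bs)) ++ᶜ sndᶜ sᵛ))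
  ([]ᶜ ,ᶜ []ᶜ) idᶜ
  poly-N+N² (λ N _ gs _ b → small-bounded (small-mono {passGroups gs} (proj₂ (bounded-groups {gs} {N} b)) (passGroups-small gs)))
  where
  bs = batchesᶜ ∘ᶜ sndᶜ (xᵛ {groupsTy} {groupTy} {batchedTy})

pass-small : ∀ L xs → Small (pass L xs) (length xs)
pass-small L xs = small-mono {pass L xs} (ℕ.≤-trans (proj₂ (groups-tidy L (sortBy st xs))) (ℕ.≤-reflexive (length-sortBy st xs))) (passGroups-small (groups L (sortBy st xs)))

passᵇ : Computable {num `× items} {batchedTy} (λ γ → pass (proj₁ γ) (proj₂ γ))
passᵇ = passGroupsᶜ ∘ᶜ groupsᵇ ∘ᶜ (fstᶜ idᶜ ,ᶜ (sortByStᶜ ∘ᶜ sndᶜ idᶜ))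

headLenᶜ : Computable {items} {num} headLen
headLenᶜ = recᶜ {items} {itemTy} {num} (lenIᶜ xᵛ) (constᶜ 0ℚ) idᶜ (poly-const 0) (λ _ _ _ _ _ → tt)

minLenᶜ : Computable {items} {num} minLen
minLenᶜ = recᶜ {items} {itemTy} {num} (ifᶜ (leᶜ (lenIᶜ xᵛ) sᵛ) (lenIᶜ xᵛ) sᵛ) headLenᶜ idᶜ (poly-const 0) (λ _ _ _ _ _ → tt)

phaseTy : Ty
phaseTy = items `× batchedTy

Batching′ : ℕ → List Item × Batched → Set
Batching′ N s = length (proj₁ (proj₂ s)) ℕ.+ length (proj₁ s) ℕ.≤ N × length (all-items (proj₂ s)) ℕ.+ length (proj₁ s) ℕ.≤ N

batching-bounded : ∀ {N} s → Batching′ N s → Bounded phaseTy s N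
batching-bounded s (a , b) = items-bounded (ℕ.≤-trans (ℕ.m≤n+m _ (length (proj₁ (proj₂ s)))) a) ,
  small-bounded (ℕ.≤-trans (ℕ.m≤m+n _ _) a , ℕ.≤-trans (ℕ.m≤m+n _ _) b)

produce : ∀ {N taken rest bs l xs new newl} → Small (new , newl) (length taken) → taken ++ rest ↭ xs →
  Batching′ N (xs , bs , l) → Batching′ N (rest , new ++ bs , newl ++ l)
produce {N} {taken} {rest} {bs} {l} {xs} {new} {newl} (c , d) p (a , b) =
  ℕ.≤-trans (ℕ.+-monoˡ-≤ (length rest) (ℕ.≤-trans (ℕ.≤-reflexive (List.length-++ new)) (ℕ.+-monoˡ-≤ (length bs) c)))
    (ℕ.≤-trans (ℕ.≤-reflexive (shuffle (length bs))) a) ,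
  ℕ.≤-trans (ℕ.+-monoˡ-≤ (length rest) (ℕ.≤-trans
      (ℕ.≤-reflexive (trans (↭.↭-length (all-items-++ new bs newl l)) (List.length-++ (all-items (new , newl)))))
      (ℕ.+-monoˡ-≤ (length (all-items (bs , l))) d)))
    (ℕ.≤-trans (ℕ.≤-reflexive (shuffle (length (all-items (bs , l))))) b)
  where
  shuffle : ∀ n → length taken ℕ.+ n ℕ.+ length rest ≡ n ℕ.+ length xs
  shuffle n = trans (arith (length taken) n (length rest)) (cong (n ℕ.+_) (trans (sym (List.length-++ taken)) (↭.↭-length p)))
    where
    arith : ∀ t n r → t ℕ.+ n ℕ.+ r ≡ n ℕ.+ (t ℕ.+ r)
    arith = ℕ-Solver.solve-∀

lengthStep-batching : ∀ {N} s → Batching′ N s → Batching′ N (lengthStep s)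
lengthStep-batching (xs , bs , l) = produce {taken = shorter b xs} {longer b xs} {bs} {l} {xs} {proj₁ p} {proj₂ p} (pass-small (minLen xs) (shorter b xs)) (shorter-longer-↭ b xs)
  where
  b = fromℕ 2 * minLen xs
  p = pass (minLen xs) (shorter b xs)

lengthStepᶜ : Computable {phaseTy} {phaseTy} lengthStep
lengthStepᶜ = (ByLength.keepᶜ ∘ᶜ (bound₂ ,ᶜ fstᶜ idᶜ)) ,ᶜ (fstᶜ passed ++ᶜ fstᶜ (sndᶜ idᶜ)) ,ᶜ (sndᶜ passed ++ᶜ sndᶜ (sndᶜ idᶜ))
  where
  bound₂ : Computable {phaseTy} {num} (λ s → fromℕ 2 * minLen (proj₁ s))
  bound₂ = fromℕ 2 ·ᶜ (minLenᶜ ∘ᶜ fstᶜ idᶜ)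
  passed : Computable {phaseTy} {batchedTy} (λ s → pass (minLen (proj₁ s)) (shorter (fromℕ 2 * minLen (proj₁ s)) (proj₁ s)))
  passed = passᵇ ∘ᶜ ((minLenᶜ ∘ᶜ fstᶜ idᶜ) ,ᶜ (ByLength.dropᶜ ∘ᶜ (bound₂ ,ᶜ fstᶜ idᶜ)))

lengthClassesᶜ : Computable {items} {batchedTy} lengthClasses
lengthClassesᶜ = sndᶜ (iterateᶜ {items} {itemTy} {phaseTy} {λ w → lengthStep (proj₂ (proj₂ (proj₂ w)))}
  (lengthStepᶜ ∘ᶜ sᵛ) (idᶜ ,ᶜ []ᶜ ,ᶜ []ᶜ) idᶜ
  (λ N _ _ s → Batching′ N s) poly-id
  (λ _ (l , _) _ → l , l)
  (λ {N} {_} {_} {_} {s} i → lengthStep-batching s i)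
  (λ {N} {_} {_} {s} i → batching-bounded s i))

lengthClasses-small : ∀ xs → Small (lengthClasses xs) (length xs)
lengthClasses-small xs = let (a , b) = go xs (xs , [] , []) (ℕ.≤-refl , ℕ.≤-refl) in
  ℕ.≤-trans (ℕ.m≤m+n _ _) a , ℕ.≤-trans (ℕ.m≤m+n _ _) b
  where
  go : ∀ {N} (fuel : List Item) s → Batching′ N s → Batching′ N (iterate (λ _ _ s → lengthStep s) fuel s)
  go []         s i = i
  go (_ ∷ fuel) s i = go fuel (lengthStep s) (lengthStep-batching s i)

harmonicStep-batching : ∀ {N} lo s → Batching′ N s → Batching′ N (harmonicStep lo s)
harmonicStep-batching lo (xs , bs , l) = produce {taken = above lo xs} {notAbove lo xs} {bs} {l} {xs} {proj₁ r} {proj₂ r} (lengthClasses-small (above lo xs)) (above-↭ lo xs)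
  where
  r = lengthClasses (above lo xs)

harmonicStepᵇ : Computable {num `× phaseTy} {phaseTy} (λ γ → harmonicStep (proj₁ γ) (proj₂ γ))
harmonicStepᵇ = (BySize.keepᶜ ∘ᶜ (fstᶜ idᶜ ,ᶜ fstᶜ (sndᶜ idᶜ))) ,ᶜ
  (fstᶜ classes ++ᶜ fstᶜ (sndᶜ (sndᶜ idᶜ))) ,ᶜ (sndᶜ classes ++ᶜ sndᶜ (sndᶜ (sndᶜ idᶜ)))
  where
  classes : Computable {num `× phaseTy} {batchedTy} (λ γ → lengthClasses (above (proj₁ γ) (proj₁ (proj₂ γ))))
  classes = lengthClassesᶜ ∘ᶜ BySize.dropᶜ ∘ᶜ (fstᶜ idᶜ ,ᶜ fstᶜ (sndᶜ idᶜ))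

-- The thresholds depend on k alone, and k is fixed for each program, so they are written into it as
-- constants.
constListᶜ : ∀ {Γ} qs → Computable {Γ} {list num} (λ _ → qs)
constListᶜ []       = []ᶜ
constListᶜ (q ∷ qs) = constᶜ q ∷ᶜ constListᶜ qs

harmonicClassesᶜ : ∀ k → Computable {items} {phaseTy} (harmonicClasses k)
harmonicClassesᶜ k = iterateᶜ {items} {num} {phaseTy} {λ w → harmonicStep (proj₁ (proj₂ w)) (proj₂ (proj₂ (proj₂ w)))}
  (harmonicStepᵇ ∘ᶜ (xᵛ ,ᶜ sᵛ)) (idᶜ ,ᶜ []ᶜ ,ᶜ []ᶜ) (constListᶜ (thresholds 1 (k ℕ.∸ 1)))
  (λ N _ _ s → Batching′ N s) poly-id
  (λ _ _ ((l , _) , _) → l , l)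
  (λ {N} {_} {lo} {_} {s} i → harmonicStep-batching lo s i)
  (λ {N} {_} {_} {s} i → batching-bounded s i)

packBatchesᶜ : Computable {machines} {machines} packBatches
packBatchesᶜ = recᶜ {machines} {items} {machines} ((nextFitPackᶜ ∘ᶜ byEndᶜ ∘ᶜ xᵛ) ++ᶜ sᵛ) []ᶜ idᶜ
  (poly-+ poly-N+N² poly-N+N²)
  (λ N _ bs _ b → let (l , c) = bounded-tidy {bs} {N} b in machines-bounded
    (ℕ.≤-trans (count bs) (ℕ.+-mono-≤ l c) , ℕ.≤-trans (ℕ.≤-reflexive (↭.↭-length (packBatches-↭ bs))) (ℕ.≤-trans c (ℕ.m≤m+n _ _))))
  where
  count : ∀ bs → length (packBatches bs) ℕ.≤ length bs ℕ.+ length (concat bs)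
  count []       = z≤n
  count (b ∷ bs) = ℕ.≤-trans (ℕ.≤-reflexive (List.length-++ (nextFitPack (byEnd b))))
    (ℕ.≤-trans (ℕ.+-mono-≤ (ℕ.≤-trans (length-nextFitPack (byEnd b)) (s≤s (ℕ.≤-reflexive (length-sortBy _ b)))) (count bs))
      (ℕ.≤-reflexive (trans (arith (length b) (length bs) (length (concat bs))) (cong (λ z → suc (length bs) ℕ.+ z) (sym (List.length-++ b))))))
    where
    arith : ∀ a b c → suc a ℕ.+ (b ℕ.+ c) ≡ suc b ℕ.+ (a ℕ.+ c)
    arith = ℕ-Solver.solve-∀

algorithm₁ᶜ : ∀ k → Computable {items} {machines} (algorithm₁ k)
algorithm₁ᶜ k = (packBatchesᶜ ∘ᶜ fstᶜ (sndᶜ (harmonicClassesᶜ k))) ++ᶜ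
  (packGeneralᶜ 3 ∘ᶜ (sndᶜ (sndᶜ (harmonicClassesᶜ k)) ++ᶜ fstᶜ (harmonicClassesᶜ k)))

-- From requests to schedules, and the comparison with an optimal schedule.

enumerate : List ⟦ requestTy ⟧ → ℚ × List Item
enumerate = rec (λ r _ s → proj₁ s + 1ℚ , (proj₁ s , r) ∷ proj₂ s) (0ℚ , [])

output : List (List Item) → List Item → List ℕ
output ms = rec (λ x _ r → indexOf (ident x) ms ∷ r) []

length-enumerate : ∀ rs → length (proj₂ (enumerate rs)) ≡ length rs
length-enumerate []       = refl
length-enumerate (r ∷ rs) = cong suc (length-enumerate rs)

enumerateᶜ : Computable {list requestTy} {num `× items} enumerate
enumerateᶜ = recᶜ {list requestTy} {requestTy} {num `× items}
  ((fstᶜ sᵛ +ᶜ constᶜ 1ℚ) ,ᶜ ((fstᶜ sᵛ ,ᶜ xᵛ) ∷ᶜ sndᶜ sᵛ)) (constᶜ 0ℚ ,ᶜ []ᶜ) idᶜ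
  poly-id (λ N _ rs _ (l , _) → tt , items-bounded (ℕ.≤-trans (ℕ.≤-reflexive (length-enumerate rs)) l))

memberIdᵇ : Decidableᶜ {num `× items} (λ γ → memberId (proj₁ γ) (proj₂ γ))
memberIdᵇ = recBoolᶜ {num `× items} {itemTy} {λ γ x _ b → if le (proj₁ γ) (ident x) ∧ le (ident x) (proj₁ γ) then true else b}
  (if?ᶜ (leᶜ (fstᶜ γᵛ) (fstᶜ xᵛ) ∧ᶜ leᶜ (fstᶜ xᵛ) (fstᶜ γᵛ)) trueᶜ (unflagᶜ sᵛ)) falseᶜ (sndᶜ idᶜ)

indexOfᵇ : Computable {num `× machines} {nat} (λ γ → indexOf (proj₁ γ) (proj₂ γ))
indexOfᵇ = recᶜ {num `× machines} {items} {nat}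
  (ifᶜ (memberIdᵇ ∘ᶜ (fstᶜ γᵛ ,ᶜ xᵛ)) (opᶜ zero′) (opᶜ suc′ ∘ᶜ sᵛ)) (opᶜ zero′) (sndᶜ idᶜ)
  poly-id (λ N γ ms _ (l , _) → ℕ.≤-trans (indexOf≤ (proj₁ γ) ms) l)

outputᵇ : Computable {machines `× items} {list nat} (λ γ → output (proj₁ γ) (proj₂ γ))
outputᵇ = recᶜ {machines `× items} {itemTy} {list nat}
  ((indexOfᵇ ∘ᶜ (fstᶜ xᵛ ,ᶜ fstᶜ γᵛ)) ∷ᶜ sᵛ) []ᶜ (sndᶜ idᶜ)
  poly-id (λ N γ xs ((l , _) , _) (l′ , _) → ℕ.≤-trans (ℕ.≤-reflexive (count (proj₁ γ) xs)) l′ , values (proj₁ γ) xs l)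
  where
  count : ∀ ms xs → length (output ms xs) ≡ length xs
  count ms []       = refl
  count ms (x ∷ xs) = cong suc (count ms xs)
  values : ∀ ms xs {N} → length ms ℕ.≤ N → All (λ m → m ℕ.≤ N) (output ms xs)
  values ms []       l = []
  values ms (x ∷ xs) l = ℕ.≤-trans (indexOf≤ (ident x) ms) l ∷ values ms xs l

module _ (algorithm : List Item → List (List Item)) (cA : Computable {items} {machines} algorithm) where

  solveWith : List ⟦ requestTy ⟧ → List ℕ
  solveWith rs = output (algorithm (proj₂ (enumerate rs))) (proj₂ (enumerate rs))

  solveWithᶜ : Computable {list requestTy} {list nat} solveWith
  solveWithᶜ = outputᵇ ∘ᶜ ((cA ∘ᶜ sndᶜ enumerateᶜ) ,ᶜ sndᶜ enumerateᶜ)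

tabulateAll : ∀ {n} {P : Request → Set} (v : Vec Request n) → (∀ i → P (lookup v i)) → All P (toList v)
tabulateAll Vec.[]       h = []
tabulateAll (x Vec.∷ v) h = h Fin.zero ∷ tabulateAll v (h ∘ Fin.suc)

max-len : ∀ {n} (v : Vec Request n) → All (λ r → len r ≤ Vec.foldr′ ℚ._⊔_ 0ℚ (Vec.map len v)) (toList v)
max-len Vec.[]       = []
max-len (x Vec.∷ v) = ℚ.p≤p⊔q (len x) _ ∷ All.map (λ h → ℚ.≤-trans h (ℚ.p≤q⊔p (len x) _)) (max-len v)

triple : Request → ⟦ requestTy ⟧
triple r = start r , end r , size r

enumerate-req : ∀ {n} (v : Vec Request n) → map req (proj₂ (enumerate (toList (Vec.map triple v)))) ≡ toList v
enumerate-req Vec.[]       = refl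
enumerate-req (x Vec.∷ v) = cong (x ∷_) (enumerate-req v)

enumerate-distinct : ∀ rs → DistinctIds (proj₂ (enumerate rs)) × All (λ x → ident x < proj₁ (enumerate rs)) (proj₂ (enumerate rs))
enumerate-distinct []       = [] , []
enumerate-distinct (r ∷ rs) = let (d , l) = enumerate-distinct rs in
  All.map (λ {y} y< eq → ℚ.<-irrefl (sym eq) y<) l ∷ d ,
  lin< 0<1 refl ∷ All.map (λ y< → ℚ.<-trans y< (lin< 0<1 refl)) l

output≡map : ∀ ms xs → output ms xs ≡ map (λ x → indexOf (ident x) ms) xs
output≡map ms []       = refl
output≡map ms (x ∷ xs) = cong (indexOf (ident x) ms ∷_) (output≡map ms xs)

toList-subst : ∀ {m n} (eq : m ≡ n) (v : Vec ℕ m) → toList (subst (Vec ℕ) eq v) ≡ toList v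
toList-subst refl v = refl

sum-≥ : ∀ {n} (f : Request → ℕ) → (∀ r → 2 ℕ.≤ f r) → (v : Vec Request n) → n ℕ.+ n ℕ.≤ Vec.sum (Vec.map f v)
sum-≥ f h Vec.[]                  = z≤n
sum-≥ {suc n} f h (x Vec.∷ v) = ℕ.≤-trans (ℕ.≤-reflexive (cong suc (ℕ.+-suc n n))) (ℕ.+-mono-≤ (h x) (sum-≥ f h v))

module OfInstance (I : Instance) where

  itemsOf : List Item
  itemsOf = proj₂ (enumerate (input I))

  req-items : map req itemsOf ≡ requestList I
  req-items = enumerate-req (requests I)

  open Classes (grid I) (grid-increasing I) (T I) (μ I) public

  0<T : 0ℚ < T I
  0<T = ℚ.positive⁻¹ (T I) {{Instance.T-positive I}}

  sized : All (λ x → Timed x × 1ℚ ≤ lenI x) itemsOf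
  sized = All.map⁻ (subst (All (λ r → 0ℚ < size r × size r ≤ 1ℚ × 0ℚ ≤ start r × end r ≤ T I × 1ℚ ≤ len r × len r ≤ μ I × r ∈ requestList I)) (sym req-items) facts)
    |> All.map λ {x} (w>0 , w≤1 , s≥0 , e≤T , 1≤l , l≤μ , r∈) →
      timed (on-grid (valid w>0 w≤1 (lin< (ℚ.<-≤-trans 0<1 1≤l) (lem (st x) (en x))))
        (∈-sortℚ (there (there (start∈ r∈)))) (∈-sortℚ (there (there (end∈ r∈)))))
        s≥0 e≤T (subst (_≤ μ I) (sym (lenI≡ x)) l≤μ) ,
      subst (1ℚ ≤_) (sym (lenI≡ x)) 1≤l
    where
    infixl 0 _|>_
    _|>_ : ∀ {A B : Set} → A → (A → B) → B
    a |> f = f a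
    lem : ∀ s e → e ≡ s + (e - s)
    lem = solve-∀ ℚ-ring
    open Instance I using (size-positive; size≤1; start≥0; end≤T; 1≤len)
    facts : All (λ r → 0ℚ < size r × size r ≤ 1ℚ × 0ℚ ≤ start r × end r ≤ T I × 1ℚ ≤ len r × len r ≤ μ I × r ∈ requestList I) (requestList I)
    facts = All.zip (tabulateAll (requests I) size-positive , All.zip (tabulateAll (requests I) size≤1 ,
      All.zip (tabulateAll (requests I) start≥0 , All.zip (tabulateAll (requests I) end≤T ,
      All.zip (tabulateAll (requests I) 1≤len , All.zip (max-len (requests I) , All.tabulate (λ i → i)))))))

  on-items : All OnGrid itemsOf
  on-items = All.map (λ s → on (proj₁ s)) sized

  valid-items : All Valid itemsOf
  valid-items = All.map is-valid on-items

  uniform-sizes : ∀ {w} → (∀ i → size (lookup (requests I) i) ≡ w) → All (λ x → sz x ≡ w) itemsOf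
  uniform-sizes {w} h = All.map⁻ (subst (All (λ r → size r ≡ w)) (sym req-items) (tabulateAll (requests I) h))

  module Optimal {O : ℚ} {σ : Schedule I} (feasible : Feasible I σ) (cost≡ : cost I σ ≡ O) where

    packs : ∀ t → PackableIn (activeSizes t (map req itemsOf)) (machinesAt I σ t)
    packs t = subst (λ rs → PackableIn (activeSizes t rs) (machinesAt I σ t)) (sym req-items) (schedule-packs I σ feasible t)

    ∫-machines : ∫ (grid I) (machinesAt I σ) ≡ O
    ∫-machines = trans (sym (cost-∫ I σ)) cost≡

    volume≤O : volume itemsOf ≤ O
    volume≤O = ℚ.≤-trans (ℚ.≤-reflexive (sym (∫-loadI on-items)))
      (ℚ.≤-trans (∫-mono (grid I) (grid-increasing I) λ t → load≤bins t itemsOf (packs t)) (ℚ.≤-reflexive ∫-machines))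

    T≤O : T I ≤ O
    T≤O = ℚ.≤-trans (ℚ.≤-reflexive (sym (trans (∫-sizeAt whole (grid-increasing I) (∈-sortℚ (here refl)) (∈-sortℚ (there (here refl))) (ℚ.<⇒≤ 0<T)) (lem (T I)))))
      (ℚ.≤-trans (∫-mono (grid I) (grid-increasing I) λ t → go t (active? t whole)) (ℚ.≤-reflexive ∫-machines))
      where
      whole = request 0ℚ (T I) 1ℚ
      lem : ∀ t → 1ℚ * (t - 0ℚ) ≡ t
      lem t = trans (ℚ.*-identityˡ (t - 0ℚ)) (ℚ.+-identityʳ t)
      go : ∀ t → Dec (Active t whole) → sizeAt t whole ≤ machinesAt I σ t
      go t (no ¬a) = ℚ.≤-trans (ℚ.≤-reflexive (sizeAt-inactive {t} {whole} ¬a)) (ℚ.≤-trans (0≤loadI t valid-items) (load≤bins t itemsOf (packs t)))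
      go t (yes a@(0≤t , t<T)) = ℚ.≤-trans (ℚ.≤-reflexive (trans (sizeAt-active {t} {whole} a) (sym (occI-1 {t} {itemsOf} active)))) (occ≤bins t itemsOf valid-items (packs t))
        where
        active : ActiveIn t itemsOf
        active = let (i , act) = Instance.always-active I t 0≤t t<T in
          Any.map⁻ (subst (Any (Active t)) (sym req-items) (lose (lookup∈ (requests I) i) act))
          where
          lookup∈ : ∀ {n} (v : Vec Request n) i → lookup v i ∈ toList v
          lookup∈ (x Vec.∷ v) Fin.zero    = here refl
          lookup∈ (x Vec.∷ v) (Fin.suc i) = there (lookup∈ v i)

  module Solved (algorithm : List Item → List (List Item)) (cA : Computable {items} {machines} algorithm) where

    ms : List (List Item)
    ms = algorithm itemsOf

    length≡ : length (solveWith algorithm cA (input I)) ≡ n I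
    length≡ = trans (cong length (output≡map ms itemsOf)) (trans (List.length-map _ itemsOf)
      (trans (sym (List.length-map req itemsOf)) (trans (cong length req-items) (Vec.length-toList (requests I)))))

    σ : Schedule I
    σ = subst (Vec ℕ) length≡ (Vec.fromList (solveWith algorithm cA (input I)))

    σ≡ : toList σ ≡ solveWith algorithm cA (input I)
    σ≡ = trans (toList-subst length≡ _) (Vec.toList∘fromList (solveWith algorithm cA (input I)))

    module _ (P : Packing itemsOf ms) where

      open Realize I itemsOf req-items (proj₁ (enumerate-distinct (input I))) ms (all-packed P) σ (trans σ≡ (output≡map ms itemsOf)) public

      σ-feasible : Feasible I σ
      σ-feasible = realize-feasible (All.map (λ {m} fit t → ℚ.≤-trans (ℚ.≤-reflexive (loadAt≡ t m)) (fit t)) (all-fit P))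

solver : (algorithm : List Item → List (List Item)) → Computable {items} {machines} algorithm →
  (∀ I → Packing (OfInstance.itemsOf I) (algorithm (OfInstance.itemsOf I))) → PolyTimeAlgorithm
solver algorithm cA packing = record
  { program     = prog c
  ; schedule    = λ I → OfInstance.Solved.σ I algorithm cA
  ; steps       = λ I → proj₁ (ran I)
  ; runs        = λ I → subst (λ ys → prog c ⊢ input I ⇓ ys ⟨ proj₁ (ran I) ⟩) (sym (OfInstance.Solved.σ≡ I algorithm cA)) (proj₂ (proj₂ (ran I)))
  ; feasible    = λ I → OfInstance.Solved.σ-feasible I algorithm cA (packing I)
  ; coefficient = proj₁ (poly c)
  ; degree      = proj₁ (proj₂ (poly c))
  ; polynomial  = λ I → ℕ.≤-trans (proj₁ (proj₂ (ran I))) (ℕ.≤-trans (proj₂ (proj₂ (poly c)) (n I))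
      (ℕ.*-monoʳ-≤ (proj₁ (poly c)) (ℕ.^-monoˡ-≤ (proj₁ (proj₂ (poly c))) (size≥ I))))
  }
  where
  c : Computable {list requestTy} {list nat} (solveWith algorithm cA)
  c = solveWithᶜ algorithm cA
  input-bounded : ∀ I → Bounded (list requestTy) (input I) (n I)
  input-bounded I = ℕ.≤-reflexive (Vec.length-toList (Vec.map triple (requests I))) , All.universal (λ _ → tt , tt , tt) (input I)
  ran : ∀ I → ∃ λ t → t ℕ.≤ bound c (n I) × prog c ⊢ input I ⇓ solveWith algorithm cA (input I) ⟨ t ⟩
  ran I = run c (n I) (input I) (input-bounded I)
  positive : ∀ {m} → Fin m → 1 ℕ.≤ m
  positive {suc m} _ = s≤s z≤n
  -- The time bound is a polynomial in n + 1. There is at least one request and each contributes at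
  -- least 2 to the input size, so n + 1 ≤ 2n is covered.
  size≥ : ∀ I → suc (n I) ℕ.≤ inputSize I
  size≥ I = ℕ.≤-trans (ℕ.+-monoˡ-≤ (n I) (positive (proj₁ (Instance.minimum-len I)))) (sum-≥ _ (λ r → s≤s (s≤s z≤n)) (requests I))

-- Logarithms and the final estimates.

^-mono : ∀ {x y} n → 0ℚ ≤ x → x ≤ y → x ^ n ≤ y ^ n
^-mono zero    0≤x x≤y = ℚ.≤-refl
^-mono {x} {y} (suc n) 0≤x x≤y = *-mono 0≤x (^-nonneg n) x≤y (^-mono n 0≤x x≤y)
  where
  ^-nonneg : ∀ n → 0ℚ ≤ x ^ n
  ^-nonneg zero    = 0≤1
  ^-nonneg (suc n) = 0≤x ⊠ ^-nonneg n

ι-^ : ∀ m n → ι (m ℕ.^ n) ≡ ι m ^ n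
ι-^ m zero    = ι≡fromℕ 1
ι-^ m (suc n) = trans (ι-* m (m ℕ.^ n)) (cong (ι m *_) (ι-^ m n))

2^-cancel : ∀ {m n} → 2 ℕ.^ m ℕ.≤ 2 ℕ.^ n → m ℕ.≤ n
2^-cancel {m} {n} h with m ℕ.≤? n
... | yes m≤n = m≤n
... | no  m≰n = contradiction h (ℕ.<⇒≱ (ℕ.^-monoʳ-< 2 (s≤s (s≤s z≤n)) (ℕ.≰⇒> m≰n)))

-- A member ℓ comes with a and b such that the power b + 1 of q is at most 2 to the a. Raising the
-- hypothesis to the power b + 1 and comparing exponents of 2 gives d (b + 1) ≤ a.
below-log : ∀ {q ℓ} → log₂ q ℓ → ∀ d → ι (2 ℕ.^ d) ≤ q → ι d ≤ ℓ
below-log {q} {ℓ} (a , b , pow , a/b≤ℓ) d h = ℚ.≤-trans (ℚ.≤-trans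
    (ℚ.≤-reflexive (sym (trans (ℚ.*-assoc (ι d) (ι (suc b)) (recip (suc b))) (trans (cong (ι d *_) (recip-inverse b)) (ℚ.*-identityʳ (ι d))))))
    (*-monoˡ (recip (suc b)) (ℚ.<⇒≤ (0<recip b)) (ℚ.≤-trans (ℚ.≤-reflexive (sym (ι-* d (suc b)))) (ι-mono (2^-cancel {d ℕ.* suc b} {a} (ι-cancel powers))))))
  (subst (λ z → z * recip (suc b) ≤ ℓ) (sym (ι≡fromℕ a)) a/b≤ℓ)
  where
  powers : ι (2 ℕ.^ (d ℕ.* suc b)) ≤ ι (2 ℕ.^ a)
  powers = ℚ.≤-trans (ℚ.≤-reflexive (trans (cong ι (sym (ℕ.^-*-assoc 2 d (suc b)))) (ι-^ (2 ℕ.^ d) (suc b))))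
    (ℚ.≤-trans (^-mono (suc b) (0≤ι (2 ℕ.^ d)) h) (ℚ.≤-trans pow
      (ℚ.≤-reflexive (sym (trans (ι-^ 2 a) (cong (_^ a) (ι≡fromℕ 2)))))))

n≤2^n : ∀ n → suc n ℕ.≤ 2 ℕ.^ suc n
n≤2^n zero    = s≤s z≤n
n≤2^n (suc n) = ℕ.≤-trans (ℕ.+-mono-≤ (1≤^ 1 (suc n)) (n≤2^n n)) (ℕ.≤-reflexive (cong (2 ℕ.^ suc n ℕ.+_) (sym (ℕ.+-identityʳ (2 ℕ.^ suc n)))))

packBatches-rate : ∀ t bs → rate t (packBatches bs) ≡ ∑ (λ b → rate t (nextFitPack (byEnd b))) bs
packBatches-rate t []       = refl
packBatches-rate t (b ∷ bs) = trans (rate-++ t (nextFitPack (byEnd b)) (packBatches bs)) (cong (rate t (nextFitPack (byEnd b)) +_) (packBatches-rate t bs))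

packBatches-fits : ∀ bs → All (All Valid) bs → All Fits (packBatches bs)
packBatches-fits []       _        = []
packBatches-fits (b ∷ bs) (v ∷ vs) = All.++⁺ (nextFitPack-fits (byEnd b) (byEnd-All v)) (packBatches-fits bs vs)

-- For k = 3 the ratio K/θ is 3 divided by 2/3, that is 9/2, rounded up to 5.
general₃-rate : ∀ t xs → All Valid xs → rate t (packGeneral 3 xs) ≤ fromℕ 5 * loadI t xs + fromℕ 3 * occI t xs
general₃-rate t xs vs = *-cancel-≤ θ 0<θ (ℚ.≤-trans (general-rate t xs vs)
  (subst (λ K → K * loadI t xs + (K * θ) * occI t xs ≤ θ * (fromℕ 5 * loadI t xs + fromℕ 3 * occI t xs)) (sym (ι≡fromℕ 3))
    (lin (diff≥0 5θ ⊠ 0≤loadI t vs) (lem θ (loadI t xs) (occI t xs)))))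
  where
  open General 3 (s≤s (s≤s z≤n))
  5θ : fromℕ 3 ≤ fromℕ 5 * θ
  5θ = subst (λ K → fromℕ 3 ≤ fromℕ 5 * ((K - 1ℚ) * third)) (sym (ι≡fromℕ 3)) (from-yes (fromℕ 3 ℚ.≤? fromℕ 5 * ((fromℕ 3 - 1ℚ) * third)))
  lem : ∀ h l o → h * (fromℕ 5 * l + fromℕ 3 * o) ≡ (fromℕ 3 * l + (fromℕ 3 * h) * o) + (fromℕ 5 * h - fromℕ 3) * l
  lem = solve-∀ ℚ-ring

0≤max : ∀ {n} (v : Vec ℚ n) → 0ℚ ≤ Vec.foldr′ ℚ._⊔_ 0ℚ v
0≤max Vec.[]       = ℚ.≤-refl
0≤max (x Vec.∷ v) = ℚ.≤-trans (0≤max v) (ℚ.p≤q⊔p x _)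

module Bounds (I : Instance) where

  open OfInstance I public

  private
    instance
      T-nonZero : ℚ.NonZero (T I)
      T-nonZero = ℚ.pos⇒nonZero (T I) {{Instance.T-positive I}}

    τ : ℚ
    τ = ℚ.1/ T I

    Tτ : T I * τ ≡ 1ℚ
    Tτ = ℚ.*-inverseʳ (T I)

    0≤τ : 0ℚ ≤ τ
    0≤τ = ℚ.<⇒≤ (ℚ.positive⁻¹ τ {{ℚ.1/pos⇒pos (T I) {{Instance.T-positive I}}}})

    G = grid I

    0≤T : 0ℚ ≤ T I
    0≤T = ℚ.<⇒≤ 0<T

  average-bound : ∀ {c β O} e → c ≤ β * O + e * T I → average I c ≤ β * average I O + e
  average-bound {c} {β} {O} e h = ℚ.≤-trans (*-monoˡ τ 0≤τ h) (ℚ.≤-reflexive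
    (trans (lem β O e (T I) τ) (trans (cong (λ z → β * (O * τ) + e * z) Tτ) (cong (β * (O * τ) +_) (ℚ.*-identityʳ e)))))
    where
    lem : ∀ b O e T t → (b * O + e * T) * t ≡ b * (O * t) + e * (T * t)
    lem = solve-∀ ℚ-ring

  undo-average : ∀ {O x y} → average I O * x ≤ y → O * x ≤ y * T I
  undo-average {O} {x} {y} h = ℚ.≤-trans (ℚ.≤-reflexive (trans (sym (ℚ.*-identityʳ (O * x))) (trans (cong (O * x *_) (sym Tτ)) (lem O x (T I) τ))))
    (*-monoˡ (T I) 0≤T h)
    where
    lem : ∀ O x T t → O * x * (T * t) ≡ O * t * x * T
    lem = solve-∀ ℚ-ring

  0≤average : ∀ {O} → 0ℚ ≤ O → 0ℚ ≤ average I O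
  0≤average h = h ⊠ 0≤τ

  ∫-occ-T : ∀ {xs} → All Timed xs → ∫ G (λ t → occI t xs) ≤ T I
  ∫-occ-T {xs} ss = ℚ.≤-trans (∫-occ≤ (All.map on ss) (All.map (λ s → 0≤st s , en≤E s) ss) 0≤T) (ℚ.≤-reflexive (ℚ.+-identityʳ (T I)))

  timed-items : All Timed itemsOf
  timed-items = All.map proj₁ sized

  module _ {O : ℚ} {σ* : Schedule I} (feasible : Feasible I σ*) (cost≡ : cost I σ* ≡ O) where

    open Optimal feasible cost≡

    ∫≤ : ∀ {f} β → (∀ t → f t ≤ β * machinesAt I σ* t) → ∫ G f ≤ β * O
    ∫≤ {f} β h = ℚ.≤-trans (∫-mono G (grid-increasing I) h)
      (ℚ.≤-reflexive (trans (∫-* β (machinesAt I σ*) G) (cong (β *_) ∫-machines)))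

    0≤O : 0ℚ ≤ O
    0≤O = ℚ.≤-trans 0≤T T≤O

    module Second {k : ℕ} (3≤k : 3 ℕ.≤ k) where

      open Solved (algorithm₂ k) (algorithm₂ᶜ k)

      packing₂ : Packing itemsOf (algorithm₂ k itemsOf)
      packing₂ = algorithm₂-packing 3≤k itemsOf valid-items

      cost₂-general : ∀ {ρ} → Π k ρ → cost I σ ≤ (fromℕ 2 * ρ * (1ℚ + recip (k ℕ.∸ 2))) * O + fromℕ k * T I
      cost₂-general {ρ} ρ∈Π = ℚ.≤-trans (realize-cost packing₂) (ℚ.≤-trans
        (∫-mono G (grid-increasing I) λ t → algorithm₂-rate {ρ = ρ} 3≤k valid-items (3≤2Π {k} {ρ} ρ∈Π 3≤k) (packs t))
        (ℚ.≤-trans (ℚ.≤-reflexive (∫-+ (λ t → β₂ * machinesAt I σ* t) (λ t → ι k * occI t itemsOf) G))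
          (ℚ.+-mono-≤ (∫≤ β₂ (λ t → ℚ.≤-refl))
            (ℚ.≤-trans (ℚ.≤-reflexive (∫-* (ι k) (λ t → occI t itemsOf) G))
              (subst (λ z → ι k * ∫ G (λ t → occI t itemsOf) ≤ z * T I) (ι≡fromℕ k) (*-monoʳ (ι k) (0≤ι k) (∫-occ-T timed-items)))))))
        where
        β₂ = fromℕ 2 * ρ * (1ℚ + recip (k ℕ.∸ 2))

      cost₂-uniform : Uniform I → cost I σ ≤ fromℕ 2 * O
      cost₂-uniform (g , h) = ℚ.≤-trans (realize-cost packing₂) (∫≤ (fromℕ 2) λ t → algorithm₂-uniform 3≤k valid-items (heads itemsOf (uniform-sizes h)) (packs t))
        where
        heads : ∀ {w} xs → All (λ x → sz x ≡ w) xs → All (λ x → sz x ≡ headSize xs) xs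
        heads []       _        = []
        heads (x ∷ xs) (e ∷ es) = refl ∷ All.map (λ e′ → trans e′ (sym e)) es

  module First {k : ℕ} (3≤k : 3 ℕ.≤ k) where

    1≤k : suc (k ℕ.∸ 1) ≡ k
    1≤k = ℕ.suc-pred k {{ℕ.>-nonZero (ℕ.≤-trans (s≤s z≤n) 3≤k)}}

    result : List Item × Batched
    result = harmonicClasses k itemsOf

    batched : List (List Item)
    batched = proj₁ (proj₂ result)

    leftover : List Item
    leftover = proj₂ (proj₂ result)

    module WithΛ {Λ : ℚ} (0≤Λ : 0ℚ ≤ Λ) (few≤ : ∀ c → Few 0≤T 1ℚ c → ι c ≤ Λ) where

      open Harmonized (harmonize 0≤T {Λ} 0≤Λ few≤ (k ℕ.∸ 1) 0 k ([] , []) itemsOf 1≤k account-[] sized (All.map sz≤1 valid-items)) public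

    -- Correctness of the packing must be known for every instance, before any member of `logμ` is
    -- given; this crude bound on the number of length classes, from n < 2ⁿ, serves to run
    -- `harmonize` there.
    trivial-few : ∀ c → Few 0≤T 1ℚ c → ι c ≤ fromℕ 2 * μ I
    trivial-few zero    _        = ℚ.≤-trans (ℚ.≤-reflexive ι-0) (ℚ.nonNegative⁻¹ (fromℕ 2) ⊠ 0≤max (Vec.map len (requests I)))
    trivial-few (suc c) (inj₂ h) = ℚ.≤-trans (ι-mono (n≤2^n c)) (ℚ.≤-trans (ℚ.≤-reflexive (trans (ι-* 2 (2 ℕ.^ c)) (cong (_* ι (2 ℕ.^ c)) (ι≡fromℕ 2))))
      (*-monoʳ (fromℕ 2) (ℚ.nonNegative⁻¹ (fromℕ 2)) (ℚ.≤-trans (ℚ.≤-reflexive (sym (ℚ.*-identityˡ (ι (2 ℕ.^ c))))) h)))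

    private
      module W = WithΛ {fromℕ 2 * μ I} (ℚ.nonNegative⁻¹ (fromℕ 2) ⊠ 0≤max (Vec.map len (requests I))) trivial-few

    rem≡ : leftover ++ proj₁ result ≡ leftover
    rem≡ = trans (cong (leftover ++_) W.exhausted) (List.++-identityʳ leftover)

    packed↭ : all-items (batched , leftover) ↭ itemsOf
    packed↭ = W.packed

    sized-all : All Timed (concat batched ++ leftover)
    sized-all = ↭.All-resp-↭ (↭-sym packed↭) timed-items

    timed-left : All Timed leftover
    timed-left = All.++⁻ʳ (concat batched) sized-all

    timed-batches : All (All Timed) batched
    timed-batches = All.concat⁻ (All.++⁻ˡ (concat batched) sized-all)

    valid-of : ∀ {xs} → All Timed xs → All Valid xs
    valid-of = All.map (λ s → is-valid (on s))

    algorithm₁≡ : algorithm₁ k itemsOf ≡ packBatches batched ++ packGeneral 3 leftover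
    algorithm₁≡ = cong (λ z → packBatches batched ++ packGeneral 3 z) rem≡

    packing₁ : Packing itemsOf (algorithm₁ k itemsOf)
    packing₁ = subst (Packing itemsOf) (sym algorithm₁≡) record
      { all-packed = ↭-trans (↭.↭-reflexive (sym (List.concat-++ (packBatches batched) _)))
          (↭-trans (↭.++⁺ (packBatches-↭ batched) (General.general-↭ 3 (s≤s (s≤s z≤n)) leftover (valid-of timed-left))) packed↭)
      ; all-fit = All.++⁺ (packBatches-fits batched (All.map valid-of timed-batches))
          (General.general-fits 3 (s≤s (s≤s z≤n)) leftover (valid-of timed-left)) }

    volume-split : ∑ volume batched + volume leftover ≡ volume itemsOf
    volume-split = trans (cong (_+ volume leftover) (sym (∑-concat (λ x → sz x * lengthOf x) batched)))
      (trans (sym (∑-++ (λ x → sz x * lengthOf x) (concat batched) leftover)) (∑-↭ (λ x → sz x * lengthOf x) packed↭))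

    0≤volume : ∀ {xs} → All Timed xs → 0ℚ ≤ volume xs
    0≤volume {xs} ts = subst (0ℚ ≤_) (∫-loadI (All.map on ts)) (subst (_≤ ∫ G (λ t → loadI t xs)) (∫-0 G)
      (∫-mono G (grid-increasing I) (λ t → 0≤loadI t (valid-of ts))))

    open Solved (algorithm₁ k) (algorithm₁ᶜ k)

    machines-cost : cost I σ ≤ machineCost batched + (fromℕ 5 * volume leftover + fromℕ 3 * T I)
    machines-cost = ℚ.≤-trans (realize-cost packing₁) (ℚ.≤-trans
      (ℚ.≤-reflexive (trans (∫-cong G λ t → trans (cong (rate t) algorithm₁≡)
          (trans (rate-++ t (packBatches batched) (packGeneral 3 leftover)) (cong (_+ rate t (packGeneral 3 leftover)) (packBatches-rate t batched))))
        (trans (∫-+ _ (λ t → rate t (packGeneral 3 leftover)) G) (cong (_+ ∫ G (λ t → rate t (packGeneral 3 leftover))) (∫-∑ (λ b t → rate t (nextFitPack (byEnd b))) batched G)))))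
      (ℚ.+-monoʳ-≤ (machineCost batched) (ℚ.≤-trans (∫-mono G (grid-increasing I) λ t → general₃-rate t leftover (valid-of timed-left))
        (ℚ.≤-trans (ℚ.≤-reflexive (trans (∫-+ (λ t → fromℕ 5 * loadI t leftover) (λ t → fromℕ 3 * occI t leftover) G)
            (cong₂ _+_ (trans (∫-* (fromℕ 5) (λ t → loadI t leftover) G) (cong (fromℕ 5 *_) (∫-loadI (All.map on timed-left)))) (∫-* (fromℕ 3) (λ t → occI t leftover) G))))
          (ℚ.+-monoʳ-≤ (fromℕ 5 * volume leftover) (*-monoʳ (fromℕ 3) (ℚ.nonNegative⁻¹ (fromℕ 3)) (∫-occ-T timed-left)))))))

    module _ {O : ℚ} {σ* : Schedule I} (feasible : Feasible I σ*) (cost≡ : cost I σ* ≡ O)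
      {ℓ : ℚ} (log : logμ I ℓ) where

      open Optimal feasible cost≡

      1≤ℓ : 1ℚ ≤ ℓ
      1≤ℓ = subst (_≤ ℓ) (ι≡fromℕ 1) (below-log log 1 (subst (_≤ fromℕ 2 ℚ.⊔ μ I) (sym (ι≡fromℕ 2)) (ℚ.p≤p⊔q (fromℕ 2) (μ I))))

      -- A number c + 1 of classes forces 2 to the c to be at most μ, so c ≤ ℓ. The remaining 1 is
      -- at most ℓ because the logarithm is taken of at least 2; this is the origin of the factor 2
      -- in `a≤`.
      few : ∀ c → Few 0≤T 1ℚ c → ι c ≤ fromℕ 2 * ℓ
      few zero    _        = ℚ.≤-trans (ℚ.≤-reflexive ι-0) (ℚ.nonNegative⁻¹ (fromℕ 2) ⊠ ℚ.≤-trans 0≤1 1≤ℓ)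
      few (suc c) (inj₂ h) = ℚ.≤-trans (ℚ.≤-reflexive (ι-suc c)) (ℚ.≤-trans
        (ℚ.+-mono-≤ 1≤ℓ (below-log log c (ℚ.≤-trans (ℚ.≤-reflexive (sym (ℚ.*-identityˡ (ι (2 ℕ.^ c))))) (ℚ.≤-trans h (ℚ.p≤q⊔p (fromℕ 2) (μ I))))))
        (ℚ.≤-reflexive (double ℓ)))
        where
        double : ∀ x → x + x ≡ (1ℚ + 1ℚ) * x
        double = solve-∀ ℚ-ring

      module L = WithΛ {fromℕ 2 * ℓ} (ℚ.nonNegative⁻¹ (fromℕ 2) ⊠ ℚ.≤-trans 0≤1 1≤ℓ) few

      -- Common to both cases: ζ is the ratio for the closed bins and m bounds the number of
      -- nonempty harmonic classes. In general these are ρ and k, for uniform sizes 1 and 1. The κ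
      -- of `Error` is m ℓ.
      cost₁ : ∀ {ζ m s} → L.n ℕ.≤ m → 1 ℕ.≤ m → (∀ t → closings t batched ≤ ζ * machinesAt I σ* t) →
        0ℚ ≤ s → O * (ι m * ℓ) ≤ s * s * T I → cost I σ ≤ ζ * O + (fromℕ 59 * s) * T I
      cost₁ {ζ} {m} {s} n≤m 1≤m closings≤ 0≤s s² = ℚ.≤-trans machines-cost
        (ℚ.≤-trans (lin (diff≥0 (paid A) ⊞ diff≥0 closing≤ ⊞ diff≥0 total-error)
          (lem (ζ * O) s (T I) (machineCost batched) (closingCost batched) (β A) (fromℕ 5 * volume leftover + fromℕ 3 * T I))) ℚ.≤-refl)
        where
        A : Account (ι L.n * (fromℕ 2 * ℓ * T I) + 0ℚ) (batched , leftover)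
        A = L.balance
        0≤ℓ : 0ℚ ≤ ℓ
        0≤ℓ = ℚ.≤-trans 0≤1 1≤ℓ
        0≤2 : 0ℚ ≤ fromℕ 2
        0≤2 = ℚ.nonNegative⁻¹ (fromℕ 2)
        1≤κ : 1ℚ ≤ ι m * ℓ
        1≤κ = ℚ.≤-trans (ℚ.≤-reflexive (sym (ℚ.*-identityˡ 1ℚ))) (*-mono 0≤1 0≤1 (ℚ.≤-trans (ℚ.≤-reflexive (sym (ι≡fromℕ 1))) (ι-mono 1≤m)) 1≤ℓ)
        a≤ : ι L.n * (fromℕ 2 * ℓ * T I) + 0ℚ ≤ fromℕ 2 * (ι m * ℓ * T I)
        a≤ = ℚ.≤-trans (ℚ.≤-reflexive (ℚ.+-identityʳ (ι L.n * (fromℕ 2 * ℓ * T I)))) (ℚ.≤-trans (*-monoˡ (fromℕ 2 * ℓ * T I) (0≤2 ⊠ 0≤ℓ ⊠ 0≤T) (ι-mono n≤m))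
          (ℚ.≤-reflexive (ring (ι m) ℓ (T I))))
          where
          ring : ∀ m l T → m * ((1ℚ + 1ℚ) * l * T) ≡ (1ℚ + 1ℚ) * (m * l * T)
          ring = solve-∀ ℚ-ring
        γ≤2O : γ A ≤ fromℕ 2 * O
        γ≤2O = ℚ.≤-trans (γ≤ A) (*-monoʳ {∑ volume batched} (fromℕ 2) 0≤2 (ℚ.≤-trans (lin (0≤volume timed-left) (sym volume-split)) volume≤O))
        0≤batches : 0ℚ ≤ ∑ volume batched
        0≤batches = ∑-nonneg batched (λ i → 0≤volume (All.lookup timed-batches i))
        v≤O : volume leftover ≤ O
        v≤O = ℚ.≤-trans (lin 0≤batches (trans (sym volume-split) (ℚ.+-comm (∑ volume batched) (volume leftover)))) volume≤O
        open Error {s} {ι m * ℓ} {T I} {O} {_} {β A} {γ A} {volume leftover} 0≤s 1≤κ 0<T T≤O s² a≤ γ≤2O (quad A) (left A) v≤O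
        closing≤ : closingCost batched ≤ ζ * O
        closing≤ = ℚ.≤-trans (ℚ.≤-reflexive (sym (∫-∑ (λ b t → activeClosed t (byEnd b)) batched G))) (∫≤ {O} {σ*} feasible cost≡ {λ t → closings t batched} ζ closings≤)
        lem : ∀ z s T m c b e → z + (fromℕ 59 * s) * T ≡ (m + e) + (((c + fromℕ 8 * b) - m) + (z - c) + (fromℕ 59 * (s * T) - (fromℕ 8 * b + e)))
        lem = solve-∀ ℚ-ring

      cost₁-general : ∀ {ρ s} → Π k ρ → 0ℚ ≤ s → O * (ι k * ℓ) ≤ s * s * T I → cost I σ ≤ ρ * O + (fromℕ 59 * s) * T I
      cost₁-general {ρ} {s} ρ∈Π = cost₁ {ρ} {k} {s} (ℕ.≤-trans L.n≤ (ℕ.≤-reflexive 1≤k)) (ℕ.≤-trans (s≤s z≤n) 3≤k)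
        (λ t → closings-Π {itemsOf} {batched} {leftover} packed↭ valid-items {k} {ρ} ρ∈Π 3≤k (L.in-class []) t (packs t))

      cost₁-uniform : ∀ {s} → Uniform I → 0ℚ ≤ s → O * (ι 1 * ℓ) ≤ s * s * T I → cost I σ ≤ 1ℚ * O + (fromℕ 59 * s) * T I
      cost₁-uniform {s} (g , h) = cost₁ {1ℚ} {1} {s} (L.n≤1 (recip (suc g) , uniform-sizes h)) ℕ.≤-refl
        (λ t → ℚ.≤-trans (closings-uniform {itemsOf} {batched} {leftover} packed↭ valid-items {g} (uniform-sizes h) t (packs t)) (ℚ.≤-reflexive (sym (ℚ.*-identityˡ (machinesAt I σ* t)))))

algorithm₁-polynomial algorithm₂-polynomial : ∀ k → 3 ℕ.≤ k → PolyTimeAlgorithm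
algorithm₁-polynomial k 3≤k = solver (algorithm₁ k) (algorithm₁ᶜ k) (λ I → Bounds.First.packing₁ I 3≤k)
algorithm₂-polynomial k 3≤k = solver (algorithm₂ k) (algorithm₂ᶜ k) (λ I → algorithm₂-packing 3≤k (OfInstance.itemsOf I) (OfInstance.valid-items I))

theorem1p1 : Σ ℕ λ C → ∀ (k : ℕ) → 3 ℕ.≤ k →
    (Σ PolyTimeAlgorithm λ alg → ∀ (I : Instance) (OPT : ℚ) → IsOPT I OPT →
    let OPTavg = ⌜ average I OPT ⌝ in
    (averageCost alg I
    ≼ Π k ⊗ OPTavg ⊕ ⌜ fromℕ C ⌝ ⊗ √ (OPTavg ⊗ ⌜ fromℕ k ⌝ ⊗ logμ I))
    × (Uniform I →
    averageCost alg I
    ≼ OPTavg ⊕ ⌜ fromℕ C ⌝ ⊗ √ (OPTavg ⊗ logμ I)))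
    ×
    (Σ PolyTimeAlgorithm λ alg → ∀ (I : Instance) (OPT : ℚ) → IsOPT I OPT →
    let OPTavg = ⌜ average I OPT ⌝ in
    (averageCost alg I
    ≼ ⌜ fromℕ 2 ⌝ ⊗ Π k ⊗ ⌜ 1ℚ + recip (k ℕ.∸ 2) ⌝ ⊗ OPTavg ⊕ ⌜ fromℕ k ⌝)
    × (Uniform I → averageCost alg I ≼ ⌜ fromℕ 2 ⌝ ⊗ OPTavg))
theorem1p1 = 59 , λ k 3≤k →
  (algorithm₁-polynomial k 3≤k , λ I O ((σ* , feasible , cost≡) , _) → general₁ k 3≤k I feasible cost≡ , uniform₁ k 3≤k I feasible cost≡) ,
  (algorithm₂-polynomial k 3≤k , λ I O ((σ* , feasible , cost≡) , _) → general₂ k 3≤k I feasible cost≡ , uniform₂ k 3≤k I feasible cost≡)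
  where
  module _ (k : ℕ) (3≤k : 3 ℕ.≤ k) (I : Instance) {O : ℚ} {σ* : Schedule I} (feasible : Feasible I σ*) (cost≡ : cost I σ* ≡ O) where

    open Bounds I

    0≤o : 0ℚ ≤ average I O
    0≤o = 0≤average (0≤O feasible cost≡)

    general₁ : averageCost (algorithm₁-polynomial k 3≤k) I ≼ Π k ⊗ ⌜ average I O ⌝ ⊕ ⌜ fromℕ 59 ⌝ ⊗ √ (⌜ average I O ⌝ ⊗ ⌜ fromℕ k ⌝ ⊗ logμ I)
    -- A member u of the right-hand side unpacks into ρ from `Π k`, ℓ above the logarithm, and s
    -- whose square is at least average · k · ℓ. These are the parameters of `cost₁-general`; the
    -- remaining components are upper bounds combined by monotonicity.
    general₁ u (u₁ , u₂ , (ρ , o , ρ∈Π , avg≤o , ρo≤) , (C , s , C≤ , (0≤s , w , (y , ℓ , (o′ , k′ , avg≤o′ , k≤k′ , oky≤) , log , yℓ≤) , w≤s²) , Cs≤) , sum≤) =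
      ℚ.≤-trans (average-bound {β = ρ} {O} (fromℕ 59 * s) (First.cost₁-general 3≤k feasible cost≡ log {ρ} {s} ρ∈Π 0≤s (undo-average {O} {ι k * ℓ} under)))
        (ℚ.≤-trans (ℚ.+-mono-≤ (ℚ.≤-trans (*-monoʳ ρ (Π-nonneg {k} {ρ} ρ∈Π 3≤k) avg≤o) ρo≤) (ℚ.≤-trans (*-monoˡ s 0≤s C≤) Cs≤)) sum≤)
      where
      0≤ℓ : 0ℚ ≤ ℓ
      0≤ℓ = ℚ.≤-trans 0≤1 (First.1≤ℓ 3≤k feasible cost≡ log)
      under : average I O * (ι k * ℓ) ≤ s * s
      under = ℚ.≤-trans (ℚ.≤-reflexive (sym (ℚ.*-assoc (average I O) (ι k) ℓ)))
        (ℚ.≤-trans (*-monoˡ ℓ 0≤ℓ (ℚ.≤-trans (*-mono 0≤o (0≤ι k) avg≤o′ (subst (_≤ k′) (sym (ι≡fromℕ k)) k≤k′)) oky≤)) (ℚ.≤-trans yℓ≤ w≤s²))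

    uniform₁ : Uniform I → averageCost (algorithm₁-polynomial k 3≤k) I ≼ ⌜ average I O ⌝ ⊕ ⌜ fromℕ 59 ⌝ ⊗ √ (⌜ average I O ⌝ ⊗ logμ I)
    uniform₁ uni u (o , u₂ , avg≤o , (C , s , C≤ , (0≤s , w , (o′ , ℓ , avg≤o′ , log , oℓ≤) , w≤s²) , Cs≤) , sum≤) =
      ℚ.≤-trans (average-bound {β = 1ℚ} {O} (fromℕ 59 * s) (First.cost₁-uniform 3≤k feasible cost≡ log {s} uni 0≤s (undo-average {O} {ι 1 * ℓ} under)))
        (ℚ.≤-trans (ℚ.+-mono-≤ (ℚ.≤-trans (ℚ.≤-reflexive (ℚ.*-identityˡ (average I O))) avg≤o) (ℚ.≤-trans (*-monoˡ s 0≤s C≤) Cs≤)) sum≤)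
      where
      0≤ℓ : 0ℚ ≤ ℓ
      0≤ℓ = ℚ.≤-trans 0≤1 (First.1≤ℓ 3≤k feasible cost≡ log)
      under : average I O * (ι 1 * ℓ) ≤ s * s
      under = ℚ.≤-trans (ℚ.≤-reflexive (cong (average I O *_) (trans (cong (_* ℓ) (ι≡fromℕ 1)) (ℚ.*-identityˡ ℓ))))
        (ℚ.≤-trans (*-monoˡ ℓ 0≤ℓ avg≤o′) (ℚ.≤-trans oℓ≤ w≤s²))

    general₂ : averageCost (algorithm₂-polynomial k 3≤k) I ≼ ⌜ fromℕ 2 ⌝ ⊗ Π k ⊗ ⌜ 1ℚ + recip (k ℕ.∸ 2) ⌝ ⊗ ⌜ average I O ⌝ ⊕ ⌜ fromℕ k ⌝
    general₂ u (u₁ , u₂ , (p , o , (p′ , r , (two , ρ , 2≤two , ρ∈Π , p′≤) , r≤ , p≤) , avg≤o , po≤) , k≤ , sum≤) =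
      ℚ.≤-trans (average-bound {β = fromℕ 2 * ρ * (1ℚ + recip (k ℕ.∸ 2))} {O} (fromℕ k) (Second.cost₂-general feasible cost≡ 3≤k {ρ} ρ∈Π))
        (ℚ.≤-trans (ℚ.+-mono-≤ (ℚ.≤-trans (*-mono 0≤factor 0≤o (ℚ.≤-trans (*-mono 0≤2ρ 0≤1+R (ℚ.≤-trans (*-monoˡ ρ 0≤ρ 2≤two) p′≤) r≤) p≤) avg≤o) po≤) k≤) sum≤)
      where
      0≤ρ : 0ℚ ≤ ρ
      0≤ρ = Π-nonneg {k} {ρ} ρ∈Π 3≤k
      0≤2ρ : 0ℚ ≤ fromℕ 2 * ρ
      0≤2ρ = ℚ.nonNegative⁻¹ (fromℕ 2) ⊠ 0≤ρ
      0≤recip : ∀ m → 0ℚ ≤ recip m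
      0≤recip zero    = ℚ.≤-refl
      0≤recip (suc m) = ℚ.<⇒≤ (0<recip m)
      0≤1+R : 0ℚ ≤ 1ℚ + recip (k ℕ.∸ 2)
      0≤1+R = 0≤1 ⊞ 0≤recip (k ℕ.∸ 2)
      0≤factor : 0ℚ ≤ fromℕ 2 * ρ * (1ℚ + recip (k ℕ.∸ 2))
      0≤factor = 0≤2ρ ⊠ 0≤1+R

    uniform₂ : Uniform I → averageCost (algorithm₂-polynomial k 3≤k) I ≼ ⌜ fromℕ 2 ⌝ ⊗ ⌜ average I O ⌝
    uniform₂ uni u (two , o , 2≤two , avg≤o , h) = ℚ.≤-trans
      (average-bound {β = fromℕ 2} {O} 0ℚ (ℚ.≤-trans (Second.cost₂-uniform feasible cost≡ 3≤k uni)
        (ℚ.≤-reflexive (sym (trans (cong (fromℕ 2 * O +_) (ℚ.*-zeroˡ (T I))) (ℚ.+-identityʳ (fromℕ 2 * O)))))))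
      (ℚ.≤-trans (ℚ.≤-reflexive (ℚ.+-identityʳ (fromℕ 2 * average I O))) (ℚ.≤-trans (*-mono (ℚ.nonNegative⁻¹ (fromℕ 2)) 0≤o 2≤two avg≤o) h))
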